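{- Let $G$ be a plane graph whose set of vertices has no accumulation point in $\mathbb{R}^2$ and which has bounded vertex degrees. Then: (1) if $G$ is non-amenable and has bounded codegree, then $G$ is hyperbolic; (2) if $G$ is hyperbolic and weakly non-amenable, then $G$ has bounded codegree; (3) if $G$ is hyperbolic and weakly non-amenable and in addition has no unbounded face, then $G$ is non-amenable.
   Context: A plane graph is a graph together with a fixed embedding of its 1-complex in $\mathbb{R}^2$ with no two edges crossing. A face is a connected component of $\mathbb{R}^2$ minus the image of the graph; the boundary of a face $F$ is the set of vertices and edges mapped into the closure of $F$, and the length $|F|$ is the number of edges in its boundary. A face is bounded if its length is finite, and unbounded otherwise. $G$ has bounded codegree if $\Delta(G^*):=\sup\{|F| : F \text{ a bounded face of } G\}<\infty$. $G$ has bounded degree if $\Delta(G):=\sup_v \deg(v)<\infty$. For a finite vertex set $S$, $\partial S=\{v\in V(G)\setminus S : v \text{ is adjacent to some } w\in S\}$. The Cheeger constant is $c(G)=\inf\{|\partial S|/|S| : \emptyset\neq S\subset V(G) \text{ finite}\}$, and $G$ is non-amenable if $c(G)>0$. $G$ is weakly non-amenable if there is a monotone increasing diverging function $f:\mathbb{N}\to\mathbb{N}$ with $|S|\le f(|\partial S|)$ for all non-empty finite vertex sets $S$. With the graph metric, a geodetic triangle consists of three vertices and three geodesics (sides) joining them pairwise; it is $\delta$-thin if each side lies in the $\delta$-neighbourhood of the union of the other two. A connected graph is $\delta$-hyperbolic if every geodetic triangle is $\delta$-thin; a graph is hyperbolic if there is $\delta\ge 0$ such that each connected component is $\delta$-h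yperbolic.
   Formalization: Part (3) is proved under the extra assumption that G has no finite component; without it (3) fails, e.g. for a single vertex, where S = V has empty boundary and c(G) = 0. The assumption is necessary for non-amenability. -}

module Defs where

import Data.Integer as ℤ
open import Data.List using (List; []; _∷_; length)
open import Data.List.Membership.Propositional using (_∈_; _∉_)
open import Data.List.Relation.Unary.Unique.Propositional using (Unique)
open import Data.Nat as ℕ using (ℕ; suc)
open import Data.Product using (Σ; ∃; ∃₂; _×_; _,_; proj₁; proj₂)
open import Data.Rational as ℚ using (ℚ; 0ℚ; 1ℚ; _/_)
import Data.Rational.Properties as ℚₚ
open import Data.Sum using (_⊎_)
open import Function using (_⇔_; _∘_)
open import Level using (0ℓ)
open import Relation.Binary.Construct.Closure.Equivalence using (EqClosure)
open import Relation.Binary.Core using (_Preserves_⟶_)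
open import Relation.Binary.PropositionalEquality using (_≡_; _≢_; refl; sym; cong; subst)
open import Relation.Nullary using (¬_)
open import Relation.Unary using (Pred; _⊆_; _∪_)

-- The predicate P has exactly n elements.
HasSize : {A : Set} → Pred A 0ℓ → ℕ → Set
HasSize {A} P n =
  Σ (List A) λ xs → Unique xs × length xs ≡ n × (∀ x → P x ⇔ x ∈ xs)

------------------------------------------------------------------------
-- Real numbers as regular Cauchy sequences (Bishop), and the plane

1/1+_ : ℕ → ℚ
1/1+ n = ℤ.+ 1 / suc n

record ℝ : Set where
  field
    seq     : ℕ → ℚ
    regular : ∀ m n → ℚ.∣ seq m ℚ.- seq n ∣ ℚ.≤ 1/1+ m ℚ.+ 1/1+ n
open ℝ public

infix 4 _≈ʳ_ _≈_ _<ʳ_ _ʳ<_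

_≈ʳ_ : ℝ → ℝ → Set
x ≈ʳ y = ∀ n → ℚ.∣ seq x n ℚ.- seq y n ∣ ℚ.≤ 1/1+ n ℚ.+ 1/1+ n

-- Strict order between a rational and a real: a term of the sequence is
-- within 1/(n+1) of the limit.
_<ʳ_ : ℚ → ℝ → Set
q <ʳ x = ∃ λ n → q ℚ.+ 1/1+ n ℚ.< seq x n

_ʳ<_ : ℝ → ℚ → Set
x ʳ< q = ∃ λ n → seq x n ℚ.+ 1/1+ n ℚ.< q

private
  0<1/1+ : ∀ n → 0ℚ ℚ.< 1/1+ n
  0<1/1+ n = ℚₚ.positive⁻¹ (1/1+ n) {{ℚₚ.normalize-pos 1 (suc n)}}

  ≤⇒≮ : ∀ {c d} → c ℚ.≤ d → ∀ n → ¬ (d ℚ.+ 1/1+ n ℚ.< c)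
  ≤⇒≮ {c} {d} c≤d n d+<c = ℚₚ.<-irrefl refl (ℚₚ.<-trans c<d+ d+<c)
    where
    c<d+ : c ℚ.< d ℚ.+ 1/1+ n
    c<d+ = subst (ℚ._< d ℚ.+ 1/1+ n) (ℚₚ.+-identityʳ c)
             (ℚₚ.+-mono-≤-< c≤d (0<1/1+ n))

fromℚ : ℚ → ℝ
fromℚ q = record
  { seq     = λ _ → q
  ; regular = λ m n →
      subst (ℚ._≤ 1/1+ m ℚ.+ 1/1+ n)
        (sym (cong ℚ.∣_∣ (ℚₚ.+-inverseʳ q)))
        (ℚₚ.<⇒≤ (ℚₚ.+-mono-< (0<1/1+ m) (0<1/1+ n)))
  }

-- The closed interval [0,1].
I : Set
I = Σ ℝ λ t → ¬ (t ʳ< 0ℚ) × ¬ (1ℚ <ʳ t)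

private
  0≤1 : 0ℚ ℚ.≤ 1ℚ
  0≤1 = ℚₚ.nonNegative⁻¹ 1ℚ

0ᴵ 1ᴵ : I
0ᴵ = fromℚ 0ℚ , (λ { (n , p) → ≤⇒≮ ℚₚ.≤-refl n p }) , λ { (n , p) → ≤⇒≮ 0≤1 n p }
1ᴵ = fromℚ 1ℚ , (λ { (n , p) → ≤⇒≮ 0≤1 n p }) , λ { (n , p) → ≤⇒≮ ℚₚ.≤-refl n p }

ℝ² : Set
ℝ² = ℝ × ℝ

_≈_ : ℝ² → ℝ² → Set
(x , y) ≈ (x′ , y′) = x ≈ʳ x′ × y ≈ʳ y′

-- Open rectangles with rational sides, a base of the Euclidean topology.
record Box : Set where
  field
    left right bottom top : ℚ
open Box public

_∈ᴮ_ : ℝ² → Box → Set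
(x , y) ∈ᴮ B = (left B <ʳ x × x ʳ< right B) × (bottom B <ʳ y × y ʳ< top B)

Open : Pred ℝ² 0ℓ → Set
Open U = ∀ x → U x → ∃ λ B → x ∈ᴮ B × (∀ y → y ∈ᴮ B → U y)

Closure : Pred ℝ² 0ℓ → Pred ℝ² 0ℓ
Closure A x = ∀ B → x ∈ᴮ B → ∃ λ y → y ∈ᴮ B × A y

AccumulationPoint : Pred ℝ² 0ℓ → Pred ℝ² 0ℓ
AccumulationPoint A x = ∀ B → x ∈ᴮ B → ∃ λ y → y ∈ᴮ B × A y × ¬ (y ≈ x)

Connected : Pred ℝ² 0ℓ → Set₁
Connected A =
  ∃ A × (∀ (U W : Pred ℝ² 0ℓ) → Open U → Open W → A ⊆ U ∪ W →
         (∃ λ x → A x × U x) → (∃ λ x → A x × W x) →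
         ∃ λ x → A x × U x × W x)

IsComponentOf : Pred ℝ² 0ℓ → Pred ℝ² 0ℓ → Set₁
IsComponentOf X C =
  C ⊆ X × Connected C ×
  (∀ (D : Pred ℝ² 0ℓ) → Connected D → C ⊆ D → D ⊆ X → D ⊆ C)

------------------------------------------------------------------------
-- Graphs

-- A simple graph.  The orientation src/tgt of an edge is arbitrary; it is
-- only used to parametrise the edge by [0,1].
record Graph : Set₁ where
  field
    V E      : Set
    src tgt  : E → V

  Joins : E → V → V → Set
  Joins e v w = (src e ≡ v × tgt e ≡ w) ⊎ (src e ≡ w × tgt e ≡ v)

  field
    loopless   : ∀ e → src e ≢ tgt e
    noParallel : ∀ {e e′ v w} → Joins e v w → Joins e′ v w → e ≡ e′

module _ (G : Graph) where
  open Graph G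

  Adjacent : V → V → Set
  Adjacent v w = ∃ λ e → Joins e v w

  Incident : V → E → Set
  Incident v e = ∃ λ w → Joins e v w

  BoundedDegree : Set
  BoundedDegree = ∃ λ Δ → ∀ v → ∃ λ d → HasSize (Incident v) d × d ℕ.≤ Δ

  -- Finite vertex sets are duplicate-free lists.
  ∂ : List V → Pred V 0ℓ
  ∂ S v = v ∉ S × ∃ λ w → w ∈ S × Adjacent v w

  -- q <c  means  q < c(G):  some r > q is a lower bound of all the quotients
  -- |∂S|/|S|.  Non-emptiness of S is expressed by the form s ∷ S.
  _<c : ℚ → Set
  q <c = ∃ λ r → q ℚ.< r ×
    (∀ s S → Unique (s ∷ S) → ∀ b → HasSize (∂ (s ∷ S)) b →
     r ℚ.≤ ℤ.+ b / length (s ∷ S))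

  NonAmenable : Set
  NonAmenable = 0ℚ <c

  WeaklyNonAmenable : Set
  WeaklyNonAmenable = Σ (ℕ → ℕ) λ f →
    f Preserves ℕ._≤_ ⟶ ℕ._≤_ ×
    (∀ N → ∃ λ n → N ℕ.≤ f n) ×
    (∀ s S → Unique (s ∷ S) → ∀ b → HasSize (∂ (s ∷ S)) b →
     length (s ∷ S) ℕ.≤ f b)

  data Walk : V → V → Set where
    done : ∀ {v} → Walk v v
    step : ∀ {u v w} → Adjacent u v → Walk v w → Walk u w

  len : ∀ {u v} → Walk u v → ℕ
  len done       = 0
  len (step _ p) = suc (len p)

  vertices : ∀ {u v} → Walk u v → List V
  vertices {u} done       = u ∷ []
  vertices {u} (step _ p) = u ∷ vertices p

  Distance : V → V → ℕ → Set
  Distance u v n = (∃ λ (p : Walk u v) → len p ≡ n) × (∀ (p : Walk u v) → n ℕ.≤ len p)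

  Geodesic : ∀ {u v} → Walk u v → Set
  Geodesic {u} {v} p = Distance u v (len p)

  Within : ℕ → List V → Pred V 0ℓ
  Within δ A u = ∃ λ w → w ∈ A × ∃ λ n → Distance u w n × n ℕ.≤ δ

  Thin : ∀ {x y z} → ℕ → Walk x y → Walk y z → Walk z x → Set
  Thin δ p q r = side p q r × side q r p × side r p q
    where
    side : ∀ {a b c d e f} → Walk a b → Walk c d → Walk e f → Set
    side s t t′ = ∀ u → u ∈ vertices s → (Within δ (vertices t) ∪ Within δ (vertices t′)) u

  ComponentOf : V → Pred V 0ℓ
  ComponentOf v u = Walk v u

  -- A walk that starts in a component stays in it, so the walks and
  -- distances of the component are those of G.
  HyperbolicComponent : ℕ → V → Set
  HyperbolicComponent δ v = ∀ {x y z} →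
    ComponentOf v x → ComponentOf v y → ComponentOf v z →
    (p : Walk x y) (q : Walk y z) (r : Walk z x) →
    Geodesic p → Geodesic q → Geodesic r → Thin δ p q r

  Hyperbolic : Set
  Hyperbolic = ∃ λ δ → ∀ v → HyperbolicComponent δ v

  -- A finite component C has ∂C = ∅, hence c(G) = 0, although finite graphs
  -- are hyperbolic, weakly non-amenable and have only bounded faces.
  NoFiniteComponent : Set
  NoFiniteComponent = ∀ v n → ¬ HasSize (ComponentOf v) n

  -- The 1-complex of G: the disjoint union of V (discrete) and E × [0,1],
  -- with (e , 0) glued to src e and (e , 1) glued to tgt e, and with the
  -- quotient topology.
  data Point : Set where
    vertex : V → Point
    on     : E → I → Point

  data Glue : Point → Point → Set where
    same  : ∀ {e s t} → proj₁ s ≈ʳ proj₁ t → Glue (on e s) (on e t)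
    start : ∀ {e} → Glue (on e 0ᴵ) (vertex (src e))
    end   : ∀ {e} → Glue (on e 1ᴵ) (vertex (tgt e))

  _∼_ : Point → Point → Set
  _∼_ = EqClosure Glue

  Open₁ : Pred Point 0ℓ → Set
  Open₁ U =
    (∀ {a b} → a ∼ b → U a → U b) ×
    (∀ e t → U (on e t) → ∃₂ λ l r →
       (l <ʳ proj₁ t × proj₁ t ʳ< r) ×
       (∀ s → l <ʳ proj₁ s → proj₁ s ʳ< r → U (on e s)))

  -- A homeomorphism of the 1-complex onto its image in the plane.
  record IsEmbedding (φ : Point → ℝ²) : Set₁ where
    field
      respects   : ∀ {a b} → a ∼ b → φ a ≈ φ b
      injective  : ∀ {a b} → φ a ≈ φ b → a ∼ b
      continuous : ∀ (W : Pred ℝ² 0ℓ) → Open W → Open₁ (W ∘ φ)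
      inverse    : ∀ (U : Pred Point 0ℓ) → Open₁ U →
                   Σ (Pred ℝ² 0ℓ) λ W → Open W × (∀ a → U a ⇔ W (φ a))

------------------------------------------------------------------------
-- Plane graphs

record PlaneGraph : Set₁ where
  field
    graph       : Graph
    φ           : Point graph → ℝ²
    isEmbedding : IsEmbedding graph φ
  open Graph graph public

module _ (P : PlaneGraph) where
  open PlaneGraph P

  VertexImage : Pred ℝ² 0ℓ
  VertexImage x = ∃ λ v → φ (vertex v) ≈ x

  AccumulationFree : Set
  AccumulationFree = ∀ x → ¬ AccumulationPoint VertexImage x

  Complement : Pred ℝ² 0ℓ
  Complement x = ∀ a → ¬ (φ a ≈ x)

  IsFace : Pred ℝ² 0ℓ → Set₁
  IsFace F = IsComponentOf Complement F

  BoundaryEdge : Pred ℝ² 0ℓ → Pred E 0ℓ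
  BoundaryEdge F e = ∀ t → Closure F (φ (on e t))

  FaceLength : Pred ℝ² 0ℓ → ℕ → Set
  FaceLength F n = HasSize (BoundaryEdge F) n

  -- "Bounded" refers to the length of the face, not to its diameter.
  BoundedFace : Pred ℝ² 0ℓ → Set
  BoundedFace F = ∃ λ n → FaceLength F n

  BoundedCodegree : Set₁
  BoundedCodegree = ∃ λ D → ∀ F → IsFace F → ∀ n → FaceLength F n → n ℕ.≤ D

  NoUnboundedFace : Set₁
  NoUnboundedFace = ∀ F → IsFace F → BoundedFace F

{-# OPTIONS --safe #-}
-- A cycle of edges has a winding number modulo 2 around every point off it,
-- the parity of its crossings with a ray.  It is constant on faces and jumps
-- across every edge of the cycle.  Conversely, a face that is surrounded by a
-- cycle, or has finite length and touches an infinite component, has a cycle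
-- of boundary edges winding around it: the outline of the face in a fine
-- lattice is pushed into the boundary edges.
--
-- (1) A cycle C is thus the sum of the boundaries of the faces inside, and
-- non-amenability bounds the number of vertices inside by a multiple of |C|.
-- If a side of a geodesic triangle strays to distance R from the other two, at
-- a vertex u, then a part of that side lies on a cycle of length O(R) that is
-- otherwise at distance at least R from u.  By parity, some face boundary
-- crosses between any two consecutive thresholds on each sphere around u, so
-- the cycle has too many vertices inside if R is large.
--
-- (2) In a hyperbolic graph a closed walk is a sum of linearly many short
-- loops.  So a face of finite length is surrounded by a short loop, and weak
-- non-amenability bounds what is inside the loop.
--
-- (3) The boundaries of the faces touching a finite set S sum up to a cycle
-- around S whose edges are near ∂S.  It is the sum of O(|∂S|) short loops, each
-- of which surrounds boundedly many vertices.
module Submission where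

open import Defs
import Algebra.Properties.AbelianGroup
open import Axiom.ExcludedMiddle using (ExcludedMiddle)
open import Data.Bool using (Bool; true; false; _xor_; _∧_; not; if_then_else_)
open import Data.Bool.Properties using (xor-same; xor-comm; xor-assoc; xor-identityʳ; ∧-zeroʳ; ∧-distribˡ-xor)
open import Data.Bool.Solver using (module xor-∧-Solver)
open import Data.Empty using (⊥; ⊥-elim)
open import Data.Fin using (Fin; zero; suc)
open import Data.Integer as ℤ using (ℤ; -[1+_])
import Data.Integer.Properties as ℤₚ
open import Data.Integer.Solver using () renaming (module +-*-Solver to ℤSolver)
open import Data.List using (List; []; _∷_; _++_; length; map; concat; cartesianProduct; upTo)
open import Data.List.Membership.Propositional using (_∈_; _∉_)
open import Data.List.Membership.Propositional.Properties using (∈-++⁺ˡ; ∈-++⁺ʳ; ∈-++⁻; ∈-map⁺; ∈-upTo⁻; ∈-cartesianProduct⁻)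
open import Data.List.Properties using (length-++; length-map; length-upTo)
open import Data.List.Relation.Unary.All using ([]; _∷_; lookup; tabulate)
open import Data.List.Relation.Unary.AllPairs using ([]; _∷_)
open import Data.List.Relation.Unary.Any using (here; there)
open import Data.List.Relation.Unary.Unique.Propositional using (Unique)
open import Data.List.Relation.Unary.Unique.Propositional.Properties using (upTo⁺; cartesianProduct⁺)
open import Data.Nat as ℕ using (ℕ; zero; suc)
open import Data.Nat.DivMod using (m<n*o⇒m/o<n; m*n/n≡m; /-monoˡ-≤)
import Data.Nat.Properties as ℕₚ
open import Data.Nat.Solver using () renaming (module +-*-Solver to ℕSolver)
open import Data.Product using (Σ; ∃; ∃₂; _×_; _,_; proj₁; proj₂)
open import Data.Rational as ℚ using (ℚ; 0ℚ; 1ℚ; ½; _+_; _*_; _-_; -_; _<_; _≤_; _⊓_; _⊔_)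
import Data.Rational.Properties as ℚₚ
open import Data.Rational.Solver using () renaming (module +-*-Solver to ℚSolver)
import Data.Rational.Unnormalised as ℚᵘ
import Data.Rational.Unnormalised.Properties as ℚᵘₚ
open import Data.Sum using (_⊎_; inj₁; inj₂; [_,_]′)
open import Data.Unit using (⊤; tt)
open import Data.Vec as Vec using (Vec; []; _∷_)
open import Function using (_⇔_; Equivalence; mk⇔)
open import Level using (0ℓ; Lift; lift) renaming (suc to lsuc)
open import Relation.Binary.Construct.Closure.ReflexiveTransitive using (_◅_) renaming (ε to ◅-nil)
open import Relation.Binary.Construct.Closure.Symmetric using (fwd; bwd)
open import Relation.Binary.PropositionalEquality hiding (J)
open import Relation.Nullary using (¬_; Dec; yes; no; does)
open import Relation.Unary using (Pred; _∪_; _⊆_)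

open ℚSolver using () renaming (solve to ringℚ; _:+_ to _⊞_; _:*_ to _⊠_; _:=_ to _≔_; con to cn)
open ℤSolver using () renaming (solve to ringℤ; _:+_ to _+ᶻ_; _:*_ to _*ᶻ_; _:=_ to _=ᶻ_; con to litᶻ)
open ℕSolver using () renaming (solve to ringℕ; _:+_ to _⊹_; _:*_ to _⊛_; _:=_ to _≐_; con to lit)
open xor-∧-Solver using () renaming (solve to bool; _:+_ to _⊕_; _:*_ to _⊗_; _:=_ to _⊜_)

-- The vertices do not accumulate, but edges may: long edges can converge to points that are not on
-- the graph. So the image of the graph need not be closed, and a face need not be open. Inside a
-- cycle this cannot happen, since only finitely many vertices, hence edges, are there. For a face
-- that is not yet known to be surrounded, only a neighbourhood of a finite subgraph is controlled,
-- and the outline of the face is cut off where it leaves that neighbourhood. The lost piece does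
-- not affect the comparison of two test points that are joined within the neighbourhood, which is
-- why differences of winding numbers are computed. The boundary of a face may be disconnected or
-- contain bridges, so all statements are about chains modulo 2, and no Jordan curve theorem is
-- invoked. The topology yields cycles with prescribed winding numbers at finitely many points only.
-- Therefore points are first sorted into the finitely many classes that the chains on a finite set
-- of edges can distinguish.

-- Solver for linear identities over the rationals

module LinearEquations where
  open ≡-Reasoning
  open Algebra.Properties.AbelianGroup ℚₚ.+-0-abelianGroup using (⁻¹-∙-comm; ⁻¹-involutive; ε⁻¹≈ε)

  infixl 6 _:+_ _:-_
  infix 8 :-_
  data Lin (n : ℕ) : Set where
    var  : Fin n → Lin n
    :0   : Lin n
    _:+_ : Lin n → Lin n → Lin n
    :-_  : Lin n → Lin n

  _:-_ : ∀ {n} → Lin n → Lin n → Lin n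
  a :- b = a :+ (:- b)

  private
    infixr 7 _⋆_ _•_
    _⋆_ : ℕ → ℚ → ℚ
    zero ⋆ x = 0ℚ
    suc n ⋆ x = x + n ⋆ x

    _•_ : ℤ → ℚ → ℚ
    (ℤ.+ n) • x = n ⋆ x
    -[1+ n ] • x = - (suc n ⋆ x)

    ⋆-+ : ∀ m n x → (m ℕ.+ n) ⋆ x ≡ m ⋆ x + n ⋆ x
    ⋆-+ zero n x = sym (ℚₚ.+-identityˡ _)
    ⋆-+ (suc m) n x = trans (cong (x +_) (⋆-+ m n x)) (sym (ℚₚ.+-assoc x (m ⋆ x) (n ⋆ x)))

    ⊖-• : ∀ m n x → (m ℤ.⊖ n) • x ≡ m ⋆ x + - (n ⋆ x)
    ⊖-• zero zero x = refl
    ⊖-• zero (suc n) x = sym (ℚₚ.+-identityˡ _)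
    ⊖-• (suc m) zero x = sym (ℚₚ.+-identityʳ _)
    ⊖-• (suc m) (suc n) x = begin
      (suc m ℤ.⊖ suc n) • x  ≡⟨ cong (_• x) (ℤₚ.[1+m]⊖[1+n]≡m⊖n m n) ⟩
      (m ℤ.⊖ n) • x          ≡⟨ ⊖-• m n x ⟩
      m ⋆ x + - (n ⋆ x)      ≡⟨ cong (_+ - (n ⋆ x)) (sym (trans (cong (_+ m ⋆ x) (ℚₚ.+-inverseʳ x)) (ℚₚ.+-identityˡ (m ⋆ x)))) ⟩
      (x + - x) + m ⋆ x + - (n ⋆ x) ≡⟨ cong (_+ - (n ⋆ x)) (trans (ℚₚ.+-assoc x (- x) (m ⋆ x)) (trans (cong (x +_) (ℚₚ.+-comm (- x) (m ⋆ x))) (sym (ℚₚ.+-assoc x (m ⋆ x) (- x))))) ⟩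
      (x + m ⋆ x) + - x + - (n ⋆ x) ≡⟨ ℚₚ.+-assoc (x + m ⋆ x) (- x) (- (n ⋆ x)) ⟩
      (x + m ⋆ x) + (- x + - (n ⋆ x)) ≡⟨ cong ((x + m ⋆ x) +_) (⁻¹-∙-comm x (n ⋆ x)) ⟩
      (x + m ⋆ x) + - (x + n ⋆ x) ∎

    •-+ : ∀ c d x → (c ℤ.+ d) • x ≡ c • x + d • x
    •-+ (ℤ.+ m) (ℤ.+ n) x = ⋆-+ m n x
    •-+ (ℤ.+ m) -[1+ n ] x = ⊖-• m (suc n) x
    •-+ -[1+ m ] (ℤ.+ n) x = trans (⊖-• n (suc m) x) (ℚₚ.+-comm (n ⋆ x) (- (suc m ⋆ x)))
    •-+ -[1+ m ] -[1+ n ] x = begin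
      - (x + suc (m ℕ.+ n) ⋆ x)     ≡⟨ cong (λ k → - (x + k)) (trans (cong (x +_) (⋆-+ m n x)) (trans (sym (ℚₚ.+-assoc x (m ⋆ x) (n ⋆ x))) (trans (cong (_+ n ⋆ x) (ℚₚ.+-comm x (m ⋆ x))) (ℚₚ.+-assoc (m ⋆ x) x (n ⋆ x))))) ⟩
      - (x + (m ⋆ x + (x + n ⋆ x))) ≡⟨ cong -_ (sym (ℚₚ.+-assoc x (m ⋆ x) (x + n ⋆ x))) ⟩
      - ((x + m ⋆ x) + (x + n ⋆ x)) ≡⟨ sym (⁻¹-∙-comm (x + m ⋆ x) (x + n ⋆ x)) ⟩
      - (x + m ⋆ x) + - (x + n ⋆ x) ∎

    •-neg : ∀ c x → (ℤ.- c) • x ≡ - (c • x)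
    •-neg (ℤ.+ zero) x = sym ε⁻¹≈ε
    •-neg (ℤ.+ suc n) x = refl
    •-neg -[1+ n ] x = sym (⁻¹-involutive _)

    -- Coefficients are integers, so checking `refl` at a use of `linear` comes down to integer
    -- arithmetic.
    Form : ℕ → Set
    Form n = Vec ℤ n

    sem : ∀ {n} → Form n → Vec ℚ n → ℚ
    sem [] [] = 0ℚ
    sem (c ∷ cs) (x ∷ xs) = c • x + sem cs xs

    unit : ∀ {n} → Fin n → Form n
    unit zero = ℤ.+ 1 ∷ Vec.replicate _ (ℤ.+ 0)
    unit (suc i) = ℤ.+ 0 ∷ unit i

    norm : ∀ {n} → Lin n → Form n
    norm (var i) = unit i
    norm :0 = Vec.replicate _ (ℤ.+ 0)
    norm (a :+ b) = Vec.zipWith ℤ._+_ (norm a) (norm b)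
    norm (:- a) = Vec.map ℤ.-_ (norm a)

    eval : ∀ {n} → Lin n → Vec ℚ n → ℚ
    eval (var i) ρ = Vec.lookup ρ i
    eval :0 ρ = 0ℚ
    eval (a :+ b) ρ = eval a ρ + eval b ρ
    eval (:- a) ρ = - eval a ρ

    sem-0 : ∀ {n} (ρ : Vec ℚ n) → sem (Vec.replicate _ (ℤ.+ 0)) ρ ≡ 0ℚ
    sem-0 [] = refl
    sem-0 (x ∷ ρ) = trans (ℚₚ.+-identityˡ _) (sem-0 ρ)

    sem-unit : ∀ {n} (i : Fin n) ρ → sem (unit i) ρ ≡ Vec.lookup ρ i
    sem-unit zero (x ∷ ρ) = trans (cong₂ _+_ (ℚₚ.+-identityʳ x) (sem-0 ρ)) (ℚₚ.+-identityʳ x)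
    sem-unit (suc i) (x ∷ ρ) = trans (ℚₚ.+-identityˡ _) (sem-unit i ρ)

    interchange : ∀ a b c d → (a + b) + (c + d) ≡ (a + c) + (b + d)
    interchange a b c d = trans (ℚₚ.+-assoc a b _) (trans (cong (a +_) (trans (sym (ℚₚ.+-assoc b c d))
      (trans (cong (_+ d) (ℚₚ.+-comm b c)) (ℚₚ.+-assoc c b d)))) (sym (ℚₚ.+-assoc a c _)))

    sem-+ : ∀ {n} (f g : Form n) ρ → sem (Vec.zipWith ℤ._+_ f g) ρ ≡ sem f ρ + sem g ρ
    sem-+ [] [] [] = refl
    sem-+ (c ∷ f) (d ∷ g) (x ∷ ρ) = trans (cong₂ _+_ (•-+ c d x) (sem-+ f g ρ)) (interchange (c • x) (d • x) _ _)

    sem-neg : ∀ {n} (f : Form n) ρ → sem (Vec.map ℤ.-_ f) ρ ≡ - sem f ρ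
    sem-neg [] [] = sym ε⁻¹≈ε
    sem-neg (c ∷ f) (x ∷ ρ) = trans (cong₂ _+_ (•-neg c x) (sem-neg f ρ)) (⁻¹-∙-comm (c • x) (sem f ρ))

    correct : ∀ {n} (e : Lin n) ρ → sem (norm e) ρ ≡ eval e ρ
    correct (var i) ρ = sem-unit i ρ
    correct :0 ρ = sem-0 ρ
    correct (a :+ b) ρ = trans (sem-+ (norm a) (norm b) ρ) (cong₂ _+_ (correct a ρ) (correct b ρ))
    correct (:- a) ρ = trans (sem-neg (norm a) ρ) (cong -_ (correct a ρ))

  open import Relation.Binary.Reflection (setoid ℚ) var eval (λ e → sem (norm e)) correct public
    using () renaming (solve to linear; _⊜_ to _:=_)

open LinearEquations using (linear; _:+_; _:-_; :-_; :0; _:=_)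

-- Sums modulo 2

xor-≡ : ∀ {a b} → a xor b ≡ false → a ≡ b
xor-≡ {false} {b} e = sym e
xor-≡ {true} {true} e = refl

≡-xor : ∀ {a b} → a ≡ b → a xor b ≡ false
≡-xor {a} refl = xor-same a

xor-cancel : ∀ a b → a xor (a xor b) ≡ b
xor-cancel false b = refl
xor-cancel true false = refl
xor-cancel true true = refl

not-both : ∀ {b : Bool} → b ≡ true → b ≡ false → ⊥
not-both refl ()

-- The pairing of a cochain `f` with the chain `xs` over the field with two elements. Equality of
-- chains is expressed throughout as agreement for every cochain, so order and even repetitions in a
-- list do not matter.
⨁ : {A : Set} → (A → Bool) → List A → Bool
⨁ f [] = false
⨁ f (x ∷ xs) = f x xor ⨁ f xs

⨁-++ : {A : Set} (f : A → Bool) (xs ys : List A) → ⨁ f (xs ++ ys) ≡ ⨁ f xs xor ⨁ f ys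
⨁-++ f [] ys = refl
⨁-++ f (x ∷ xs) ys = trans (cong (f x xor_) (⨁-++ f xs ys)) (sym (xor-assoc (f x) _ _))

⨁-cong : {A : Set} {f g : A → Bool} (xs : List A) → (∀ {x} → x ∈ xs → f x ≡ g x) → ⨁ f xs ≡ ⨁ g xs
⨁-cong [] h = refl
⨁-cong (x ∷ xs) h = cong₂ _xor_ (h (here refl)) (⨁-cong xs λ m → h (there m))

xor-interchange : ∀ a b c d → (a xor b) xor (c xor d) ≡ (a xor c) xor (b xor d)
xor-interchange = bool 4 (λ a b c d → (a ⊕ b) ⊕ (c ⊕ d) ⊜ (a ⊕ c) ⊕ (b ⊕ d)) refl

⨁-xor : {A : Set} (f g : A → Bool) (xs : List A) → ⨁ (λ x → f x xor g x) xs ≡ ⨁ f xs xor ⨁ g xs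
⨁-xor f g [] = refl
⨁-xor f g (x ∷ xs) = trans (cong ((f x xor g x) xor_) (⨁-xor f g xs)) (xor-interchange (f x) (g x) _ _)

⨁-false : {A : Set} {f : A → Bool} (xs : List A) → (∀ {x} → x ∈ xs → f x ≡ false) → ⨁ f xs ≡ false
⨁-false [] h = refl
⨁-false (x ∷ xs) h = cong₂ _xor_ (h (here refl)) (⨁-false xs λ m → h (there m))

⨁-true : {A : Set} {f : A → Bool} (xs : List A) → ⨁ f xs ≡ true → ∃ λ x → x ∈ xs × f x ≡ true
⨁-true {f = f} (x ∷ xs) e with f x in fx
... | true = x , here refl , fx
... | false with ⨁-true xs e
... | y , y∈ , fy = y , there y∈ , fy

-- Classical decisions and finite lists

module Classical (em : ExcludedMiddle (lsuc 0ℓ)) where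

  dec : (P : Set) → Dec P
  dec P with em {Lift (lsuc 0ℓ) P}
  ... | yes (lift p) = yes p
  ... | no ¬p        = no λ p → ¬p (lift p)

  opaque
    -- Truth values as elements of the field with two elements; through them regions and sets of
    -- vertices enter parity sums.
    ⟦_⟧ : Set → Bool
    ⟦ P ⟧ = does (dec P)

    ⟦⟧-true : ∀ {P} → P → ⟦ P ⟧ ≡ true
    ⟦⟧-true {P} p with dec P
    ... | yes _ = refl
    ... | no ¬p = ⊥-elim (¬p p)

    ⟦⟧-false : ∀ {P} → ¬ P → ⟦ P ⟧ ≡ false
    ⟦⟧-false {P} ¬p with dec P
    ... | yes p = ⊥-elim (¬p p)
    ... | no _  = refl

    ⟦⟧-sound : ∀ {P} → ⟦ P ⟧ ≡ true → P
    ⟦⟧-sound {P} eq with dec P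
    ... | yes p = p
    ⟦⟧-sound () | no _

    ⟦⟧-refute : ∀ {P} → ⟦ P ⟧ ≡ false → ¬ P
    ⟦⟧-refute {P} eq with dec P
    ⟦⟧-refute () | yes _
    ... | no ¬p = ¬p

    ⟦⟧-cong : ∀ {P Q} → (P → Q) → (Q → P) → ⟦ P ⟧ ≡ ⟦ Q ⟧
    ⟦⟧-cong {P} {Q} f g with dec P | dec Q
    ... | yes _ | yes _ = refl
    ... | yes p | no ¬q = ⊥-elim (¬q (f p))
    ... | no ¬p | yes q = ⊥-elim (¬p (g q))
    ... | no _  | no _  = refl

  dne : ∀ {P : Set} → ¬ ¬ P → P
  dne {P} nn with dec P
  ... | yes p = p
  ... | no ¬p = ⊥-elim (nn ¬p)

  ¬∀⇒∃ : ∀ {A : Set} {P : A → Set} → ¬ (∀ a → P a) → ∃ λ a → ¬ P a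
  ¬∀⇒∃ {A} {P} n with dec (∃ λ a → ¬ P a)
  ... | yes e = e
  ... | no ¬e = ⊥-elim (n λ a → dne λ np → ¬e (a , np))

  module _ {A : Set} where

    unique-cons : ∀ {x : A} {xs} → x ∉ xs → Unique xs → Unique (x ∷ xs)
    unique-cons n u = tabulate (λ m e → n (subst (_∈ _) (sym e) m)) ∷ u

    unique-head : ∀ {x : A} {xs} → Unique (x ∷ xs) → x ∉ xs
    unique-head (a ∷ _) m = lookup a m refl

    unique-tail : ∀ {x : A} {xs} → Unique (x ∷ xs) → Unique xs
    unique-tail (_ ∷ u) = u

    record Extract (e : A) (R : List A) : Set where
      field
        rest   : List A
        parity : ∀ ψ → ⨁ ψ R ≡ ψ e xor ⨁ ψ rest
        rest⊂  : ∀ {x} → x ∈ rest → x ∈ R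
        others : ∀ {x} → x ∈ R → x ≢ e → x ∈ rest
        shrink : length R ≡ suc (length rest)
        uniq   : Unique R → Unique rest × e ∉ rest

    extract : ∀ {e R} → e ∈ R → Extract e R
    extract {e} {x ∷ R} (here refl) = record { rest = R ; parity = λ _ → refl ; rest⊂ = there ; others = λ { (here refl) n → ⊥-elim (n refl) ; (there m) _ → m } ; shrink = refl ; uniq = λ u → unique-tail u , unique-head u }
    extract {e} {x ∷ R} (there m) = let module X = Extract (extract m) in record
      { rest = x ∷ X.rest
      ; parity = λ ψ → trans (cong (ψ x xor_) (X.parity ψ)) (swap (ψ x) (ψ e) (⨁ ψ X.rest))
      ; rest⊂ = λ { (here refl) → here refl ; (there k) → there (X.rest⊂ k) }
      ; others = λ { (here refl) _ → here refl ; (there k) n → there (X.others k n) }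
      ; shrink = cong suc X.shrink
      ; uniq = λ u → unique-cons (λ k → unique-head u (X.rest⊂ k)) (proj₁ (X.uniq (unique-tail u))) , λ { (here refl) → unique-head u m ; (there k) → proj₂ (X.uniq (unique-tail u)) k } }
      where
      swap : ∀ a b c → a xor (b xor c) ≡ b xor (a xor c)
      swap = bool 3 (λ a b c → a ⊕ (b ⊕ c) ⊜ b ⊕ (a ⊕ c)) refl

    pigeonhole : ∀ {xs ys : List A} → Unique xs → (∀ {x} → x ∈ xs → x ∈ ys) → length xs ℕ.≤ length ys
    pigeonhole {[]} u s = ℕ.z≤n
    pigeonhole {x ∷ xs} {ys} u s = let module X = Extract (extract (s (here refl))) in
      subst (suc (length xs) ℕ.≤_) (sym X.shrink) (ℕ.s≤s (pigeonhole (unique-tail u) (λ {y} m → X.others (s (there m)) (λ e → unique-head u (subst (_∈ xs) e m)))))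

    record Dedup (xs : List A) : Set where
      field
        list  : List A
        uniq  : Unique list
        sound : ∀ {x} → x ∈ list → x ∈ xs
        full  : ∀ {x} → x ∈ xs → x ∈ list

    dedup : ∀ xs → Dedup xs
    dedup [] = record { list = [] ; uniq = [] ; sound = λ m → m ; full = λ m → m }
    dedup (x ∷ xs) = go (dec (x ∈ Dedup.list (dedup xs)))
      where
      module D = Dedup (dedup xs)
      go : Dec (x ∈ D.list) → Dedup (x ∷ xs)
      go (yes m) = record { list = D.list ; uniq = D.uniq ; sound = λ k → there (D.sound k) ; full = λ { (here refl) → m ; (there k) → D.full k } }
      go (no n) = record { list = x ∷ D.list ; uniq = unique-cons n D.uniq ; sound = λ { (here refl) → here refl ; (there k) → there (D.sound k) } ; full = λ { (here refl) → here refl ; (there k) → there (D.full k) } }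

    select : ∀ (Pr : A → Set) (xs : List A) → ∃ λ ys → (∀ {x} → x ∈ ys → x ∈ xs × Pr x) × (∀ {x} → x ∈ xs → Pr x → x ∈ ys)
    select Pr [] = [] , (λ ()) , λ ()
    select Pr (x ∷ xs) = go (dec (Pr x)) (select Pr xs)
      where
      go : Dec (Pr x) → _ → ∃ λ ys → (∀ {y} → y ∈ ys → y ∈ x ∷ xs × Pr y) × (∀ {y} → y ∈ x ∷ xs → Pr y → y ∈ ys)
      go (yes p) (ys , f , g) = x ∷ ys , (λ { (here refl) → here refl , p ; (there m) → let (a , b) = f m in there a , b }) , λ { (here refl) _ → here refl ; (there m) q → there (g m q) }
      go (no n) (ys , f , g) = ys , (λ m → let (a , b) = f m in there a , b) , λ { (here refl) q → ⊥-elim (n q) ; (there m) q → g m q }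

    record Finite (Pr : A → Set) : Set where
      constructor finite
      field
        elems : List A
        uniq  : Unique elems
        sound : ∀ {x} → x ∈ elems → Pr x
        full  : ∀ {x} → Pr x → x ∈ elems

    enumerate : ∀ (Pr : A → Set) (xs : List A) → (∀ {x} → Pr x → x ∈ xs) → Finite Pr
    enumerate Pr xs h = let (ys , f , g) = select Pr xs
                            module D = Dedup (dedup ys)
                        in finite D.list D.uniq (λ m → proj₂ (f (D.sound m))) (λ p → D.full (g (h p) p))

    hasSize : ∀ {Pr : A → Set} (f : Finite Pr) → HasSize Pr (length (Finite.elems f))
    hasSize (finite xs u s f) = xs , u , refl , λ x → mk⇔ f s

    fromSize : ∀ {Pr : A → Set} {n} → HasSize Pr n → Σ (Finite Pr) λ f → length (Finite.elems f) ≡ n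
    fromSize (xs , u , e , h) = finite xs u (λ {x} → Equivalence.from (h x)) (λ {x} → Equivalence.to (h x)) , e

    finite-≤ : ∀ {Pr : A → Set} (f : Finite Pr) xs → (∀ {x} → Pr x → x ∈ xs) → length (Finite.elems f) ℕ.≤ length xs
    finite-≤ (finite ys u s _) xs h = pigeonhole u (λ m → h (s m))

    -- Unlike `Dedup`, this cancels repetitions in pairs. The chain modulo 2 stays the same and its
    -- support becomes visible: exactly the elements of odd multiplicity survive.
    record Reduced (L : List A) : Set where
      field
        list  : List A
        uniq  : Unique list
        sound : ∀ {x} → x ∈ list → x ∈ L
        equal : ∀ ψ → ⨁ ψ list ≡ ⨁ ψ L

    reduce : ∀ L → Reduced L
    reduce [] = record { list = [] ; uniq = [] ; sound = λ m → m ; equal = λ _ → refl }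
    reduce (x ∷ L) = go (dec (x ∈ Reduced.list (reduce L)))
      where
      module R = Reduced (reduce L)
      go : Dec (x ∈ R.list) → Reduced (x ∷ L)
      go (no n) = record { list = x ∷ R.list ; uniq = unique-cons n R.uniq ; sound = λ { (here refl) → here refl ; (there k) → there (R.sound k) } ; equal = λ ψ → cong (ψ x xor_) (R.equal ψ) }
      go (yes m) = let module X = Extract (extract m) in record { list = X.rest ; uniq = proj₁ (X.uniq R.uniq) ; sound = λ k → there (R.sound (X.rest⊂ k))
        ; equal = λ ψ → trans (sym (xor-cancel (ψ x) (⨁ ψ X.rest))) (cong (ψ x xor_) (trans (sym (X.parity ψ)) (R.equal ψ))) }

    concat-length : ∀ {B : Set} (f : B → List A) k xs → (∀ {x} → x ∈ xs → length (f x) ℕ.≤ k) → length (concat (map f xs)) ℕ.≤ length xs ℕ.* k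
    concat-length f k [] h = ℕ.z≤n
    concat-length f k (x ∷ xs) h = subst (ℕ._≤ k ℕ.+ length xs ℕ.* k) (sym (length-++ (f x))) (ℕₚ.+-mono-≤ (h (here refl)) (concat-length f k xs (λ m → h (there m))))

    ∈-concat-map : ∀ {B : Set} (f : B → List A) {xs x y} → x ∈ xs → y ∈ f x → y ∈ concat (map f xs)
    ∈-concat-map f {x ∷ xs} (here refl) m = ∈-++⁺ˡ m
    ∈-concat-map f {x ∷ xs} (there k) m = ∈-++⁺ʳ (f x) (∈-concat-map f k m)

    ∈-concat-map⁻ : ∀ {B : Set} (f : B → List A) xs {y} → y ∈ concat (map f xs) → ∃ λ x → x ∈ xs × y ∈ f x
    ∈-concat-map⁻ f (x ∷ xs) m = [ (λ k → x , here refl , k) , (λ k → let (a , b , c) = ∈-concat-map⁻ f xs k in a , there b , c) ]′ (∈-++⁻ (f x) m)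

  -- Finitely many tests have finitely many joint outcomes; one point is kept for each outcome that
  -- occurs within `Pr`.
  representatives : ∀ {X T : Set} (test : T → X → Bool) (ts : List T) (Pr : X → Set) →
    ∃ λ (reps : List X) → (∀ {r} → r ∈ reps → Pr r) × (∀ {x} → Pr x → ∃ λ r → r ∈ reps × (∀ {t} → t ∈ ts → test t x ≡ test t r))
  representatives {X} {T} test [] Pr = go (dec (∃ Pr))
    where
    go : Dec (∃ Pr) → ∃ λ (reps : List X) → (∀ {r} → r ∈ reps → Pr r) × (∀ {x} → Pr x → ∃ λ r → r ∈ reps × (∀ {t : T} → t ∈ [] → test t x ≡ test t r))
    go (yes (x , p)) = x ∷ [] , (λ { (here refl) → p }) , λ _ → x , here refl , λ ()
    go (no n) = [] , (λ ()) , λ p → ⊥-elim (n (_ , p))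
  representatives {X} test (t ∷ ts) Pr =
    let (R , f , g) = representatives test ts (λ x → Pr x × test t x ≡ true)
        (R' , f' , g') = representatives test ts (λ x → Pr x × test t x ≡ false)
    in R ++ R' , (λ m → [ (λ k → proj₁ (f k)) , (λ k → proj₁ (f' k)) ]′ (∈-++⁻ R m)) ,
       λ {x} p → side R R' f g f' g' x p (test t x) refl
    where
    side : ∀ R R' → (∀ {r} → r ∈ R → Pr r × test t r ≡ true) → (∀ {x} → Pr x × test t x ≡ true → ∃ λ r → r ∈ R × (∀ {t} → t ∈ ts → test t x ≡ test t r)) →
      (∀ {r} → r ∈ R' → Pr r × test t r ≡ false) → (∀ {x} → Pr x × test t x ≡ false → ∃ λ r → r ∈ R' × (∀ {t} → t ∈ ts → test t x ≡ test t r)) →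
      ∀ x → Pr x → ∀ b → test t x ≡ b → ∃ λ r → r ∈ R ++ R' × (∀ {s} → s ∈ t ∷ ts → test s x ≡ test s r)
    side R R' f g f' g' x p true e = let (r , m , h) = g (p , e) in r , ∈-++⁺ˡ m , λ { (here refl) → trans e (sym (proj₂ (f m))) ; (there k) → h k }
    side R R' f g f' g' x p false e = let (r , m , h) = g' (p , e) in r , ∈-++⁺ʳ R m , λ { (here refl) → trans e (sym (proj₂ (f' m))) ; (there k) → h k }

  sublists : ∀ {A : Set} → List A → List (List A)
  sublists [] = [] ∷ []
  sublists (x ∷ xs) = map (x ∷_) (sublists xs) ++ sublists xs

  -- Modulo 2 there are only finitely many chains on `K`. Together with `representatives` this
  -- reduces questions about all points of the plane to finitely many points.
  sublist-of : ∀ {A : Set} (K L : List A) → (∀ {x} → x ∈ L → x ∈ K) → ∃ λ M → M ∈ sublists K × (∀ {x} → x ∈ M → x ∈ L) × (∀ ψ → ⨁ ψ M ≡ ⨁ ψ L)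
  sublist-of {A} K L s = let module R = Reduced (reduce L)
                             (M , a , b , c) = go K R.list R.uniq (λ m → s (R.sound m)) in M , a , (λ m → R.sound (b m)) , λ ψ → trans (c ψ) (R.equal ψ)
    where
    open import Data.List.Membership.Propositional.Properties using (∈-map⁺)
    go : ∀ K R → Unique R → (∀ {x} → x ∈ R → x ∈ K) → ∃ λ M → M ∈ sublists K × (∀ {x} → x ∈ M → x ∈ R) × (∀ ψ → ⨁ ψ M ≡ ⨁ ψ R)
    go [] [] u s = [] , here refl , (λ m → m) , λ _ → refl
    go [] (x ∷ R) u s with s (here refl)
    ... | ()
    go (k ∷ K) R u s = pick (dec (k ∈ R))
      where
      pick : Dec (k ∈ R) → ∃ λ M → M ∈ sublists (k ∷ K) × (∀ {x} → x ∈ M → x ∈ R) × (∀ ψ → ⨁ ψ M ≡ ⨁ ψ R)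
      pick (yes m) = let module X = Extract (extract m)
                         (M , a , b , c) = go K X.rest (proj₁ (X.uniq u)) (λ {x} q → tailOf (s (X.rest⊂ q)) (λ e → proj₂ (X.uniq u) (subst (_∈ X.rest) e q)))
                     in k ∷ M , ∈-++⁺ˡ (∈-map⁺ (k ∷_) a) , (λ { (here refl) → m ; (there q) → X.rest⊂ (b q) }) , λ ψ → trans (cong (ψ k xor_) (c ψ)) (sym (X.parity ψ))
        where
        tailOf : ∀ {x} → x ∈ k ∷ K → x ≢ k → x ∈ K
        tailOf (here e) n = ⊥-elim (n e)
        tailOf (there q) _ = q
      pick (no n) = let (M , a , b , c) = go K R u (λ {x} q → tailOf (s q) (λ e → n (subst (_∈ R) e q))) in M , ∈-++⁺ʳ (map (k ∷_) (sublists K)) a , b , c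
        where
        tailOf : ∀ {x} → x ∈ k ∷ K → x ≢ k → x ∈ K
        tailOf (here e) n = ⊥-elim (n e)
        tailOf (there q) _ = q

-- Rational estimates

module RealPlane (em : ExcludedMiddle (lsuc 0ℓ)) where
  open Classical em

  -- Linear arithmetic: an inequality follows from another one with the same difference of sides.
  lin< : ∀ {p q a b} → p < q → b + p ≡ a + q → a < b
  lin< {p} {q} {a} {b} h e = subst₂ _<_
    (linear 3 (λ a p q → (a :+ q) :+ (:- q) := a) refl a p q)
    (linear 3 (λ b p q → (b :+ q) :+ (:- q) := b) refl b p q)
    (ℚₚ.+-monoˡ-< (- q) (subst (_< b + q) e (ℚₚ.+-monoʳ-< b h)))

  lin≤ : ∀ {p q a b} → p ≤ q → b + p ≡ a + q → a ≤ b
  lin≤ {p} {q} {a} {b} h e = subst₂ _≤_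
    (linear 3 (λ a p q → (a :+ q) :+ (:- q) := a) refl a p q)
    (linear 3 (λ b p q → (b :+ q) :+ (:- q) := b) refl b p q)
    (ℚₚ.+-monoˡ-≤ (- q) (subst (_≤ b + q) e (ℚₚ.+-monoʳ-≤ b h)))

  infixl 5 _<+<_ _<+≤_ _≤+<_ _≤+≤_
  _<+<_ : ∀ {a b c d} → a < b → c < d → a + c < b + d
  _<+<_ = ℚₚ.+-mono-<
  _<+≤_ : ∀ {a b c d} → a < b → c ≤ d → a + c < b + d
  _<+≤_ = ℚₚ.+-mono-<-≤
  _≤+<_ : ∀ {a b c d} → a ≤ b → c < d → a + c < b + d
  _≤+<_ = ℚₚ.+-mono-≤-<
  _≤+≤_ : ∀ {a b c d} → a ≤ b → c ≤ d → a + c ≤ b + d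
  _≤+≤_ = ℚₚ.+-mono-≤

  ≮⇒≥ : ∀ {p q : ℚ} → ¬ (p < q) → q ≤ p
  ≮⇒≥ = ℚₚ.≮⇒≥

  <-or-≥ : ∀ (p q : ℚ) → p < q ⊎ q ≤ p
  <-or-≥ p q with p ℚₚ.<? q
  ... | yes h = inj₁ h
  ... | no h  = inj₂ (≮⇒≥ h)

  <⇒≢≥ : ∀ {p q : ℚ} → p < q → q ≤ p → ⊥
  <⇒≢≥ h k = ℚₚ.<-irrefl refl (ℚₚ.<-≤-trans h k)

  0<1/ : ∀ n → 0ℚ < 1/1+ n
  0<1/ n = ℚₚ.positive⁻¹ (1/1+ n) {{ℚₚ.normalize-pos 1 (suc n)}}

  1/1+-toℚᵘ : ∀ n → ℚ.toℚᵘ (1/1+ n) ℚᵘ.≃ ℚᵘ.mkℚᵘ (ℤ.+ 1) n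
  1/1+-toℚᵘ n = ℚₚ.toℚᵘ-fromℚᵘ (ℚᵘ.mkℚᵘ (ℤ.+ 1) n)

  1/≤pos : ∀ {q} → 0ℚ < q → ∃ λ d → 1/1+ d ≤ q
  1/≤pos {q@(ℚ.mkℚ (ℤ.+ suc a) d c)} h = d , ℚₚ.toℚᵘ-cancel-≤
    (ℚᵘₚ.≤-respˡ-≃ (ℚᵘₚ.≃-sym (1/1+-toℚᵘ d)) (ℚᵘ.*≤* (ℤₚ.*-monoʳ-≤-nonNeg (ℤ.+ suc d) {ℤ.+ 1} {ℤ.+ suc a} (ℤ.+≤+ (ℕ.s≤s ℕ.z≤n)))))
  1/≤pos {ℚ.mkℚ (ℤ.+ zero) d c} (ℚ.*<* (ℤ.+<+ ()))
  1/≤pos {ℚ.mkℚ (ℤ.-[1+ n ]) d c} (ℚ.*<* ())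

  1/-anti : ∀ {m n} → m ℕ.≤ n → 1/1+ n ≤ 1/1+ m
  1/-anti {m} {n} h = ℚₚ.toℚᵘ-cancel-≤
    (ℚᵘₚ.≤-respˡ-≃ (ℚᵘₚ.≃-sym (1/1+-toℚᵘ n)) (ℚᵘₚ.≤-respʳ-≃ (ℚᵘₚ.≃-sym (1/1+-toℚᵘ m))
      (ℚᵘ.*≤* (ℤₚ.*-monoˡ-≤-nonNeg (ℤ.+ 1) (ℤ.+≤+ (ℕ.s≤s h))))))

  1/-halve : ∀ n → 1/1+ (suc (n ℕ.+ n)) + 1/1+ (suc (n ℕ.+ n)) ≡ 1/1+ n
  1/-halve n = ℚₚ.toℚᵘ-injective (ℚᵘₚ.≃-trans (ℚₚ.toℚᵘ-homo-+ (1/1+ k) (1/1+ k))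
     (ℚᵘₚ.≃-trans (ℚᵘₚ.+-cong (1/1+-toℚᵘ k) (1/1+-toℚᵘ k)) (ℚᵘₚ.≃-trans (ℚᵘ.*≡* eq) (ℚᵘₚ.≃-sym (1/1+-toℚᵘ n)))))
    where
    k = suc (n ℕ.+ n)
    eq : (ℤ.+ 1 ℤ.* ℤ.+ suc k ℤ.+ ℤ.+ 1 ℤ.* ℤ.+ suc k) ℤ.* ℤ.+ suc n ≡ ℤ.+ 1 ℤ.* (ℤ.+ suc k ℤ.* ℤ.+ suc k)
    eq = subst (λ z → (ℤ.+ 1 ℤ.* z ℤ.+ ℤ.+ 1 ℤ.* z) ℤ.* ℤ.+ suc n ≡ ℤ.+ 1 ℤ.* (z ℤ.* z))
           (cong (λ m → ℤ.+ suc m) (ℕₚ.+-suc n n))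
           (ringℤ 1 (λ s → (litᶻ (ℤ.+ 1) *ᶻ (s +ᶻ s) +ᶻ litᶻ (ℤ.+ 1) *ᶻ (s +ᶻ s)) *ᶻ s =ᶻ litᶻ (ℤ.+ 1) *ᶻ ((s +ᶻ s) *ᶻ (s +ᶻ s))) refl (ℤ.+ suc n))

  steps : ℕ → ℚ
  steps zero = 1ℚ
  steps (suc n) = steps n + 1ℚ

  natBound : ∀ q → ∃ λ n → q ≤ steps n
  natBound (ℚ.mkℚ (ℤ.+ a) d c) = a , ℚₚ.toℚᵘ-cancel-≤ (ℚᵘₚ.≤-respʳ-≃ (ℚᵘₚ.≃-sym (steps≃ a))
      (ℚᵘ.*≤* (ℤₚ.≤-trans (ℤₚ.≤-reflexive (ℤₚ.*-identityʳ (ℤ.+ a))) (ℤₚ.≤-trans (ℤ.+≤+ (ℕₚ.≤-trans (ℕₚ.n≤1+n a) (ℕₚ.m≤m*n (suc a) (suc d)))) (ℤₚ.≤-reflexive (ℤₚ.pos-* (suc a) (suc d)))))))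
    where
    steps≃ : ∀ n → ℚ.toℚᵘ (steps n) ℚᵘ.≃ ℚᵘ.mkℚᵘ (ℤ.+ suc n) 0
    steps≃ zero = ℚᵘₚ.≃-refl
    steps≃ (suc n) = ℚᵘₚ.≃-trans (ℚₚ.toℚᵘ-homo-+ (steps n) 1ℚ) (ℚᵘₚ.≃-trans (ℚᵘₚ.+-congˡ (ℚ.toℚᵘ 1ℚ) (steps≃ n)) (ℚᵘ.*≡* (eq n)))
      where
      eq : ∀ n → ((ℤ.+ suc n ℤ.* ℤ.+ 1) ℤ.+ (ℤ.+ 1 ℤ.* ℤ.+ 1)) ℤ.* ℤ.+ 1 ≡ ℤ.+ suc (suc n) ℤ.* ℤ.+ 1
      eq n = cong (ℤ._* ℤ.+ 1) (trans (cong (ℤ._+ ℤ.+ 1) (ℤₚ.*-identityʳ (ℤ.+ suc n))) (cong ℤ.+_ (ℕₚ.+-comm (suc n) 1)))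
  natBound (ℚ.mkℚ (ℤ.-[1+ a ]) d c) = 0 , ℚ.*≤* ℤ.-≤+

  archi : ∀ {ε} → 0ℚ < ε → ∃ λ n → 1/1+ n + 1/1+ n ≤ ε
  archi {ε} h = from (1/≤pos h)
    where
    from : (∃ λ d → 1/1+ d ≤ ε) → ∃ λ n → 1/1+ n + 1/1+ n ≤ ε
    from (d , le) = suc (d ℕ.+ d) , subst (_≤ ε) (sym (1/-halve d)) le

  archi4 : ∀ {ε} → 0ℚ < ε → ∃ λ n → (1/1+ n + 1/1+ n) + (1/1+ n + 1/1+ n) ≤ ε
  archi4 {ε} h = from (archi h)
    where
    from : (∃ λ d → 1/1+ d + 1/1+ d ≤ ε) → ∃ λ n → (1/1+ n + 1/1+ n) + (1/1+ n + 1/1+ n) ≤ ε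
    from (d , le) = suc (d ℕ.+ d) , subst (_≤ ε) (cong₂ _+_ (sym (1/-halve d)) (sym (1/-halve d))) le

  midpoint : ℚ → ℚ → ℚ
  midpoint l r = ½ * (l + r)

  ½2 : ∀ a → ½ * a + ½ * a ≡ a
  ½2 = ringℚ 1 (λ a → cn ½ ⊠ a ⊞ cn ½ ⊠ a ≔ a) refl

  half-pos : ∀ {a} → 0ℚ < a → 0ℚ < ½ * a
  half-pos {a} h = subst (_< ½ * a) (ℚₚ.*-zeroʳ ½) (ℚₚ.*-monoʳ-<-pos ½ h)

  midpoint≥ : ∀ {l r} → l ≤ r → l ≤ midpoint l r
  midpoint≥ {l} {r} h = lin≤ (ℚₚ.*-monoˡ-≤-nonNeg ½ h) (ringℚ 2 (λ l r → cn ½ ⊠ (l ⊞ r) ⊞ cn ½ ⊠ l ≔ l ⊞ cn ½ ⊠ r) refl l r)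

  midpoint≤ : ∀ {l r} → l ≤ r → midpoint l r ≤ r
  midpoint≤ {l} {r} h = lin≤ (ℚₚ.*-monoˡ-≤-nonNeg ½ h) (ringℚ 2 (λ l r → r ⊞ cn ½ ⊠ l ≔ cn ½ ⊠ (l ⊞ r) ⊞ cn ½ ⊠ r) refl l r)

  p≤∣p∣ : ∀ p → p ≤ ℚ.∣ p ∣
  p≤∣p∣ p with ℚₚ.≤-total 0ℚ p
  ... | inj₁ h = ℚₚ.≤-reflexive (sym (ℚₚ.0≤p⇒∣p∣≡p h))
  ... | inj₂ h = ℚₚ.≤-trans h (ℚₚ.0≤∣p∣ p)

  reg-≤ : ∀ (x : ℝ) m n → seq x m ≤ seq x n + (1/1+ m + 1/1+ n)
  reg-≤ x m n = lin≤ (ℚₚ.≤-trans (p≤∣p∣ _) (regular x m n))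
      (linear 4 (λ a b c d → (b :+ (c :+ d)) :+ (a :- b) := a :+ (c :+ d)) refl (seq x m) (seq x n) (1/1+ m) (1/1+ n))

  -- Real numbers as located cuts of the rationals

  infix 4 _<∙_ _∙<_ _≋_ _≺_
  opaque
    _<∙_ : ℚ → ℝ → Set
    q <∙ x = q <ʳ x

    _∙<_ : ℝ → ℚ → Set
    x ∙< q = x ʳ< q

    _≋_ : ℝ → ℝ → Set
    x ≋ y = x ≈ʳ y

  _≺_ : ℝ → ℝ → Set
  x ≺ y = ∃ λ q → x ∙< q × q <∙ y

  opaque
    unfolding _<∙_ _∙<_ _≋_

    mk<∙ : ∀ {q x} → q <ʳ x → q <∙ x
    mk<∙ h = h
    un<∙ : ∀ {q x} → q <∙ x → q <ʳ x
    un<∙ h = h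
    mk∙< : ∀ {q x} → x ʳ< q → x ∙< q
    mk∙< h = h
    un∙< : ∀ {q x} → x ∙< q → x ʳ< q
    un∙< h = h
    mk≋ : ∀ {x y} → x ≈ʳ y → x ≋ y
    mk≋ h = h
    un≋ : ∀ {x y} → x ≋ y → x ≈ʳ y
    un≋ h = h

    cut-< : ∀ {q s} (x : ℝ) → q <∙ x → x ∙< s → q < s
    cut-< {q} {s} x (n , a) (m , b) = lin< (a <+< b <+≤ reg-≤ x n m)
      (linear 6 (λ q s xn xm n m → s :+ (q :+ n :+ (xm :+ m) :+ xn) := q :+ (xn :+ s :+ (xm :+ (n :+ m)))) refl
         q s (seq x n) (seq x m) (1/1+ n) (1/1+ m))

    diff-pos : ∀ {q s} → q < s → 0ℚ < s - q
    diff-pos {q} {s} h = lin< h (linear 2 (λ q s → (s :- q) :+ q := :0 :+ s) refl q s)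

    -- Four error terms fit between `q` and `s`, so a single approximation of that precision decides
    -- which alternative to choose.
    cut-loc : ∀ {q s} (x : ℝ) → q < s → q <∙ x ⊎ x ∙< s
    cut-loc {q} {s} x h = from (archi4 (diff-pos h))
      where
      from : (∃ λ n → (1/1+ n + 1/1+ n) + (1/1+ n + 1/1+ n) ≤ s - q) → q <∙ x ⊎ x ∙< s
      from (k , le) = split (<-or-≥ (seq x k + 1/1+ k) s)
        where
        split : seq x k + 1/1+ k < s ⊎ s ≤ seq x k + 1/1+ k → q <∙ x ⊎ x ∙< s
        split (inj₁ lt) = inj₂ (k , lt)
        split (inj₂ ge) = inj₁ (k , lin< ((0<1/ k <+< 0<1/ k) <+≤ le <+≤ ge)
          (linear 4 (λ q s x k → x :+ (:0 :+ :0 :+ ((k :+ k) :+ (k :+ k)) :+ s) := (q :+ k) :+ ((k :+ k) :+ (s :- q) :+ (x :+ k))) refl q s (seq x k) (1/1+ k)))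

    <∙-down : ∀ {q q'} (x : ℝ) → q' ≤ q → q <∙ x → q' <∙ x
    <∙-down x h (n , a) = n , ℚₚ.≤-<-trans (ℚₚ.+-monoˡ-≤ (1/1+ n) h) a

    ∙<-up : ∀ {q q'} (x : ℝ) → q ≤ q' → x ∙< q → x ∙< q'
    ∙<-up x h (n , a) = n , ℚₚ.<-≤-trans a h

    <∙-round : ∀ {q} (x : ℝ) → q <∙ x → ∃ λ q' → q < q' × q' <∙ x
    <∙-round {q} x (n , a) = from (ℚₚ.<-dense a)
      where
      from : (∃ λ m → q + 1/1+ n < m × m < seq x n) → ∃ λ q' → q < q' × q' <∙ x
      from (m , l , r) = m - 1/1+ n , lin< l (linear 3 (λ q m n → (m :- n) :+ (q :+ n) := q :+ m) refl q m (1/1+ n))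
       , n , lin< r (linear 3 (λ x m n → x :+ m := (m :- n :+ n) :+ x) refl (seq x n) m (1/1+ n))

    ∙<-round : ∀ {q} (x : ℝ) → x ∙< q → ∃ λ q' → q' < q × x ∙< q'
    ∙<-round {q} x (n , a) = from (ℚₚ.<-dense a)
      where
      from : (∃ λ m → seq x n + 1/1+ n < m × m < q) → ∃ λ q' → q' < q × x ∙< q'
      from (m , l , r) = m , r , n , l

    bracket : ∀ (x : ℝ) {ε} → 0ℚ < ε → ∃ λ l → ∃ λ r → l <∙ x × x ∙< r × r ≤ l + ε
    bracket x {ε} h = from (archi4 h)
      where
      from : (∃ λ n → (1/1+ n + 1/1+ n) + (1/1+ n + 1/1+ n) ≤ ε) → ∃ λ l → ∃ λ r → l <∙ x × x ∙< r × r ≤ l + ε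
      from (n , le) = seq x n - (1/1+ n + 1/1+ n) , seq x n + (1/1+ n + 1/1+ n)
       , (n , lin< (0<1/ n) (linear 2 (λ x n → x :+ :0 := (x :- (n :+ n) :+ n) :+ n) refl (seq x n) (1/1+ n)))
       , (n , lin< (0<1/ n) (linear 2 (λ x n → (x :+ (n :+ n)) :+ :0 := (x :+ n) :+ n) refl (seq x n) (1/1+ n)))
       , lin≤ le (linear 3 (λ x n e → (x :- (n :+ n) :+ e) :+ ((n :+ n) :+ (n :+ n)) := (x :+ (n :+ n)) :+ e) refl (seq x n) (1/1+ n) ε)

    gap⇒≺ : ∀ (x y : ℝ) n → seq x n + (1/1+ n + 1/1+ n) < seq y n → x ≺ y
    gap⇒≺ x y n lt = from (ℚₚ.<-dense (lin< {a = seq x n + 1/1+ n} {b = seq y n - 1/1+ n} lt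
         (linear 3 (λ x y n → (y :- n) :+ (x :+ (n :+ n)) := (x :+ n) :+ y) refl (seq x n) (seq y n) (1/1+ n))))
      where
      from : (∃ λ q → seq x n + 1/1+ n < q × q < seq y n - 1/1+ n) → x ≺ y
      from (q , l , r) = q , (n , l) , n , lin< r (linear 3 (λ y q n → y :+ q := (q :+ n) :+ (y :- n)) refl (seq y n) q (1/1+ n))

    ∣∣≤ : ∀ {a b c : ℚ} → a ≤ b + c → b ≤ a + c → ℚ.∣ a - b ∣ ≤ c
    ∣∣≤ {a} {b} {c} h k = from (ℚₚ.∣p∣≡p∨∣p∣≡-p (a - b))
      where
      from : ℚ.∣ a - b ∣ ≡ a - b ⊎ ℚ.∣ a - b ∣ ≡ - (a - b) → ℚ.∣ a - b ∣ ≤ c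
      from (inj₁ e) = ℚₚ.≤-trans (ℚₚ.≤-reflexive e) (lin≤ h (linear 3 (λ a b c → c :+ a := (a :- b) :+ (b :+ c)) refl a b c))
      from (inj₂ e) = ℚₚ.≤-trans (ℚₚ.≤-reflexive e) (lin≤ k (linear 3 (λ a b c → c :+ b := (:- (a :- b)) :+ (a :+ c)) refl a b c))

    ≉⇒≺ : ∀ {x y : ℝ} → ¬ (x ≋ y) → x ≺ y ⊎ y ≺ x
    ≉⇒≺ {x} {y} ne = from (¬∀⇒∃ ne)
      where
      from : (∃ λ n → ¬ (ℚ.∣ seq x n - seq y n ∣ ≤ 1/1+ n + 1/1+ n)) → x ≺ y ⊎ y ≺ x
      from (n , nle) = split (<-or-≥ (seq x n + (1/1+ n + 1/1+ n)) (seq y n)) (<-or-≥ (seq y n + (1/1+ n + 1/1+ n)) (seq x n))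
        where
        split : seq x n + (1/1+ n + 1/1+ n) < seq y n ⊎ seq y n ≤ seq x n + (1/1+ n + 1/1+ n) →
                seq y n + (1/1+ n + 1/1+ n) < seq x n ⊎ seq x n ≤ seq y n + (1/1+ n + 1/1+ n) → x ≺ y ⊎ y ≺ x
        split (inj₁ lt) _ = inj₁ (gap⇒≺ x y n lt)
        split _ (inj₁ lt) = inj₂ (gap⇒≺ y x n lt)
        split (inj₂ g) (inj₂ g') = ⊥-elim (nle (∣∣≤ g' g))

    ≈⇒⊀ : ∀ {x y : ℝ} → x ≋ y → ¬ (y ≺ x)
    ≈⇒⊀ {x} {y} e (q , (m , a) , (n , b)) = from (archi4 (lin< {b = (seq x n - 1/1+ n) - (seq y m + 1/1+ m)} (a <+< b)
          (linear 5 (λ x y q m n → ((x :- n) :- (y :+ m)) :+ ((y :+ m) :+ (q :+ n)) := :0 :+ (q :+ x)) refl (seq x n) (seq y m) q (1/1+ m) (1/1+ n))))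
      where
      from : (∃ λ k → (1/1+ k + 1/1+ k) + (1/1+ k + 1/1+ k) ≤ (seq x n - 1/1+ n) - (seq y m + 1/1+ m)) → ⊥
      from (k , le) = <⇒≢≥ (0<1/ k <+< 0<1/ k) (lin≤ (le ≤+≤ reg-≤ x n j ≤+≤ reg-≤ y j m ≤+≤ xj≤ ≤+≤ 2j ≤+≤ 2j)
         (linear 9 (λ xn ym q m n k xj yj j → (:0 :+ :0) :+ (((k :+ k) :+ (k :+ k)) :+ xn :+ yj :+ xj :+ (j :+ j) :+ (j :+ j))
             := (k :+ k) :+ (((xn :- n) :- (ym :+ m)) :+ (xj :+ (n :+ j)) :+ (ym :+ (j :+ m)) :+ (yj :+ (j :+ j)) :+ k :+ k)) refl
           (seq x n) (seq y m) q (1/1+ m) (1/1+ n) (1/1+ k) (seq x j) (seq y j) (1/1+ j)))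
        where
        j : ℕ
        j = suc (k ℕ.+ k)
        2j : 1/1+ j + 1/1+ j ≤ 1/1+ k
        2j = ℚₚ.≤-reflexive (1/-halve k)
        xj≤ : seq x j ≤ seq y j + (1/1+ j + 1/1+ j)
        xj≤ = lin≤ (ℚₚ.≤-trans (p≤∣p∣ _) (e j)) (linear 3 (λ x y k → (y :+ (k :+ k)) :+ (x :- y) := x :+ (k :+ k)) refl (seq x j) (seq y j) (1/1+ j))

    ≋-sym : ∀ {x y} → x ≋ y → y ≋ x
    ≋-sym {x} {y} e n = subst (ℚ._≤ (1/1+ n + 1/1+ n)) (trans (sym (ℚₚ.∣-p∣≡∣p∣ (seq x n - seq y n))) (cong ℚ.∣_∣ (linear 2 (λ a b → :- (a :- b) := b :- a) refl (seq x n) (seq y n)))) (e n)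

    <⇒<∙ : ∀ {q s} → q < s → q <∙ fromℚ s
    <⇒<∙ {q} {s} h = from (archi4 (diff-pos h))
      where
      from : (∃ λ n → (1/1+ n + 1/1+ n) + (1/1+ n + 1/1+ n) ≤ s - q) → q <∙ fromℚ s
      from (n , le) = n , lin< (le ≤+< (0<1/ n <+< 0<1/ n <+< 0<1/ n)) (linear 3 (λ q s n → s :+ (((n :+ n) :+ (n :+ n)) :+ (:0 :+ :0 :+ :0)) := (q :+ n) :+ ((s :- q) :+ (n :+ n :+ n))) refl q s (1/1+ n))

    <⇒∙< : ∀ {q s} → q < s → fromℚ q ∙< s
    <⇒∙< {q} {s} h = from (archi4 (diff-pos h))
      where
      from : (∃ λ n → (1/1+ n + 1/1+ n) + (1/1+ n + 1/1+ n) ≤ s - q) → fromℚ q ∙< s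
      from (n , le) = n , lin< (le ≤+< (0<1/ n <+< 0<1/ n <+< 0<1/ n)) (linear 3 (λ q s n → s :+ (((n :+ n) :+ (n :+ n)) :+ (:0 :+ :0 :+ :0)) := (q :+ n) :+ ((s :- q) :+ (n :+ n :+ n))) refl q s (1/1+ n))

  ≺-irrefl : ∀ {x} → ¬ (x ≺ x)
  ≺-irrefl {x} (q , a , b) = ℚₚ.<-irrefl refl (cut-< x b a)

  ≺-cmp : ∀ {x z} y → x ≺ z → x ≺ y ⊎ y ≺ z
  ≺-cmp {x} {z} y (q , a , b) = from (<∙-round z b)
    where
    from : (∃ λ q' → q < q' × q' <∙ z) → x ≺ y ⊎ y ≺ z
    from (q' , lt , b') = [ (λ c → inj₁ (q , a , c)) , (λ c → inj₂ (q' , c , b')) ]′ (cut-loc y lt)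

  infix 4 _≼_
  _≼_ : ℝ → ℝ → Set
  x ≼ y = ¬ (y ≺ x)

  ≺-≼ : ∀ {x y z} → x ≺ y → y ≼ z → x ≺ z
  ≺-≼ {z = z} h k = [ (λ a → a) , (λ b → ⊥-elim (k b)) ]′ (≺-cmp z h)

  ≼-≺ : ∀ {x y z} → x ≼ y → y ≺ z → x ≺ z
  ≼-≺ {x = x} h k = [ (λ a → ⊥-elim (h a)) , (λ b → b) ]′ (≺-cmp x k)

  ≺⇒≼ : ∀ {x y} → x ≺ y → x ≼ y
  ≺⇒≼ {x} {y} (q , u , v) (q' , u' , v') = ≺-irrefl {x} (q , u , <∙-down x (ℚₚ.<⇒≤ (cut-< y v u')) v')

  ≼-refl : ∀ {x} → x ≼ x
  ≼-refl = ≺-irrefl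

  ≼-trans : ∀ {x y z} → x ≼ y → y ≼ z → x ≼ z
  ≼-trans {y = y} h k l = [ k , h ]′ (≺-cmp y l)

  ≼-total : ∀ x y → x ≼ y ⊎ y ≼ x
  ≼-total x y = from (dec (y ≺ x))
    where
    from : Dec (y ≺ x) → x ≼ y ⊎ y ≼ x
    from (yes h) = inj₂ (≺⇒≼ h)
    from (no h) = inj₁ h

  ≼-antisym : ∀ {x y} → x ≼ y → y ≼ x → x ≋ y
  ≼-antisym h k = dne λ ne → [ k , h ]′ (≉⇒≺ ne)

  ≈⇒⊁ : ∀ {x y : ℝ} → x ≋ y → ¬ (x ≺ y)
  ≈⇒⊁ e = ≈⇒⊀ (≋-sym e)

  ≋-refl : ∀ {x} → x ≋ x
  ≋-refl = ≼-antisym ≼-refl ≼-refl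

  ≋-trans : ∀ {x y z} → x ≋ y → y ≋ z → x ≋ z
  ≋-trans e f = ≼-antisym (≼-trans (≈⇒⊀ e) (≈⇒⊀ f)) (≼-trans (≈⇒⊁ f) (≈⇒⊁ e))

  ≈-<∙ : ∀ {x y q} → x ≋ y → q <∙ x → q <∙ y
  ≈-<∙ {x} {y} {q} e h = from (<∙-round x h)
    where
    from : (∃ λ q' → q < q' × q' <∙ x) → q <∙ y
    from (q' , lt , b) = [ (λ c → c) , (λ c → ⊥-elim (≈⇒⊀ e (q' , c , b))) ]′ (cut-loc y lt)

  ≈-∙< : ∀ {x y q} → x ≋ y → x ∙< q → y ∙< q
  ≈-∙< {x} {y} {q} e h = from (∙<-round x h)
    where
    from : (∃ λ q' → q' < q × x ∙< q') → y ∙< q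
    from (q' , lt , b) = [ (λ c → ⊥-elim (≈⇒⊁ e (q' , b , c))) , (λ c → c) ]′ (cut-loc y lt)

  <∙-≼ : ∀ {x y q} → q <∙ x → x ≼ y → q <∙ y
  <∙-≼ {x} {y} {q} h k = from (<∙-round x h)
    where
    from : (∃ λ q' → q < q' × q' <∙ x) → q <∙ y
    from (q' , lt , b) = [ (λ c → c) , (λ c → ⊥-elim (k (q' , c , b))) ]′ (cut-loc y lt)

  ≼-∙< : ∀ {x y q} → x ≼ y → y ∙< q → x ∙< q
  ≼-∙< {x} {y} {q} k h = from (∙<-round y h)
    where
    from : (∃ λ q' → q' < q × y ∙< q') → x ∙< q
    from (q' , lt , b) = [ (λ c → ⊥-elim (k (q' , b , c))) , (λ c → c) ]′ (cut-loc x lt)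

  <∙⇒< : ∀ {q s} → q <∙ fromℚ s → q < s
  <∙⇒< {q} {s} h = dne λ n → go n (<∙-round (fromℚ s) h)
    where
    go : ¬ (q < s) → (∃ λ q' → q < q' × q' <∙ fromℚ s) → ⊥
    go n (q' , lt , b) = ℚₚ.<-irrefl refl (cut-< (fromℚ s) b (<⇒∙< (ℚₚ.≤-<-trans (≮⇒≥ n) lt)))

  ∙<⇒< : ∀ {q s} → fromℚ s ∙< q → s < q
  ∙<⇒< {q} {s} h = dne λ n → go n (∙<-round (fromℚ s) h)
    where
    go : ¬ (s < q) → (∃ λ q' → q' < q × fromℚ s ∙< q') → ⊥
    go n (q' , lt , b) = ℚₚ.<-irrefl refl (cut-< (fromℚ s) (<⇒<∙ (ℚₚ.<-≤-trans lt (≮⇒≥ n))) b)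

  <∙⇒≺ : ∀ {q x} → q <∙ x → fromℚ q ≺ x
  <∙⇒≺ {q} {x} h = go (<∙-round x h)
    where
    go : (∃ λ q' → q < q' × q' <∙ x) → fromℚ q ≺ x
    go (q' , lt , b) = q' , <⇒∙< lt , b

  ∙<⇒≺ : ∀ {q x} → x ∙< q → x ≺ fromℚ q
  ∙<⇒≺ {q} {x} h = go (∙<-round x h)
    where
    go : (∃ λ q' → q' < q × x ∙< q') → x ≺ fromℚ q
    go (q' , lt , b) = q' , b , <⇒<∙ lt

  ≺⇒<∙ : ∀ {q x} → fromℚ q ≺ x → q <∙ x
  ≺⇒<∙ {q} {x} (s , a , b) = <∙-down x (ℚₚ.<⇒≤ (∙<⇒< a)) b

  ≺⇒∙< : ∀ {q x} → x ≺ fromℚ q → x ∙< q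
  ≺⇒∙< {q} {x} (s , a , b) = ∙<-up x (ℚₚ.<⇒≤ (<∙⇒< b)) a

  ≤⇒≼ : ∀ {q s} → q ≤ s → fromℚ q ≼ fromℚ s
  ≤⇒≼ h (t , a , b) = <⇒≢≥ (ℚₚ.<-trans (∙<⇒< a) (<∙⇒< b)) h

  -- Cousin's lemma; the only use of the completeness of ℝ.
  module Cousin (Q : ℚ → ℚ → Set) (α β : ℚ)
    (add : ∀ {l m r} → α ≤ l → l ≤ m → m ≤ r → r ≤ β → Q l m → Q m r → Q l r)
    (loc : ∀ x → fromℚ α ≼ x → x ≼ fromℚ β → ∃₂ λ l₀ r₀ → l₀ <∙ x × x ∙< r₀ ×
           (∀ {l r} → α ≤ l → l ≤ r → r ≤ β → l₀ < l → r < r₀ → Q l r)) where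

    private
      -- A counterexample of length at most `1/1+ n`. At this rate of shrinking, the left ends of
      -- nested counterexamples form a regular sequence as they stand, and their limit contradicts
      -- `loc`.
      record Bad (n : ℕ) : Set where
        constructor bad
        field
          l r : ℚ
          α≤l : α ≤ l
          l≤r : l ≤ r
          r≤β : r ≤ β
          thin : r ≤ l + 1/1+ n
          ¬Q  : ¬ Q l r
      open Bad

      thin-half : ∀ n {l r} → l ≤ r → r ≤ l + 1/1+ n → ½ * r ≤ ½ * l + 1/1+ (suc n)
      thin-half n {l} {r} h k = ℚₚ.≤-trans (ℚₚ.*-monoˡ-≤-nonNeg ½ k) (ℚₚ.≤-trans (ℚₚ.≤-reflexive (ℚₚ.*-distribˡ-+ ½ l (1/1+ n)))
         (ℚₚ.+-monoʳ-≤ (½ * l) (ℚₚ.≤-trans (ℚₚ.≤-reflexive half) (1/-anti {suc n} {suc (n ℕ.+ n)} (ℕ.s≤s (ℕₚ.m≤m+n n n))))))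
        where
        half : ½ * 1/1+ n ≡ 1/1+ (suc (n ℕ.+ n))
        half = trans (cong (½ *_) (sym (1/-halve n))) (trans (ℚₚ.*-distribˡ-+ ½ (1/1+ (suc (n ℕ.+ n))) (1/1+ (suc (n ℕ.+ n)))) (½2 (1/1+ (suc (n ℕ.+ n)))))

      halve : ∀ {n} → (b : Bad n) → Σ (Bad (suc n)) λ b' → l b ≤ l b' × r b' ≤ r b
      halve {n} b@(bad l r α≤l l≤r r≤β thin ¬Q) = from (dec (Q l m))
        where
        m = midpoint l r
        m≡ : m ≡ ½ * l + ½ * r
        m≡ = ℚₚ.*-distribˡ-+ ½ l r
        th = thin-half n l≤r thin
        from : Dec (Q l m) → Σ (Bad (suc n)) λ b' → l ≤ Bad.l b' × Bad.r b' ≤ r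
        from (yes q) = bad m r (ℚₚ.≤-trans α≤l (midpoint≥ l≤r)) (midpoint≤ l≤r) r≤β
            (lin≤ th (trans (cong (λ z → (z + 1/1+ (suc n)) + ½ * r) m≡) (trans (linear 3 (λ l r e → ((l :+ r) :+ e) :+ r := (r :+ r) :+ (l :+ e)) refl (½ * l) (½ * r) (1/1+ (suc n))) (cong (_+ (½ * l + 1/1+ (suc n))) (½2 r)))))
            (λ q' → ¬Q (add α≤l (midpoint≥ l≤r) (midpoint≤ l≤r) r≤β q q')) , midpoint≥ l≤r , ℚₚ.≤-refl
        from (no nq) = bad l m α≤l (midpoint≥ l≤r) (ℚₚ.≤-trans (midpoint≤ l≤r) r≤β)
            (lin≤ th (trans (cong (λ z → (z + 1/1+ (suc n)) + ½ * r) (sym (½2 l))) (trans (linear 3 (λ l r e → ((l :+ l) :+ e) :+ r := (l :+ r) :+ (l :+ e)) refl (½ * l) (½ * r) (1/1+ (suc n))) (cong (_+ (½ * l + 1/1+ (suc n))) (sym m≡)))))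
            nq , ℚₚ.≤-refl , midpoint≤ l≤r

      module Nest (b₀ : Bad 0) where
        b : ∀ n → Bad n
        b zero = b₀
        b (suc n) = proj₁ (halve (b n))

        nest : ∀ n k → l (b n) ≤ l (b (k ℕ.+ n)) × r (b (k ℕ.+ n)) ≤ r (b n)
        nest n zero = ℚₚ.≤-refl , ℚₚ.≤-refl
        nest n (suc k) = ℚₚ.≤-trans (proj₁ (nest n k)) (proj₁ (proj₂ (halve (b (k ℕ.+ n)))))
                       , ℚₚ.≤-trans (proj₂ (proj₂ (halve (b (k ℕ.+ n))))) (proj₂ (nest n k))

        nest≤ : ∀ {n m} → n ℕ.≤ m → l (b n) ≤ l (b m) × r (b m) ≤ r (b n)
        nest≤ {n} {m} h = subst (λ k → l (b n) ≤ l (b k) × r (b k) ≤ r (b n)) (ℕₚ.m∸n+n≡m h) (nest n (m ℕ.∸ n))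

        bound : ∀ m n → l (b m) ≤ l (b n) + (1/1+ m + 1/1+ n)
        bound m n = [ case₁ , case₂ ]′ (ℕₚ.≤-total m n)
          where
          case₁ : m ℕ.≤ n → l (b m) ≤ l (b n) + (1/1+ m + 1/1+ n)
          case₁ h = lin≤ (proj₁ (nest≤ h) ≤+≤ ℚₚ.<⇒≤ (0<1/ m <+< 0<1/ n)) (linear 4 (λ a c e f → (c :+ (e :+ f)) :+ (a :+ (:0 :+ :0)) := a :+ (c :+ (e :+ f))) refl (l (b m)) (l (b n)) (1/1+ m) (1/1+ n))
          case₂ : n ℕ.≤ m → l (b m) ≤ l (b n) + (1/1+ m + 1/1+ n)
          case₂ h = lin≤ ((ℚₚ.≤-trans (l≤r (b m)) (ℚₚ.≤-trans (proj₂ (nest≤ h)) (thin (b n)))) ≤+≤ ℚₚ.<⇒≤ (0<1/ m))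
            (linear 4 (λ a c e f → (c :+ (e :+ f)) :+ (a :+ :0) := a :+ ((c :+ f) :+ e)) refl (l (b m)) (l (b n)) (1/1+ m) (1/1+ n))

        x : ℝ
        x = record { seq = λ n → l (b n) ; regular = λ m n → ∣∣≤ (bound m n) (subst (λ z → l (b n) ≤ l (b m) + z) (ℚₚ.+-comm (1/1+ n) (1/1+ m)) (bound n m)) }

        lower′ : ∀ q → x ʳ< q → q < α → ⊥
        lower′ q (n , a) c = <⇒≢≥ (a <+< c <+< 0<1/ n) (lin≤ (α≤l (b n)) (linear 4 (λ q l e a → (l :+ e :+ q :+ :0) :+ a := (q :+ a :+ e) :+ l) refl q (l (b n)) (1/1+ n) α))

        upper′ : ∀ q → q <ʳ x → β < q → ⊥
        upper′ q (n , a) c = <⇒≢≥ (a <+< c <+< 0<1/ n) (lin≤ (ℚₚ.≤-trans (l≤r (b n)) (r≤β (b n))) (linear 4 (λ q l e a → (q :+ e :+ a :+ :0) :+ l := (l :+ q :+ e) :+ a) refl q (l (b n)) (1/1+ n) β))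

        contra : ⊥
        contra = from (loc x (λ { (q , a , c) → lower′ q (un∙< a) (<∙⇒< c) }) (λ { (q , c , a) → upper′ q (un<∙ a) (∙<⇒< c) }))
          where
          from : (∃₂ λ l₀ r₀ → l₀ <∙ x × x ∙< r₀ × (∀ {l r} → α ≤ l → l ≤ r → r ≤ β → l₀ < l → r < r₀ → Q l r)) → ⊥
          from (l₀ , r₀ , a' , c' , f) = go (un<∙ a') (un∙< c')
            where
            go : l₀ <ʳ x → x ʳ< r₀ → ⊥
            go (n , a) (m , c) = ¬Q (b k) (f (α≤l (b k)) (l≤r (b k)) (r≤β (b k))
                (ℚₚ.<-≤-trans (lin< (a <+< 0<1/ n) (linear 3 (λ q l e → l :+ (q :+ e :+ :0) := q :+ (l :+ e)) refl l₀ (l (b n)) (1/1+ n))) (proj₁ (nest≤ (ℕₚ.m≤m⊔n n m))))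
                (ℚₚ.≤-<-trans (proj₂ (nest≤ (ℕₚ.m≤n⊔m n m))) (ℚₚ.≤-<-trans (thin (b m)) c)))
              where k = n ℕ.⊔ m

      unit : ∀ {l r} → α ≤ l → l ≤ r → r ≤ β → r ≤ l + 1/1+ 0 → Q l r
      unit {l} {r} a h c t = dne λ nq → Nest.contra (bad l r a h c t nq)

      -- Bisection starts from length at most 1, so a longer interval is first divided into unit
      -- steps.
      long : ∀ n {l} → α ≤ l → l ≤ β → β ≤ l + steps n → Q l β
      long zero a h t = unit a h ℚₚ.≤-refl t
      long (suc n) {l} a h t = from (<-or-≥ (l + 1ℚ) β)
        where
        1≥0 : l ≤ l + 1ℚ
        1≥0 = lin≤ (ℚₚ.<⇒≤ (0<1/ 0)) (linear 2 (λ l e → (l :+ e) :+ :0 := l :+ e) refl l 1ℚ)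
        from : l + 1ℚ < β ⊎ β ≤ l + 1ℚ → Q l β
        from (inj₁ lt) = add a 1≥0 (ℚₚ.<⇒≤ lt) ℚₚ.≤-refl (unit a 1≥0 (ℚₚ.<⇒≤ lt) ℚₚ.≤-refl)
          (long n (ℚₚ.≤-trans a 1≥0) (ℚₚ.<⇒≤ lt) (lin≤ t (linear 4 (λ b l s e → ((l :+ e) :+ s) :+ b := b :+ (l :+ (s :+ e))) refl β l (steps n) 1ℚ)))
        from (inj₂ ge) = unit a h ℚₚ.≤-refl ge

    cousin : α ≤ β → Q α β
    cousin h = from (natBound (β - α))
      where
      from : (∃ λ n → β - α ≤ steps n) → Q α β
      from (n , le) = long n ℚₚ.≤-refl h (lin≤ le (linear 3 (λ a b s → (a :+ s) :+ (b :- a) := b :+ s) refl α β (steps n)))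

  -- Boxes in the plane

  opaque
    infix 4 _∈□_ _≑_
    _∈□_ : ℝ² → Box → Set
    x ∈□ B = (left B <∙ proj₁ x × proj₁ x ∙< right B) × (bottom B <∙ proj₂ x × proj₂ x ∙< top B)

    _≑_ : ℝ² → ℝ² → Set
    x ≑ y = proj₁ x ≋ proj₁ y × proj₂ x ≋ proj₂ y

    mk∈ : ∀ {x B} → left B <∙ proj₁ x → proj₁ x ∙< right B → bottom B <∙ proj₂ x → proj₂ x ∙< top B → x ∈□ B
    mk∈ a b c d = (a , b) , (c , d)
    ∈-left : ∀ {x B} → x ∈□ B → left B <∙ proj₁ x
    ∈-left h = proj₁ (proj₁ h)
    ∈-right : ∀ {x B} → x ∈□ B → proj₁ x ∙< right B
    ∈-right h = proj₂ (proj₁ h)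
    ∈-bottom : ∀ {x B} → x ∈□ B → bottom B <∙ proj₂ x
    ∈-bottom h = proj₁ (proj₂ h)
    ∈-top : ∀ {x B} → x ∈□ B → proj₂ x ∙< top B
    ∈-top h = proj₂ (proj₂ h)

    mk≑ : ∀ {x y} → proj₁ x ≋ proj₁ y → proj₂ x ≋ proj₂ y → x ≑ y
    mk≑ a b = a , b
    ≑₁ : ∀ {x y} → x ≑ y → proj₁ x ≋ proj₁ y
    ≑₁ = proj₁
    ≑₂ : ∀ {x y} → x ≑ y → proj₂ x ≋ proj₂ y
    ≑₂ = proj₂

    ∈ᴮ⇒∈□ : ∀ {x B} → x ∈ᴮ B → x ∈□ B
    ∈ᴮ⇒∈□ ((a , b) , (c , d)) = (mk<∙ a , mk∙< b) , (mk<∙ c , mk∙< d)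
    ∈□⇒∈ᴮ : ∀ {x B} → x ∈□ B → x ∈ᴮ B
    ∈□⇒∈ᴮ ((a , b) , (c , d)) = (un<∙ a , un∙< b) , (un<∙ c , un∙< d)
    ≈⇒≑ : ∀ {x y} → x ≈ y → x ≑ y
    ≈⇒≑ (a , b) = mk≋ a , mk≋ b
    ≑⇒≈ : ∀ {x y} → x ≑ y → x ≈ y
    ≑⇒≈ (a , b) = un≋ a , un≋ b

  ≑-refl : ∀ {x} → x ≑ x
  ≑-refl = mk≑ ≋-refl ≋-refl

  ≑-sym : ∀ {x y} → x ≑ y → y ≑ x
  ≑-sym e = mk≑ (≋-sym (≑₁ e)) (≋-sym (≑₂ e))

  ≑-trans : ∀ {x y z} → x ≑ y → y ≑ z → x ≑ z
  ≑-trans e f = mk≑ (≋-trans (≑₁ e) (≑₁ f)) (≋-trans (≑₂ e) (≑₂ f))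

  ∈-≑ : ∀ {x y B} → x ≑ y → x ∈□ B → y ∈□ B
  ∈-≑ e h = mk∈ (≈-<∙ (≑₁ e) (∈-left h)) (≈-∙< (≑₁ e) (∈-right h)) (≈-<∙ (≑₂ e) (∈-bottom h)) (≈-∙< (≑₂ e) (∈-top h))

  mkBox : ℚ → ℚ → ℚ → ℚ → Box
  mkBox l r b t = record { left = l ; right = r ; bottom = b ; top = t }

  infix 4 _⊑_
  record _⊑_ (A B : Box) : Set where
    constructor sub
    field
      ⊑l : left B ≤ left A
      ⊑r : right A ≤ right B
      ⊑b : bottom B ≤ bottom A
      ⊑t : top A ≤ top B
  open _⊑_ public

  record Size (ε : ℚ) (B : Box) : Set where
    constructor size
    field
      width  : right B ≤ left B + ε
      height : top B ≤ bottom B + ε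
  open Size public

  -- Weak inequalities are enough as boxes are open. An axis-parallel separating line decides the
  -- comparisons that occur in the crossing parity.
  data Sep (A B : Box) : Set where
    sepₗ : right A ≤ left B → Sep A B
    sepᵣ : right B ≤ left A → Sep A B
    sepᵇ : top A ≤ bottom B → Sep A B
    sepᵗ : top B ≤ bottom A → Sep A B

  ∈-⊑ : ∀ {A B x} → A ⊑ B → x ∈□ A → x ∈□ B
  ∈-⊑ {x = x} (sub l r b t) h = mk∈ (<∙-down (proj₁ x) l (∈-left h)) (∙<-up (proj₁ x) r (∈-right h)) (<∙-down (proj₂ x) b (∈-bottom h)) (∙<-up (proj₂ x) t (∈-top h))

  ⊑-refl : ∀ {A} → A ⊑ A
  ⊑-refl = sub ℚₚ.≤-refl ℚₚ.≤-refl ℚₚ.≤-refl ℚₚ.≤-refl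

  ⊑-trans : ∀ {A B C} → A ⊑ B → B ⊑ C → A ⊑ C
  ⊑-trans (sub a b c d) (sub a' b' c' d') = sub (ℚₚ.≤-trans a' a) (ℚₚ.≤-trans b b') (ℚₚ.≤-trans c' c) (ℚₚ.≤-trans d d')

  infixl 7 _⊓□_
  _⊓□_ : Box → Box → Box
  A ⊓□ B = mkBox (left A ⊔ left B) (right A ⊓ right B) (bottom A ⊔ bottom B) (top A ⊓ top B)

  ⊓⊑ˡ : ∀ A B → A ⊓□ B ⊑ A
  ⊓⊑ˡ A B = sub (ℚₚ.p≤p⊔q (left A) (left B)) (ℚₚ.p⊓q≤p (right A) (right B)) (ℚₚ.p≤p⊔q (bottom A) (bottom B)) (ℚₚ.p⊓q≤p (top A) (top B))

  ⊓⊑ʳ : ∀ A B → A ⊓□ B ⊑ B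
  ⊓⊑ʳ A B = sub (ℚₚ.p≤q⊔p (left A) (left B)) (ℚₚ.p⊓q≤q (right A) (right B)) (ℚₚ.p≤q⊔p (bottom A) (bottom B)) (ℚₚ.p⊓q≤q (top A) (top B))

  <∙-⊔ : ∀ {a b x} → a <∙ x → b <∙ x → a ⊔ b <∙ x
  <∙-⊔ {a} {b} {x} h k = [ (λ e → subst (_<∙ x) (sym e) h) , (λ e → subst (_<∙ x) (sym e) k) ]′ (ℚₚ.⊔-sel a b)

  ∙<-⊓ : ∀ {a b x} → x ∙< a → x ∙< b → x ∙< a ⊓ b
  ∙<-⊓ {a} {b} {x} h k = [ (λ e → subst (x ∙<_) (sym e) h) , (λ e → subst (x ∙<_) (sym e) k) ]′ (ℚₚ.⊓-sel a b)

  0<⊓ : ∀ {a b} → 0ℚ < a → 0ℚ < b → 0ℚ < a ⊓ b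
  0<⊓ {a} {b} h k = [ (λ e → subst (0ℚ <_) (sym e) h) , (λ e → subst (0ℚ <_) (sym e) k) ]′ (ℚₚ.⊓-sel a b)

  ∈⊓ : ∀ {A B x} → x ∈□ A → x ∈□ B → x ∈□ A ⊓□ B
  ∈⊓ h k = mk∈ (<∙-⊔ (∈-left h) (∈-left k)) (∙<-⊓ (∈-right h) (∈-right k)) (<∙-⊔ (∈-bottom h) (∈-bottom k)) (∙<-⊓ (∈-top h) (∈-top k))

  Size-mono : ∀ {ε ε' B} → ε ≤ ε' → Size ε B → Size ε' B
  Size-mono {B = B} h (size w v) = size (ℚₚ.≤-trans w (ℚₚ.+-monoʳ-≤ (left B) h)) (ℚₚ.≤-trans v (ℚₚ.+-monoʳ-≤ (bottom B) h))

  smallBox : ∀ x {ε} → 0ℚ < ε → ∃ λ B → x ∈□ B × Size ε B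
  smallBox x {ε} h = from (bracket (proj₁ x) h) (bracket (proj₂ x) h)
    where
    from : (∃ λ l → ∃ λ r → l <∙ proj₁ x × proj₁ x ∙< r × r ≤ l + ε) → (∃ λ l → ∃ λ r → l <∙ proj₂ x × proj₂ x ∙< r × r ≤ l + ε) → ∃ λ B → x ∈□ B × Size ε B
    from (l , r , a , b , c) (l' , r' , a' , b' , c') = mkBox l r l' r' , mk∈ a b a' b' , size c c'

  margin₁ : ∀ {l r} x → l <∙ x → x ∙< r → ∃ λ l' → ∃ λ r' → ∃ λ ε → l ≤ l' × r' ≤ r × l' <∙ x × x ∙< r' × 0ℚ < ε ×
    (∀ {y a b δ} → δ ≤ ε → l' <∙ y → y ∙< r' → a <∙ y → y ∙< b → b ≤ a + δ → l ≤ a × b ≤ r)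
  margin₁ {l} {r} x h k = from (<∙-round x h) (∙<-round x k)
    where
    from : (∃ λ l' → l < l' × l' <∙ x) → (∃ λ r' → r' < r × x ∙< r') → ∃ λ l' → ∃ λ r' → ∃ λ ε → l ≤ l' × r' ≤ r × l' <∙ x × x ∙< r' × 0ℚ < ε ×
       (∀ {y a b δ} → δ ≤ ε → l' <∙ y → y ∙< r' → a <∙ y → y ∙< b → b ≤ a + δ → l ≤ a × b ≤ r)
    from (l' , p , u) (r' , q , v) = l' , r' , (l' - l) ⊓ (r - r') , ℚₚ.<⇒≤ p , ℚₚ.<⇒≤ q , u , v , 0<⊓ (diff-pos p) (diff-pos q) ,
      λ {y} {a} {b} {δ} dε ly yr ay yb s →
        ℚₚ.<⇒≤ (lin< (cut-< y ly yb <+≤ s <+≤ ℚₚ.≤-trans dε (ℚₚ.p⊓q≤p (l' - l) (r - r'))) (linear 5 (λ l l' a b d → a :+ (l' :+ b :+ d) := l :+ (b :+ (a :+ d) :+ (l' :- l))) refl l l' a b δ)) ,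
        ℚₚ.<⇒≤ (lin< (cut-< y ay yr <+≤ s <+≤ ℚₚ.≤-trans dε (ℚₚ.p⊓q≤q (l' - l) (r - r'))) (linear 5 (λ r r' a b d → r :+ (a :+ b :+ d) := b :+ (r' :+ (a :+ d) :+ (r :- r'))) refl r r' a b δ))

  -- A Lebesgue number near `x`; it supplies the uniform box size in the compactness arguments along
  -- edges.
  margin : ∀ {x B} → x ∈□ B → ∃ λ B₁ → ∃ λ ε → x ∈□ B₁ × 0ℚ < ε × B₁ ⊑ B × (∀ {y A} → y ∈□ B₁ → Size ε A → y ∈□ A → A ⊑ B)
  margin {x} {B} h = from (margin₁ (proj₁ x) (∈-left h) (∈-right h)) (margin₁ (proj₂ x) (∈-bottom h) (∈-top h))
    where
    from : _ → _ → ∃ λ B₁ → ∃ λ ε → x ∈□ B₁ × 0ℚ < ε × B₁ ⊑ B × (∀ {y A} → y ∈□ B₁ → Size ε A → y ∈□ A → A ⊑ B)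
    from (l , r , ε , p , q , u , v , e , f) (l' , r' , ε' , p' , q' , u' , v' , e' , f') =
      mkBox l r l' r' , ε ⊓ ε' , mk∈ u v u' v' , 0<⊓ e e' , sub p q p' q' ,
      λ {y} {A} i s j → let a = f (ℚₚ.p⊓q≤p ε ε') (∈-left i) (∈-right i) (∈-left j) (∈-right j) (width s)
                            b = f' (ℚₚ.p⊓q≤q ε ε') (∈-bottom i) (∈-top i) (∈-bottom j) (∈-top j) (height s)
                        in sub (proj₁ a) (proj₂ a) (proj₁ b) (proj₂ b)

  Sep-sym : ∀ {A B} → Sep A B → Sep B A
  Sep-sym (sepₗ h) = sepᵣ h
  Sep-sym (sepᵣ h) = sepₗ h
  Sep-sym (sepᵇ h) = sepᵗ h
  Sep-sym (sepᵗ h) = sepᵇ h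

  Sep-⊑ : ∀ {A A' B B'} → A' ⊑ A → B' ⊑ B → Sep A B → Sep A' B'
  Sep-⊑ (sub l r b t) (sub l' r' b' t') (sepₗ h) = sepₗ (ℚₚ.≤-trans r (ℚₚ.≤-trans h l'))
  Sep-⊑ (sub l r b t) (sub l' r' b' t') (sepᵣ h) = sepᵣ (ℚₚ.≤-trans r' (ℚₚ.≤-trans h l))
  Sep-⊑ (sub l r b t) (sub l' r' b' t') (sepᵇ h) = sepᵇ (ℚₚ.≤-trans t (ℚₚ.≤-trans h b'))
  Sep-⊑ (sub l r b t) (sub l' r' b' t') (sepᵗ h) = sepᵗ (ℚₚ.≤-trans t' (ℚₚ.≤-trans h b))

  Sep-∉ : ∀ {A B x} → Sep A B → x ∈□ A → ¬ (x ∈□ B)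
  Sep-∉ {x = x} (sepₗ h) i j = <⇒≢≥ (cut-< (proj₁ x) (∈-left j) (∈-right i)) h
  Sep-∉ {x = x} (sepᵣ h) i j = <⇒≢≥ (cut-< (proj₁ x) (∈-left i) (∈-right j)) h
  Sep-∉ {x = x} (sepᵇ h) i j = <⇒≢≥ (cut-< (proj₂ x) (∈-bottom j) (∈-top i)) h
  Sep-∉ {x = x} (sepᵗ h) i j = <⇒≢≥ (cut-< (proj₂ x) (∈-bottom i) (∈-top j)) h

  ≉⇒Sep : ∀ {x y} → ¬ (x ≑ y) → ∃₂ λ A B → x ∈□ A × y ∈□ B × Sep A B
  ≉⇒Sep {x} {y} ne = from (smallBox x (0<1/ 0)) (smallBox y (0<1/ 0)) (dec (proj₁ x ≋ proj₁ y))
    where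
    from : (∃ λ A → x ∈□ A × Size 1ℚ A) → (∃ λ B → y ∈□ B × Size 1ℚ B) → Dec (proj₁ x ≋ proj₁ y) → ∃₂ λ A B → x ∈□ A × y ∈□ B × Sep A B
    from (A , i , _) (B , j , _) (no n) = [ (λ { (q , a , b) → mkBox (left A) q (bottom A) (top A) , mkBox q (right B) (bottom B) (top B) , mk∈ (∈-left i) a (∈-bottom i) (∈-top i) , mk∈ b (∈-right j) (∈-bottom j) (∈-top j) , sepₗ ℚₚ.≤-refl })
        , (λ { (q , b , a) → mkBox q (right A) (bottom A) (top A) , mkBox (left B) q (bottom B) (top B) , mk∈ a (∈-right i) (∈-bottom i) (∈-top i) , mk∈ (∈-left j) b (∈-bottom j) (∈-top j) , sepᵣ ℚₚ.≤-refl }) ]′ (≉⇒≺ n)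
    from (A , i , _) (B , j , _) (yes e) = [ (λ { (q , a , b) → mkBox (left A) (right A) (bottom A) q , mkBox (left B) (right B) q (top B) , mk∈ (∈-left i) (∈-right i) (∈-bottom i) a , mk∈ (∈-left j) (∈-right j) b (∈-top j) , sepᵇ ℚₚ.≤-refl })
        , (λ { (q , b , a) → mkBox (left A) (right A) q (top A) , mkBox (left B) (right B) (bottom B) q , mk∈ (∈-left i) (∈-right i) a (∈-top i) , mk∈ (∈-left j) (∈-right j) (∈-bottom j) b , sepᵗ ℚₚ.≤-refl }) ]′ (≉⇒≺ (λ f → ne (mk≑ e f)))

  -- The points of the interval are represented by a type A with coordinate map
  -- ι, to cover both ℝ and I.
  module Conn {A : Set} (ι : A → ℝ) (G : A → Bool) (s t : A) (s≼t : ι s ≼ ι t)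
    (full : ∀ x → ι s ≼ x → x ≼ ι t → ∃ λ a → ι a ≡ x)
    (local : ∀ a → ι s ≼ ι a → ι a ≼ ι t → ∃₂ λ l r → l <∙ ι a × ι a ∙< r ×
       (∀ b → l <∙ ι b → ι b ∙< r → ι s ≼ ι b → ι b ≼ ι t → G b ≡ G a)) where

    private
      Q : ℚ → ℚ → Set
      Q l r = ∀ a b → fromℚ l ≼ ι a → ι a ≼ fromℚ r → fromℚ l ≼ ι b → ι b ≼ fromℚ r →
        ι s ≼ ι a → ι a ≼ ι t → ι s ≼ ι b → ι b ≼ ι t → G a ≡ G b

      Q-add : ∀ {l m r} → Q l m → Q m r → Q l r
      Q-add {l} {m} {r} p q a b la ar lb br sa at sb bt = from (≼-total (ι a) (fromℚ m)) (≼-total (ι b) (fromℚ m))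
        where
        via : ∀ {a b} → fromℚ l ≼ ι a → ι a ≼ fromℚ m → fromℚ m ≼ ι b → ι b ≼ fromℚ r → ι s ≼ ι a → ι a ≼ ι t → ι s ≼ ι b → ι b ≼ ι t → G a ≡ G b
        via {a} {b} la am mb br sa at sb bt = go (full (fromℚ m) (≼-trans sa am) (≼-trans mb bt))
          where
          go : (∃ λ c → ι c ≡ fromℚ m) → G a ≡ G b
          go (c , e) = trans (p a c la am (≼-trans la am′) m≼ sa at (≼-trans sa am′) (≼-trans mb′ bt)) (q c b mc (≼-trans mb′ br) mb br (≼-trans sa am′) (≼-trans mb′ bt) sb bt)
            where
            am′ : ι a ≼ ι c
            am′ = subst (ι a ≼_) (sym e) am
            mb′ : ι c ≼ ι b
            mb′ = subst (_≼ ι b) (sym e) mb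
            m≼ : ι c ≼ fromℚ m
            m≼ = subst (_≼ fromℚ m) (sym e) ≼-refl
            mc : fromℚ m ≼ ι c
            mc = subst (fromℚ m ≼_) (sym e) ≼-refl
        from : ι a ≼ fromℚ m ⊎ fromℚ m ≼ ι a → ι b ≼ fromℚ m ⊎ fromℚ m ≼ ι b → G a ≡ G b
        from (inj₁ u) (inj₁ v) = p a b la u lb v sa at sb bt
        from (inj₁ u) (inj₂ v) = via la u v br sa at sb bt
        from (inj₂ u) (inj₁ v) = sym (via lb v u ar sb bt sa at)
        from (inj₂ u) (inj₂ v) = q a b u ar v br sa at sb bt

      Q-loc : ∀ x → ∃₂ λ l₀ r₀ → l₀ <∙ x × x ∙< r₀ × (∀ {l r} → l₀ < l → r < r₀ → Q l r)
      Q-loc x = from (dec (x ≺ ι s)) (dec (ι t ≺ x)) (bracket x (0<1/ 0))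
        where
        from : Dec (x ≺ ι s) → Dec (ι t ≺ x) → (∃ λ l → ∃ λ r → l <∙ x × x ∙< r × r ≤ l + 1ℚ) → ∃₂ λ l₀ r₀ → l₀ <∙ x × x ∙< r₀ × (∀ {l r} → l₀ < l → r < r₀ → Q l r)
        from (yes (q , a , b)) _ (l , _ , c , _) = l , q , c , a , λ _ rq _ _ _ ar _ _ sa _ _ _ → ⊥-elim (≼-trans sa ar (q , <⇒∙< rq , b))
        from (no _) (yes (q , a , b)) (_ , r , _ , c , _) = q , r , b , c , λ ql _ x y la _ _ _ _ xt _ _ → ⊥-elim (≼-trans la xt (q , a , <⇒<∙ ql))
        from (no p) (no q) _ = go (full x p q)
          where
          go : (∃ λ a → ι a ≡ x) → ∃₂ λ l₀ r₀ → l₀ <∙ x × x ∙< r₀ × (∀ {l r} → l₀ < l → r < r₀ → Q l r)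
          go (a , refl) = go′ (local a p q)
            where
            go′ : _ → ∃₂ λ l₀ r₀ → l₀ <∙ x × x ∙< r₀ × (∀ {l r} → l₀ < l → r < r₀ → Q l r)
            go′ (l , r , u , v , f) = l , r , u , v , λ {l'} {r'} ll rr b c lb br lc cr sb bt sc ct →
              trans (f b (<∙-≼ (<⇒<∙ ll) lb) (≼-∙< br (<⇒∙< rr)) sb bt) (sym (f c (<∙-≼ (<⇒<∙ ll) lc) (≼-∙< cr (<⇒∙< rr)) sc ct))

    constant : G s ≡ G t
    constant = from (bracket (ι s) (0<1/ 0)) (bracket (ι t) (0<1/ 0))
      where
      from : (∃ λ l → ∃ λ r → l <∙ ι s × ι s ∙< r × r ≤ l + 1ℚ) → (∃ λ l → ∃ λ r → l <∙ ι t × ι t ∙< r × r ≤ l + 1ℚ) → G s ≡ G t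
      from (α , _ , a , _) (_ , β , _ , b , _) = Cousin.cousin Q α β (λ _ _ _ _ → Q-add) (λ x _ _ → let (l , r , u , v , f) = Q-loc x in l , r , u , v , λ _ _ _ → f)
         (ℚₚ.<⇒≤ (cut-< (ι t) (<∙-≼ a s≼t) b)) s t (≺⇒≼ (<∙⇒≺ a)) (≼-trans s≼t tβ) (≼-trans (≺⇒≼ (<∙⇒≺ a)) s≼t) tβ ≼-refl s≼t s≼t ≼-refl
        where
        tβ : ι t ≼ fromℚ β
        tβ = ≺⇒≼ (∙<⇒≺ b)

  -- Two points of the box are joined by a horizontal and a vertical segment, and `Conn` applies to
  -- each of them.
  boxConn : ∀ {B} (G : ℝ² → Bool) → (∀ x → x ∈□ B → ∃ λ A → x ∈□ A × (∀ y → y ∈□ A → y ∈□ B → G y ≡ G x)) →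
    ∀ {x y} → x ∈□ B → y ∈□ B → G x ≡ G y
  boxConn {B} G loc {x} {y} xB yB = trans horizontal vertical
    where
    hor : ∀ {a b : ℝ} → left B <∙ a → b ∙< right B → a ≼ b → G (a , proj₂ x) ≡ G (b , proj₂ x)
    hor {a} {b} la br ab = Conn.constant (λ z → z) (λ z → G (z , proj₂ x)) a b ab (λ z _ _ → z , refl) λ z az zb →
      let inB : ∀ {z} → a ≼ z → z ≼ b → (z , proj₂ x) ∈□ B
          inB az zb = mk∈ (<∙-≼ la az) (≼-∙< zb br) (∈-bottom xB) (∈-top xB)
          (A , i , f) = loc (z , proj₂ x) (inB az zb)
      in left A , right A , ∈-left i , ∈-right i , λ w lw wr aw wb → f (w , proj₂ x) (mk∈ lw wr (∈-bottom i) (∈-top i)) (inB aw wb)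
    ver : ∀ {a b : ℝ} → bottom B <∙ a → b ∙< top B → a ≼ b → G (proj₁ y , a) ≡ G (proj₁ y , b)
    ver {a} {b} la br ab = Conn.constant (λ z → z) (λ z → G (proj₁ y , z)) a b ab (λ z _ _ → z , refl) λ z az zb →
      let inB : ∀ {z} → a ≼ z → z ≼ b → (proj₁ y , z) ∈□ B
          inB az zb = mk∈ (∈-left yB) (∈-right yB) (<∙-≼ la az) (≼-∙< zb br)
          (A , i , f) = loc (proj₁ y , z) (inB az zb)
      in bottom A , top A , ∈-bottom i , ∈-top i , λ w lw wr aw wb → f (proj₁ y , w) (mk∈ (∈-left i) (∈-right i) lw wr) (inB aw wb)
    horizontal : G x ≡ G (proj₁ y , proj₂ x)
    horizontal = [ hor (∈-left xB) (∈-right yB) , (λ h → sym (hor (∈-left yB) (∈-right xB) h)) ]′ (≼-total (proj₁ x) (proj₁ y))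
    vertical : G (proj₁ y , proj₂ x) ≡ G y
    vertical = [ ver (∈-bottom xB) (∈-top yB) , (λ h → sym (ver (∈-bottom yB) (∈-top xB) h)) ]′ (≼-total (proj₂ x) (proj₂ y))

  -- Parity of crossings with a ray

  opaque
    hgt rgt : ℝ² → ℝ² → Bool
    hgt p a = ⟦ proj₂ p ≺ proj₂ a ⟧
    rgt p a = ⟦ proj₁ p ≺ proj₁ a ⟧

    hgt≡ : ∀ p a → hgt p a ≡ ⟦ proj₂ p ≺ proj₂ a ⟧
    hgt≡ p a = refl
    rgt≡ : ∀ p a → rgt p a ≡ ⟦ proj₁ p ≺ proj₁ a ⟧
    rgt≡ p a = refl

    hgt-true : ∀ {p a} → proj₂ p ≺ proj₂ a → hgt p a ≡ true
    hgt-true h = ⟦⟧-true h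
    hgt-false : ∀ {p a} → ¬ (proj₂ p ≺ proj₂ a) → hgt p a ≡ false
    hgt-false h = ⟦⟧-false h
    rgt-true : ∀ {p a} → proj₁ p ≺ proj₁ a → rgt p a ≡ true
    rgt-true h = ⟦⟧-true h
    rgt-false : ∀ {p a} → ¬ (proj₁ p ≺ proj₁ a) → rgt p a ≡ false
    rgt-false h = ⟦⟧-false h

  -- Parity of the crossings of the step from a to b with the horizontal ray
  -- from p to the right; meaningful when a and b lie in a box missing p.
  cr : ℝ² → ℝ² → ℝ² → Bool
  cr p a b = (hgt p a xor hgt p b) ∧ rgt p a

  -- The 0-cochain that bounds the difference of cr p and cr q away from p and q.
  shift : ℝ² → ℝ² → ℝ² → Bool
  shift p q a = rgt p a ∧ (hgt p a xor hgt q a)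

  ≺-resp : ∀ {x y z w} → x ≋ z → y ≋ w → x ≺ y → z ≺ w
  ≺-resp e f (q , a , b) = q , ≈-∙< e a , ≈-<∙ f b

  hgt-≑ : ∀ {p a b} → a ≑ b → hgt p a ≡ hgt p b
  hgt-≑ {p} {a} {b} e = subst₂ _≡_ (sym (hgt≡ p a)) (sym (hgt≡ p b)) (⟦⟧-cong (≺-resp ≋-refl (≑₂ e)) (≺-resp ≋-refl (≋-sym (≑₂ e))))

  rgt-≑ : ∀ {p a b} → a ≑ b → rgt p a ≡ rgt p b
  rgt-≑ {p} {a} {b} e = subst₂ _≡_ (sym (rgt≡ p a)) (sym (rgt≡ p b)) (⟦⟧-cong (≺-resp ≋-refl (≑₁ e)) (≺-resp ≋-refl (≋-sym (≑₁ e))))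

  cr-≑ : ∀ {p a b} → a ≑ b → cr p a b ≡ false
  cr-≑ {p} {a} {b} e = cong (_∧ rgt p a) (≡-xor (hgt-≑ {p} e))

  shift-≑ : ∀ {p q a b} → a ≑ b → shift p q a ≡ shift p q b
  shift-≑ {p} {q} e = cong₂ _∧_ (rgt-≑ {p} e) (cong₂ _xor_ (hgt-≑ {p} e) (hgt-≑ {q} e))

  -- The point `p` is beyond one of the four sides of `B`. So within `B` the cochain `cr p` is zero,
  -- or the coboundary of `hgt p` times a constant; either way it satisfies the cocycle law.
  ∉-split : ∀ {p B} → ¬ (p ∈□ B) → (∃ λ v → ∀ {a} → a ∈□ B → hgt p a ≡ v) ⊎ (∃ λ v → ∀ {a} → a ∈□ B → rgt p a ≡ v)
  ∉-split {p} {B} n = from (dec (left B <∙ proj₁ p)) (dec (proj₁ p ∙< right B)) (dec (bottom B <∙ proj₂ p)) (dec (proj₂ p ∙< top B))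
    where
    lower≼ : ∀ {l x} → ¬ (l <∙ x) → ∀ {y} → l <∙ y → x ≺ y
    lower≼ n h = ≼-≺ (λ k → n (≺⇒<∙ k)) (<∙⇒≺ h)
    upper≼ : ∀ {r x} → ¬ (x ∙< r) → ∀ {y} → y ∙< r → ¬ (x ≺ y)
    upper≼ n h k = n (≺⇒∙< (≺-≼ k (≺⇒≼ (∙<⇒≺ h))))
    from : _ → _ → _ → _ → (∃ λ v → ∀ {a} → a ∈□ B → hgt p a ≡ v) ⊎ (∃ λ v → ∀ {a} → a ∈□ B → rgt p a ≡ v)
    from (no k) _ _ _ = inj₂ (true , λ i → rgt-true (lower≼ k (∈-left i)))
    from _ (no k) _ _ = inj₂ (false , λ i → rgt-false (upper≼ k (∈-right i)))
    from _ _ (no k) _ = inj₁ (true , λ i → hgt-true (lower≼ k (∈-bottom i)))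
    from _ _ _ (no k) = inj₁ (false , λ i → hgt-false (upper≼ k (∈-top i)))
    from (yes a) (yes b) (yes c) (yes d) = ⊥-elim (n (mk∈ a b c d))

  cr-cocycle : ∀ {p B a b d} → ¬ (p ∈□ B) → a ∈□ B → b ∈□ B → d ∈□ B → cr p a b xor cr p b d ≡ cr p a d
  cr-cocycle {p} {B} {a} {b} {d} n i j k = from (∉-split n)
    where
    alg : ∀ x y z v → ((x xor y) ∧ v) xor ((y xor z) ∧ v) ≡ (x xor z) ∧ v
    alg false y z false = trans (cong₂ _xor_ (∧-zeroʳ y) (∧-zeroʳ (y xor z))) (sym (∧-zeroʳ z))
    alg true y z false = trans (cong₂ _xor_ (∧-zeroʳ (not y)) (∧-zeroʳ (y xor z))) (sym (∧-zeroʳ (not z)))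
    alg false false false true = refl
    alg false false true true = refl
    alg false true false true = refl
    alg false true true true = refl
    alg true false false true = refl
    alg true false true true = refl
    alg true true false true = refl
    alg true true true true = refl
    from : (∃ λ v → ∀ {a} → a ∈□ B → hgt p a ≡ v) ⊎ (∃ λ v → ∀ {a} → a ∈□ B → rgt p a ≡ v) → cr p a b xor cr p b d ≡ cr p a d
    from (inj₁ (v , f)) rewrite f i | f j | f k | xor-same v = refl
    from (inj₂ (v , f)) rewrite f i | f j = alg (hgt p a) (hgt p b) (hgt p d) v

  cr-sym : ∀ {p B a b} → ¬ (p ∈□ B) → a ∈□ B → b ∈□ B → cr p a b ≡ cr p b a
  cr-sym {p} {B} {a} {b} n i j = xor-≡ (trans (cr-cocycle n i j i) (cr-≑ ≑-refl))

  -- If a vertical line separates the boxes, `rgt` has the same value for both base points. If a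
  -- horizontal line does, all the `hgt` agree and both sides vanish.
  cr-move : ∀ {B B' p q a b} → Sep B B' → p ∈□ B → q ∈□ B → a ∈□ B' → b ∈□ B' →
    cr p a b xor cr q a b ≡ shift p q a xor shift p q b
  cr-move {B} {B'} {p} {q} {a} {b} s pB qB aB bB = from s
    where
    above : ∀ {l r} {x y : ℝ} → r ≤ l → x ∙< r → l <∙ y → x ≺ y
    above {y = y} h u v = _ , u , <∙-down y h v
    below : ∀ {l r} {x y : ℝ} → r ≤ l → y ∙< r → l <∙ x → ¬ (x ≺ y)
    below h u v = ≺⇒≼ (above h u v)
    alg : ∀ x y z w v → ((x xor y) ∧ v) xor ((z xor w) ∧ v) ≡ (v ∧ (x xor z)) xor (v ∧ (y xor w))
    alg = bool 5 (λ x y z w v → ((x ⊕ y) ⊗ v) ⊕ ((z ⊕ w) ⊗ v) ⊜ (v ⊗ (x ⊕ z)) ⊕ (v ⊗ (y ⊕ w))) refl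
    hor : ∀ v → rgt p a ≡ v → rgt p b ≡ v → rgt q a ≡ v → cr p a b xor cr q a b ≡ shift p q a xor shift p q b
    hor v e f g rewrite e | f | g = alg (hgt p a) (hgt p b) (hgt q a) (hgt q b) v
    ver : ∀ v → hgt p a ≡ v → hgt p b ≡ v → hgt q a ≡ v → hgt q b ≡ v → cr p a b xor cr q a b ≡ shift p q a xor shift p q b
    ver v e f g k rewrite e | f | g | k | xor-same v | ∧-zeroʳ (rgt p a) | ∧-zeroʳ (rgt p b) = refl
    from : Sep B B' → cr p a b xor cr q a b ≡ shift p q a xor shift p q b
    from (sepₗ h) = hor true (rgt-true (above h (∈-right pB) (∈-left aB))) (rgt-true (above h (∈-right pB) (∈-left bB))) (rgt-true (above h (∈-right qB) (∈-left aB)))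
    from (sepᵣ h) = hor false (rgt-false (below h (∈-right aB) (∈-left pB))) (rgt-false (below h (∈-right bB) (∈-left pB))) (rgt-false (below h (∈-right aB) (∈-left qB)))
    from (sepᵇ h) = ver true (hgt-true (above h (∈-top pB) (∈-bottom aB))) (hgt-true (above h (∈-top pB) (∈-bottom bB))) (hgt-true (above h (∈-top qB) (∈-bottom aB))) (hgt-true (above h (∈-top qB) (∈-bottom bB)))
    from (sepᵗ h) = ver false (hgt-false (below h (∈-top aB) (∈-bottom pB))) (hgt-false (below h (∈-top bB) (∈-bottom pB))) (hgt-false (below h (∈-top aB) (∈-bottom qB))) (hgt-false (below h (∈-top bB) (∈-bottom qB)))

  -- Parity sums over a lattice

  ∑ : ℕ → (ℕ → Bool) → Bool
  ∑ zero f = false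
  ∑ (suc n) f = ∑ n f xor f n

  ∑-cong : ∀ n {f g} → (∀ i → f i ≡ g i) → ∑ n f ≡ ∑ n g
  ∑-cong zero h = refl
  ∑-cong (suc n) h = cong₂ _xor_ (∑-cong n h) (h n)

  ∑-false : ∀ n {f} → (∀ i → f i ≡ false) → ∑ n f ≡ false
  ∑-false zero h = refl
  ∑-false (suc n) h = cong₂ _xor_ (∑-false n h) (h n)

  ∑-xor : ∀ n f g → ∑ n (λ i → f i xor g i) ≡ ∑ n f xor ∑ n g
  ∑-xor zero f g = refl
  ∑-xor (suc n) f g = trans (cong (_xor (f n xor g n)) (∑-xor n f g)) (xor-interchange (∑ n f) (∑ n g) (f n) (g n))

  ∑-swap : ∀ m n (f : ℕ → ℕ → Bool) → ∑ m (λ j → ∑ n (λ i → f i j)) ≡ ∑ n (λ i → ∑ m (λ j → f i j))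
  ∑-swap zero n f = sym (∑-false n λ _ → refl)
  ∑-swap (suc m) n f = trans (cong (_xor ∑ n (λ i → f i m)) (∑-swap m n f)) (sym (∑-xor n (λ i → ∑ m (f i)) (λ i → f i m)))

  ∑-by-parts : ∀ n (R V : ℕ → Bool) → R 0 ≡ false → R n ≡ false →
    ∑ n (λ i → (R i xor R (suc i)) ∧ V (suc i)) ≡ ∑ n (λ i → R i ∧ (V i xor V (suc i)))
  ∑-by-parts n R V e f = sym (xor-≡ (trans (go n) (cong₂ (λ a b → (a ∧ V 0) xor (b ∧ V n)) e f)))
    where
    alg : ∀ A B r r' v v' v0 → A xor B ≡ v0 xor (r ∧ v) →
      (A xor (r ∧ (v xor v'))) xor (B xor ((r xor r') ∧ v')) ≡ v0 xor (r' ∧ v')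
    alg A B r r' v v' v0 h = trans (xor-interchange A _ B _) (trans (cong (_xor ((r ∧ (v xor v')) xor ((r xor r') ∧ v'))) h)
      (bool 5 (λ r r' v v' v0 → (v0 ⊕ (r ⊗ v)) ⊕ ((r ⊗ (v ⊕ v')) ⊕ ((r ⊕ r') ⊗ v')) ⊜ v0 ⊕ (r' ⊗ v')) refl r r' v v' v0))
    go : ∀ n → ∑ n (λ i → R i ∧ (V i xor V (suc i))) xor ∑ n (λ i → (R i xor R (suc i)) ∧ V (suc i)) ≡ (R 0 ∧ V 0) xor (R n ∧ V n)
    go zero = sym (xor-same (R 0 ∧ V 0))
    go (suc n) = alg (∑ n (λ i → R i ∧ (V i xor V (suc i)))) (∑ n (λ i → (R i xor R (suc i)) ∧ V (suc i))) (R n) (R (suc n)) (V n) (V (suc n)) (R 0 ∧ V 0) (go n)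

  -- The difference of a monotone indicator `s` is a point mass at the index where `s` jumps. This
  -- locates the row or column of the lattice that contains a given point.
  ∑-pick : ∀ n (s f : ℕ → Bool) → (∀ i → s i ≡ true → s (suc i) ≡ true) → s 0 ≡ false →
    (s n ≡ false × ∑ n (λ i → f i ∧ (s i xor s (suc i))) ≡ false) ⊎
    (s n ≡ true × ∃ λ i → s i ≡ false × s (suc i) ≡ true × ∀ (g : ℕ → Bool) → ∑ n (λ i → g i ∧ (s i xor s (suc i))) ≡ g i)
  ∑-pick zero s f m e = inj₁ (e , refl)
  ∑-pick (suc n) s f m e with ∑-pick n s f m e | s (suc n) in e'
  ... | inj₁ (sn , z) | false = inj₁ (refl , trans (cong₂ _xor_ z (trans (cong (λ v → f n ∧ (v xor false)) sn) (∧-zeroʳ (f n)))) refl)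
  ... | inj₁ (sn , z) | true = inj₂ (refl , n , sn , e' , λ g → trans (cong₂ _xor_ (zero′ g) (trans (cong (λ v → g n ∧ (v xor true)) sn) (∧-true (g n)))) refl)
    where
    ∧-true : ∀ b → b ∧ true ≡ b
    ∧-true false = refl
    ∧-true true = refl
    down : ∀ i k → s (k ℕ.+ i) ≡ false → s i ≡ false
    down i zero h = h
    down i (suc k) h with s (k ℕ.+ i) in q
    ... | false = down i k q
    ... | true = ⊥-elim (not-both (m _ q) h)
    zero′ : ∀ g → ∑ n (λ i → g i ∧ (s i xor s (suc i))) ≡ false
    zero′ g = go n sn
      where
      go : ∀ k → s k ≡ false → ∑ k (λ i → g i ∧ (s i xor s (suc i))) ≡ false
      go zero _ = refl
      go (suc k) h = cong₂ _xor_ (go k (down k 1 h)) (trans (cong₂ (λ u v → g k ∧ (u xor v)) (down k 1 h) h) (∧-zeroʳ (g k)))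
  ... | inj₂ (sn , _) | false = ⊥-elim (not-both (m n sn) e')
  ... | inj₂ (sn , i , a , b , h) | true = inj₂ (refl , i , a , b , λ g → trans (cong₂ _xor_ (h g) (trans (cong (λ v → g n ∧ (v xor true)) sn) (∧-zeroʳ (g n)))) (xor-identityʳ (g i)))

  gather : {A : Set} → ℕ → (ℕ → List A) → List A
  gather zero f = []
  gather (suc n) f = gather n f ++ f n

  ⨁-gather : {A : Set} (G : A → Bool) (n : ℕ) (f : ℕ → List A) → ⨁ G (gather n f) ≡ ∑ n (λ i → ⨁ G (f i))
  ⨁-gather G zero f = refl
  ⨁-gather G (suc n) f = trans (⨁-++ G (gather n f) (f n)) (cong (_xor ⨁ G (f n)) (⨁-gather G n f))

  ∈-gather : {A : Set} {z : A} (n : ℕ) (f : ℕ → List A) → z ∈ gather n f → ∃ λ i → z ∈ f i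
  ∈-gather (suc n) f h = [ ∈-gather n f , (λ k → n , k) ]′ (∈-++⁻ (gather n f) h)

  module Grid (h : ℚ) (h>0 : 0ℚ < h) where

    grid : ℚ → ℕ → ℚ
    grid l zero = l
    grid l (suc i) = grid l i + h

    grid-mono : ∀ {l l'} → l ≤ l' → ∀ i → grid l i ≤ grid l' i
    grid-mono le zero = le
    grid-mono le (suc i) = ℚₚ.+-monoˡ-≤ h (grid-mono le i)

    grid-+ : ∀ l i j → grid (grid l i) j ≡ grid l (j ℕ.+ i)
    grid-+ l i zero = refl
    grid-+ l i (suc j) = cong (_+ h) (grid-+ l i j)

    grid-reaches : ∀ l r → l ≤ r → ∃ λ n → r ≤ grid l n
    grid-reaches l r = Cousin.cousin (λ l r → ∃ λ n → r ≤ grid l n) l r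
      (λ {a} {b} {c} _ _ _ _ (n , p) (m , q) → m ℕ.+ n , ℚₚ.≤-trans q (ℚₚ.≤-trans (grid-mono p m) (ℚₚ.≤-reflexive (grid-+ a n m))))
      (λ x _ _ → let (l₀ , r₀ , a , b , c) = bracket x h>0 in l₀ , r₀ , a , b , λ _ _ _ p q → 1 , ℚₚ.<⇒≤ (ℚₚ.<-≤-trans q (ℚₚ.≤-trans c (ℚₚ.+-monoˡ-≤ h (ℚₚ.<⇒≤ p)))))

  -- The mesh `h` is an eighth of `ε`. Five meshes are the side of the largest box used around a
  -- lattice edge: its length `h`, and `2h` more at each end.
  fifth : ∀ {ε} → 0ℚ < ε → ∃ λ h → 0ℚ < h × (h + h) + ((h + h) + h) ≤ ε
  fifth {ε} ε>0 = h , h>0 , lin≤ (0≤h ≤+≤ 0≤h ≤+≤ 0≤h) (trans (cong (_+ (0ℚ + 0ℚ + 0ℚ)) (trans (sym (½2 ε)) (cong₂ _+_ ε/2 ε/2)))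
      (linear 1 (λ h → (((h :+ h) :+ (h :+ h)) :+ ((h :+ h) :+ (h :+ h))) :+ (:0 :+ :0 :+ :0) := ((h :+ h) :+ ((h :+ h) :+ h)) :+ (h :+ h :+ h)) refl h))
    where
    h : ℚ
    h = ½ * (½ * (½ * ε))
    h>0 : 0ℚ < h
    h>0 = half-pos (half-pos (half-pos ε>0))
    0≤h : 0ℚ ≤ h
    0≤h = ℚₚ.<⇒≤ h>0
    ε/4 : ½ * (½ * ε) ≡ h + h
    ε/4 = sym (½2 (½ * (½ * ε)))
    ε/2 : ½ * ε ≡ (h + h) + (h + h)
    ε/2 = trans (sym (½2 (½ * ε))) (cong₂ _+_ ε/4 ε/4)

  record Supp (lo hi : ℚ) (x : ℝ²) : Set where
    constructor supp
    field
      lo₁ : lo <∙ proj₁ x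
      hi₁ : proj₁ x ∙< hi
      lo₂ : lo <∙ proj₂ x
      hi₂ : proj₂ x ∙< hi

  -- Outline of a plane region by lattice cells

  module Star {T : Set} (pos : T → ℝ²) where

    Free : Box → Set
    Free B = ∀ a → ¬ (pos a ∈□ B)

    Far : ℚ → ℝ² → Set
    Far ε q = ∀ {B} → Size ε B → q ∈□ B → Free B

    module _ (Φ : ℝ² → Set) (inv : ∀ {x y B} → x ∈□ B → y ∈□ B → Free B → Φ x → Φ y)
      (lo hi : ℚ) (lo≤hi : lo ≤ hi) (sup : ∀ {x} → Φ x → Supp lo hi x) where

      private
        module Lattice (h : ℚ) (h>0 : 0ℚ < h) (a₀ : T) where
          open Grid h h>0

          t : ℕ → ℚ
          t = grid lo

          t-up : ∀ i → t i < t (suc i)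
          t-up i = lin< h>0 (linear 2 (λ t h → (t :+ h) :+ :0 := t :+ h) refl (t i) h)

          n : ℕ
          n = proj₁ (grid-reaches lo hi lo≤hi)
          hi≤tn : hi ≤ t n
          hi≤tn = proj₂ (grid-reaches lo hi lo≤hi)

          corner : ℕ → ℕ → ℝ²
          corner i j = fromℚ (t i) , fromℚ (t j)

          -- The corner colours the whole cell of which it is the lower left corner.
          R : ℕ → ℕ → Bool
          R i j = ⟦ Φ (corner i j) ⟧

          near : ℕ → ℕ → Box
          near i j = mkBox (t i - (h + h)) (t i + (h + h)) (t j - (h + h)) (t j + (h + h))

          -- An obstacle within `2h` of the corner, or the default `a₀`. Where the colour changes, a
          -- box around the lattice edge in question contains an obstacle, so the ends of an outline
          -- edge never get the default; the values at other corners cancel in the sums.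
          κ : ℕ → ℕ → T
          κ i j with dec (∃ λ a → pos a ∈□ near i j)
          ... | yes (a , _) = a
          ... | no _ = a₀

          κ-near : ∀ {i j a} → pos a ∈□ near i j → pos (κ i j) ∈□ near i j
          κ-near {i} {j} {a} h with dec (∃ λ a → pos a ∈□ near i j)
          ... | yes (_ , k) = k
          ... | no k = ⊥-elim (k (a , h))

          0≤h : 0ℚ ≤ h
          0≤h = ℚₚ.<⇒≤ h>0
          <+h : ∀ x → x < x + h
          <+h x = lin< h>0 (linear 2 (λ t h → (t :+ h) :+ :0 := t :+ h) refl x h)
          -h< : ∀ x → x - h < x
          -h< x = lin< h>0 (linear 2 (λ t h → t :+ :0 := (t :- h) :+ h) refl x h)

          corner∈ : ∀ {l r b u} i j → l < t i → t i < r → b < t j → t j < u → corner i j ∈□ mkBox l r b u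
          corner∈ i j a b c d = mk∈ (<⇒<∙ a) (<⇒∙< b) (<⇒<∙ c) (<⇒∙< d)

          hbox vbox : ℕ → ℕ → Box
          hbox i j = mkBox (t i - h) ((t i + h) + h) (t j - h) (t j + h)
          vbox i j = mkBox (t i - h) (t i + h) (t j - h) ((t j + h) + h)

          R-h : ∀ i j → Free (hbox i j) → R i j ≡ R (suc i) j
          R-h i j f = ⟦⟧-cong (inv p q f) (inv q p f)
            where
            p : corner i j ∈□ hbox i j
            p = corner∈ i j (-h< (t i)) (ℚₚ.<-trans (<+h (t i)) (<+h _)) (-h< (t j)) (<+h (t j))
            q : corner (suc i) j ∈□ hbox i j
            q = corner∈ (suc i) j (ℚₚ.<-trans (-h< (t i)) (<+h (t i))) (<+h (t i + h)) (-h< (t j)) (<+h (t j))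

          R-v : ∀ i j → Free (vbox i j) → R i j ≡ R i (suc j)
          R-v i j f = ⟦⟧-cong (inv p q f) (inv q p f)
            where
            p : corner i j ∈□ vbox i j
            p = corner∈ i j (-h< (t i)) (<+h (t i)) (-h< (t j)) (ℚₚ.<-trans (<+h (t j)) (<+h _))
            q : corner i (suc j) ∈□ vbox i j
            q = corner∈ i (suc j) (-h< (t i)) (<+h (t i)) (ℚₚ.<-trans (-h< (t j)) (<+h (t j))) (<+h (t j + h))

          ≤₁ : ∀ x → x - (h + h) ≤ x - h
          ≤₁ x = lin≤ 0≤h (linear 2 (λ x h → (x :- h) :+ :0 := (x :- (h :+ h)) :+ h) refl x h)
          ≤₂ : ∀ x → (x + h) - (h + h) ≤ x - h
          ≤₂ x = ℚₚ.≤-reflexive (linear 2 (λ x h → (x :+ h) :- (h :+ h) := x :- h) refl x h)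
          ≤₃ : ∀ x → (x + h) + h ≤ (x + h) + (h + h)
          ≤₃ x = lin≤ 0≤h (linear 2 (λ x h → ((x :+ h) :+ (h :+ h)) :+ :0 := ((x :+ h) :+ h) :+ h) refl x h)
          ≤₄ : ∀ x → x + h ≤ x + (h + h)
          ≤₄ x = lin≤ 0≤h (linear 2 (λ x h → (x :+ (h :+ h)) :+ :0 := (x :+ h) :+ h) refl x h)
          ≤₅ : ∀ x → x + h ≤ (x + h) + (h + h)
          ≤₅ x = lin≤ (0≤h ≤+≤ 0≤h) (linear 2 (λ x h → ((x :+ h) :+ (h :+ h)) :+ (:0 :+ :0) := (x :+ h) :+ (h :+ h)) refl x h)
          ≤₆ : ∀ x → x - (h + h) ≤ (x + h) - (h + h)
          ≤₆ x = lin≤ 0≤h (linear 2 (λ x h → ((x :+ h) :- (h :+ h)) :+ :0 := (x :- (h :+ h)) :+ h) refl x h)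
          ≤₇ : ∀ x → x + (h + h) ≤ (x + h) + (h + h)
          ≤₇ x = lin≤ 0≤h (linear 2 (λ x h → ((x :+ h) :+ (h :+ h)) :+ :0 := (x :+ (h :+ h)) :+ h) refl x h)

          hbox⊑₀ : ∀ i j → hbox i j ⊑ near (suc i) j
          hbox⊑₀ i j = sub (≤₂ (t i)) (≤₃ (t i)) (≤₁ (t j)) (≤₄ (t j))
          hbox⊑₁ : ∀ i j → hbox i j ⊑ near (suc i) (suc j)
          hbox⊑₁ i j = sub (≤₂ (t i)) (≤₃ (t i)) (≤₂ (t j)) (≤₅ (t j))
          vbox⊑₀ : ∀ i j → vbox i j ⊑ near i (suc j)
          vbox⊑₀ i j = sub (≤₁ (t i)) (≤₄ (t i)) (≤₂ (t j)) (≤₃ (t j))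
          vbox⊑₁ : ∀ i j → vbox i j ⊑ near (suc i) (suc j)
          vbox⊑₁ i j = sub (≤₂ (t i)) (≤₅ (t i)) (≤₂ (t j)) (≤₃ (t j))

          vedge hedge : ℕ → ℕ → Box
          vedge i j = mkBox (t i - (h + h)) (t i + (h + h)) (t j - (h + h)) ((t j + h) + (h + h))
          hedge i j = mkBox (t i - (h + h)) ((t i + h) + (h + h)) (t j - (h + h)) (t j + (h + h))

          near⊑v₀ : ∀ i j → near i j ⊑ vedge i j
          near⊑v₀ i j = sub ℚₚ.≤-refl ℚₚ.≤-refl ℚₚ.≤-refl (≤₇ (t j))
          near⊑v₁ : ∀ i j → near i (suc j) ⊑ vedge i j
          near⊑v₁ i j = sub ℚₚ.≤-refl ℚₚ.≤-refl (≤₆ (t j)) ℚₚ.≤-refl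
          near⊑h₀ : ∀ i j → near i j ⊑ hedge i j
          near⊑h₀ i j = sub ℚₚ.≤-refl (≤₇ (t i)) ℚₚ.≤-refl ℚₚ.≤-refl
          near⊑h₁ : ∀ i j → near (suc i) j ⊑ hedge i j
          near⊑h₁ i j = sub (≤₆ (t i)) ℚₚ.≤-refl ℚₚ.≤-refl ℚₚ.≤-refl

          corner∈near : ∀ i j → corner i j ∈□ near i j
          corner∈near i j = corner∈ i j (lt (t i)) (gt (t i)) (lt (t j)) (gt (t j))
            where
            lt : ∀ x → x - (h + h) < x
            lt x = lin< (h>0 <+< h>0) (linear 2 (λ x h → x :+ (:0 :+ :0) := (x :- (h :+ h)) :+ (h :+ h)) refl x h)
            gt : ∀ x → x < x + (h + h)
            gt x = lin< (h>0 <+< h>0) (linear 2 (λ x h → (x :+ (h :+ h)) :+ (:0 :+ :0) := x :+ (h :+ h)) refl x h)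

          h5 : ℚ
          h5 = (h + h) + ((h + h) + h)

          size-v : ∀ i j → Size h5 (vedge i j)
          size-v i j = size (w₄ (t i)) (w₅ (t j))
            where
            w₄ : ∀ x → x + (h + h) ≤ (x - (h + h)) + h5
            w₄ x = lin≤ 0≤h (linear 2 (λ x h → ((x :- (h :+ h)) :+ ((h :+ h) :+ ((h :+ h) :+ h))) :+ :0 := (x :+ (h :+ h)) :+ h) refl x h)
            w₅ : ∀ x → (x + h) + (h + h) ≤ (x - (h + h)) + h5
            w₅ x = ℚₚ.≤-reflexive (linear 2 (λ x h → (x :+ h) :+ (h :+ h) := (x :- (h :+ h)) :+ ((h :+ h) :+ ((h :+ h) :+ h))) refl x h)
          size-h : ∀ i j → Size h5 (hedge i j)
          size-h i j = size (height (size-v j i)) (width (size-v j i))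

          near-v : ∀ i j → (R i j xor R (suc i) j) ≡ true → pos (κ (suc i) j) ∈□ near (suc i) j × pos (κ (suc i) (suc j)) ∈□ near (suc i) (suc j)
          near-v i j e with dec (∃ λ a → pos a ∈□ hbox i j)
          ... | yes (a , k) = κ-near (∈-⊑ (hbox⊑₀ i j) k) , κ-near (∈-⊑ (hbox⊑₁ i j) k)
          ... | no k = ⊥-elim (not-both e (≡-xor (R-h i j λ a q → k (a , q))))

          near-h : ∀ i j → (R i j xor R i (suc j)) ≡ true → pos (κ i (suc j)) ∈□ near i (suc j) × pos (κ (suc i) (suc j)) ∈□ near (suc i) (suc j)
          near-h i j e with dec (∃ λ a → pos a ∈□ vbox i j)
          ... | yes (a , k) = κ-near (∈-⊑ (vbox⊑₀ i j) k) , κ-near (∈-⊑ (vbox⊑₁ i j) k)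
          ... | no k = ⊥-elim (not-both e (≡-xor (R-v i j λ a q → k (a , q))))

          only : Bool → T × T → List (T × T)
          only b z = if b then z ∷ [] else []

          ⨁-only : ∀ G b z → ⨁ G (only b z) ≡ b ∧ G z
          ⨁-only G false z = refl
          ⨁-only G true z = xor-identityʳ (G z)

          -- The cells at `(i , j)` and `(i + 1 , j)` share the vertical edge that starts at corner
          -- `(i + 1 , j)`, and similarly for the cells above each other; hence the shifted indices.
          Zv Zh : ℕ → ℕ → List (T × T)
          Zv i j = only (R i j xor R (suc i) j) (κ (suc i) j , κ (suc i) (suc j))
          Zh i j = only (R i j xor R i (suc j)) (κ i (suc j) , κ (suc i) (suc j))

          Z : List (T × T)
          Z = gather n λ j → gather n λ i → Zv i j ++ Zh i j

          Close : T × T → Set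
          Close (a , b) = ∃ λ B → Size h5 B × pos a ∈□ B × pos b ∈□ B

          only-close : ∀ b {z w} → (b ≡ true → Close z) → w ∈ only b z → Close w
          only-close true c (here refl) = c refl

          Zv-close : ∀ i j {w} → w ∈ Zv i j → Close w
          Zv-close i j = only-close _ λ e → vedge (suc i) j , size-v (suc i) j , ∈-⊑ (near⊑v₀ (suc i) j) (proj₁ (near-v i j e)) , ∈-⊑ (near⊑v₁ (suc i) j) (proj₂ (near-v i j e))
          Zh-close : ∀ i j {w} → w ∈ Zh i j → Close w
          Zh-close i j = only-close _ λ e → hedge i (suc j) , size-h i (suc j) , ∈-⊑ (near⊑h₀ i (suc j)) (proj₁ (near-h i j e)) , ∈-⊑ (near⊑h₁ i (suc j)) (proj₂ (near-h i j e))

          Z-close : ∀ {w} → w ∈ Z → Close w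
          Z-close {w} m = outer (∈-gather n (λ j → gather n λ i → Zv i j ++ Zh i j) m)
            where
            inner : ∀ j → (∃ λ i → w ∈ Zv i j ++ Zh i j) → Close w
            inner j (i , k) = [ Zv-close i j , Zh-close i j ]′ (∈-++⁻ (Zv i j) k)
            outer : (∃ λ j → w ∈ gather n λ i → Zv i j ++ Zh i j) → Close w
            outer (j , k) = inner j (∈-gather n (λ i → Zv i j ++ Zh i j) k)

          R-left : ∀ j → R 0 j ≡ false
          R-left j = ⟦⟧-false λ p → ℚₚ.<-irrefl refl (<∙⇒< (Supp.lo₁ (sup p)))
          R-bottom : ∀ i → R i 0 ≡ false
          R-bottom i = ⟦⟧-false λ p → ℚₚ.<-irrefl refl (<∙⇒< (Supp.lo₂ (sup p)))
          R-right : ∀ j → R n j ≡ false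
          R-right j = ⟦⟧-false λ p → <⇒≢≥ (∙<⇒< (Supp.hi₁ (sup p))) hi≤tn
          R-top : ∀ i → R i n ≡ false
          R-top i = ⟦⟧-false λ p → <⇒≢≥ (∙<⇒< (Supp.hi₂ (sup p))) hi≤tn

          -- Summation by parts: boundary edges against cells of the region.
          module _ (V H : ℕ → ℕ → Bool) where
            cell : ℕ → ℕ → Bool
            cell i j = (V i j xor V (suc i) j) xor (H i j xor H i (suc j))

            parts : ∑ n (λ j → ∑ n (λ i → ((R i j xor R (suc i) j) ∧ V (suc i) j) xor ((R i j xor R i (suc j)) ∧ H i (suc j)))) ≡ ∑ n (λ j → ∑ n (λ i → R i j ∧ cell i j))
            parts = begin
              _ ≡⟨ ∑-cong n (λ j → ∑-xor n _ _) ⟩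
              _ ≡⟨ ∑-xor n _ _ ⟩
              ∑ n (λ j → ∑ n (λ i → (R i j xor R (suc i) j) ∧ V (suc i) j)) xor ∑ n (λ j → ∑ n (λ i → (R i j xor R i (suc j)) ∧ H i (suc j)))
                ≡⟨ cong₂ _xor_ (∑-cong n (λ j → ∑-by-parts n (λ i → R i j) (λ i → V i j) (R-left j) (R-right j)))
                     (trans (∑-swap n n (λ i j → (R i j xor R i (suc j)) ∧ H i (suc j))) (trans (∑-cong n (λ i → ∑-by-parts n (R i) (H i) (R-bottom i) (R-top i))) (sym (∑-swap n n (λ i j → R i j ∧ (H i j xor H i (suc j))))))) ⟩
              ∑ n (λ j → ∑ n (λ i → R i j ∧ (V i j xor V (suc i) j))) xor ∑ n (λ j → ∑ n (λ i → R i j ∧ (H i j xor H i (suc j))))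
                ≡⟨ sym (∑-xor n _ _) ⟩
              _ ≡⟨ ∑-cong n (λ j → sym (∑-xor n _ _)) ⟩
              _ ≡⟨ ∑-cong n (λ j → ∑-cong n (λ i → sym (∧-distribˡ-xor (R i j) (V i j xor V (suc i) j) (H i j xor H i (suc j))))) ⟩
              _ ∎
              where open ≡-Reasoning

          -- Stokes' formula on the lattice. `V` and `H` extend `G` from the outline to all lattice
          -- edges, and the extension may be arbitrary off the outline.
          ⨁-Z : ∀ (G : T × T → Bool) (V H : ℕ → ℕ → Bool) →
            (∀ i j → (R i j xor R (suc i) j) ≡ true → G (κ (suc i) j , κ (suc i) (suc j)) ≡ V (suc i) j) →
            (∀ i j → (R i j xor R i (suc j)) ≡ true → G (κ i (suc j) , κ (suc i) (suc j)) ≡ H i (suc j)) →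
            ⨁ G Z ≡ ∑ n (λ j → ∑ n (λ i → R i j ∧ cell V H i j))
          ⨁-Z G V H ev eh = trans (⨁-gather G n _) (trans (∑-cong n λ j → trans (⨁-gather G n _) (∑-cong n λ i →
              trans (⨁-++ G (Zv i j) (Zh i j)) (cong₂ _xor_ (one _ _ (ev i j)) (one _ _ (eh i j))))) (parts V H))
            where
            one : ∀ b z {v} → (b ≡ true → G z ≡ v) → ⨁ G (only b z) ≡ b ∧ v
            one b z {v} f = trans (⨁-only G b z) (help b f)
              where
              help : ∀ b → (b ≡ true → G z ≡ v) → b ∧ G z ≡ b ∧ v
              help false _ = refl
              help true f = f refl

          private
            cancel₄ : ∀ a b c d → ((a xor b) xor (c xor d)) xor ((a xor c) xor (b xor d)) ≡ false
            cancel₄ a b c d = trans (cong (_xor ((a xor c) xor (b xor d))) (xor-interchange a b c d)) (xor-same ((a xor c) xor (b xor d)))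

            coboundary₀ : ∀ (f : ℕ → ℕ → Bool) → ∑ n (λ j → ∑ n (λ i → R i j ∧ cell (λ i j → f i j xor f i (suc j)) (λ i j → f i j xor f (suc i) j) i j)) ≡ false
            coboundary₀ f = ∑-false n λ j → ∑-false n λ i → trans (cong (R i j ∧_) (cancel₄ (f i j) (f i (suc j)) (f (suc i) j) (f (suc i) (suc j)))) (∧-zeroʳ (R i j))

          Z-closed : ∀ (F : T → Bool) → ⨁ (λ z → F (proj₁ z) xor F (proj₂ z)) Z ≡ false
          Z-closed F = trans (⨁-Z (λ z → F (proj₁ z) xor F (proj₂ z)) (λ i j → F (κ i j) xor F (κ i (suc j))) (λ i j → F (κ i j) xor F (κ (suc i) j))
            (λ _ _ _ → refl) (λ _ _ _ → refl)) (coboundary₀ λ i j → F (κ i j))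

          module _ (q : ℝ²) (far : Far h5 q) where
            -- The way from a corner to its obstacle. It enters `V` and `H` as a coboundary, so the
            -- cell values are those of the undistorted lattice even where `κ` is a default.
            e : ℕ → ℕ → Bool
            e i j = cr q (corner i j) (pos (κ i j))

            V H : ℕ → ℕ → Bool
            V i j = cr q (corner i j) (corner i (suc j)) xor (e i j xor e i (suc j))
            H i j = cr q (corner i j) (corner (suc i) j) xor (e i j xor e (suc i) j)

            quad : ∀ {B x y a b} → ¬ (q ∈□ B) → x ∈□ B → y ∈□ B → a ∈□ B → b ∈□ B → cr q a b ≡ cr q x y xor (cr q x a xor cr q y b)
            quad {B} {x} {y} {a} {b} nq xB yB aB bB = trans
              (bool′ (cr q a b) (cr q x y) (cr q x a) (cr q y b) (trans (cr-cocycle nq xB aB bB) (sym (cr-cocycle nq xB yB bB)))) refl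
              where
              bool′ : ∀ ab xy xa yb → xa xor ab ≡ xy xor yb → ab ≡ xy xor (xa xor yb)
              bool′ ab xy xa yb h = trans (sym (xor-cancel xa ab)) (trans (cong (xa xor_) h) (bool 3 (λ xa xy yb → xa ⊕ (xy ⊕ yb) ⊜ xy ⊕ (xa ⊕ yb)) refl xa xy yb))

            Gv : ∀ i j → (R i j xor R (suc i) j) ≡ true → cr q (pos (κ (suc i) j)) (pos (κ (suc i) (suc j))) ≡ V (suc i) j
            Gv i j r = quad (λ qB → far (size-v (suc i) j) qB _ k₀) (∈-⊑ (near⊑v₀ (suc i) j) (corner∈near (suc i) j)) (∈-⊑ (near⊑v₁ (suc i) j) (corner∈near (suc i) (suc j))) k₀ (∈-⊑ (near⊑v₁ (suc i) j) (proj₂ (near-v i j r)))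
              where k₀ = ∈-⊑ (near⊑v₀ (suc i) j) (proj₁ (near-v i j r))

            Gh : ∀ i j → (R i j xor R i (suc j)) ≡ true → cr q (pos (κ i (suc j))) (pos (κ (suc i) (suc j))) ≡ H i (suc j)
            Gh i j r = quad (λ qB → far (size-h i (suc j)) qB _ k₀) (∈-⊑ (near⊑h₀ i (suc j)) (corner∈near i (suc j))) (∈-⊑ (near⊑h₁ i (suc j)) (corner∈near (suc i) (suc j))) k₀ (∈-⊑ (near⊑h₁ i (suc j)) (proj₂ (near-h i j r)))
              where k₀ = ∈-⊑ (near⊑h₀ i (suc j)) (proj₁ (near-h i j r))

            sx sy : ℕ → Bool
            sx i = ⟦ proj₁ q ≺ fromℚ (t i) ⟧
            sy j = ⟦ proj₂ q ≺ fromℚ (t j) ⟧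

            s-mono : ∀ (x : ℝ) i → ⟦ x ≺ fromℚ (t i) ⟧ ≡ true → ⟦ x ≺ fromℚ (t (suc i)) ⟧ ≡ true
            s-mono x i m = ⟦⟧-true (≺-≼ (⟦⟧-sound m) (≤⇒≼ (ℚₚ.<⇒≤ (t-up i))))

            vert : ∀ i j → cr q (corner i j) (corner i (suc j)) ≡ (sy j xor sy (suc j)) ∧ sx i
            vert i j = cong₂ _∧_ (cong₂ _xor_ (hgt≡ q (corner i j)) (hgt≡ q (corner i (suc j)))) (rgt≡ q (corner i j))
            horiz : ∀ i j → cr q (corner i j) (corner (suc i) j) ≡ false
            horiz i j = cong (_∧ rgt q (corner i j)) (≡-xor (trans (hgt≡ q (corner i j)) (sym (hgt≡ q (corner (suc i) j)))))

            -- Only vertical lattice edges can cross a horizontal ray. What remains is the indicator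
            -- of the cell that contains `q`.
            cell-value : ∀ i j → cell V H i j ≡ (sy j xor sy (suc j)) ∧ (sx i xor sx (suc i))
            cell-value i j = trans
              (cong₂ _xor_ (cong₂ _xor_ (cong (_xor (e i j xor e i (suc j))) (vert i j)) (cong (_xor (e (suc i) j xor e (suc i) (suc j))) (vert (suc i) j)))
                           (cong₂ _xor_ (cong (_xor (e i j xor e (suc i) j)) (horiz i j)) (cong (_xor (e i (suc j) xor e (suc i) (suc j))) (horiz i (suc j)))))
              (trans (lem ((sy j xor sy (suc j)) ∧ sx i) ((sy j xor sy (suc j)) ∧ sx (suc i)) (e i j xor e i (suc j)) (e (suc i) j xor e (suc i) (suc j)) _ (xor-interchange (e i j) (e i (suc j)) (e (suc i) j) (e (suc i) (suc j))))
                (sym (∧-distribˡ-xor (sy j xor sy (suc j)) (sx i) (sx (suc i)))))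
              where
              lem : ∀ P Q s u v → s xor u ≡ v → ((P xor s) xor (Q xor u)) xor v ≡ P xor Q
              lem P Q s u v refl = bool 4 (λ P Q s u → ((P ⊕ s) ⊕ (Q ⊕ u)) ⊕ (s ⊕ u) ⊜ P ⊕ Q) refl P Q s u

            sum≡ : ⨁ (λ z → cr q (pos (proj₁ z)) (pos (proj₂ z))) Z ≡ ∑ n (λ j → ∑ n (λ i → R i j ∧ (sx i xor sx (suc i))) ∧ (sy j xor sy (suc j)))
            sum≡ = trans (⨁-Z _ V H Gv Gh) (∑-cong n λ j → trans (∑-cong n λ i → trans (cong (R i j ∧_) (cell-value i j)) (re (R i j) (sy j xor sy (suc j)) (sx i xor sx (suc i)))) (∑-∧ n _ (sy j xor sy (suc j))))
              where
              re : ∀ r y x → r ∧ (y ∧ x) ≡ (r ∧ x) ∧ y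
              re = bool 3 (λ r y x → r ⊗ (y ⊗ x) ⊜ (r ⊗ x) ⊗ y) refl
              ∑-∧ : ∀ n f y → ∑ n (λ i → f i ∧ y) ≡ ∑ n f ∧ y
              ∑-∧ zero f y = refl
              ∑-∧ (suc n) f y = trans (cong (_xor (f n ∧ y)) (∑-∧ n f y)) (bool 3 (λ a b y → (a ⊗ y) ⊕ (b ⊗ y) ⊜ (a ⊕ b) ⊗ y) refl (∑ n f) (f n) y)

            -- The point `q` and the corner of its cell share a box of side `3h`, which is free
            -- because `q` is far from the obstacles.
            in-cell : ∀ {i j} → sx i ≡ false → sx (suc i) ≡ true → sy j ≡ false → sy (suc j) ≡ true → R i j ≡ ⟦ Φ q ⟧
            in-cell {i} {j} x₀ x₁ y₀ y₁ = ⟦⟧-cong (inv cB qB (far sz qB)) (inv qB cB (far sz qB))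
              where
              B : Box
              B = mkBox (t i - h) (t i + (h + h)) (t j - h) (t j + (h + h))
              0<2h : ∀ x → x < x + (h + h)
              0<2h x = ℚₚ.<-≤-trans (<+h x) (≤₄ x)
              cB : corner i j ∈□ B
              cB = corner∈ i j (-h< (t i)) (0<2h (t i)) (-h< (t j)) (0<2h (t j))
              low : ∀ {x : ℝ} {i} → ⟦ x ≺ fromℚ (t i) ⟧ ≡ false → t i - h <∙ x
              low {i = i} z = <∙-≼ (<⇒<∙ (-h< (t i))) (⟦⟧-refute z)
              upp : ∀ {x : ℝ} {i} → ⟦ x ≺ fromℚ (t (suc i)) ⟧ ≡ true → x ∙< t i + (h + h)
              upp {x} {i} z = ∙<-up x (≤₄ (t i)) (≺⇒∙< (⟦⟧-sound z))
              qB : q ∈□ B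
              qB = mk∈ (low {proj₁ q} {i} x₀) (upp {proj₁ q} {i} x₁) (low {proj₂ q} {j} y₀) (upp {proj₂ q} {j} y₁)
              w : ∀ x → x + (h + h) ≤ (x - h) + h5
              w x = lin≤ (0≤h ≤+≤ 0≤h) (linear 2 (λ x h → ((x :- h) :+ ((h :+ h) :+ ((h :+ h) :+ h))) :+ (:0 :+ :0) := (x :+ (h :+ h)) :+ (h :+ h)) refl x h)
              sz : Size h5 B
              sz = size (w (t i)) (w (t j))

            value : ⨁ (λ z → cr q (pos (proj₁ z)) (pos (proj₂ z))) Z ≡ ⟦ Φ q ⟧
            value = trans sum≡ (go (sx 0) refl (sy 0) refl)
              where
              total : Bool
              total = ∑ n (λ j → ∑ n (λ i → R i j ∧ (sx i xor sx (suc i))) ∧ (sy j xor sy (suc j)))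
              stuck : ∀ (s : ℕ → Bool) → (∀ i → s i ≡ true → s (suc i) ≡ true) → s 0 ≡ true → ∀ (f : ℕ → Bool) → ∑ n (λ i → f i ∧ (s i xor s (suc i))) ≡ false
              stuck s m e f = ∑-false n λ i → trans (cong₂ (λ a b → f i ∧ (a xor b)) (all i) (all (suc i))) (∧-zeroʳ (f i))
                where
                all : ∀ i → s i ≡ true
                all zero = e
                all (suc i) = m i (all i)
              noΦ : ¬ Φ q → false ≡ ⟦ Φ q ⟧
              noΦ k = sym (⟦⟧-false k)
              row0 : (∀ j → ∑ n (λ i → R i j ∧ (sx i xor sx (suc i))) ≡ false) → total ≡ false
              row0 z = ∑-false n λ j → cong (_∧ (sy j xor sy (suc j))) (z j)
              go : ∀ a → sx 0 ≡ a → ∀ b → sy 0 ≡ b → total ≡ ⟦ Φ q ⟧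
              go true ex _ _ = trans (row0 λ j → stuck sx (s-mono (proj₁ q)) ex (λ i → R i j)) (noΦ λ p → ≺⇒≼ (<∙⇒≺ (Supp.lo₁ (sup p))) (⟦⟧-sound ex))
              go false _ true ey = trans (stuck sy (s-mono (proj₂ q)) ey _) (noΦ λ p → ≺⇒≼ (<∙⇒≺ (Supp.lo₂ (sup p))) (⟦⟧-sound ey))
              go false ex false ey = both (∑-pick n sx (λ _ → false) (s-mono (proj₁ q)) ex) (∑-pick n sy row (s-mono (proj₂ q)) ey)
                where
                row : ℕ → Bool
                row j = ∑ n (λ i → R i j ∧ (sx i xor sx (suc i)))
                both : (sx n ≡ false × ∑ n (λ i → false ∧ (sx i xor sx (suc i))) ≡ false) ⊎
                       (sx n ≡ true × ∃ λ i → sx i ≡ false × sx (suc i) ≡ true × ∀ (g : ℕ → Bool) → ∑ n (λ i → g i ∧ (sx i xor sx (suc i))) ≡ g i) →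
                       (sy n ≡ false × ∑ n (λ j → row j ∧ (sy j xor sy (suc j))) ≡ false) ⊎
                       (sy n ≡ true × ∃ λ j → sy j ≡ false × sy (suc j) ≡ true × ∀ (g : ℕ → Bool) → ∑ n (λ j → g j ∧ (sy j xor sy (suc j))) ≡ g j) → total ≡ ⟦ Φ q ⟧
                both _ (inj₁ (m , z)) = trans z (noΦ λ p → ⟦⟧-refute m (≺-≼ (∙<⇒≺ (Supp.hi₂ (sup p))) (≤⇒≼ hi≤tn)))
                both (inj₁ (m , _)) (inj₂ _) = trans (row0 λ j → dead j (∑-pick n sx (λ i → R i j) (s-mono (proj₁ q)) ex)) (noΦ λ p → ⟦⟧-refute m (≺-≼ (∙<⇒≺ (Supp.hi₁ (sup p))) (≤⇒≼ hi≤tn)))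
                  where
                  dead : ∀ j → (sx n ≡ false × row j ≡ false) ⊎ (sx n ≡ true × ∃ λ i → sx i ≡ false × sx (suc i) ≡ true × ∀ (g : ℕ → Bool) → ∑ n (λ i → g i ∧ (sx i xor sx (suc i))) ≡ g i) → row j ≡ false
                  dead j (inj₁ (_ , z)) = z
                  dead j (inj₂ (m' , _)) = ⊥-elim (not-both m' m)
                both (inj₂ (_ , i , x₀ , x₁ , f)) (inj₂ (_ , j , y₀ , y₁ , g)) = trans (g row) (trans (f (λ i → R i j)) (in-cell {i} {j} x₀ x₁ y₀ y₁))

      StarChain : ℚ → Set
      StarChain ε = ∃ λ (Z : List (T × T)) →
        (∀ {a b} → (a , b) ∈ Z → ∃ λ B → Size ε B × pos a ∈□ B × pos b ∈□ B) ×
        (∀ (F : T → Bool) → ⨁ (λ z → F (proj₁ z) xor F (proj₂ z)) Z ≡ false) ×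
        (∀ q → Far ε q → ⨁ (λ z → cr q (pos (proj₁ z)) (pos (proj₂ z))) Z ≡ ⟦ Φ q ⟧)

      -- The chain is the boundary of the union of the coloured cells, with every corner moved to an
      -- obstacle nearby. As a boundary it is closed, and it winds around exactly the points of the
      -- union.
      star : ∀ ε → 0ℚ < ε → StarChain ε
      star ε ε>0 = from (dec T)
       where
       from : Dec T → StarChain ε
       -- Without obstacles every box is free, so a nonempty region would spread beyond the square
       -- that bounds it.
       from (no ¬t) = [] , (λ ()) , (λ _ → refl) , λ q _ → sym (⟦⟧-false λ p → escape p)
        where
        escape : ∀ {q} → Φ q → ⊥
        escape {q} p = ℚₚ.<-irrefl refl (∙<⇒< (Supp.hi₁ (sup (inv {B = B} i j (λ a → ⊥-elim (¬t a)) p))))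
          where
          B : Box
          B = mkBox lo (hi + 1ℚ) lo (hi + 1ℚ)
          hi< : hi < hi + 1ℚ
          hi< = lin< (0<1/ 0) (linear 2 (λ t h → (t :+ h) :+ :0 := t :+ h) refl hi 1ℚ)
          i : q ∈□ B
          i = mk∈ (Supp.lo₁ (sup p)) (∙<-up (proj₁ q) (ℚₚ.<⇒≤ hi<) (Supp.hi₁ (sup p))) (Supp.lo₂ (sup p)) (∙<-up (proj₂ q) (ℚₚ.<⇒≤ hi<) (Supp.hi₂ (sup p)))
          lo<hi : lo < hi
          lo<hi = cut-< (proj₁ q) (Supp.lo₁ (sup p)) (Supp.hi₁ (sup p))
          j : (fromℚ hi , fromℚ hi) ∈□ B
          j = mk∈ (<⇒<∙ lo<hi) (<⇒∙< hi<) (<⇒<∙ lo<hi) (<⇒∙< hi<)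
       from (yes a₀) = go (fifth ε>0)
        where
        go : (∃ λ h → 0ℚ < h × (h + h) + ((h + h) + h) ≤ ε) → StarChain ε
        go (h , h>0 , h5≤) = Z , (λ m → let (B , s , u) = Z-close m in B , Size-mono h5≤ s , u) , Z-closed , λ q far → value q λ s → far (Size-mono h5≤ s)
          where open Lattice h h>0 a₀

-- Walks, geodesics and graph distance

module Walks (em : ExcludedMiddle (lsuc 0ℓ)) (G : Graph) where
  open Classical em
  open Graph G

  walkEdges : ∀ {u v} → Walk G u v → List E
  walkEdges done = []
  walkEdges (step (e , _) w) = e ∷ walkEdges w

  infixr 5 _·_
  _·_ : ∀ {u v w} → Walk G u v → Walk G v w → Walk G u w
  done · q = q
  step a p · q = step a (p · q)

  ·-assoc : ∀ {u v w x} (p : Walk G u v) (q : Walk G v w) (r : Walk G w x) → (p · q) · r ≡ p · (q · r)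
  ·-assoc done q r = refl
  ·-assoc (step a p) q r = cong (step a) (·-assoc p q r)

  ·-done : ∀ {u v} (p : Walk G u v) → p · done ≡ p
  ·-done done = refl
  ·-done (step a p) = cong (step a) (·-done p)

  len-· : ∀ {u v w} (p : Walk G u v) (q : Walk G v w) → len G (p · q) ≡ len G p ℕ.+ len G q
  len-· done q = refl
  len-· (step a p) q = cong suc (len-· p q)

  adj-sym : ∀ {u v} → Adjacent G u v → Adjacent G v u
  adj-sym (e , inj₁ (a , b)) = e , inj₂ (a , b)
  adj-sym (e , inj₂ (a , b)) = e , inj₁ (a , b)

  rev : ∀ {u v} → Walk G u v → Walk G v u
  rev done = done
  rev (step a p) = rev p · step (adj-sym a) done

  len-rev : ∀ {u v} (p : Walk G u v) → len G (rev p) ≡ len G p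
  len-rev done = refl
  len-rev (step a p) = trans (len-· (rev p) (step (adj-sym a) done)) (trans (cong (ℕ._+ 1) (len-rev p)) (ℕₚ.+-comm (len G p) 1))

  ⨁-· : ∀ ψ {u v w} (p : Walk G u v) (q : Walk G v w) → ⨁ ψ (walkEdges (p · q)) ≡ ⨁ ψ (walkEdges p) xor ⨁ ψ (walkEdges q)
  ⨁-· ψ done q = refl
  ⨁-· ψ (step (e , _) p) q = trans (cong (ψ e xor_) (⨁-· ψ p q)) (sym (xor-assoc (ψ e) (⨁ ψ (walkEdges p)) (⨁ ψ (walkEdges q))))

  adj-sym-edge : ∀ {u v} (a : Adjacent G u v) → proj₁ (adj-sym a) ≡ proj₁ a
  adj-sym-edge (e , inj₁ _) = refl
  adj-sym-edge (e , inj₂ _) = refl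

  ⨁-rev : ∀ ψ {u v} (p : Walk G u v) → ⨁ ψ (walkEdges (rev p)) ≡ ⨁ ψ (walkEdges p)
  ⨁-rev ψ done = refl
  ⨁-rev ψ (step a@(e , _) p) = trans (⨁-· ψ (rev p) (step (adj-sym a) done)) (trans (cong₂ (λ x f → x xor (ψ f xor false)) (⨁-rev ψ p) (adj-sym-edge a)) (trans (cong (⨁ ψ (walkEdges p) xor_) (xor-identityʳ (ψ e))) (xor-comm (⨁ ψ (walkEdges p)) (ψ e))))

  length-edges : ∀ {u v} (p : Walk G u v) → length (walkEdges p) ≡ len G p
  length-edges done = refl
  length-edges (step _ p) = cong suc (length-edges p)

  length-vertices : ∀ {u v} (p : Walk G u v) → length (vertices G p) ≡ suc (len G p)
  length-vertices done = refl
  length-vertices (step _ p) = cong suc (length-vertices p)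

  joins-δ : ∀ (g : V → Bool) {e u v} → Joins e u v → g (src e) xor g (tgt e) ≡ g u xor g v
  joins-δ g (inj₁ (refl , refl)) = refl
  joins-δ g {e} (inj₂ (refl , refl)) = xor-comm (g (src e)) (g (tgt e))

  walk-δ : ∀ (g : V → Bool) {u v} (p : Walk G u v) → ⨁ (λ e → g (src e) xor g (tgt e)) (walkEdges p) ≡ g u xor g v
  walk-δ g {u} done = sym (xor-same (g u))
  walk-δ g {u} {v} (step {v = w} (e , j) p) = trans (cong₂ _xor_ (joins-δ g j) (walk-δ g p)) (bool 3 (λ a b c → (a ⊕ b) ⊕ (b ⊕ c) ⊜ a ⊕ c) refl (g u) (g w) (g v))

  first∈ : ∀ {u v} (p : Walk G u v) → u ∈ vertices G p
  first∈ done = here refl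
  first∈ (step _ _) = here refl

  last∈ : ∀ {u v} (p : Walk G u v) → v ∈ vertices G p
  last∈ done = here refl
  last∈ (step _ p) = there (last∈ p)

  vertices-·⁻ : ∀ {u v w x} (p : Walk G u v) (q : Walk G v w) → x ∈ vertices G (p · q) → x ∈ vertices G p ⊎ x ∈ vertices G q
  vertices-·⁻ done q m = inj₂ m
  vertices-·⁻ (step _ p) q (here refl) = inj₁ (here refl)
  vertices-·⁻ (step _ p) q (there m) = [ (λ k → inj₁ (there k)) , inj₂ ]′ (vertices-·⁻ p q m)

  vertices-·ˡ : ∀ {u v w x} (p : Walk G u v) (q : Walk G v w) → x ∈ vertices G p → x ∈ vertices G (p · q)
  vertices-·ˡ done q (here refl) = first∈ q
  vertices-·ˡ (step _ p) q (here refl) = here refl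
  vertices-·ˡ (step _ p) q (there m) = there (vertices-·ˡ p q m)

  vertices-·ʳ : ∀ {u v w x} (p : Walk G u v) (q : Walk G v w) → x ∈ vertices G q → x ∈ vertices G (p · q)
  vertices-·ʳ done q m = m
  vertices-·ʳ (step _ p) q m = there (vertices-·ʳ p q m)

  vertices-rev : ∀ {u v x} (p : Walk G u v) → x ∈ vertices G (rev p) → x ∈ vertices G p
  vertices-rev done m = m
  vertices-rev (step a p) m = [ (λ k → there (vertices-rev p k)) , (λ { (here refl) → there (first∈ p) ; (there (here refl)) → here refl }) ]′ (vertices-·⁻ (rev p) (step (adj-sym a) done) m)

  vertices-rev⁺ : ∀ {u v x} (p : Walk G u v) → x ∈ vertices G p → x ∈ vertices G (rev p)
  vertices-rev⁺ done m = m
  vertices-rev⁺ (step b p) (here refl) = vertices-·ʳ (rev p) (step (adj-sym b) done) (there (here refl))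
  vertices-rev⁺ (step b p) (there m) = vertices-·ˡ (rev p) (step (adj-sym b) done) (vertices-rev⁺ p m)

  edge-ends : ∀ {u v e} (p : Walk G u v) → e ∈ walkEdges p → src e ∈ vertices G p × tgt e ∈ vertices G p
  edge-ends (step (e , inj₁ (refl , refl)) p) (here refl) = here refl , there (first∈ p)
  edge-ends (step (e , inj₂ (refl , refl)) p) (here refl) = there (first∈ p) , here refl
  edge-ends (step _ p) (there m) = let (a , b) = edge-ends p m in there a , there b

  Loop : Set
  Loop = ∃ λ v → Walk G v v

  record Split {u v} (p : Walk G u v) : Set where
    constructor split
    field
      {mid} : V
      fore  : Walk G u mid
      aft   : Walk G mid v
      glue  : p ≡ fore · aft
  open Split public

  splitAt : ∀ {u v} (p : Walk G u v) k → k ℕ.≤ len G p → Σ (Split p) λ s → len G (fore s) ≡ k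
  splitAt p zero _ = split done p refl , refl
  splitAt (step a p) (suc k) (ℕ.s≤s h) = let (split f b e , l) = splitAt p k h in split (step a f) b (cong (step a) e) , cong suc l

  splitVertex : ∀ {u v x} (p : Walk G u v) → x ∈ vertices G p → Σ (Split p) λ s → mid s ≡ x
  splitVertex done (here refl) = split done done refl , refl
  splitVertex (step a p) (here refl) = split done (step a p) refl , refl
  splitVertex (step a p) (there m) = let (split f b e , l) = splitVertex p m in split (step a f) b (cong (step a) e) , l

  shorten : ∀ n {u v} (p : Walk G u v) → len G p ℕ.≤ n → Σ (Walk G u v) (Geodesic G)
  shorten n {u} {v} p h = go (dec (∃ λ (q : Walk G u v) → len G q ℕ.< len G p)) n h
    where
    go : Dec (∃ λ (q : Walk G u v) → len G q ℕ.< len G p) → ∀ n → len G p ℕ.≤ n → Σ (Walk G u v) (Geodesic G)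
    go (no k) n _ = p , (p , refl) , λ q → ℕₚ.≮⇒≥ λ l → k (q , l)
    go (yes (q , l)) zero h = ⊥-elim (ℕₚ.n≮0 (ℕₚ.<-≤-trans l h))
    go (yes (q , l)) (suc n) h = shorten n q (ℕ.s≤s⁻¹ (ℕₚ.<-≤-trans l h))

  geodesic : ∀ {u v} → Walk G u v → Σ (Walk G u v) (Geodesic G)
  geodesic p = shorten (len G p) p ℕₚ.≤-refl

  dist′ : ∀ {u v} → Dec (Walk G u v) → ℕ
  dist′ (yes p) = len G (proj₁ (geodesic p))
  dist′ (no _) = 0

  opaque
    -- Graph distance, with the junk value 0 between different components.
    dist : V → V → ℕ
    dist u v = dist′ (dec (Walk G u v))

    dist-spec : ∀ {u v} → Walk G u v → Distance G u v (dist u v)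
    dist-spec {u} {v} p = go (dec (Walk G u v))
      where
      go : (d : Dec (Walk G u v)) → Distance G u v (dist′ d)
      go (yes q) = proj₂ (geodesic q)
      go (no n) = ⊥-elim (n p)

  dist-unique : ∀ {u v n} → Distance G u v n → dist u v ≡ n
  dist-unique ((p , refl) , h) = let ((q , e) , k) = dist-spec p in ℕₚ.≤-antisym (k p) (subst (len G p ℕ.≤_) e (h q))

  dist≤ : ∀ {u v} (p : Walk G u v) → dist u v ℕ.≤ len G p
  dist≤ p = proj₂ (dist-spec p) p

  path′ : ∀ {u v} → Walk G u v → Σ (Walk G u v) λ p → len G p ≡ dist u v
  path′ p = proj₁ (dist-spec p)

  geo-len : ∀ {u v} {p : Walk G u v} → Geodesic G p → dist u v ≡ len G p
  geo-len g = dist-unique g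

  dist-tri : ∀ {u v w} → Walk G u v → Walk G v w → dist u w ℕ.≤ dist u v ℕ.+ dist v w
  dist-tri p q = let (p' , e) = path′ p
                     (q' , f) = path′ q
                 in ℕₚ.≤-trans (dist≤ (p' · q')) (ℕₚ.≤-reflexive (trans (len-· p' q') (cong₂ ℕ._+_ e f)))

  dist-sym : ∀ {u v} → Walk G u v → dist u v ≡ dist v u
  dist-sym p = ℕₚ.≤-antisym (half (rev p)) (half p)
    where
    half : ∀ {u v} → Walk G u v → dist v u ℕ.≤ dist u v
    half p = let (q , e) = path′ p in subst (dist _ _ ℕ.≤_) (trans (len-rev q) e) (dist≤ (rev q))

  dist-self : ∀ {u} → dist u u ≡ 0
  dist-self {u} = ℕₚ.n≤0⇒n≡0 (dist≤ (done {v = u}))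

  geo-fore : ∀ {u v w} (p : Walk G u v) (q : Walk G v w) → Geodesic G (p · q) → Geodesic G p
  geo-fore p q (_ , h) = (p , refl) , λ r → ℕₚ.+-cancelʳ-≤ (len G q) _ _ (subst₂ ℕ._≤_ (len-· p q) (len-· r q) (h (r · q)))

  geo-aft : ∀ {u v w} (p : Walk G u v) (q : Walk G v w) → Geodesic G (p · q) → Geodesic G q
  geo-aft p q (_ , h) = (q , refl) , λ r → ℕₚ.+-cancelˡ-≤ (len G p) _ _ (subst₂ ℕ._≤_ (len-· p q) (len-· p r) (h (p · r)))

  geo-rev : ∀ {u v} (p : Walk G u v) → Geodesic G p → Geodesic G (rev p)
  geo-rev p (_ , h) = (rev p , refl) , λ r → subst₂ ℕ._≤_ (sym (len-rev p)) (len-rev r) (h (rev r))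

  geo-through : ∀ {u v x} (p : Walk G u v) → Geodesic G p → x ∈ vertices G p → Walk G u x × Walk G x v × dist u x ℕ.+ dist x v ≡ dist u v
  geo-through p g m with splitVertex p m
  ... | split A B refl , refl = A , B , trans (cong₂ ℕ._+_ (geo-len (geo-fore A B g)) (geo-len (geo-aft A B g))) (trans (sym (len-· A B)) (sym (geo-len g)))

  -- Filling closed walks in a hyperbolic graph by short loops

  argmax : ∀ {A : Set} (f : A → ℕ) x xs → ∃ λ m → m ∈ x ∷ xs × (∀ {y} → y ∈ x ∷ xs → f y ℕ.≤ f m)
  argmax f x [] = x , here refl , λ { (here refl) → ℕₚ.≤-refl }
  argmax f x (y ∷ ys) = let (m , i , h) = argmax f y ys in [ (λ le → m , there i , λ { (here refl) → le ; (there k) → h k }) , (λ ge → x , here refl , λ { (here refl) → ℕₚ.≤-refl ; (there k) → ℕₚ.≤-trans (h k) ge }) ]′ (ℕₚ.≤-total (f x) (f m))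

  -- A closed walk in a hyperbolic graph is not locally geodesic: at the vertex x
  -- farthest from the base point the walk would have to backtrack.
  module Dehn (δ : ℕ) (hyp : ∀ v → HyperbolicComponent G δ v) where

    -- One more than the bound `δ + δ` provided by `near`, so that a geodesic piece of length `h`
    -- contradicts it.
    h : ℕ
    h = suc (δ ℕ.+ δ)

    Shortcut : ∀ {a b} → Walk G a b → Set
    Shortcut {a} {b} w = ∃₂ λ y z → Σ (Walk G a y) λ A → Σ (Walk G y z) λ s → Σ (Walk G z b) λ B → w ≡ A · s · B × len G s ℕ.≤ h ℕ.+ h × ¬ Geodesic G s

    private
      -- As `w` is on a geodesic from `a` to `y`, and `y` is not farther from `a` than `x` is, `w`
      -- is at least as near to `y` as to `x`. So the way from `x` to `y` through `w` has length at
      -- most `δ + δ`.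
      near : ∀ {a x y w n} (r : Walk G a y) → Geodesic G r → Walk G a x → w ∈ vertices G r → Distance G x w n → n ℕ.≤ δ → dist a y ℕ.≤ dist a x → dist x y ℕ.≤ δ ℕ.+ δ
      near {a} {x} {y} {w} {n} r g ax m ((q , e) , k) nδ le =
        let (aw , wy , eq) = geo-through r g m
            xw≤ : dist x w ℕ.≤ δ
            xw≤ = ℕₚ.≤-trans (dist≤ q) (ℕₚ.≤-trans (ℕₚ.≤-reflexive e) nδ)
            wx : dist w x ≡ dist x w
            wx = dist-sym (rev q)
            step₁ : dist a w ℕ.+ dist w y ℕ.≤ dist a w ℕ.+ dist w x
            step₁ = ℕₚ.≤-trans (ℕₚ.≤-reflexive eq) (ℕₚ.≤-trans le (dist-tri aw (rev q)))
        in ℕₚ.≤-trans (dist-tri q wy) (ℕₚ.+-mono-≤ xw≤ (ℕₚ.≤-trans (ℕₚ.+-cancelˡ-≤ (dist a w) _ _ step₁) (ℕₚ.≤-trans (ℕₚ.≤-reflexive wx) xw≤)))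

    shortcut : ∀ {a} (w : Walk G a a) → h ℕ.≤ len G w → Shortcut w
    shortcut {a} w hw = dne contra
      where
      contra : ¬ ¬ Shortcut w
      contra none = go (argmax′ (vertices G w) (first∈ w))
        where
        geo : ∀ {y z} (A : Walk G a y) (s : Walk G y z) (B : Walk G z a) → w ≡ A · s · B → len G s ℕ.≤ h ℕ.+ h → Geodesic G s
        geo A s B e l = dne λ n → none (_ , _ , A , s , B , e , l , n)
        argmax′ : ∀ xs → a ∈ xs → ∃ λ m → m ∈ xs × (∀ {y} → y ∈ xs → dist a y ℕ.≤ dist a m)
        argmax′ (x ∷ xs) _ = argmax (dist a) x xs
        go : (∃ λ m → m ∈ vertices G w × (∀ {y} → y ∈ vertices G w → dist a y ℕ.≤ dist a m)) → ⊥
        go (x , m , mx) = go₁ (splitVertex w m)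
          where
          go₁ : (Σ (Split w) λ s → mid s ≡ x) → ⊥
          go₁ (split A B e , refl) = go₂ (splitAt A (len G A ℕ.∸ h) (ℕₚ.m∸n≤m (len G A) h)) (splitAt B (h ℕ.⊓ len G B) (ℕₚ.m⊓n≤n h (len G B)))
            where
            go₂ : (Σ (Split A) λ s → len G (fore s) ≡ len G A ℕ.∸ h) → (Σ (Split B) λ s → len G (fore s) ≡ h ℕ.⊓ len G B) → ⊥
            go₂ (split {y} A₁ A₂ eA , lA) (split {z} B₁ B₂ eB , lB) = go₃ (thin (A₂ · B₁) q r gs gq gr)
              where
              eq : w ≡ A₁ · (A₂ · B₁) · B₂
              eq = trans e (trans (cong₂ _·_ eA eB) (trans (·-assoc A₁ A₂ (B₁ · B₂)) (cong (A₁ ·_) (sym (·-assoc A₂ B₁ B₂)))))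
              lenA : len G A ≡ len G A₁ ℕ.+ len G A₂
              lenA = trans (cong (len G) eA) (len-· A₁ A₂)
              A₂≡ : len G A₂ ≡ len G A ℕ.∸ (len G A ℕ.∸ h)
              A₂≡ = trans (sym (ℕₚ.m+n∸m≡n (len G A₁) (len G A₂))) (cong₂ ℕ._∸_ (sym lenA) lA)
              A₂≤ : len G A₂ ℕ.≤ h
              A₂≤ = subst (ℕ._≤ h) (sym A₂≡) (ℕₚ.m≤n+o⇒m∸n≤o (len G A) (len G A ℕ.∸ h) (subst (len G A ℕ.≤_) (ℕₚ.+-comm h _) (ℕₚ.m≤n+m∸n (len G A) h)))
              s≤ : len G (A₂ · B₁) ℕ.≤ h ℕ.+ h
              s≤ = subst (ℕ._≤ h ℕ.+ h) (sym (len-· A₂ B₁)) (ℕₚ.+-mono-≤ A₂≤ (subst (ℕ._≤ h) (sym lB) (ℕₚ.m⊓n≤m h (len G B))))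
              gs : Geodesic G (A₂ · B₁)
              gs = geo A₁ (A₂ · B₁) B₂ eq s≤
              gq′ = geodesic B₂
              gr′ = geodesic A₁
              q = proj₁ gq′
              gq = proj₂ gq′
              r = proj₁ gr′
              gr = proj₂ gr′
              -- the initial piece of length h is geodesic, so x is at distance at least h
              far : h ℕ.≤ dist a x
              far = far′ (splitAt w h hw)
                where
                far′ : (Σ (Split w) λ s → len G (fore s) ≡ h) → h ℕ.≤ dist a x
                far′ (split U U' eU , lU) = ℕₚ.≤-trans (ℕₚ.≤-reflexive (trans (sym lU) (sym (geo-len (geo done U U' eU (ℕₚ.≤-trans (ℕₚ.≤-reflexive lU) (ℕₚ.m≤m+n h h)))))))
                  (mx (subst (λ k → _ ∈ vertices G k) (sym eU) (vertices-·ˡ U U' (last∈ U))))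
              y∈ : y ∈ vertices G w
              y∈ = subst (λ k → y ∈ vertices G k) (sym eq) (vertices-·ˡ A₁ ((A₂ · B₁) · B₂) (last∈ A₁))
              z∈ : z ∈ vertices G w
              z∈ = subst (λ k → z ∈ vertices G k) (sym eq) (vertices-·ʳ A₁ ((A₂ · B₁) · B₂) (vertices-·ʳ (A₂ · B₁) B₂ (first∈ B₂)))
              thin : (p : Walk G y z) (q : Walk G z a) (r : Walk G a y) → Geodesic G p → Geodesic G q → Geodesic G r → Thin G δ p q r
              thin p q r = hyp a A₁ (A₁ · A₂ · B₁) done p q r
              x∈s : x ∈ vertices G (A₂ · B₁)
              x∈s = vertices-·ʳ A₂ B₁ (first∈ B₁)
              y-case : dist x y ℕ.≤ δ ℕ.+ δ → ⊥
              y-case le = [ (λ short → startc short) , (λ long → ℕₚ.<-irrefl refl (ℕₚ.≤-trans (ℕₚ.≤-trans (ℕₚ.≤-reflexive (sym (long-eq long))) (ℕₚ.≤-reflexive (sym dxy))) le)) ]′ (ℕₚ.≤-total (len G A) h)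
                where
                dxy : dist x y ≡ len G A₂
                dxy = trans (dist-sym (rev A₂)) (geo-len (geo-fore A₂ B₁ gs))
                long-eq : h ℕ.≤ len G A → len G A₂ ≡ h
                long-eq l = trans A₂≡ (ℕₚ.m∸[m∸n]≡n l)
                -- Truncated subtraction makes `y` the base point in this case, and `far` gives the
                -- contradiction.
                startc : len G A ℕ.≤ h → ⊥
                startc l = base A₁ (trans lA (ℕₚ.m≤n⇒m∸n≡0 l)) le
                  where
                  base : ∀ {y} (A₁ : Walk G a y) → len G A₁ ≡ 0 → dist x y ℕ.≤ δ ℕ.+ δ → ⊥
                  base done _ le = ℕₚ.<-irrefl refl (ℕₚ.≤-trans far (ℕₚ.≤-trans (ℕₚ.≤-reflexive (dist-sym A)) le))
              z-case : dist x z ℕ.≤ δ ℕ.+ δ → ⊥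
              z-case le = [ (λ long → ℕₚ.<-irrefl refl (ℕₚ.≤-trans (ℕₚ.≤-reflexive (sym (trans dxz (trans lB (ℕₚ.m≤n⇒m⊓n≡m long))))) le)) , (λ short → startc short) ]′ (ℕₚ.≤-total h (len G B))
                where
                dxz : dist x z ≡ len G B₁
                dxz = geo-len (geo-aft A₂ B₁ gs)
                startc : len G B ℕ.≤ h → ⊥
                startc l = base B₂ B₂0 le
                  where
                  B₂0 : len G B₂ ≡ 0
                  B₂0 = ℕₚ.+-cancelˡ-≡ (len G B₁) _ _ (trans (trans (sym (len-· B₁ B₂)) (cong (len G) (sym eB))) (trans (sym (trans lB (ℕₚ.m≥n⇒m⊓n≡n l))) (sym (ℕₚ.+-identityʳ _))))
                  base : ∀ {z} (B₂ : Walk G z a) → len G B₂ ≡ 0 → dist x z ℕ.≤ δ ℕ.+ δ → ⊥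
                  base done _ le = ℕₚ.<-irrefl refl (ℕₚ.≤-trans far (ℕₚ.≤-trans (ℕₚ.≤-reflexive (dist-sym A)) le))
              go₃ : Thin G δ (A₂ · B₁) q r → ⊥
              go₃ (side , _ , _) = [ (λ { (v , v∈ , n , dv , nδ) → z-case (near (rev q) (geo-rev q gq) A (vertices-rev⁺ q v∈) dv nδ (mx z∈)) })
                                   , (λ { (v , v∈ , n , dv , nδ) → y-case (near r gr A v∈ dv nδ (mx y∈)) }) ]′ (side x x∈s)

    k : ℕ
    k = (h ℕ.+ h) ℕ.+ (h ℕ.+ h)

    Filling : ∀ {a} → Walk G a a → ℕ → Set
    Filling w n = ∃ λ (Ls : List Loop) → length Ls ℕ.≤ suc n × (∀ {l} → l ∈ Ls → len G (proj₂ l) ℕ.≤ k) × (∀ ψ → ⨁ ψ (walkEdges w) ≡ ⨁ (λ l → ⨁ ψ (walkEdges (proj₂ l))) Ls)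

    -- Each shortcut splits off a loop made of a piece of length at most `h + h` and a shorter
    -- geodesic, whence `k`. The rest of the walk is shorter by at least one edge, so the length of
    -- the walk bounds the number of loops.
    linearFilling : ∀ n {a} (w : Walk G a a) → len G w ℕ.≤ n → Filling w n
    linearFilling n {a} w l = cases (ℕₚ.≤-total h (len G w)) n l
      where
      trivial : len G w ℕ.≤ h → ∀ n → Filling w n
      trivial s n = (a , w) ∷ [] , ℕ.s≤s ℕ.z≤n , (λ { (here refl) → ℕₚ.≤-trans s (ℕₚ.≤-trans (ℕₚ.m≤m+n h h) (ℕₚ.m≤m+n (h ℕ.+ h) (h ℕ.+ h))) }) , λ ψ → sym (xor-identityʳ _)
      cases : h ℕ.≤ len G w ⊎ len G w ℕ.≤ h → ∀ n → len G w ℕ.≤ n → Filling w n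
      cases (inj₂ s) n l = trivial s n
      cases (inj₁ g) zero l = ⊥-elim (ℕₚ.n≮0 (ℕₚ.≤-trans g l))
      cases (inj₁ g) (suc n) l = cut (shortcut w g)
        where
        cut : Shortcut w → Filling w (suc n)
        cut (y , z , A , s , B , refl , ls , ng) =
          let (s' , gs') = geodesic s
              shorter : len G s' ℕ.< len G s
              shorter = ℕₚ.≰⇒> λ le → ng ((s , refl) , λ t → ℕₚ.≤-trans le (proj₂ gs' t))
              w' = A · s' · B
              lw : len G (A · s · B) ≡ len G A ℕ.+ (len G s ℕ.+ len G B)
              lw = trans (len-· A (s · B)) (cong (len G A ℕ.+_) (len-· s B))
              lw' : len G w' ≡ len G A ℕ.+ (len G s' ℕ.+ len G B)
              lw' = trans (len-· A (s' · B)) (cong (len G A ℕ.+_) (len-· s' B))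
              w'≤ : len G w' ℕ.≤ n
              w'≤ = ℕ.s≤s⁻¹ (ℕₚ.≤-trans (subst₂ ℕ._<_ (sym lw') (sym lw) (ℕₚ.+-monoʳ-< (len G A) (ℕₚ.+-monoˡ-< (len G B) shorter))) l)
              (Ls , c , b , e) = linearFilling n w' w'≤
              loop : Loop
              loop = y , s · rev s'
          in loop ∷ Ls , ℕ.s≤s c , (λ { (here refl) → subst (ℕ._≤ k) (sym (trans (len-· s (rev s')) (cong (len G s ℕ.+_) (len-rev s')))) (ℕₚ.+-mono-≤ ls (ℕₚ.≤-trans (ℕₚ.<⇒≤ shorter) ls)) ; (there m) → b m }) ,
             λ ψ → trans (parts ψ A s B) (trans (alg (⨁ ψ (walkEdges A)) (⨁ ψ (walkEdges s)) (⨁ ψ (walkEdges s')) (⨁ ψ (walkEdges B)))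
               (cong₂ _xor_ (sym (trans (⨁-· ψ s (rev s')) (cong (⨁ ψ (walkEdges s) xor_) (⨁-rev ψ s')))) (trans (sym (parts ψ A s' B)) (e ψ))))
          where
          parts : ∀ ψ {a b c d} (A : Walk G a b) (s : Walk G b c) (B : Walk G c d) → ⨁ ψ (walkEdges (A · s · B)) ≡ ⨁ ψ (walkEdges A) xor (⨁ ψ (walkEdges s) xor ⨁ ψ (walkEdges B))
          parts ψ A s B = trans (⨁-· ψ A (s · B)) (cong (⨁ ψ (walkEdges A) xor_) (⨁-· ψ s B))
          alg : ∀ a s t b → a xor (s xor b) ≡ (s xor t) xor (a xor (t xor b))
          alg = bool 4 (λ a s t b → a ⊕ (s ⊕ b) ⊜ (s ⊕ t) ⊕ (a ⊕ (t ⊕ b))) refl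

  -- Closed chains as sums of closed walks

  δ′ : (V → Bool) → E → Bool
  δ′ g e = g (src e) xor g (tgt e)

  private
    record Trail {x v} (w : Walk G x v) (R : List E) : Set where
      field
        loop  : Walk G v v
        rest  : List E
        closed : ∀ g → ⨁ (δ′ g) rest ≡ false
        sums  : ∀ ψ → ⨁ ψ (walkEdges w) xor ⨁ ψ R ≡ ⨁ ψ (walkEdges loop) xor ⨁ ψ rest
        count : length rest ℕ.+ len G loop ≡ length R ℕ.+ len G w
        less  : length rest ℕ.≤ length R
        loop⊂ : ∀ {e} → e ∈ walkEdges loop → e ∈ walkEdges w ⊎ e ∈ R
        rest⊂ : ∀ {e} → e ∈ rest → e ∈ R

    -- Tested with the indicator of `x`, the boundary of `R` is odd as long as `x` differs from `v`.
    -- So some edge of `R` ends at `x`, and the walk is extended backwards by it.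
    trail : ∀ n {x v} (w : Walk G x v) (R : List E) → length R ℕ.≤ n → (∀ g → ⨁ (δ′ g) R ≡ g x xor g v) → Trail w R
    trail n {x} {v} w R l bdy = go (dec (x ≡ v))
      where
      go : Dec (x ≡ v) → Trail w R
      go (yes refl) = record { loop = w ; rest = R ; closed = λ g → trans (bdy g) (xor-same (g x)) ; sums = λ _ → refl ; count = refl ; less = ℕₚ.≤-refl ; loop⊂ = inj₁ ; rest⊂ = λ m → m }
      go (no ne) = next n l (dne edge)
        where
        edge : ¬ ¬ (∃₂ λ f y → f ∈ R × Joins f y x)
        edge none = contra (trans (sym (⨁-false R zero′)) (bdy g))
          where
          g : V → Bool
          g u = ⟦ u ≡ x ⟧
          zero′ : ∀ {f} → f ∈ R → δ′ g f ≡ false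
          zero′ {f} m = cong₂ _xor_ (⟦⟧-false λ e → none (f , tgt f , m , inj₂ (e , refl))) (⟦⟧-false λ e → none (f , src f , m , inj₁ (refl , e)))
          contra : false ≡ g x xor g v → ⊥
          contra h with trans h (cong₂ _xor_ (⟦⟧-true refl) (⟦⟧-false (λ e → ne (sym e))))
          ... | ()
        next : ∀ n → length R ℕ.≤ n → (∃₂ λ f y → f ∈ R × Joins f y x) → Trail w R
        next zero l (f , y , m , _) = ⊥-elim (empty R l m)
          where
          empty : ∀ R → length R ℕ.≤ 0 → f ∈ R → ⊥
          empty (_ ∷ _) () _
        next (suc n) l (f , y , m , j) = extend (trail n (step (f , j) w) X.rest (ℕ.s≤s⁻¹ (subst (ℕ._≤ suc n) X.shrink l)) bdy′)
          where
          module X = Extract (extract m)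
          bdy′ : ∀ g → ⨁ (δ′ g) X.rest ≡ g y xor g v
          bdy′ g = trans (sym (xor-cancel (δ′ g f) (⨁ (δ′ g) X.rest))) (trans (cong₂ _xor_ (joins-δ g j) (trans (sym (X.parity (δ′ g))) (bdy g))) (bool 3 (λ a b c → (a ⊕ b) ⊕ (b ⊕ c) ⊜ a ⊕ c) refl (g y) (g x) (g v)))
          alg : ∀ a b c → a xor (b xor c) ≡ (b xor a) xor c
          alg = bool 3 (λ a b c → a ⊕ (b ⊕ c) ⊜ (b ⊕ a) ⊕ c) refl
          extend : Trail (step (f , j) w) X.rest → Trail w R
          extend T = record
            { loop = T.loop ; rest = T.rest ; closed = T.closed
            ; sums = λ ψ → trans (cong (⨁ ψ (walkEdges w) xor_) (X.parity ψ)) (trans (alg (⨁ ψ (walkEdges w)) (ψ f) (⨁ ψ X.rest)) (T.sums ψ))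
            ; count = trans T.count (trans (ℕₚ.+-suc (length X.rest) (len G w)) (cong (ℕ._+ len G w) (sym X.shrink)))
            ; less = ℕₚ.≤-trans T.less (subst (length X.rest ℕ.≤_) (sym X.shrink) (ℕₚ.n≤1+n _))
            ; loop⊂ = λ k → [ (λ { (here refl) → inj₂ m ; (there q) → inj₁ q }) , (λ q → inj₂ (X.rest⊂ q)) ]′ (T.loop⊂ k)
            ; rest⊂ = λ k → X.rest⊂ (T.rest⊂ k) }
            where module T = Trail T

  totalLen : List Loop → ℕ
  totalLen [] = 0
  totalLen ((_ , w) ∷ Ls) = len G w ℕ.+ totalLen Ls

  len≤total : ∀ {l Ls} → l ∈ Ls → len G (proj₂ l) ℕ.≤ totalLen Ls
  len≤total {Ls = (_ , w) ∷ Ls} (here refl) = ℕₚ.m≤m+n (len G w) (totalLen Ls)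
  len≤total {Ls = (_ , w) ∷ Ls} (there m) = ℕₚ.≤-trans (len≤total m) (ℕₚ.m≤n+m (totalLen Ls) (len G w))

  record Euler (R : List E) : Set where
    field
      loops  : List Loop
      sums   : ∀ ψ → ⨁ ψ R ≡ ⨁ (λ l → ⨁ ψ (walkEdges (proj₂ l))) loops
      loops⊂ : ∀ {l e} → l ∈ loops → e ∈ walkEdges (proj₂ l) → e ∈ R
      total  : totalLen loops ℕ.≤ length R
      count  : length loops ℕ.≤ length R

  euler : ∀ n (R : List E) → length R ℕ.≤ n → (∀ g → ⨁ (δ′ g) R ≡ false) → Euler R
  euler n [] _ _ = record { loops = [] ; sums = λ _ → refl ; loops⊂ = λ () ; total = ℕ.z≤n ; count = ℕ.z≤n }
  euler (suc n) (f ∷ R) (ℕ.s≤s l) cl = record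
    { loops = (src f , T.loop) ∷ U.loops
    ; sums = λ ψ → trans (trans (cong (_xor ⨁ ψ R) (sym (xor-identityʳ (ψ f)))) (T.sums ψ)) (cong (⨁ ψ (walkEdges T.loop) xor_) (U.sums ψ))
    ; loops⊂ = λ { (here refl) k → [ (λ { (here refl) → here refl }) , there ]′ (T.loop⊂ k) ; (there m) k → there (T.rest⊂ (U.loops⊂ m k)) }
    ; total = ℕₚ.≤-trans (ℕₚ.+-monoʳ-≤ (len G T.loop) U.total) (ℕₚ.≤-reflexive (trans (ℕₚ.+-comm (len G T.loop) (length T.rest)) (trans T.count (ℕₚ.+-comm (length R) 1))))
    ; count = ℕ.s≤s (ℕₚ.≤-trans U.count T.less) }
    where
    w₀ : Walk G (tgt f) (src f)
    w₀ = step (f , inj₂ (refl , refl)) done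
    module T = Trail (trail (length R) w₀ R ℕₚ.≤-refl (λ g → trans (sym (xor-≡ (cl g))) (xor-comm (g (src f)) (g (tgt f)))))
    module U = Euler (euler n T.rest (ℕₚ.≤-trans T.less l) T.closed)

  -- Balls and exits from finite sets

  module Balls (Δ : ℕ) (star : V → List E) (star-len : ∀ v → length (star v) ℕ.≤ Δ) (star-full : ∀ {e v w} → Joins e v w → e ∈ star v) where

    ends : E → List V
    ends e = src e ∷ tgt e ∷ []

    edgesAt : List V → List E
    edgesAt L = concat (map star L)

    edgesAt-len : ∀ L → length (edgesAt L) ℕ.≤ length L ℕ.* Δ
    edgesAt-len L = concat-length star Δ L (λ {v} _ → star-len v)

    edgesAt-full : ∀ {L e v w} → v ∈ L → Joins e v w → e ∈ edgesAt L
    edgesAt-full m j = ∈-concat-map star m (star-full j)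

    grow : V → List V
    grow v = v ∷ concat (map ends (star v))

    base : ℕ
    base = suc (Δ ℕ.* 2)

    grow-len : ∀ v → length (grow v) ℕ.≤ base
    grow-len v = ℕ.s≤s (ℕₚ.≤-trans (concat-length ends 2 (star v) (λ _ → ℕₚ.≤-refl)) (ℕₚ.*-monoˡ-≤ 2 (star-len v)))

    ball : ℕ → List V → List V
    ball zero L = L
    ball (suc n) L = concat (map grow (ball n L))

    ball-len : ∀ n L → length (ball n L) ℕ.≤ length L ℕ.* base ℕ.^ n
    ball-len zero L = ℕₚ.≤-reflexive (sym (ℕₚ.*-identityʳ (length L)))
    ball-len (suc n) L = ℕₚ.≤-trans (concat-length grow base (ball n L) (λ {v} _ → grow-len v)) (ℕₚ.≤-trans (ℕₚ.*-monoˡ-≤ base (ball-len n L)) (ℕₚ.≤-reflexive (trans (ℕₚ.*-assoc (length L) (base ℕ.^ n) base) (cong (length L ℕ.*_) (ℕₚ.*-comm (base ℕ.^ n) base)))))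

    ball-grow : ∀ n L {v} → v ∈ ball n L → v ∈ ball (suc n) L
    ball-grow n L m = ∈-concat-map grow m (here refl)

    ball-mono : ∀ {n m L v} → n ℕ.≤ m → v ∈ ball n L → v ∈ ball m L
    ball-mono {n} {m} {L} {v} h i = subst (λ k → v ∈ ball k L) (ℕₚ.m∸n+n≡m h) (go (m ℕ.∸ n))
      where
      go : ∀ k → v ∈ ball (k ℕ.+ n) L
      go zero = i
      go (suc k) = ball-grow (k ℕ.+ n) L (go k)

    ball-adj : ∀ n L {v w} → v ∈ ball n L → Adjacent G v w → w ∈ ball (suc n) L
    ball-adj n L m (e , j) = ∈-concat-map grow m (there (∈-concat-map ends (star-full j) (end∈ j)))
      where
      end∈ : ∀ {e v w} → Joins e v w → w ∈ ends e
      end∈ (inj₁ (_ , refl)) = there (here refl)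
      end∈ (inj₂ (refl , _)) = here refl

    ball-walk : ∀ n L {v w} → v ∈ ball n L → (p : Walk G v w) → w ∈ ball (len G p ℕ.+ n) L
    ball-walk n L m done = m
    ball-walk n L {w = w} m (step a p) = subst (λ k → w ∈ ball k L) (ℕₚ.+-suc (len G p) n) (ball-walk (suc n) L (ball-adj n L m a) p)

    ball-full : ∀ {n L v w} → v ∈ L → (p : Walk G v w) → len G p ℕ.≤ n → w ∈ ball n L
    ball-full {n} {L} m p l = ball-mono (subst (ℕ._≤ n) (sym (ℕₚ.+-identityʳ (len G p))) l) (ball-walk 0 L m p)

  unique-aft : ∀ {u v w} (p : Walk G u v) (q : Walk G v w) → Unique (vertices G (p · q)) → Unique (vertices G q)
  unique-aft done q u = u
  unique-aft (step _ p) q u = unique-aft p q (unique-tail u)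

  simplify : ∀ {u v} (p : Walk G u v) → Σ (Walk G u v) λ q → Unique (vertices G q) × (∀ {x} → x ∈ vertices G q → x ∈ vertices G p)
  simplify done = done , ([] ∷ []) , λ m → m
  simplify {u} {v} (step {v = w} a p) = go (simplify p)
    where
    Result : Set
    Result = Σ (Walk G u v) λ q → Unique (vertices G q) × (∀ {x} → x ∈ vertices G q → x ∈ u ∷ vertices G p)
    cut : ∀ {y} (q : Walk G w v) → Unique (vertices G q) → (∀ {x} → x ∈ vertices G q → x ∈ vertices G p) → (Σ (Split q) λ s → mid s ≡ y) → y ≡ u → Result
    cut q un s (split A B refl , refl) refl = B , unique-aft A B un , λ m → there (s (vertices-·ʳ A B m))
    go : (Σ (Walk G w v) λ q → Unique (vertices G q) × (∀ {x} → x ∈ vertices G q → x ∈ vertices G p)) → Result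
    go (q , un , s) = pick (dec (u ∈ vertices G q))
      where
      pick : Dec (u ∈ vertices G q) → Result
      pick (yes m) = cut q un s (splitVertex q m) refl
      pick (no n) = step a q , unique-cons n un , λ { (here refl) → here refl ; (there m) → there (s m) }

  record Exit (H : List V) {u v} (p : Walk G u v) : Set where
    field
      {last next} : V
      within : Walk G u last
      leave  : Adjacent G last next
      onward : Walk G next v
      inside : ∀ {x} → x ∈ vertices G within → x ∈ H
      out    : next ∉ H
      shorter : len G onward ℕ.≤ len G p

  exit : ∀ H {u v} (p : Walk G u v) → u ∈ H → v ∉ H → Exit H p
  exit H done i o = ⊥-elim (o i)
  exit H {u} (step {v = w} a p) i o = go (dec (w ∈ H))
    where
    go : Dec (w ∈ H) → Exit H (step a p)
    go (no n) = record { within = done ; leave = a ; onward = p ; inside = λ { (here refl) → i } ; out = n ; shorter = ℕₚ.n≤1+n _ }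
    go (yes m) = let module X = Exit (exit H p m o) in record { within = step a X.within ; leave = X.leave ; onward = X.onward
      ; inside = λ { (here refl) → i ; (there k) → X.inside k } ; out = X.out ; shorter = ℕₚ.≤-trans X.shorter (ℕₚ.n≤1+n _) }

  -- Before it leaves `H` the walk can be made simple, and a simple walk within `H` has at most
  -- `length H` vertices.
  quickExit : ∀ H {u v} (p : Walk G u v) → u ∈ H → v ∉ H → ∃₂ λ y z → y ∈ H × z ∉ H × Adjacent G y z × Σ (Walk G u z) λ q → len G q ℕ.≤ length H
  quickExit H p i o =
    let module X = Exit (exit H p i o)
        (A , un , s) = simplify X.within
    in X.last , X.next , X.inside (last∈ X.within) , X.out , X.leave , A · step X.leave done ,
       ℕₚ.≤-trans (ℕₚ.≤-reflexive (trans (len-· A (step X.leave done)) (trans (ℕₚ.+-comm (len G A) 1) (sym (length-vertices A))))) (pigeonhole un (λ m → X.inside (s m)))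

  grid : ∀ {A : Set} n m (I : List A) (key : A → ℕ × ℕ) → (∀ i j → i ℕ.< n → j ℕ.< m → ∃ λ x → x ∈ I × key x ≡ (i , j)) → n ℕ.* m ℕ.≤ length I
  grid n m I key h = ℕₚ.≤-trans (ℕₚ.≤-reflexive (sym (trans (area (upTo n) (upTo m)) (cong₂ ℕ._*_ (length-upTo n) (length-upTo m)))))
    (ℕₚ.≤-trans (pigeonhole (cartesianProduct⁺ (upTo⁺ n) (upTo⁺ m)) (λ {ij} m → found ij m)) (ℕₚ.≤-reflexive (length-map key I)))
    where
    area : ∀ {A B : Set} (xs : List A) (ys : List B) → length (cartesianProduct xs ys) ≡ length xs ℕ.* length ys
    area [] ys = refl
    area (x ∷ xs) ys = trans (length-++ (map (x ,_) ys)) (cong₂ ℕ._+_ (length-map (x ,_) ys) (area xs ys))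
    found : ∀ ij → ij ∈ cartesianProduct (upTo n) (upTo m) → ij ∈ map key I
    found (i , j) k = let (a , b) = ∈-cartesianProduct⁻ (upTo n) (upTo m) k
                          (x , x∈ , e) = h i j (∈-upTo⁻ a) (∈-upTo⁻ b)
                      in subst (_∈ map key I) e (∈-map⁺ key x∈)

  -- The vertex at position j, or the last one if there is none.
  at : ∀ {u v} → Walk G u v → ℕ → V
  at {u} done j = u
  at {u} (step a p) zero = u
  at (step a p) (suc j) = at p j

  at-split : ∀ {u v} (p : Walk G u v) {j} → j ℕ.≤ len G p → Σ (Walk G u (at p j)) λ F → Σ (Walk G (at p j) v) λ B → len G F ≡ j × p ≡ F · B
  at-split done {zero} h = done , done , refl , refl
  at-split (step a p) {zero} h = done , step a p , refl , refl
  at-split (step a p) {suc j} (ℕ.s≤s h) = let (F , B , e , f) = at-split p h in step a F , B , cong suc e , cong (step a) f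

  at-index : ∀ {u v y} (p : Walk G u v) → y ∈ vertices G p → ∃ λ j → j ℕ.≤ len G p × y ≡ at p j
  at-index done (here refl) = 0 , ℕ.z≤n , refl
  at-index (step a p) (here refl) = 0 , ℕ.z≤n , refl
  at-index (step a p) (there m) = let (j , l , e) = at-index p m in suc j , ℕ.s≤s l , e

  at-dist : ∀ {u v} {p : Walk G u v} → Geodesic G p → ∀ {j} → j ℕ.≤ len G p → dist u (at p j) ≡ j
  at-dist {p = p} g {j} h = let (F , B , e , f) = at-split p h in trans (geo-len (geo-fore F B (subst (Geodesic G) f g))) e

  walk-between : ∀ {u v x y} (p : Walk G u v) → x ∈ vertices G p → y ∈ vertices G p → Σ (Walk G x y) λ q → len G q ℕ.≤ len G p × (∀ {w} → w ∈ vertices G q → w ∈ vertices G p) × (Geodesic G p → Geodesic G q)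
  walk-between {u} {v} {x} {y} p m n = go (splitVertex p m)
    where
    Result : Set
    Result = Σ (Walk G x y) λ q → len G q ℕ.≤ len G p × (∀ {w} → w ∈ vertices G q → w ∈ vertices G p) × (Geodesic G p → Geodesic G q)
    go : (Σ (Split p) λ s → mid s ≡ x) → Result
    go (split A B refl , refl) = [ before , after ]′ (vertices-·⁻ A B n)
      where
      before : y ∈ vertices G A → Result
      before k = part (splitVertex A k)
        where
        part : (Σ (Split A) λ s → mid s ≡ y) → Result
        part (split A₁ A₂ refl , refl) = rev A₂ , ℕₚ.≤-trans (ℕₚ.≤-reflexive (len-rev A₂)) (ℕₚ.≤-trans (ℕₚ.m≤n+m (len G A₂) (len G A₁)) (ℕₚ.≤-trans (ℕₚ.≤-reflexive (sym (len-· A₁ A₂))) (ℕₚ.≤-trans (ℕₚ.m≤m+n (len G (A₁ · A₂)) (len G B)) (ℕₚ.≤-reflexive (sym (len-· (A₁ · A₂) B)))))) ,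
          (λ w → vertices-·ˡ (A₁ · A₂) B (vertices-·ʳ A₁ A₂ (vertices-rev A₂ w))) , λ g → geo-rev A₂ (geo-aft A₁ A₂ (geo-fore (A₁ · A₂) B g))
      after : y ∈ vertices G B → Result
      after k = part (splitVertex B k)
        where
        part : (Σ (Split B) λ s → mid s ≡ y) → Result
        part (split B₁ B₂ refl , refl) = B₁ , ℕₚ.≤-trans (ℕₚ.m≤m+n (len G B₁) (len G B₂)) (ℕₚ.≤-trans (ℕₚ.≤-reflexive (sym (len-· B₁ B₂))) (ℕₚ.≤-trans (ℕₚ.m≤n+m (len G (B₁ · B₂)) (len G A)) (ℕₚ.≤-reflexive (sym (len-· A (B₁ · B₂)))))) ,
          (λ w → vertices-·ʳ A (B₁ · B₂) (vertices-·ˡ B₁ B₂ w)) , λ g → geo-fore B₁ B₂ (geo-aft A (B₁ · B₂) g)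

  -- Thin triangles from linear fillings

  module Cuts (u : V) (k : ℕ) (o : V) (t : ℕ) where

    -- The walk is required because `dist` is 0 between different components.
    In : V → Set
    In v = Walk G u v × dist u v ℕ.≤ k

    Cut : E → V → V → Set
    Cut e v w = Joins e v w × In v × ¬ In w

    -- The threshold `t` divides the coboundary of the ball into two parts, and this is the part
    -- near `o`. The inner end of an edge of the coboundary is determined by the edge, so `cut-at`
    -- can evaluate it.
    cut : E → Bool
    cut e = ⟦ (∃₂ λ v w → Cut e v w × dist v o ℕ.< t) ⟧

    cut-at : ∀ {e v w} → Cut e v w → cut e ≡ ⟦ dist v o ℕ.< t ⟧
    cut-at {e} {v} {w} (j , i , n) = ⟦⟧-cong (λ { (v' , w' , (j' , i' , n') , lt) → subst (λ z → dist z o ℕ.< t) (end-≡ j j' i') lt }) (λ lt → v , w , (j , i , n) , lt)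
      where
      end-≡ : ∀ {v' w'} → Joins e v w → Joins e v' w' → In v' → v' ≡ v
      end-≡ (inj₁ (a , b)) (inj₁ (a' , b')) _ = trans (sym a') a
      end-≡ (inj₁ (a , b)) (inj₂ (a' , b')) i' = ⊥-elim (n (subst In (trans (sym b') b) i'))
      end-≡ (inj₂ (a , b)) (inj₁ (a' , b')) i' = ⊥-elim (n (subst In (trans (sym a') a) i'))
      end-≡ (inj₂ (a , b)) (inj₂ (a' , b')) _ = trans (sym b') b

    cut-none : ∀ {e v w} → Joins e v w → (In v → In w) → (In w → In v) → cut e ≡ false
    cut-none {e} {v} {w} j f g = ⟦⟧-false λ { (v' , w' , (j' , i' , n') , _) → clash j j' i' n' }
      where
      clash : ∀ {v' w'} → Joins e v w → Joins e v' w' → In v' → ¬ In w' → ⊥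
      clash (inj₁ (refl , refl)) (inj₁ (refl , refl)) i n = n (f i)
      clash (inj₁ (refl , refl)) (inj₂ (refl , refl)) i n = n (g i)
      clash (inj₂ (refl , refl)) (inj₁ (refl , refl)) i n = n (g i)
      clash (inj₂ (refl , refl)) (inj₂ (refl , refl)) i n = n (f i)

    cut-level : ∀ {e v w} → Cut e v w → dist u v ≡ k
    cut-level {e} (j , (p , l) , n) = ℕₚ.≤-antisym l (ℕₚ.≮⇒≥ λ lt → n (p · step (e , j) done ,
      ℕₚ.≤-trans (dist-tri p (step (e , j) done)) (ℕₚ.≤-trans (ℕₚ.+-monoʳ-≤ (dist u _) (dist≤ (step (e , j) done))) (subst (ℕ._≤ k) (ℕₚ.+-comm 1 _) lt))))

    -- Each step increases the distance from `u` by one. So the walk leaves the ball at most once,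
    -- and at a known vertex.
    Radial : ∀ {x z} → ℕ → Walk G x z → Set
    Radial {x} i done = Walk G u x × dist u x ≡ i
    Radial {x} i (step a p) = (Walk G u x × dist u x ≡ i) × Radial (suc i) p

    radial-first : ∀ {x z} i (p : Walk G x z) → Radial i p → Walk G u x × dist u x ≡ i
    radial-first i done r = r
    radial-first i (step a p) r = proj₁ r

    radial : ∀ {x z} (A : Walk G u x) (p : Walk G x z) → Geodesic G (A · p) → Radial (len G A) p
    radial A done g = A , geo-len (geo-fore A done g)
    radial A (step a p) g = (A , geo-len (geo-fore A (step a p) g)) ,
      subst (λ i → Radial i p) (trans (len-· A (step a done)) (ℕₚ.+-comm (len G A) 1)) (radial (A · step a done) p (subst (Geodesic G) (sym (·-assoc A (step a done) p)) g))

    outside : ∀ {x z} i (p : Walk G x z) → Radial i p → k ℕ.< i → ⨁ cut (walkEdges p) ≡ false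
    outside i done r lt = refl
    outside i (step (e , j) p) ((_ , d) , r) lt = cong₂ _xor_
      (cut-none j (λ { (_ , l) → ⊥-elim (ℕₚ.<⇒≱ lt (subst (ℕ._≤ k) d l)) }) (λ { (_ , l) → ⊥-elim (ℕₚ.<⇒≱ (ℕₚ.m<n⇒m<1+n lt) (subst (ℕ._≤ k) (proj₂ (radial-first (suc i) p r)) l)) }))
      (outside (suc i) p r (ℕₚ.m<n⇒m<1+n lt))

    crossing : ∀ {x z} i (p : Walk G x z) → Radial i p → ∀ j → i ℕ.+ j ≡ k → j ℕ.< len G p → ⨁ cut (walkEdges p) ≡ ⟦ dist (at p j) o ℕ.< t ⟧
    crossing i (step (e , a) p) ((q , d) , r) zero eq lt = trans (cong₂ _xor_
        (cut-at (a , (q , ℕₚ.≤-reflexive (trans d i≡k)) , λ { (_ , l) → ℕₚ.<⇒≱ k<si (subst (ℕ._≤ k) (proj₂ (radial-first (suc i) p r)) l) })) (outside (suc i) p r k<si)) (xor-identityʳ _)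
      where
      i≡k : i ≡ k
      i≡k = trans (sym (ℕₚ.+-identityʳ i)) eq
      k<si : k ℕ.< suc i
      k<si = subst (ℕ._< suc i) i≡k ℕₚ.≤-refl
    crossing i (step (e , a) p) ((q , d) , r) (suc j) eq (ℕ.s≤s lt) = trans (cong (_xor ⨁ cut (walkEdges p))
        (cut-none a (λ _ → proj₁ f , ℕₚ.≤-trans (ℕₚ.≤-reflexive (proj₂ f)) si≤k) (λ _ → q , ℕₚ.≤-trans (ℕₚ.≤-reflexive d) (ℕₚ.≤-trans (ℕₚ.n≤1+n i) si≤k))))
        (crossing (suc i) p r j (trans (sym (ℕₚ.+-suc i j)) eq) lt)
      where
      f = radial-first (suc i) p r
      si≤k : suc i ℕ.≤ k
      si≤k = ℕₚ.≤-trans (ℕₚ.m≤m+n (suc i) j) (ℕₚ.≤-reflexive (trans (sym (ℕₚ.+-suc i j)) eq))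

    far : ∀ {x z} (p : Walk G x z) → (∀ {y} → y ∈ vertices G p → k ℕ.< dist u y) → ⨁ cut (walkEdges p) ≡ false
    far done h = refl
    far (step (e , j) p) h = cong₂ _xor_ (cut-none j (λ { (_ , l) → ⊥-elim (ℕₚ.<⇒≱ (h (here refl)) l) }) (λ { (_ , l) → ⊥-elim (ℕₚ.<⇒≱ (h (there (first∈ p))) l) })) (far p (λ m → h (there m)))

    -- A loop leaves and enters the ball equally often, so it also has an edge of
    -- the other kind.
    odd-loop : Walk G u o → ∀ {a} (l : Walk G a a) → ⨁ cut (walkEdges l) ≡ true → ∃ λ y → Walk G u y × dist u y ≡ k × dist y o ℕ.< t × t ℕ.≤ len G l ℕ.+ dist y o × ∃ λ e → e ∈ walkEdges l × (y ≡ src e ⊎ y ≡ tgt e)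
    odd-loop uo {a} l odd = go (⨁-true (walkEdges l) odd) (⨁-true (walkEdges l) other)
      where
      f : V → Bool
      f v = ⟦ In v ⟧
      other : ⨁ (λ e → (f (src e) xor f (tgt e)) xor cut e) (walkEdges l) ≡ true
      other = trans (⨁-xor (λ e → f (src e) xor f (tgt e)) cut (walkEdges l)) (cong₂ _xor_ (trans (walk-δ f l) (xor-same (f a))) odd)
      joins-end : ∀ {e v w} → Joins e v w → v ≡ src e ⊎ v ≡ tgt e
      joins-end (inj₁ (p , _)) = inj₁ (sym p)
      joins-end (inj₂ (_ , q)) = inj₂ (sym q)
      end∈ : ∀ {e v} → e ∈ walkEdges l → v ≡ src e ⊎ v ≡ tgt e → v ∈ vertices G l
      end∈ m (inj₁ refl) = proj₁ (edge-ends l m)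
      end∈ m (inj₂ refl) = proj₂ (edge-ends l m)
      go : (∃ λ e → e ∈ walkEdges l × cut e ≡ true) → (∃ λ e → e ∈ walkEdges l × (f (src e) xor f (tgt e)) xor cut e ≡ true) →
        ∃ λ y → Walk G u y × dist u y ≡ k × dist y o ℕ.< t × t ℕ.≤ len G l ℕ.+ dist y o × ∃ λ e → e ∈ walkEdges l × (y ≡ src e ⊎ y ≡ tgt e)
      go (e₁ , m₁ , c₁) (e₂ , m₂ , c₂) = found (⟦⟧-sound c₁) second
        where
        Second : Set
        Second = ∃₂ λ v w → Cut e₂ v w × ¬ (dist v o ℕ.< t)
        ends-In : Dec (In (src e₂)) → Dec (In (tgt e₂)) → Second
        ends-In (yes i) (no n) = src e₂ , tgt e₂ , (inj₁ (refl , refl) , i , n) , λ lt → not-both c₂ (cong₂ _xor_ (cong₂ _xor_ (⟦⟧-true i) (⟦⟧-false n)) (trans (cut-at (inj₁ (refl , refl) , i , n)) (⟦⟧-true lt)))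
        ends-In (no n) (yes i) = tgt e₂ , src e₂ , (inj₂ (refl , refl) , i , n) , λ lt → not-both c₂ (cong₂ _xor_ (cong₂ _xor_ (⟦⟧-false n) (⟦⟧-true i)) (trans (cut-at (inj₂ (refl , refl) , i , n)) (⟦⟧-true lt)))
        ends-In (yes i) (yes i') = ⊥-elim (not-both c₂ (cong₂ _xor_ (cong₂ _xor_ (⟦⟧-true i) (⟦⟧-true i')) (cut-none (inj₁ (refl , refl)) (λ _ → i') (λ _ → i))))
        ends-In (no n) (no n') = ⊥-elim (not-both c₂ (cong₂ _xor_ (cong₂ _xor_ (⟦⟧-false n) (⟦⟧-false n')) (cut-none (inj₁ (refl , refl)) (λ i → ⊥-elim (n i)) (λ i → ⊥-elim (n' i)))))
        second : Second
        second = ends-In (dec (In (src e₂))) (dec (In (tgt e₂)))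
        found : (∃₂ λ v w → Cut e₁ v w × dist v o ℕ.< t) → Second → ∃ λ y → Walk G u y × dist u y ≡ k × dist y o ℕ.< t × t ℕ.≤ len G l ℕ.+ dist y o × ∃ λ e → e ∈ walkEdges l × (y ≡ src e ⊎ y ≡ tgt e)
        found (v , w , c@(j , (uv , _) , _) , lt) (v' , w' , (j' , _ , _) , ge) =
          let (q , ql , _) = walk-between l (end∈ m₂ (joins-end j')) (end∈ m₁ (joins-end j))
          in v , uv , cut-level c , lt , ℕₚ.≤-trans (ℕₚ.≮⇒≥ ge) (ℕₚ.≤-trans (dist-tri q (rev uv · uo)) (ℕₚ.+-monoˡ-≤ (dist v o) (ℕₚ.≤-trans (dist≤ q) ql))) , e₁ , m₁ , joins-end j

  -- All that the argument for thin triangles uses of the plane. In the application, `new` consists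
  -- of the vertices inside the closed walk, and the loops come from the boundaries of the faces
  -- inside.
  record Filled (D c : ℕ) {a} (w : Walk G a a) : Set where
    field
      new    : List V
      few    : length new ℕ.≤ c ℕ.* len G w
      loops  : List Loop
      short  : ∀ {l} → l ∈ loops → len G (proj₂ l) ℕ.≤ D
      within : ∀ {l e v} → l ∈ loops → e ∈ walkEdges (proj₂ l) → v ≡ src e ⊎ v ≡ tgt e → v ∈ vertices G w ⊎ v ∈ new
      sums   : ∀ ψ → ⨁ ψ (walkEdges w) ≡ ⨁ (λ l → ⨁ ψ (walkEdges (proj₂ l))) loops

  module Bypass (D′ c : ℕ) (filling : ∀ {a} (w : Walk G a a) → Filled (suc D′) c w)
    {a b u} (A : Walk G a u) (B : Walk G u b) (Q : Walk G b a) (geo : Geodesic G (A · B)) (R : ℕ) (avoids : ∀ {y} → y ∈ vertices G Q → R ℕ.≤ dist u y) where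
    private
      D = suc D′
      C = (A · B) · Q
      module F = Filled (filling C)
      gA : Geodesic G (rev A)
      gA = geo-rev A (geo-fore A B geo)
      gB : Geodesic G B
      gB = geo-aft A B geo
      R≤B : R ℕ.≤ len G B
      R≤B = ℕₚ.≤-trans (avoids (first∈ Q)) (ℕₚ.≤-reflexive (geo-len gB))
      R≤A : R ℕ.≤ len G (rev A)
      R≤A = ℕₚ.≤-trans (avoids (last∈ Q)) (ℕₚ.≤-reflexive (geo-len gA))
      back : ℕ → V
      back k = at (rev A) k

      module _ {k} (k<R : k ℕ.< R) where
        splitA = at-split (rev A) (ℕₚ.<⇒≤ (ℕₚ.≤-trans k<R R≤A))
        splitB = at-split B (ℕₚ.<⇒≤ (ℕₚ.≤-trans k<R R≤B))
        -- A shorter connection between the two vertices would shorten the geodesic `A · B`.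
        opposite : k ℕ.+ k ℕ.≤ dist (at B k) (back k)
        opposite = from splitA splitB
          where
          from : (Σ (Walk G u (back k)) λ F → Σ (Walk G (back k) a) λ B′ → len G F ≡ k × rev A ≡ F · B′) → (Σ (Walk G u (at B k)) λ F → Σ (Walk G (at B k) b) λ B′ → len G F ≡ k × B ≡ F · B′) → k ℕ.+ k ℕ.≤ dist (at B k) (back k)
          from (F₁ , B₁ , l₁ , e₁) (F₂ , B₂ , l₂ , e₂) =
            let (s , sl) = path′ (rev F₂ · F₁)
                short : len G A ℕ.+ len G B ℕ.≤ len G B₁ ℕ.+ (len G s ℕ.+ len G B₂)
                short = subst₂ ℕ._≤_ (len-· A B) (trans (len-· (rev B₁) (rev s · B₂)) (cong₂ ℕ._+_ (len-rev B₁) (trans (len-· (rev s) B₂) (cong (ℕ._+ len G B₂) (len-rev s))))) (proj₂ geo (rev B₁ · rev s · B₂))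
                lA : len G A ≡ k ℕ.+ len G B₁
                lA = trans (sym (len-rev A)) (trans (cong (len G) e₁) (trans (len-· F₁ B₁) (cong (ℕ._+ len G B₁) l₁)))
                lB : len G B ≡ k ℕ.+ len G B₂
                lB = trans (cong (len G) e₂) (trans (len-· F₂ B₂) (cong (ℕ._+ len G B₂) l₂))
            in ℕₚ.≤-trans (ℕₚ.+-cancelʳ-≤ (len G B₁ ℕ.+ len G B₂) _ _ (subst₂ ℕ._≤_ (trans (cong₂ ℕ._+_ lA lB) (ringℕ 3 (λ k x y → (k ⊹ x) ⊹ (k ⊹ y) ≐ (k ⊹ k) ⊹ (x ⊹ y)) refl k (len G B₁) (len G B₂)))
                 (ringℕ 3 (λ s x y → x ⊹ (s ⊹ y) ≐ s ⊹ (x ⊹ y)) refl (len G s) (len G B₁) (len G B₂)) short)) (ℕₚ.≤-reflexive sl)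

        -- The thresholds start at `2 D`. Going around a loop costs up to `D`, and the remaining
        -- lower bound, at least `D` and thus positive, keeps the vertex found away from `back k`.
        module _ (j : ℕ) (fits : suc (suc j) ℕ.* D ℕ.≤ k ℕ.+ k) where
          t = suc (suc j) ℕ.* D
          open Cuts u k (back k) t
          parity : ⨁ cut (walkEdges C) ≡ true
          parity = trans (⨁-· cut (A · B) Q) (cong₂ _xor_ (trans (⨁-· cut A B) (cong₂ _xor_ pA pB)) (far Q (λ m → ℕₚ.≤-trans k<R (avoids m))))
            where
            pA : ⨁ cut (walkEdges A) ≡ true
            pA = trans (sym (⨁-rev cut A)) (trans (crossing 0 (rev A) (radial done (rev A) gA) k refl (ℕₚ.≤-trans k<R R≤A)) (⟦⟧-true (subst (ℕ._< t) (sym dist-self) (ℕ.s≤s ℕ.z≤n))))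
            pB : ⨁ cut (walkEdges B) ≡ false
            pB = trans (crossing 0 B (radial done B gB) k refl (ℕₚ.≤-trans k<R R≤B)) (⟦⟧-false (ℕₚ.≤⇒≯ (ℕₚ.≤-trans fits opposite)))
          -- The closed walk `C` is odd for the cut: `A` leaves the ball at `back k` itself, `B`
          -- leaves it beyond the threshold, and `Q` avoids it. So some short loop is odd. The
          -- vertex of the loop given by `odd-loop` is not on `A`, since it is not `back k`; not on
          -- `B`, since it is below the threshold; and not on `Q`, since `k` is less than `R`.
          vertexAt : ∃ λ y → y ∈ F.new × dist u y ≡ k × dist y (back k) ℕ.< t × suc j ℕ.* D ℕ.≤ dist y (back k)
          vertexAt = from (⨁-true F.loops (trans (sym (F.sums cut)) parity))
            where
            from : (∃ λ l → l ∈ F.loops × ⨁ cut (walkEdges (proj₂ l)) ≡ true) → ∃ λ y → y ∈ F.new × dist u y ≡ k × dist y (back k) ℕ.< t × suc j ℕ.* D ℕ.≤ dist y (back k)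
            from (l , l∈ , odd) = from₂ (odd-loop (proj₁ splitA) (proj₂ l) odd)
              where
              from₂ : (∃ λ y → Walk G u y × dist u y ≡ k × dist y (back k) ℕ.< t × t ℕ.≤ len G (proj₂ l) ℕ.+ dist y (back k) × ∃ λ e → e ∈ walkEdges (proj₂ l) × (y ≡ src e ⊎ y ≡ tgt e)) →
                ∃ λ y → y ∈ F.new × dist u y ≡ k × dist y (back k) ℕ.< t × suc j ℕ.* D ℕ.≤ dist y (back k)
              from₂ (y , uy , dy , lt , ge , e , e∈ , ye) = y , [ (λ m → ⊥-elim (onC m)) , (λ m → m) ]′ (F.within l∈ e∈ ye) , dy , lt , ge′
                where
                ge′ : suc j ℕ.* D ℕ.≤ dist y (back k)
                ge′ = ℕₚ.+-cancelˡ-≤ D _ _ (ℕₚ.≤-trans ge (ℕₚ.+-monoˡ-≤ (dist y (back k)) (F.short l∈)))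
                onA : y ∈ vertices G (rev A) → ⊥
                onA m = let (i , il , e) = at-index (rev A) m
                            i≡k = trans (sym (at-dist gA il)) (trans (cong (dist u) (sym e)) dy)
                            y≡ : y ≡ back k
                            y≡ = trans e (cong (at (rev A)) i≡k)
                        in ℕₚ.n≮0 (subst (D′ ℕ.<_) dist-self (ℕₚ.≤-trans (ℕₚ.m≤m+n D (j ℕ.* D)) (subst (λ z → suc j ℕ.* D ℕ.≤ dist z (back k)) y≡ ge′)))
                onB : y ∈ vertices G B → ⊥
                onB m = let (i , il , e) = at-index B m
                            i≡k = trans (sym (at-dist gB il)) (trans (cong (dist u) (sym e)) dy)
                        in ℕₚ.<⇒≱ (subst (λ z → dist z (back k) ℕ.< t) (trans e (cong (at B) i≡k)) lt) (ℕₚ.≤-trans fits opposite)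
                onC : y ∈ vertices G C → ⊥
                onC m = [ (λ m → [ (λ m → onA (vertices-rev⁺ A m)) , onB ]′ (vertices-·⁻ A B m)) , (λ m → ℕₚ.<⇒≱ k<R (ℕₚ.≤-trans (avoids m) (ℕₚ.≤-reflexive dy))) ]′ (vertices-·⁻ (A · B) Q m)

    -- By parity, the cut at distance k₀ + i with threshold (j + 2) D meets a short
    -- loop in a new vertex, which occupies the cell (i , j) of a grid.
    core : ∀ J k₀ n → suc J ℕ.* D ℕ.≤ k₀ ℕ.+ k₀ → k₀ ℕ.+ n ℕ.≤ R → n ℕ.* J ℕ.≤ c ℕ.* len G C
    core J k₀ n big le = ℕₚ.≤-trans (grid n J F.new key cell) F.few
      where
      key : V → ℕ × ℕ
      key y = dist u y ℕ.∸ k₀ , (dist y (back (dist u y)) ℕ./ D) ℕ.∸ 1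
      cell : ∀ i j → i ℕ.< n → j ℕ.< J → ∃ λ x → x ∈ F.new × key x ≡ (i , j)
      cell i j i<n j<J = from (vertexAt (ℕₚ.≤-trans (ℕₚ.+-monoʳ-< k₀ i<n) le) j fits)
        where
        k = k₀ ℕ.+ i
        fits : suc (suc j) ℕ.* D ℕ.≤ k ℕ.+ k
        fits = ℕₚ.≤-trans (ℕₚ.*-monoˡ-≤ D (ℕ.s≤s j<J)) (ℕₚ.≤-trans big (ℕₚ.+-mono-≤ (ℕₚ.m≤m+n k₀ i) (ℕₚ.m≤m+n k₀ i)))
        from : (∃ λ y → y ∈ F.new × dist u y ≡ k × dist y (back k) ℕ.< suc (suc j) ℕ.* D × suc j ℕ.* D ℕ.≤ dist y (back k)) → ∃ λ x → x ∈ F.new × key x ≡ (i , j)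
        from (y , m , dy , lt , ge) = y , m , cong₂ _,_ (trans (cong (ℕ._∸ k₀) dy) (ℕₚ.m+n∸m≡n k₀ i)) (trans (cong (λ q → (dist y (back q) ℕ./ D) ℕ.∸ 1) dy) (cong (ℕ._∸ 1) quotient))
          where
          quotient : dist y (back k) ℕ./ D ≡ suc j
          quotient = ℕₚ.≤-antisym (ℕ.s≤s⁻¹ (m<n*o⇒m/o<n {n = suc (suc j)} lt)) (ℕₚ.≤-trans (ℕₚ.≤-reflexive (sym (m*n/n≡m (suc j) D))) (/-monoˡ-≤ D ge))

  module Polygon (D′ c : ℕ) (filling : ∀ {a} (w : Walk G a a) → Filled (suc D′) c w) where

    -- For a closed walk of length at most `40 R`, `Bypass.core` gives `d * J ≤ c * 40 * R` with
    -- `d = R - k₀`. As `R` exceeds `k₀ + k₀`, it is at most `2 d`, so `c * 80` is the critical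
    -- value for `J`. The longest closed walk built below has length `34 R`, which 40 rounds up.
    J k₀ R₀ : ℕ
    J = suc (c ℕ.* 80)
    k₀ = suc J ℕ.* suc D′
    R₀ = k₀ ℕ.+ k₀

    -- A longest excursion of a side of a triangle: the vertex u of the first side p is at
    -- distance at least R from the other sides, and every excursion is at most R.
    module Excursion (R : ℕ) (large : R₀ ℕ.< R) {x y z u} (Px : Walk G x u) (Py : Walk G u y) (q : Walk G y z) (r : Walk G z x)
      (gp : Geodesic G (Px · Py)) (gq : Geodesic G q) (gr : Geodesic G r) where

      -- Lengths are counted in units of `R`, so the lengths of composed routes add up as numerals.
      Short : V → V → ℕ → Set
      Short s e n = Σ (Walk G s e) λ w → len G w ℕ.≤ n ℕ.* R

      Far : V → Set
      Far v = R ℕ.≤ dist u v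

      Route : V → V → ℕ → Set
      Route s e n = Σ (Walk G s e) λ w → len G w ℕ.≤ n ℕ.* R × (∀ {v} → v ∈ vertices G w → Far v)

      infixl 5 _▹_ _▸_
      _▹_ : ∀ {s e f m n} → Short s e m → Short e f n → Short s f (m ℕ.+ n)
      _▹_ {m = m} {n} (v , vl) (w , wl) = v · w , ℕₚ.≤-trans (ℕₚ.≤-reflexive (len-· v w)) (ℕₚ.≤-trans (ℕₚ.+-mono-≤ vl wl) (ℕₚ.≤-reflexive (sym (ℕₚ.*-distribʳ-+ R m n))))

      back : ∀ {s e n} → Short s e n → Short e s n
      back (w , l) = rev w , ℕₚ.≤-trans (ℕₚ.≤-reflexive (len-rev w)) l

      _▸_ : ∀ {s e f m n} → Route s e m → Route e f n → Route s f (m ℕ.+ n)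
      _▸_ {m = m} {n} (v , vl , vf) (w , wl , wf) = let (p , l) = _▹_ {m = m} {n} (v , vl) (w , wl) in p , l , λ k → [ vf , wf ]′ (vertices-·⁻ v w k)

      backʳ : ∀ {s e n} → Route s e n → Route e s n
      backʳ {n = n} (w , l , f) = let (p , k) = back {n = n} (w , l) in p , k , λ m → f (vertices-rev w m)

      short : ∀ {s e n} → Route s e n → Short s e n
      short (w , l , _) = w , l

      dist-short : ∀ {s e n} → Short s e n → dist s e ℕ.≤ n ℕ.* R
      dist-short (w , l) = ℕₚ.≤-trans (dist≤ w) l

      Before After : V → ℕ → Set
      Before s m = Σ (Walk G x s) λ P₀ → Σ (Walk G s u) λ A → Px ≡ P₀ · A × len G A ℕ.≤ m ℕ.* R
      After e n = Σ (Walk G u e) λ B → Σ (Walk G e y) λ P₁ → Py ≡ B · P₁ × len G B ℕ.≤ n ℕ.* R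

      gPx : Geodesic G Px
      gPx = geo-fore Px Py gp
      gPy : Geodesic G Py
      gPy = geo-aft Px Py gp

      positive : 0 ℕ.< R
      positive = ℕₚ.≤-trans (ℕ.s≤s ℕ.z≤n) large

      -- The piece of the first side around `u` and a route off the `R`-ball form a closed walk that
      -- is too short for the number of vertices that `Bypass.core` finds in its filling.
      close : ∀ {s e m n k} → Before s m → After e n → Route e s k → m ℕ.+ n ℕ.+ k ℕ.≤ 40 → ⊥
      close {m = m} {n} {k} (P₀ , A , refl , lA) (B , P₁ , refl , lB) (Q , lQ , far) le =
          ℕₚ.<⇒≱ (ℕₚ.≤-trans strict (Bypass.core D′ c filling A B Q geo R far J k₀ d (ℕₚ.m≤m+n k₀ k₀) (ℕₚ.≤-reflexive k₀+d))) upper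
        where
        geo : Geodesic G (A · B)
        geo = geo-fore (A · B) P₁ (geo-aft P₀ ((A · B) · P₁) (subst (Geodesic G) (trans (·-assoc P₀ A (B · P₁)) (cong (P₀ ·_) (sym (·-assoc A B P₁)))) gp))
        d : ℕ
        d = R ℕ.∸ k₀
        k₀+d : k₀ ℕ.+ d ≡ R
        k₀+d = ℕₚ.m+[n∸m]≡n (ℕₚ.≤-trans (ℕₚ.m≤m+n k₀ k₀) (ℕₚ.<⇒≤ large))
        k₀<d : k₀ ℕ.< d
        k₀<d = ℕₚ.+-cancelˡ-< k₀ k₀ d (subst (R₀ ℕ.<_) (sym k₀+d) large)
        R≤ : R ℕ.≤ d ℕ.+ d
        R≤ = subst (ℕ._≤ d ℕ.+ d) k₀+d (ℕₚ.+-monoˡ-≤ d (ℕₚ.<⇒≤ k₀<d))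
        lC : len G ((A · B) · Q) ℕ.≤ 40 ℕ.* R
        lC = ℕₚ.≤-trans (ℕₚ.≤-reflexive (trans (len-· (A · B) Q) (cong (ℕ._+ len G Q) (len-· A B))))
          (ℕₚ.≤-trans (ℕₚ.+-mono-≤ (ℕₚ.+-mono-≤ lA lB) lQ)
          (ℕₚ.≤-trans (ℕₚ.≤-reflexive (sym (trans (ℕₚ.*-distribʳ-+ R (m ℕ.+ n) k) (cong (ℕ._+ k ℕ.* R) (ℕₚ.*-distribʳ-+ R m n))))) (ℕₚ.*-monoˡ-≤ R le)))
        upper : c ℕ.* len G ((A · B) · Q) ℕ.≤ d ℕ.* (c ℕ.* 80)
        upper = ℕₚ.≤-trans (ℕₚ.*-monoʳ-≤ c (ℕₚ.≤-trans lC (ℕₚ.*-monoʳ-≤ 40 R≤))) (ℕₚ.≤-reflexive (ringℕ 2 (λ c d → c ⊛ (lit 40 ⊛ (d ⊹ d)) ≐ d ⊛ (c ⊛ lit 80)) refl c d))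
        strict : d ℕ.* (c ℕ.* 80) ℕ.< d ℕ.* J
        strict = ℕₚ.≤-trans (ℕₚ.+-monoˡ-≤ (d ℕ.* (c ℕ.* 80)) (ℕₚ.≤-trans (ℕ.s≤s ℕ.z≤n) k₀<d)) (ℕₚ.≤-reflexive (sym (ℕₚ.*-suc d (c ℕ.* 80))))

      sideRoute : ∀ {a b v w n} {s : Walk G a b} → Geodesic G s → (∀ {v} → v ∈ vertices G s → Far v) → v ∈ vertices G s → w ∈ vertices G s → Short v w n → Route v w n
      sideRoute {n = n} {s = s} g far v∈ w∈ sh = let (t , _ , in-s , gt) = walk-between s v∈ w∈ in
        t , ℕₚ.≤-trans (ℕₚ.≤-reflexive (sym (geo-len (gt g)))) (dist-short {n = n} sh) , λ m → far (in-s m)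

      nearRoute : ∀ {v w} → Walk G u v → 2 ℕ.* R ℕ.≤ dist u v → Short v w 1 → Route v w 1
      nearRoute {v} {w} uv big sh = let (t , tl) = path′ (proj₁ sh) in t , tl≤ t tl , λ m → far t tl (splitVertex t m)
        where
        tl≤ : (t : Walk G v w) → len G t ≡ dist v w → len G t ℕ.≤ 1 ℕ.* R
        tl≤ t e = ℕₚ.≤-trans (ℕₚ.≤-reflexive e) (dist-short {n = 1} sh)
        far : ∀ {y} (t : Walk G v w) → len G t ≡ dist v w → (Σ (Split t) λ s → mid s ≡ y) → Far y
        far {y} t e (split F B refl , refl) = ℕₚ.+-cancelʳ-≤ (1 ℕ.* R) _ _ (ℕₚ.≤-trans (ℕₚ.≤-reflexive (ringℕ 1 (λ R → R ⊹ lit 1 ⊛ R ≐ lit 2 ⊛ R) refl R))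
          (ℕₚ.≤-trans big (ℕₚ.≤-trans (dist-tri (uv · F) (rev F)) (ℕₚ.+-monoʳ-≤ (dist u y)
            (ℕₚ.≤-trans (dist≤ (rev F)) (ℕₚ.≤-trans (ℕₚ.≤-reflexive (len-rev F)) (ℕₚ.≤-trans (ℕₚ.m≤m+n (len G F) (len G B)) (ℕₚ.≤-trans (ℕₚ.≤-reflexive (sym (len-· F B))) (tl≤ (F · B) e)))))))))

      distant : ∀ {v w} → Short u v 3 → Walk G v w → dist v w ≡ 10 ℕ.* R → 2 ℕ.* R ℕ.≤ dist u w
      distant {v} {w} uv vw e = ℕₚ.+-cancelˡ-≤ (3 ℕ.* R) _ _ (ℕₚ.≤-trans (ℕₚ.≤-trans (ℕₚ.≤-reflexive (sym (ℕₚ.*-distribʳ-+ R 3 2))) (ℕₚ.*-monoˡ-≤ R {5} {10} (ℕₚ.m≤m+n 5 5)))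
        (ℕₚ.≤-trans (ℕₚ.≤-reflexive (sym e)) (ℕₚ.≤-trans (dist-tri (rev (proj₁ uv)) (proj₁ uv · vw)) (ℕₚ.+-monoˡ-≤ (dist u w) (dist-short {n = 3} (back {n = 3} uv))))))

      absurd : ∀ {d e} → 10 ℕ.* R ℕ.+ d ℕ.≤ e → e ℕ.≤ 4 ℕ.* R ℕ.+ d → ⊥
      absurd {d} h k = ℕₚ.<⇒≱ (ℕₚ.+-monoˡ-< d (ℕₚ.*-monoˡ-< R {{ℕ.>-nonZero positive}} {4} {10} (ℕₚ.m≤m+n 5 5))) (ℕₚ.≤-trans h k)

      module _ (nearP : ∀ {v} → v ∈ vertices G (Px · Py) → ∃ λ w → (w ∈ vertices G q ⊎ w ∈ vertices G r) × Short v w 1)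
               (nearR : ∀ {v} → v ∈ vertices G r → ∃ λ w → (w ∈ vertices G (Px · Py) ⊎ w ∈ vertices G q) × Short v w 1)
               (farQ : ∀ {w} → w ∈ vertices G q → Far w) (farR : ∀ {w} → w ∈ vertices G r → Far w) where

        -- The vertex `a` is `2 R` before `u`, so a link of length `R` to another side stays off the
        -- `R`-ball. If the side ends earlier, its end `x` is already on `r` and the link is
        -- trivial.
        record EndA : Set where
          field
            {a a′}  : V
            before  : Before a 2
            side    : a′ ∈ vertices G q ⊎ a′ ∈ vertices G r
            link    : Route a a′ 1
          toU : Short u a′ 3
          toU = let (_ , A , _ , l) = before in _▹_ {m = 2} {1} (back {n = 2} (A , l)) (short {n = 1} link)

        record EndB : Set where
          field
            {b b′}  : V
            after   : After b 2
            side    : b′ ∈ vertices G q ⊎ b′ ∈ vertices G r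
            link    : Route b b′ 1
          toU : Short u b′ 3
          toU = let (B , _ , _ , l) = after in _▹_ {m = 2} {1} (B , l) (short {n = 1} link)

        endA : EndA
        endA = cases (ℕₚ.≤-total (len G Px) (2 ℕ.* R))
          where
          cases : len G Px ℕ.≤ 2 ℕ.* R ⊎ 2 ℕ.* R ℕ.≤ len G Px → EndA
          cases (inj₁ l) = record { before = done , Px , refl , l ; side = inj₂ (last∈ r) ; link = done , ℕ.z≤n , λ { (here refl) → farR (last∈ r) } }
          cases (inj₂ l) = at-2R (splitAt Px (len G Px ℕ.∸ 2 ℕ.* R) (ℕₚ.m∸n≤m (len G Px) (2 ℕ.* R)))
            where
            at-2R : (Σ (Split Px) λ s → len G (fore s) ≡ len G Px ℕ.∸ 2 ℕ.* R) → EndA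
            at-2R (split {a} P₀ A e , l₀) = let (a′ , sd , sh) = nearP a∈ in record { before = P₀ , A , e , ℕₚ.≤-reflexive lA ; side = sd ; link = nearRoute (rev A) (ℕₚ.≤-reflexive (sym dua)) sh }
              where
              lA : len G A ≡ 2 ℕ.* R
              lA = trans (trans (sym (ℕₚ.m+n∸m≡n (len G P₀) (len G A))) (cong₂ ℕ._∸_ (trans (sym (len-· P₀ A)) (cong (len G) (sym e))) l₀)) (ℕₚ.m∸[m∸n]≡n l)
              dua : dist u a ≡ 2 ℕ.* R
              dua = trans (dist-sym (rev A)) (trans (geo-len (geo-aft P₀ A (subst (Geodesic G) e gPx))) lA)
              a∈ : a ∈ vertices G (Px · Py)
              a∈ = vertices-·ˡ Px Py (subst (λ w → a ∈ vertices G w) (sym e) (vertices-·ˡ P₀ A (last∈ P₀)))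

        endB : EndB
        endB = cases (ℕₚ.≤-total (len G Py) (2 ℕ.* R))
          where
          cases : len G Py ℕ.≤ 2 ℕ.* R ⊎ 2 ℕ.* R ℕ.≤ len G Py → EndB
          cases (inj₁ l) = record { after = Py , done , sym (·-done Py) , l ; side = inj₁ (first∈ q) ; link = done , ℕ.z≤n , λ { (here refl) → farQ (first∈ q) } }
          cases (inj₂ l) = at-2R (splitAt Py (2 ℕ.* R) l)
            where
            at-2R : (Σ (Split Py) λ s → len G (fore s) ≡ 2 ℕ.* R) → EndB
            at-2R (split {b} B P₁ e , lB) = let (b′ , sd , sh) = nearP b∈ in record { after = B , P₁ , e , ℕₚ.≤-reflexive lB ; side = sd
                ; link = nearRoute B (ℕₚ.≤-reflexive (sym (trans (geo-len (geo-fore B P₁ (subst (Geodesic G) e gPy))) lB))) sh }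
              where
              b∈ : b ∈ vertices G (Px · Py)
              b∈ = vertices-·ʳ Px Py (subst (λ w → b ∈ vertices G w) (sym e) (vertices-·ˡ B P₁ (last∈ B)))

        -- Ten units along `r` are enough to get out of the `2 R`-ball when starting within `3 R` of
        -- `u`, and to exceed the four units that a comparison of distances through `u` can lose in
        -- `absurd`.
        Advance : V → V → Set
        Advance m f = Route m f 10 ⊎ ∃ λ m″ → m″ ∈ vertices G r × Route m m″ 10 × dist m m″ ≡ 10 ℕ.* R × dist m f ≡ 10 ℕ.* R ℕ.+ dist m″ f

        advance : ∀ {m f} (T : Walk G m f) → Geodesic G T → (∀ {v} → v ∈ vertices G T → v ∈ vertices G r) → Advance m f
        advance {m} {f} T g T⊂ = cases (ℕₚ.≤-total (len G T) (10 ℕ.* R))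
          where
          cases : len G T ℕ.≤ 10 ℕ.* R ⊎ 10 ℕ.* R ℕ.≤ len G T → Advance m f
          cases (inj₁ l) = inj₁ (T , l , λ k → farR (T⊂ k))
          cases (inj₂ l) = cutT (splitAt T (10 ℕ.* R) l)
            where
            cutT : (Σ (Split T) λ s → len G (fore s) ≡ 10 ℕ.* R) → Advance m f
            cutT (split {m″} S₁ S₂ refl , l₁) = inj₂ (m″ , T⊂ (vertices-·ˡ S₁ S₂ (last∈ S₁)) , (S₁ , ℕₚ.≤-reflexive l₁ , λ k → farR (T⊂ (vertices-·ˡ S₁ S₂ k))) ,
              trans (geo-len (geo-fore S₁ S₂ g)) l₁ , trans (geo-len g) (trans (len-· S₁ S₂) (cong₂ ℕ._+_ l₁ (sym (geo-len (geo-aft S₁ S₂ g))))))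

        onPx : ∀ {w n} → w ∈ vertices G Px → Short w u n → Before w n
        onPx {w} {n} m sh = from (splitVertex Px m)
          where
          from : (Σ (Split Px) λ s → mid s ≡ w) → Before w n
          from (split P₀ A e , refl) = P₀ , A , e , ℕₚ.≤-trans (ℕₚ.≤-reflexive (sym (geo-len (geo-aft P₀ A (subst (Geodesic G) e gPx))))) (dist-short {n = n} sh)

        onPy : ∀ {w n} → w ∈ vertices G Py → Short u w n → After w n
        onPy {w} {n} m sh = from (splitVertex Py m)
          where
          from : (Σ (Split Py) λ s → mid s ≡ w) → After w n
          from (split B P₁ e , refl) = B , P₁ , e , ℕₚ.≤-trans (ℕₚ.≤-reflexive (sym (geo-len (geo-fore B P₁ (subst (Geodesic G) e gPy))))) (dist-short {n = n} sh)

        impossible : ⊥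
        impossible = sides EA.side EB.side
          where
          module EA = EndA endA
          module EB = EndB endB
          open EA using (a; a′; before)
          open EB using (b; b′; after)

          b′a′ : Short b′ a′ 6
          b′a′ = _▹_ {m = 3} {3} (back {n = 3} EB.toU) EA.toU

          same-side : Route b′ a′ 6 → ⊥
          same-side s = close {m = 2} {2} {8} before after (_▸_ {m = 7} {1} (_▸_ {m = 1} {6} EB.link s) (backʳ {n = 1} EA.link)) (ℕₚ.m≤m+n 12 28)

          -- The links end on the two sides that meet at `z`. Going from `a′` towards `z`, one
          -- either reaches `z` within ten units, and `q` leads back to `b′`, or meets a vertex `a″`
          -- close to another side. If that is `q` or the piece of the first side after `u`, a short
          -- closed walk arises. The piece before `u` is excluded because `a″` is too far from `x`.
          parallel : b′ ∈ vertices G q → a′ ∈ vertices G r → ⊥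
          parallel bq ar = from (splitVertex r ar)
            where
            from : (Σ (Split r) λ s → mid s ≡ a′) → ⊥
            from (split r₁ r₂ e , refl) = cases (advance (rev r₁) (geo-rev r₁ (geo-fore r₁ r₂ (subst (Geodesic G) e gr))) (λ k → subst (λ w → _ ∈ vertices G w) (sym e) (vertices-·ˡ r₁ r₂ (vertices-rev r₁ k))))
              where
              cases : Advance a′ z → ⊥
              cases (inj₁ az) = close {m = 2} {2} {28} before after
                (_▸_ {m = 27} {1} (_▸_ {m = 17} {10} (_▸_ {m = 1} {16} EB.link (sideRoute {n = 16} gq farQ bq (last∈ q) (_▹_ {m = 6} {10} b′a′ (short {n = 10} az)))) (backʳ {n = 10} az)) (backʳ {n = 1} EA.link)) (ℕₚ.m≤m+n 32 8)
              cases (inj₂ (a″ , a″∈ , aa″ , d , dz)) = meet (nearR a″∈)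
                where
                big : 2 ℕ.* R ℕ.≤ dist u a″
                big = distant EA.toU (proj₁ aa″) d
                onward : ∀ {w} → Short a″ w 1 → Route a″ w 1
                onward = nearRoute (proj₁ EA.toU · proj₁ aa″) big
                dx : dist a″ x ≡ 10 ℕ.* R ℕ.+ dist a′ x
                dx = ℕₚ.+-cancelˡ-≡ (dist z a″) _ _ (begin
                  dist z a″ ℕ.+ dist a″ x                   ≡⟨ proj₂ (proj₂ (geo-through r gr a″∈)) ⟩
                  dist z x                                  ≡⟨ proj₂ (proj₂ (geo-through r gr ar)) ⟨
                  dist z a′ ℕ.+ dist a′ x                   ≡⟨ cong (ℕ._+ dist a′ x) (trans (dist-sym r₁) dz) ⟩
                  (10 ℕ.* R ℕ.+ dist a″ z) ℕ.+ dist a′ x    ≡⟨ cong (λ k → (10 ℕ.* R ℕ.+ k) ℕ.+ dist a′ x) (dist-sym (rev (proj₁ aa″) · rev r₁)) ⟩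
                  (10 ℕ.* R ℕ.+ dist z a″) ℕ.+ dist a′ x    ≡⟨ ringℕ 3 (λ t p q → (t ⊹ p) ⊹ q ≐ p ⊹ (t ⊹ q)) refl (10 ℕ.* R) (dist z a″) (dist a′ x) ⟩
                  dist z a″ ℕ.+ (10 ℕ.* R ℕ.+ dist a′ x)    ∎)
                  where open ≡-Reasoning
                meet : (∃ λ w → (w ∈ vertices G (Px · Py) ⊎ w ∈ vertices G q) × Short a″ w 1) → ⊥
                meet (w , inj₂ wq , sh) = close {m = 2} {2} {30} before after
                  (_▸_ {m = 29} {1} (_▸_ {m = 19} {10} (_▸_ {m = 18} {1} (_▸_ {m = 1} {17} EB.link (sideRoute {n = 17} gq farQ bq wq (_▹_ {m = 16} {1} (_▹_ {m = 6} {10} b′a′ (short {n = 10} aa″)) sh)))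
                    (backʳ {n = 1} (onward sh))) (backʳ {n = 10} aa″)) (backʳ {n = 1} EA.link)) (ℕₚ.m≤m+n 34 6)
                meet (w , inj₁ wp , sh) = [ on-x , on-y ]′ (vertices-·⁻ Px Py wp)
                  where
                  uw : Short u w 14
                  uw = _▹_ {m = 13} {1} (_▹_ {m = 3} {10} EA.toU (short {n = 10} aa″)) sh
                  on-y : w ∈ vertices G Py → ⊥
                  on-y m = close {m = 2} {14} {12} before (onPy {n = 14} m uw) (_▸_ {m = 11} {1} (_▸_ {m = 1} {10} (backʳ {n = 1} (onward sh)) (backʳ {n = 10} aa″)) (backʳ {n = 1} EA.link)) (ℕₚ.m≤m+n 28 12)
                  on-x : w ∈ vertices G Px → ⊥
                  on-x m = absurd {dist a′ x} {dist a″ x} (ℕₚ.≤-reflexive (sym dx)) (begin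
                      dist a″ x                               ≤⟨ dist-tri (proj₁ sh) wx ⟩
                      dist a″ w ℕ.+ dist w x                  ≤⟨ ℕₚ.+-mono-≤ (dist-short {n = 1} sh) (ℕₚ.≤-trans (ℕₚ.m≤n+m (dist w x) (dist u w)) (ℕₚ.≤-reflexive (proj₂ (proj₂ through)))) ⟩
                      1 ℕ.* R ℕ.+ dist u x                    ≤⟨ ℕₚ.+-monoʳ-≤ (1 ℕ.* R) (dist-tri (proj₁ EA.toU) r₂) ⟩
                      1 ℕ.* R ℕ.+ (dist u a′ ℕ.+ dist a′ x)   ≤⟨ ℕₚ.+-monoʳ-≤ (1 ℕ.* R) (ℕₚ.+-monoˡ-≤ (dist a′ x) (dist-short {n = 3} EA.toU)) ⟩
                      1 ℕ.* R ℕ.+ (3 ℕ.* R ℕ.+ dist a′ x)     ≡⟨ ringℕ 2 (λ R d → lit 1 ⊛ R ⊹ (lit 3 ⊛ R ⊹ d) ≐ lit 4 ⊛ R ⊹ d) refl R (dist a′ x) ⟩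
                      4 ℕ.* R ℕ.+ dist a′ x                   ∎)
                    where
                    open ℕₚ.≤-Reasoning
                    through = geo-through (rev Px) (geo-rev Px gPx) (vertices-rev⁺ Px m)
                    wx = proj₁ (proj₂ through)

          -- The links end on the wrong sides, so one goes from `b′` along `r` towards `x`. A vertex
          -- `b″` ten units on is too close to `x` to be near the piece of the first side after `u`;
          -- all other positions yield a short closed walk.
          crossed : b′ ∈ vertices G r → a′ ∈ vertices G q → ⊥
          crossed br aq = from (splitVertex r br)
            where
            from : (Σ (Split r) λ s → mid s ≡ b′) → ⊥
            from (split r₁ r₂ e , refl) = cases (advance r₂ (geo-aft r₁ r₂ (subst (Geodesic G) e gr)) (λ k → subst (λ w → _ ∈ vertices G w) (sym e) (vertices-·ʳ r₁ r₂ k)))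
              where
              cases : Advance b′ x → ⊥
              cases (inj₁ bx) = close {m = 13} {2} {11} (onPx {n = 13} (first∈ Px) (_▹_ {m = 10} {3} (back {n = 10} (short {n = 10} bx)) (back {n = 3} EB.toU))) after (_▸_ {m = 1} {10} EB.link bx) (ℕₚ.m≤m+n 26 14)
              cases (inj₂ (b″ , b″∈ , bb″ , d , dx)) = meet (nearR b″∈)
                where
                onward : ∀ {w} → Short b″ w 1 → Route b″ w 1
                onward = nearRoute (proj₁ EB.toU · proj₁ bb″) (distant EB.toU (proj₁ bb″) d)
                meet : (∃ λ w → (w ∈ vertices G (Px · Py) ⊎ w ∈ vertices G q) × Short b″ w 1) → ⊥
                meet (w , inj₂ wq , sh) = close {m = 2} {2} {30} before after
                  (_▸_ {m = 29} {1} (_▸_ {m = 12} {17} (_▸_ {m = 11} {1} (_▸_ {m = 1} {10} EB.link bb″) (onward sh))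
                    (sideRoute {n = 17} gq farQ wq aq (_▹_ {m = 11} {6} (_▹_ {m = 1} {10} (back {n = 1} sh) (back {n = 10} (short {n = 10} bb″))) b′a′))) (backʳ {n = 1} EA.link)) (ℕₚ.m≤m+n 34 6)
                meet (w , inj₁ wp , sh) = [ on-x , on-y ]′ (vertices-·⁻ Px Py wp)
                  where
                  uw : Short u w 14
                  uw = _▹_ {m = 13} {1} (_▹_ {m = 3} {10} EB.toU (short {n = 10} bb″)) sh
                  on-x : w ∈ vertices G Px → ⊥
                  on-x m = close {m = 14} {2} {12} (onPx {n = 14} m (back {n = 14} uw)) after (_▸_ {m = 11} {1} (_▸_ {m = 1} {10} EB.link bb″) (onward sh)) (ℕₚ.m≤m+n 28 12)
                  on-y : w ∈ vertices G Py → ⊥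
                  on-y m = beyond (splitVertex Py m)
                    where
                    beyond : (Σ (Split Py) λ s → mid s ≡ w) → ⊥
                    beyond (split B P₁ refl , refl) = absurd {dist b″ x} {dist b′ x} (ℕₚ.≤-reflexive (sym dx)) (begin
                        dist b′ x                               ≤⟨ dist-tri (rev (proj₁ EB.toU)) (rev Px) ⟩
                        dist b′ u ℕ.+ dist u x                  ≤⟨ ℕₚ.+-mono-≤ (dist-short {n = 3} (back {n = 3} EB.toU)) closer ⟩
                        3 ℕ.* R ℕ.+ dist w x                    ≤⟨ ℕₚ.+-monoʳ-≤ (3 ℕ.* R) (dist-tri (rev (proj₁ sh)) (rev (proj₁ bb″) · r₂)) ⟩
                        3 ℕ.* R ℕ.+ (dist w b″ ℕ.+ dist b″ x)   ≤⟨ ℕₚ.+-monoʳ-≤ (3 ℕ.* R) (ℕₚ.+-monoˡ-≤ (dist b″ x) (dist-short {n = 1} (back {n = 1} sh))) ⟩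
                        3 ℕ.* R ℕ.+ (1 ℕ.* R ℕ.+ dist b″ x)     ≡⟨ ringℕ 2 (λ R d → lit 3 ⊛ R ⊹ (lit 1 ⊛ R ⊹ d) ≐ lit 4 ⊛ R ⊹ d) refl R (dist b″ x) ⟩
                        4 ℕ.* R ℕ.+ dist b″ x                   ∎)
                      where
                      open ℕₚ.≤-Reasoning
                      closer : dist u x ℕ.≤ dist w x
                      closer = subst₂ ℕ._≤_ (dist-sym Px) (dist-sym (Px · B)) (ℕₚ.≤-trans (ℕₚ.≤-reflexive (geo-len gPx)) (ℕₚ.≤-trans (ℕₚ.m≤m+n (len G Px) (len G B))
                        (ℕₚ.≤-reflexive (sym (trans (geo-len (geo-fore (Px · B) P₁ (subst (Geodesic G) (sym (·-assoc Px B P₁)) gp))) (len-· Px B))))))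

          sides : a′ ∈ vertices G q ⊎ a′ ∈ vertices G r → b′ ∈ vertices G q ⊎ b′ ∈ vertices G r → ⊥
          sides (inj₁ aq) (inj₁ bq) = same-side (sideRoute {n = 6} gq farQ bq aq b′a′)
          sides (inj₂ ar) (inj₂ br) = same-side (sideRoute {n = 6} gr farR br ar b′a′)
          sides (inj₂ ar) (inj₁ bq) = parallel bq ar
          sides (inj₁ aq) (inj₂ br) = crossed br aq

    private
      Side : ∀ {a b c d e f} → ℕ → Walk G a b → Walk G c d → Walk G e f → Set
      Side δ s t t′ = ∀ u → u ∈ vertices G s → Within G δ (vertices G t) u ⊎ Within G δ (vertices G t′) u

      within : ∀ {δ A u w} → w ∈ A → (p : Walk G u w) → dist u w ℕ.≤ δ → Within G δ A u
      within m p l = _ , m , _ , dist-spec p , l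

      within-mono : ∀ {δ δ′ A u} → δ ℕ.≤ δ′ → Within G δ A u → Within G δ′ A u
      within-mono l (w , m , n , d , k) = w , m , n , d , ℕₚ.≤-trans k l

      side-mono : ∀ {a b c d e f δ δ′} {s : Walk G a b} {t : Walk G c d} {t′ : Walk G e f} → δ ℕ.≤ δ′ → Side δ s t t′ → Side δ′ s t t′
      side-mono l h u m = [ (λ w → inj₁ (within-mono l w)) , (λ w → inj₂ (within-mono l w)) ]′ (h u m)

      ¬side : ∀ {a b c d e f δ} (s : Walk G a b) (t : Walk G c d) (t′ : Walk G e f) → ¬ Side δ s t t′ →
        ∃ λ u → u ∈ vertices G s × ¬ (Within G δ (vertices G t) u ⊎ Within G δ (vertices G t′) u)
      ¬side s t t′ n = dne λ k → n λ u m → dne λ w → k (u , m , w)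

    -- An extremal choice: thinness holds for `suc m` and fails for `m`. So the same number bounds
    -- every excursion from above and the one at `u` from below.
    excursion : ∀ {x y z} (p : Walk G x y) (q : Walk G y z) (r : Walk G z x) → Geodesic G p → Geodesic G q → Geodesic G r →
      ∀ m → R₀ ℕ.≤ m → Thin G (suc m) p q r → ¬ Side m p q r → ⊥
    excursion p q r gp gq gr m large (tp , tq , tr) n = from (¬side p q r n)
      where
      from : (∃ λ u → u ∈ vertices G p × ¬ (Within G m (vertices G q) u ⊎ Within G m (vertices G r) u)) → ⊥
      from (u , u∈ , far) = at-u (splitVertex p u∈)
        where
        at-u : (Σ (Split p) λ s → mid s ≡ u) → ⊥
        at-u (split Px Py refl , refl) = Excursion.impossible (suc m) (ℕ.s≤s large) Px Py q r gp gq gr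
            (λ {v} k → [ (λ w → close w inj₁) , (λ w → close w inj₂) ]′ (tp v k))
            (λ {v} k → [ (λ w → close w inj₁) , (λ w → close w inj₂) ]′ (tr v k))
            (λ {w} k → ℕₚ.≰⇒> λ l → far (inj₁ (within k (u→q k) l)))
            (λ {w} k → ℕₚ.≰⇒> λ l → far (inj₂ (within k (u→r k) l)))
          where
          close : ∀ {A v} {C : V → Set} → Within G (suc m) A v → (∀ {w} → w ∈ A → C w) → ∃ λ w → C w × Σ (Walk G v w) λ s → len G s ℕ.≤ 1 ℕ.* suc m
          close (w , w∈ , k , ((s , e) , _) , l) f = w , f w∈ , s , ℕₚ.≤-trans (ℕₚ.≤-reflexive e) (ℕₚ.≤-trans l (ℕₚ.≤-reflexive (sym (ℕₚ.*-identityˡ (suc m)))))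
          u→q : ∀ {w} → w ∈ vertices G q → Walk G u w
          u→q k = Py · fore (proj₁ (splitVertex q k)) · subst (Walk G (mid (proj₁ (splitVertex q k)))) (proj₂ (splitVertex q k)) done
          u→r : ∀ {w} → w ∈ vertices G r → Walk G u w
          u→r k = Py · q · fore (proj₁ (splitVertex r k)) · subst (Walk G (mid (proj₁ (splitVertex r k)))) (proj₂ (splitVertex r k)) done

    -- A triangle is thin for the sum of its side lengths, and `excursion` lowers the constant one
    -- by one down to `R₀`.
    thin : ∀ {x y z} (p : Walk G x y) (q : Walk G y z) (r : Walk G z x) → Geodesic G p → Geodesic G q → Geodesic G r → Thin G R₀ p q r
    thin p q r gp gq gr = descend (len G p ℕ.+ (len G q ℕ.+ len G r)) trivial
      where
      trivial : Thin G (len G p ℕ.+ (len G q ℕ.+ len G r)) p q r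
      trivial = (λ u m → inj₁ (near p (first∈ q) m (last∈ p) (ℕₚ.m≤m+n (len G p) _)))
              , (λ u m → inj₁ (near q (first∈ r) m (last∈ q) (ℕₚ.≤-trans (ℕₚ.m≤m+n (len G q) (len G r)) (ℕₚ.m≤n+m _ (len G p)))))
              , (λ u m → inj₁ (near r (first∈ p) m (last∈ r) (ℕₚ.≤-trans (ℕₚ.m≤n+m (len G r) (len G q)) (ℕₚ.m≤n+m _ (len G p)))))
        where
        near : ∀ {a b u w δ A} (s : Walk G a b) → w ∈ A → u ∈ vertices G s → w ∈ vertices G s → len G s ℕ.≤ δ → Within G δ A u
        near s w∈ m n l = let (t , tl , _) = walk-between s m n in within w∈ t (ℕₚ.≤-trans (dist≤ t) (ℕₚ.≤-trans tl l))
      cases : ∀ m → R₀ ℕ.≤ m → Thin G (suc m) p q r → Dec (Side m p q r) → Dec (Side m q r p) → Dec (Side m r p q) → Thin G m p q r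
      cases m l (tp , tq , tr) (yes a) (yes b) (yes c) = a , b , c
      cases m l (tp , tq , tr) (no n) _ _ = ⊥-elim (excursion p q r gp gq gr m l (tp , tq , tr) n)
      cases m l (tp , tq , tr) (yes _) (no n) _ = ⊥-elim (excursion q r p gq gr gp m l (tq , tr , tp) n)
      cases m l (tp , tq , tr) (yes _) (yes _) (no n) = ⊥-elim (excursion r p q gr gp gq m l (tr , tp , tq) n)
      descend : ∀ m → Thin G m p q r → Thin G R₀ p q r
      small : ∀ {m} → m ℕ.≤ R₀ → Thin G m p q r → Thin G R₀ p q r
      small l (tp , tq , tr) = side-mono {s = p} {q} {r} l tp , side-mono {s = q} {r} {p} l tq , side-mono {s = r} {p} {q} l tr
      descend zero t = small ℕ.z≤n t
      descend (suc m) t = [ (λ l → small l t) , (λ l → descend m (cases m (ℕ.s≤s⁻¹ l) t (dec (Side m p q r)) (dec (Side m q r p)) (dec (Side m r p q)))) ]′ (ℕₚ.≤-<-connex (suc m) R₀)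

-- Points and edges of the embedded graph

module Embedded (em : ExcludedMiddle (lsuc 0ℓ)) (P : PlaneGraph) where
  open Classical em
  open RealPlane em
  open PlaneGraph P

  open IsEmbedding isEmbedding

  γ : E → I → ℝ²
  γ e t = φ (on e t)

  vx : V → ℝ²
  vx v = φ (vertex v)

  𝟎 𝟏 : ℝ
  𝟎 = fromℚ 0ℚ
  𝟏 = fromℚ 1ℚ

  I≥0 : ∀ (t : I) → 𝟎 ≼ proj₁ t
  I≥0 (t , a , b) h = a (un∙< (≺⇒∙< h))

  I≤1 : ∀ (t : I) → proj₁ t ≼ 𝟏
  I≤1 (t , a , b) h = b (un<∙ (≺⇒<∙ h))

  toI : ∀ x → 𝟎 ≼ x → x ≼ 𝟏 → I
  toI x a b = x , (λ h → a (∙<⇒≺ (mk∙< h))) , λ h → b (<∙⇒≺ (mk<∙ h))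

  0≺1 : 𝟎 ≺ 𝟏
  0≺1 = <∙⇒≺ (<⇒<∙ (0<1/ 0))

  Interior : I → Set
  Interior t = 𝟎 ≺ proj₁ t × proj₁ t ≺ 𝟏

  I-cases : ∀ (t : I) → proj₁ t ≋ 𝟎 ⊎ proj₁ t ≋ 𝟏 ⊎ Interior t
  I-cases t = from (dec (𝟎 ≺ proj₁ t)) (dec (proj₁ t ≺ 𝟏))
    where
    from : Dec (𝟎 ≺ proj₁ t) → Dec (proj₁ t ≺ 𝟏) → proj₁ t ≋ 𝟎 ⊎ proj₁ t ≋ 𝟏 ⊎ Interior t
    from (no a) _ = inj₁ (≼-antisym a (I≥0 t))
    from (yes _) (no b) = inj₂ (inj₁ (≼-antisym (I≤1 t) b))
    from (yes a) (yes b) = inj₂ (inj₂ (a , b))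

  0≉1 : ∀ {x} → x ≋ 𝟎 → x ≋ 𝟏 → ⊥
  0≉1 a b = ≈⇒⊁ (≋-trans (≋-sym a) b) 0≺1

  0≉int : ∀ {t : I} → Interior t → ¬ (proj₁ t ≋ 𝟎)
  0≉int (a , _) e = ≈⇒⊀ e a

  1≉int : ∀ {t : I} → Interior t → ¬ (proj₁ t ≋ 𝟏)
  1≉int (_ , b) e = ≈⇒⊁ e b

  γ-≋ : ∀ {e s t} → proj₁ s ≋ proj₁ t → γ e s ≑ γ e t
  γ-≋ h = ≈⇒≑ (respects (fwd (same (un≋ h)) ◅ ◅-nil))

  γ-src : ∀ {e t} → proj₁ t ≋ 𝟎 → γ e t ≑ vx (src e)
  γ-src h = ≈⇒≑ (respects (fwd (same (un≋ h)) ◅ fwd start ◅ ◅-nil))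

  γ-tgt : ∀ {e t} → proj₁ t ≋ 𝟏 → γ e t ≑ vx (tgt e)
  γ-tgt h = ≈⇒≑ (respects (fwd (same (un≋ h)) ◅ fwd end ◅ ◅-nil))

  -- A predicate that gluing preserves. Carried along the equivalence that `injective` returns, it
  -- recovers which names a point of the complex can have; `OnInt` does the same for interior points
  -- of edges.
  At : V → Point graph → Set
  At v (vertex w) = w ≡ v
  At v (on e t) = (proj₁ t ≋ 𝟎 × src e ≡ v) ⊎ (proj₁ t ≋ 𝟏 × tgt e ≡ v)

  OnInt : E → I → Point graph → Set
  OnInt e s (vertex w) = ⊥
  OnInt e s (on f t) = f ≡ e × proj₁ t ≋ proj₁ s

  invariant : (Q : Point graph → Set) → (∀ {a b} → Glue graph a b → Q a → Q b) → (∀ {a b} → Glue graph a b → Q b → Q a) →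
    ∀ {a b} → _∼_ graph a b → Q a → Q b
  invariant Q f g ◅-nil q = q
  invariant Q f g (fwd x ◅ xs) q = invariant Q f g xs (f x q)
  invariant Q f g (bwd x ◅ xs) q = invariant Q f g xs (g x q)

  At-∼ : ∀ {v a b} → _∼_ graph a b → At v a → At v b
  At-∼ {v} = invariant (At v) f g
    where
    f : ∀ {a b} → Glue graph a b → At v a → At v b
    f (same h) (inj₁ (z , w)) = inj₁ (≋-trans (≋-sym (mk≋ h)) z , w)
    f (same h) (inj₂ (z , w)) = inj₂ (≋-trans (≋-sym (mk≋ h)) z , w)
    f start (inj₁ (_ , w)) = w
    f start (inj₂ (z , _)) = ⊥-elim (0≉1 ≋-refl z)
    f end (inj₁ (z , _)) = ⊥-elim (0≉1 z ≋-refl)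
    f end (inj₂ (_ , w)) = w
    g : ∀ {a b} → Glue graph a b → At v b → At v a
    g (same h) (inj₁ (z , w)) = inj₁ (≋-trans (mk≋ h) z , w)
    g (same h) (inj₂ (z , w)) = inj₂ (≋-trans (mk≋ h) z , w)
    g start w = inj₁ (≋-refl , w)
    g end w = inj₂ (≋-refl , w)

  OnInt-∼ : ∀ {e s a b} → Interior s → _∼_ graph a b → OnInt e s a → OnInt e s b
  OnInt-∼ {e} {s} int = invariant (OnInt e s) f g
    where
    f : ∀ {a b} → Glue graph a b → OnInt e s a → OnInt e s b
    f (same h) (w , z) = w , ≋-trans (≋-sym (mk≋ h)) z
    f start (_ , z) = ⊥-elim (0≉int {s} int (≋-sym z))
    f end (_ , z) = ⊥-elim (1≉int {s} int (≋-sym z))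
    g : ∀ {a b} → Glue graph a b → OnInt e s b → OnInt e s a
    g (same h) (w , z) = w , ≋-trans (mk≋ h) z

  vx-inj : ∀ {v w} → vx v ≑ vx w → v ≡ w
  vx-inj h = sym (At-∼ (injective (≑⇒≈ h)) refl)

  vx-γ : ∀ {v e t} → vx v ≑ γ e t → At v (on e t)
  vx-γ h = At-∼ (injective (≑⇒≈ h)) refl

  γ-int-inj : ∀ {e f s t} → Interior s → γ e s ≑ γ f t → f ≡ e × proj₁ t ≋ proj₁ s
  γ-int-inj {s = s} i h = OnInt-∼ {s = s} i (injective (≑⇒≈ h)) (refl , ≋-refl)

  Inc : V → E → Set
  Inc v e = src e ≡ v ⊎ tgt e ≡ v

  At⇒Inc : ∀ {v e t} → At v (on e t) → Inc v e
  At⇒Inc (inj₁ (_ , h)) = inj₁ h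
  At⇒Inc (inj₂ (_ , h)) = inj₂ h

  At⇒vx : ∀ {v e t} → At v (on e t) → γ e t ≑ vx v
  At⇒vx (inj₁ (z , refl)) = γ-src z
  At⇒vx (inj₂ (z , refl)) = γ-tgt z

  γ-meet : ∀ {e f s t} → e ≢ f → γ e s ≑ γ f t → ∃ λ v → At v (on e s) × At v (on f t)
  γ-meet {e} {f} {s} {t} ne h = from (I-cases s)
    where
    from : proj₁ s ≋ 𝟎 ⊎ proj₁ s ≋ 𝟏 ⊎ Interior s → ∃ λ v → At v (on e s) × At v (on f t)
    from (inj₁ z) = src e , inj₁ (z , refl) , vx-γ (≑-trans (≑-sym (γ-src z)) h)
    from (inj₂ (inj₁ z)) = tgt e , inj₂ (z , refl) , vx-γ (≑-trans (≑-sym (γ-tgt z)) h)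
    from (inj₂ (inj₂ i)) = ⊥-elim (ne (sym (proj₁ (γ-int-inj i h))))

  cont : ∀ e t {B} → γ e t ∈□ B → ∃₂ λ l r → l <∙ proj₁ t × proj₁ t ∙< r × (∀ s → l <∙ proj₁ s → proj₁ s ∙< r → γ e s ∈□ B)
  cont e t {B} h = from (proj₂ (continuous (_∈ᴮ B) (λ x k → B , k , λ y j → j)) e t (∈□⇒∈ᴮ h))
    where
    from : (∃₂ λ l r → (l <ʳ proj₁ t × proj₁ t ʳ< r) × (∀ s → l <ʳ proj₁ s → proj₁ s ʳ< r → γ e s ∈ᴮ B)) → _
    from (l , r , (a , b) , f) = l , r , mk<∙ a , mk∙< b , λ s u v → ∈ᴮ⇒∈□ (f s (un<∙ u) (un∙< v))

  Btw : I → I → I → Set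
  Btw s t u = (proj₁ s ≼ proj₁ u × proj₁ u ≼ proj₁ t) ⊎ (proj₁ t ≼ proj₁ u × proj₁ u ≼ proj₁ s)

  Btw-sym : ∀ {s t u} → Btw s t u → Btw t s u
  Btw-sym (inj₁ h) = inj₂ h
  Btw-sym (inj₂ h) = inj₁ h

  Btw-l : ∀ {s t} → Btw s t s
  Btw-l {s} {t} = [ (λ h → inj₁ (≼-refl , h)) , (λ h → inj₂ (h , ≼-refl)) ]′ (≼-total (proj₁ s) (proj₁ t))

  Btw-r : ∀ {s t} → Btw s t t
  Btw-r {s} {t} = Btw-sym {t} {s} {t} (Btw-l {t} {s})

  Btw-open : ∀ {s t u l r} → Btw s t u → l <∙ proj₁ s → proj₁ s ∙< r → l <∙ proj₁ t → proj₁ t ∙< r → l <∙ proj₁ u × proj₁ u ∙< r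
  Btw-open (inj₁ (a , b)) ls sr lt tr = <∙-≼ ls a , ≼-∙< b tr
  Btw-open (inj₂ (a , b)) ls sr lt tr = <∙-≼ lt a , ≼-∙< b sr

  In[_,_] : ℚ → ℚ → I → Set
  In[ l , r ] t = fromℚ l ≼ proj₁ t × proj₁ t ≼ fromℚ r

  In[]-open : ∀ {l r l₀ r₀ t} → In[ l , r ] t → l₀ < l → r < r₀ → l₀ <∙ proj₁ t × proj₁ t ∙< r₀
  In[]-open (a , b) p q = <∙-≼ (<⇒<∙ p) a , ≼-∙< b (<⇒∙< q)

  All-In : ∀ t → In[ 0ℚ , 1ℚ ] t
  All-In t = I≥0 t , I≤1 t

  cousinI : (Q : ℚ → ℚ → Set) → (∀ {l m r} → 0ℚ ≤ l → l ≤ m → m ≤ r → r ≤ 1ℚ → Q l m → Q m r → Q l r) →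
    (∀ t → ∃₂ λ l₀ r₀ → l₀ <∙ proj₁ t × proj₁ t ∙< r₀ × (∀ {l r} → l₀ < l → r < r₀ → Q l r)) → Q 0ℚ 1ℚ
  cousinI Q add loc = Cousin.cousin Q 0ℚ 1ℚ add
    (λ x a b → let (l , r , u , v , f) = loc (toI x a b) in l , r , u , v , λ _ _ _ → f) (ℚₚ.<⇒≤ (0<1/ 0))

  pointwise : ∀ {R : I → Set} {l m r} → (∀ t → In[ l , m ] t → R t) → (∀ t → In[ m , r ] t → R t) → ∀ t → In[ l , r ] t → R t
  pointwise {m = m} p q t (a , b) = [ (λ h → p t (a , h)) , (λ h → q t (h , b)) ]′ (≼-total (proj₁ t) (fromℚ m))

  connI : ∀ (G : I → Bool) s t → (∀ a → Btw s t a → ∃₂ λ l r → l <∙ proj₁ a × proj₁ a ∙< r ×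
    (∀ b → l <∙ proj₁ b → proj₁ b ∙< r → Btw s t b → G b ≡ G a)) → G s ≡ G t
  connI G s t local = [ up , (λ h → sym (down h)) ]′ (≼-total (proj₁ s) (proj₁ t))
    where
    up : proj₁ s ≼ proj₁ t → G s ≡ G t
    up h = Conn.constant proj₁ G s t h (λ x a b → toI x (≼-trans (I≥0 s) a) (≼-trans b (I≤1 t)) , refl)
      λ a p q → let (l , r , u , v , f) = local a (inj₁ (p , q)) in l , r , u , v , λ b x y z w → f b x y (inj₁ (z , w))
    down : proj₁ t ≼ proj₁ s → G t ≡ G s
    down h = Conn.constant proj₁ G t s h (λ x a b → toI x (≼-trans (I≥0 t) a) (≼-trans b (I≤1 s)) , refl)
      λ a p q → let (l , r , u , v , f) = local a (inj₂ (p , q)) in l , r , u , v , λ b x y z w → f b x y (inj₂ (z , w))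

  Off : ℝ² → E → Set
  Off x e = ∀ t → ¬ (γ e t ≑ x)

  OffL : ℝ² → List E → Set
  OffL x L = ∀ {e} → e ∈ L → Off x e

  -- Stronger than disjointness: each point of the edge has a box separated from `B` by a line, as
  -- `cr-move` requires.
  Clear : Box → E → Set
  Clear B e = ∀ t → ∃ λ A → γ e t ∈□ A × Sep B A

  Clear-⊑ : ∀ {A B e} → A ⊑ B → Clear B e → Clear A e
  Clear-⊑ h c t = let (A , i , s) = c t in A , i , Sep-⊑ h ⊑-refl s

  Clear-Off : ∀ {B e x} → Clear B e → x ∈□ B → Off x e
  Clear-Off c xB t h = let (A , i , s) = c t in Sep-∉ s xB (∈-≑ h i)

  avoid : ∀ {x e} → Off x e → ∃ λ B → x ∈□ B × Clear B e
  avoid {x} {e} off = let (B , i , f) = cousinI Q add loc in B , i , λ t → f t (All-In t)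
    where
    Q : ℚ → ℚ → Set
    Q l r = ∃ λ B → x ∈□ B × (∀ t → In[ l , r ] t → ∃ λ A → γ e t ∈□ A × Sep B A)
    add : ∀ {l m r} → 0ℚ ≤ l → l ≤ m → m ≤ r → r ≤ 1ℚ → Q l m → Q m r → Q l r
    add _ _ _ _ (B , i , f) (B' , i' , f') = B ⊓□ B' , ∈⊓ i i' ,
      pointwise (λ t h → let (A , j , s) = f t h in A , j , Sep-⊑ (⊓⊑ˡ B B') ⊑-refl s) (λ t h → let (A , j , s) = f' t h in A , j , Sep-⊑ (⊓⊑ʳ B B') ⊑-refl s)
    loc : ∀ t → ∃₂ λ l₀ r₀ → l₀ <∙ proj₁ t × proj₁ t ∙< r₀ × (∀ {l r} → l₀ < l → r < r₀ → Q l r)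
    loc t = let (A , B , i , j , s) = ≉⇒Sep (off t)
                (l , r , u , v , f) = cont e t i
            in l , r , u , v , λ p q → B , j , λ t' h → let (a , b) = In[]-open {t = t'} h p q in A , f t' a b , Sep-sym s

  avoidL : ∀ {x} L → OffL x L → ∃ λ B → x ∈□ B × (∀ {e} → e ∈ L → Clear B e)
  avoidL {x} [] off = let (B , i , _) = smallBox x (0<1/ 0) in B , i , λ ()
  avoidL (e ∷ L) off =
    let (B , i , c) = avoid (off (here refl))
        (B' , i' , c') = avoidL L (λ m → off (there m))
    in B ⊓□ B' , ∈⊓ i i' , λ { (here refl) → Clear-⊑ (⊓⊑ˡ B B') c ; (there m) → Clear-⊑ (⊓⊑ʳ B B') (c' m) }

  Supp-mono : ∀ {lo hi lo' hi' x} → lo' ≤ lo → hi ≤ hi' → Supp lo hi x → Supp lo' hi' x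
  Supp-mono {x = x} a b (supp p q r s) = supp (<∙-down (proj₁ x) a p) (∙<-up (proj₁ x) b q) (<∙-down (proj₂ x) a r) (∙<-up (proj₂ x) b s)

  ∈⇒Supp : ∀ {x B} → x ∈□ B → Supp (left B ⊓ bottom B) (right B ⊔ top B) x
  ∈⇒Supp {x} {B} h = supp (<∙-down (proj₁ x) (ℚₚ.p⊓q≤p _ _) (∈-left h)) (∙<-up (proj₁ x) (ℚₚ.p≤p⊔q _ _) (∈-right h))
                          (<∙-down (proj₂ x) (ℚₚ.p⊓q≤q (left B) _) (∈-bottom h)) (∙<-up (proj₂ x) (ℚₚ.p≤q⊔p (right B) _) (∈-top h))

  window₁ : ∀ e → ∃₂ λ lo hi → ∀ t → Supp lo hi (γ e t)
  window₁ e = let (lo , hi , f) = cousinI Q add loc in lo , hi , λ t → f t (All-In t)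
    where
    Q : ℚ → ℚ → Set
    Q l r = ∃₂ λ lo hi → ∀ t → In[ l , r ] t → Supp lo hi (γ e t)
    add : ∀ {l m r} → 0ℚ ≤ l → l ≤ m → m ≤ r → r ≤ 1ℚ → Q l m → Q m r → Q l r
    add _ _ _ _ (lo , hi , f) (lo' , hi' , f') = lo ⊓ lo' , hi ⊔ hi' , pointwise
      (λ t h → Supp-mono (ℚₚ.p⊓q≤p lo lo') (ℚₚ.p≤p⊔q hi hi') (f t h)) (λ t h → Supp-mono (ℚₚ.p⊓q≤q lo lo') (ℚₚ.p≤q⊔p hi hi') (f' t h))
    loc : ∀ t → ∃₂ λ l₀ r₀ → l₀ <∙ proj₁ t × proj₁ t ∙< r₀ × (∀ {l r} → l₀ < l → r < r₀ → Q l r)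
    loc t = let (A , i , _) = smallBox (γ e t) (0<1/ 0)
                (l , r , u , v , f) = cont e t i
            in l , r , u , v , λ p q → left A ⊓ bottom A , right A ⊔ top A , λ t' h → let (a , b) = In[]-open {t = t'} h p q in ∈⇒Supp (f t' a b)

  window : ∀ L → ∃₂ λ lo hi → ∀ {e} → e ∈ L → ∀ t → Supp lo hi (γ e t)
  window [] = 0ℚ , 0ℚ , λ ()
  window (e ∷ L) =
    let (lo , hi , f) = window₁ e
        (lo' , hi' , f') = window L
    in lo ⊓ lo' , hi ⊔ hi' , λ { (here refl) t → Supp-mono (ℚₚ.p⊓q≤p lo lo') (ℚₚ.p≤p⊔q hi hi') (f t) ; (there m) t → Supp-mono (ℚₚ.p⊓q≤q lo lo') (ℚₚ.p≤q⊔p hi hi') (f' m t) }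

  -- Winding numbers modulo 2

  Seg : Box → E → I → I → Set
  Seg B e s t = ∀ u → Btw s t u → γ e u ∈□ B

  Btw-sub : ∀ {s t m u} → Btw s t m → Btw s m u → Btw s t u
  Btw-sub (inj₁ (a , b)) (inj₁ (c , d)) = inj₁ (c , ≼-trans d b)
  Btw-sub (inj₁ (a , b)) (inj₂ (c , d)) = inj₁ (≼-trans a c , ≼-trans d (≼-trans a b))
  Btw-sub (inj₂ (a , b)) (inj₁ (c , d)) = inj₂ (≼-trans (≼-trans a b) c , ≼-trans d b)
  Btw-sub (inj₂ (a , b)) (inj₂ (c , d)) = inj₂ (≼-trans a c , d)

  -- A primitive along the edge of the crossing cochain. It is prescribed only on pieces that stay
  -- in a box without `p`, where the parity of crossings depends on the two ends alone.
  Prim : ℝ² → E → (I → Bool) → Set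
  Prim p e g = ∀ s t {B} → ¬ (p ∈□ B) → Seg B e s t → g s xor g t ≡ cr p (γ e s) (γ e t)

  missBox : ∀ {p e} → Off p e → ∀ t → ∃ λ B → γ e t ∈□ B × ¬ (p ∈□ B)
  missBox off t = let (A , B , i , j , s) = ≉⇒Sep (off t) in A , i , λ k → Sep-∉ s k j

  prim : ∀ {p e} → Off p e → ∃ (Prim p e)
  prim {p} {e} off = let (g , f) = cousinI Q add loc in g , λ s t n sg → f s t (All-In s) (All-In t) n sg
    where
    Q : ℚ → ℚ → Set
    Q l r = ∃ λ (g : I → Bool) → ∀ s t → In[ l , r ] s → In[ l , r ] t → ∀ {B} → ¬ (p ∈□ B) → Seg B e s t → g s xor g t ≡ cr p (γ e s) (γ e t)
    loc : ∀ t → ∃₂ λ l₀ r₀ → l₀ <∙ proj₁ t × proj₁ t ∙< r₀ × (∀ {l r} → l₀ < l → r < r₀ → Q l r)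
    loc t₀ = let (A , i , n) = missBox {p} {e} off t₀
                 (l , r , u , v , f) = cont e t₀ i
             in l , r , u , v , λ pl pr → (λ s → cr p (γ e t₀) (γ e s)) , λ s t is it _ _ →
               let (a , b) = In[]-open {t = s} is pl pr
                   (c , d) = In[]-open {t = t} it pl pr
               in trans (cong (cr p (γ e t₀) (γ e s) xor_) (sym (cr-cocycle n i (f s a b) (f t c d)))) (xor-cancel (cr p (γ e t₀) (γ e s)) _)
    add : ∀ {l m r} → 0ℚ ≤ l → l ≤ m → m ≤ r → r ≤ 1ℚ → Q l m → Q m r → Q l r
    add {l} {m} {r} 0l lm mr r1 (g₁ , f₁) (g₂ , f₂) = G , ok
      where
      M : I
      M = toI (fromℚ m) (≤⇒≼ (ℚₚ.≤-trans 0l lm)) (≤⇒≼ (ℚₚ.≤-trans mr r1))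
      M₁ : In[ l , m ] M
      M₁ = ≤⇒≼ lm , ≼-refl
      M₂ : In[ m , r ] M
      M₂ = ≼-refl , ≤⇒≼ mr
      -- Both primitives are normalised to vanish at the common point `M`, so they can be glued.
      G′ : ∀ s → Dec (proj₁ s ≼ fromℚ m) → Bool
      G′ s (yes _) = g₁ s xor g₁ M
      G′ s (no _) = g₂ s xor g₂ M
      G : I → Bool
      G s = G′ s (dec (proj₁ s ≼ fromℚ m))
      two : ∀ x y z → (x xor z) xor (y xor z) ≡ x xor y
      two = bool 3 (λ x y z → (x ⊕ z) ⊕ (y ⊕ z) ⊜ x ⊕ y) refl
      ok′ : ∀ s t → (ds : Dec (proj₁ s ≼ fromℚ m)) (dt : Dec (proj₁ t ≼ fromℚ m)) → In[ l , r ] s → In[ l , r ] t → ∀ {B} → ¬ (p ∈□ B) → Seg B e s t → G′ s ds xor G′ t dt ≡ cr p (γ e s) (γ e t)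
      mid-case : ∀ s t → proj₁ s ≼ fromℚ m → ¬ (proj₁ t ≼ fromℚ m) → In[ l , r ] s → In[ l , r ] t → ∀ {B} → ¬ (p ∈□ B) → Seg B e s t → (g₁ s xor g₁ M) xor (g₂ t xor g₂ M) ≡ cr p (γ e s) (γ e t)
      mid-case s t a b is it n sg =
        let mt : fromℚ m ≼ proj₁ t
            mt = ≺⇒≼ (dne b)
            bt : Btw s t M
            bt = inj₁ (a , mt)
        in trans (cong₂ _xor_ (f₁ s M (proj₁ is , a) M₁ n (λ u h → sg u (Btw-sub {s} {t} {M} {u} bt h)))
                              (trans (xor-comm (g₂ t) (g₂ M)) (f₂ M t M₂ (mt , proj₂ it) n (λ u h → sg u (Btw-sym {t} {s} {u} (Btw-sub {t} {s} {M} {u} (Btw-sym {s} {t} {M} bt) (Btw-sym {M} {t} {u} h)))))))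
                 (cr-cocycle n (sg s (Btw-l {s} {t})) (sg M bt) (sg t (Btw-r {s} {t})))
      ok′ s t (yes a) (yes b) is it n sg = trans (two (g₁ s) (g₁ t) (g₁ M)) (f₁ s t (proj₁ is , a) (proj₁ it , b) n sg)
      ok′ s t (yes a) (no b) is it n sg = mid-case s t a b is it n sg
      ok′ s t (no a) (yes b) is it n sg = trans (xor-comm (g₂ s xor g₂ M) (g₁ t xor g₁ M)) (trans (mid-case t s b a it is n (λ u h → sg u (Btw-sym {t} {s} {u} h)))
         (cr-sym n (sg t (Btw-r {s} {t})) (sg s (Btw-l {s} {t}))))
      ok′ s t (no a) (no b) is it n sg = trans (two (g₂ s) (g₂ t) (g₂ M)) (f₂ s t (≺⇒≼ (dne a) , proj₂ is) (≺⇒≼ (dne b) , proj₂ it) n sg)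
      ok : ∀ s t → In[ l , r ] s → In[ l , r ] t → ∀ {B} → ¬ (p ∈□ B) → Seg B e s t → G s xor G t ≡ cr p (γ e s) (γ e t)
      ok s t = ok′ s t (dec (proj₁ s ≼ fromℚ m)) (dec (proj₁ t ≼ fromℚ m))

  opaque
    -- The parity of the crossings with the ray from `p`, accumulated from the start of the edge up
    -- to `t`. For `p` on the edge the value is junk.
    acc : ℝ² → E → I → Bool
    acc p e t with dec (Off p e)
    ... | yes off = proj₁ (prim {p} {e} off) 0ᴵ xor proj₁ (prim {p} {e} off) t
    ... | no _ = false

    acc-prim : ∀ {p e} → Off p e → Prim p e (acc p e)
    acc-prim {p} {e} off s t n sg with dec (Off p e)
    ... | no k = ⊥-elim (k off)
    ... | yes off' = trans (alg (g 0ᴵ) (g s) (g t)) (proj₂ (prim {p} {e} off') s t n sg)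
      where
      g : I → Bool
      g = proj₁ (prim {p} {e} off')
      alg : ∀ x y z → (x xor y) xor (x xor z) ≡ y xor z
      alg = bool 3 (λ x y z → (x ⊕ y) ⊕ (x ⊕ z) ⊜ y ⊕ z) refl

    acc-0 : ∀ p e → acc p e 0ᴵ ≡ false
    acc-0 p e with dec (Off p e)
    ... | yes off = xor-same (proj₁ (prim {p} {e} off) 0ᴵ)
    ... | no _ = refl

  acc-≋ : ∀ {p e s t} → Off p e → proj₁ s ≋ proj₁ t → acc p e s ≡ acc p e t
  acc-≋ {p} {e} {s} {t} off h = let (A , i , n) = missBox {p} {e} off s in
    xor-≡ (trans (acc-prim off s t n (λ u b → ∈-≑ (γ-≋ {e} {s} {u} (eq {u} b)) i)) (cr-≑ (γ-≋ {e} {s} {t} h)))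
    where
    eq : ∀ {u} → Btw s t u → proj₁ s ≋ proj₁ u
    eq (inj₁ (a , b)) = ≼-antisym a (≼-trans b (≈⇒⊀ (≋-sym h)))
    eq (inj₂ (a , b)) = ≼-antisym (≼-trans (≈⇒⊀ h) a) b

  var′ : ℝ² → E → Bool
  var′ p e = acc p e 1ᴵ

  edgeConst : ∀ e (G : I → Bool) → (∀ t → ∃ λ B → γ e t ∈□ B × (∀ s u → Seg B e s u → G s ≡ G u)) → G 0ᴵ ≡ G 1ᴵ
  edgeConst e G f = connI G 0ᴵ 1ᴵ λ a _ →
    let (B , i , g) = f a
        (l , r , u , v , h) = cont e a i
    in l , r , u , v , λ b x y _ → g b a (λ w bt → let (p , q) = Btw-open {b} {a} {w} bt x y u v in h w p q)

  var-exact : ∀ {p e} (g : ℝ² → Bool) → (∀ {a b} → a ≑ b → g a ≡ g b) → Off p e →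
    (∀ t → ∃ λ B → γ e t ∈□ B × ¬ (p ∈□ B) × (∀ {a b} → a ∈□ B → b ∈□ B → cr p a b ≡ g a xor g b)) →
    var′ p e ≡ g (vx (src e)) xor g (vx (tgt e))
  var-exact {p} {e} g resp off f = alg (acc p e 1ᴵ) (trans (sym (cong (_xor g (γ e 0ᴵ)) (acc-0 p e))) (edgeConst e (λ t → acc p e t xor g (γ e t)) loc))
    where
    loc : ∀ t → ∃ λ B → γ e t ∈□ B × (∀ s u → Seg B e s u → acc p e s xor g (γ e s) ≡ acc p e u xor g (γ e u))
    loc t = let (B , i , n , h) = f t in B , i , λ s u sg →
      xor-≡ (trans (xor-interchange (acc p e s) (g (γ e s)) (acc p e u) (g (γ e u)))
        (trans (cong (_xor (g (γ e s) xor g (γ e u))) (trans (acc-prim off s u n sg) (h (sg s (Btw-l {s} {u})) (sg u (Btw-r {s} {u}))))) (xor-same (g (γ e s) xor g (γ e u)))))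
    alg : ∀ A → g (γ e 0ᴵ) ≡ A xor g (γ e 1ᴵ) → A ≡ g (vx (src e)) xor g (vx (tgt e))
    alg A h = trans (sym (trans (cong (_xor g (γ e 1ᴵ)) h) (trans (xor-assoc A (g (γ e 1ᴵ)) (g (γ e 1ᴵ))) (trans (cong (A xor_) (xor-same (g (γ e 1ᴵ)))) (xor-identityʳ A)))))
       (cong₂ _xor_ (resp (γ-src {e} {0ᴵ} ≋-refl)) (resp (γ-tgt {e} {1ᴵ} ≋-refl)))

  -- By `cr-move`, the sum of `acc p e`, `acc q e` and `shift p q` is locally constant along the
  -- edge; its values at the two ends are compared.
  var-move : ∀ {p q e B} → Clear B e → p ∈□ B → q ∈□ B →
    var′ p e xor var′ q e ≡ shift p q (vx (src e)) xor shift p q (vx (tgt e))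
  var-move {p} {q} {e} {B} cl pB qB = trans (fin (acc p e 1ᴵ) (acc q e 1ᴵ) (g (γ e 0ᴵ)) (g (γ e 1ᴵ)) (trans (sym start0) (edgeConst e G loc)))
      (cong₂ _xor_ (shift-≑ {p} {q} (γ-src {e} {0ᴵ} ≋-refl)) (shift-≑ {p} {q} (γ-tgt {e} {1ᴵ} ≋-refl)))
    where
    g : ℝ² → Bool
    g = shift p q
    offp : Off p e
    offp = Clear-Off cl pB
    offq : Off q e
    offq = Clear-Off cl qB
    G : I → Bool
    G t = (acc p e t xor acc q e t) xor g (γ e t)
    start0 : G 0ᴵ ≡ g (γ e 0ᴵ)
    start0 = cong₂ (λ a b → (a xor b) xor g (γ e 0ᴵ)) (acc-0 p e) (acc-0 q e)
    fin : ∀ a b x y → x ≡ (a xor b) xor y → a xor b ≡ x xor y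
    fin a b x y refl = bool 3 (λ a b y → a ⊕ b ⊜ ((a ⊕ b) ⊕ y) ⊕ y) refl a b y
    loc : ∀ t → ∃ λ A → γ e t ∈□ A × (∀ s u → Seg A e s u → G s ≡ G u)
    loc t = let (A , i , sp) = cl t in A , i , λ s u sg →
      let sA = sg s (Btw-l {s} {u})
          uA = sg u (Btw-r {s} {u})
      in xor-≡ (trans (mix (acc p e s) (acc q e s) (g (γ e s)) (acc p e u) (acc q e u) (g (γ e u)))
           (trans (cong (_xor (g (γ e s) xor g (γ e u))) (trans (cong₂ _xor_ (acc-prim offp s u (Sep-∉ sp pB) sg) (acc-prim offq s u (Sep-∉ sp qB) sg)) (cr-move sp pB qB sA uA))) (xor-same (g (γ e s) xor g (γ e u)))))
      where
      mix : ∀ a b c d f h → ((a xor b) xor c) xor ((d xor f) xor h) ≡ ((a xor d) xor (b xor f)) xor (c xor h)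
      mix = bool 6 (λ a b c d f h → ((a ⊕ b) ⊕ c) ⊕ ((d ⊕ f) ⊕ h) ⊜ ((a ⊕ d) ⊕ (b ⊕ f)) ⊕ (c ⊕ h)) refl

  δ : (V → Bool) → E → Bool
  δ g e = g (src e) xor g (tgt e)

  -- A list of edges, with multiplicities modulo 2, without boundary.
  record Cycle (L : List E) : Set where
    constructor mkCycle
    field bd : ∀ g → ⨁ (δ g) L ≡ false
  open Cycle public

  Cycle-++ : ∀ {L M} → Cycle L → Cycle M → Cycle (L ++ M)
  Cycle-++ {L} {M} a b = mkCycle λ g → trans (⨁-++ (δ g) L M) (cong₂ _xor_ (bd a g) (bd b g))

  opaque
    -- The winding number modulo 2 of the cycle L around p.
    wind : List E → ℝ² → Bool
    wind L p = ⨁ (var′ p) L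

    wind≡ : ∀ L p → wind L p ≡ ⨁ (var′ p) L
    wind≡ L p = refl

  wind-++ : ∀ L M p → wind (L ++ M) p ≡ wind L p xor wind M p
  wind-++ L M p = trans (wind≡ (L ++ M) p) (trans (⨁-++ (var′ p) L M) (cong₂ _xor_ (sym (wind≡ L p)) (sym (wind≡ M p))))

  wind-∷ : ∀ e L p → wind (e ∷ L) p ≡ var′ p e xor wind L p
  wind-∷ e L p = trans (wind≡ (e ∷ L) p) (cong (var′ p e xor_) (sym (wind≡ L p)))

  -- `L` need not be closed. For a cycle the right-hand side vanishes; for a cycle without one edge
  -- it is the contribution of that edge.
  wind-move : ∀ {L p q B} → (∀ {e} → e ∈ L → Clear B e) → p ∈□ B → q ∈□ B →
    wind L p xor wind L q ≡ ⨁ (δ (λ v → shift p q (vx v))) L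
  wind-move {L} {p} {q} cl pB qB = trans (cong₂ _xor_ (wind≡ L p) (wind≡ L q)) (trans (sym (⨁-xor (var′ p) (var′ q) L)) (⨁-cong L λ m → var-move (cl m) pB qB))

  wind-local : ∀ {L x} → Cycle L → OffL x L → ∃ λ B → x ∈□ B × (∀ {e} → e ∈ L → Clear B e) × (∀ {y z} → y ∈□ B → z ∈□ B → wind L y ≡ wind L z)
  wind-local {L} {x} cy off = let (B , i , c) = avoidL L off in B , i , c , λ {y} {z} j k → xor-≡ (trans (wind-move c j k) (bd cy (λ v → shift y z (vx v))))

  wind-≑ : ∀ {L x y} → Cycle L → OffL x L → x ≑ y → wind L x ≡ wind L y
  wind-≑ cy off h = let (B , i , _ , f) = wind-local cy off in f i (∈-≑ h i)

  -- By `∉-split`, the crossing cochain of a point outside the square is a coboundary on the whole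
  -- square, and coboundaries vanish on cycles.
  wind-outside : ∀ {L lo hi p} → Cycle L → (∀ {e} → e ∈ L → ∀ t → Supp lo hi (γ e t)) → ¬ Supp lo hi p → wind L p ≡ false
  wind-outside {L} {lo} {hi} {p} cy w ns = from (∉-split pB)
    where
    B : Box
    B = mkBox lo hi lo hi
    pB : ¬ (p ∈□ B)
    pB i = ns (supp (∈-left i) (∈-right i) (∈-bottom i) (∈-top i))
    inB : ∀ {e} → e ∈ L → ∀ t → γ e t ∈□ B
    inB m t = let (supp a b c d) = w m t in mk∈ a b c d
    off : OffL p L
    off m t h = pB (∈-≑ h (inB m t))
    exact : (g : ℝ² → Bool) → (∀ {a b} → a ≑ b → g a ≡ g b) → (∀ {a b} → a ∈□ B → b ∈□ B → cr p a b ≡ g a xor g b) → wind L p ≡ false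
    exact g resp h = trans (wind≡ L p) (trans (⨁-cong L λ m → var-exact g resp (off m) λ t → B , inB m t , pB , h) (bd cy (λ v → g (vx v))))
    from : (∃ λ v → ∀ {a} → a ∈□ B → hgt p a ≡ v) ⊎ (∃ λ v → ∀ {a} → a ∈□ B → rgt p a ≡ v) → wind L p ≡ false
    from (inj₁ (v , f)) = exact (λ _ → false) (λ _ → refl) λ {a} i j → cong (_∧ rgt p a) (≡-xor (trans (f i) (sym (f j))))
    from (inj₂ (v , f)) = exact (λ a → hgt p a ∧ v) (λ h → cong (_∧ v) (hgt-≑ {p} h)) λ {a} {b} i j → trans (cong ((hgt p a xor hgt p b) ∧_) (f i)) (bool 3 (λ x y v → (x ⊕ y) ⊗ v ⊜ (x ⊗ v) ⊕ (y ⊗ v)) refl (hgt p a) (hgt p b) v)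

  wind-edge : ∀ {L} f s t → Cycle L → (∀ u → Btw s t u → OffL (γ f u) L) → wind L (γ f s) ≡ wind L (γ f t)
  wind-edge {L} f s t cy off = connI (λ u → wind L (γ f u)) s t λ a b →
    let (B , i , _ , g) = wind-local cy (off a b)
        (l , r , u , v , h) = cont f a i
    in l , r , u , v , λ c x y _ → g (h c x y) i

  -- Local connectedness of finite subgraphs

  mkOpen : (U : Point graph → Set) → (∀ {a b} → Glue graph a b → U a → U b) → (∀ {a b} → Glue graph a b → U b → U a) →
    (∀ e t → U (on e t) → ∃₂ λ l r → l <∙ proj₁ t × proj₁ t ∙< r × (∀ s → l <∙ proj₁ s → proj₁ s ∙< r → U (on e s))) → Open₁ graph U
  mkOpen U f g o = invariant U f g , λ e t u → let (l , r , a , b , h) = o e t u in l , r , (un<∙ a , un∙< b) , λ s x y → h s (mk<∙ x) (mk∙< y)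

  -- The continuity of the inverse of the embedding enters here: points of the graph that are close
  -- in the plane are close in the complex.
  openBox : ∀ {U} → Open₁ graph U → ∀ {a} → U a → ∃ λ B → φ a ∈□ B × (∀ b → φ b ∈□ B → U b)
  openBox {U} o {a} u = from (inverse U o)
    where
    from : (Σ (Pred ℝ² 0ℓ) λ W → Open W × (∀ a → U a ⇔ W (φ a))) → ∃ λ B → φ a ∈□ B × (∀ b → φ b ∈□ B → U b)
    from (W , oW , f) = let (B , i , h) = oW (φ a) (Equivalence.to (f a) u) in B , ∈ᴮ⇒∈□ i , λ b j → Equivalence.from (f b) (h (φ b) (∈□⇒∈ᴮ j))

  Interior-≋ : ∀ {s t : I} → proj₁ s ≋ proj₁ t → Interior s → Interior t
  Interior-≋ h (a , b) = ≺-resp ≋-refl h a , ≺-resp h ≋-refl b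

  Interior-open : ∀ {t : I} → Interior t → ∃₂ λ l r → l <∙ proj₁ t × proj₁ t ∙< r × (∀ (s : I) → l <∙ proj₁ s → proj₁ s ∙< r → Interior s)
  Interior-open ((q , a , b) , (q' , a' , b')) = q , q' , b , a' , λ s x y → (q , a , x) , (q' , y , b')

  module _ (K : List E) where

    -- `st` and `en` only change the name of a point, from an end of an edge to the vertex there.
    data Step (B : Box) : Point graph → Point graph → Set where
      seg : ∀ {e s t} → e ∈ K → Seg B e s t → Step B (on e s) (on e t)
      st  : ∀ {e t} → e ∈ K → proj₁ t ≋ 𝟎 → Step B (on e t) (vertex (src e))
      en  : ∀ {e t} → e ∈ K → proj₁ t ≋ 𝟏 → Step B (on e t) (vertex (tgt e))

    data Chain (B : Box) : Point graph → Point graph → Set where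
      nil : ∀ {a} → Chain B a a
      _▸_ : ∀ {a b c} → Step B a b → Chain B b c → Chain B a c
      _◂_ : ∀ {a b c} → Step B b a → Chain B b c → Chain B a c

    chain-trans : ∀ {B a b c} → Chain B a b → Chain B b c → Chain B a c
    chain-trans nil d = d
    chain-trans (s ▸ c) d = s ▸ chain-trans c d
    chain-trans (s ◂ c) d = s ◂ chain-trans c d

    chain-sym : ∀ {B a b} → Chain B a b → Chain B b a
    chain-sym nil = nil
    chain-sym (s ▸ c) = chain-trans (chain-sym c) (s ◂ nil)
    chain-sym (s ◂ c) = chain-trans (chain-sym c) (s ▸ nil)

    -- The open set used is completed by the interiors of the edges outside K.
    nbhd : ∀ {e₀ t₀ B} → e₀ ∈ K → γ e₀ t₀ ∈□ B → ∃ λ B₁ → γ e₀ t₀ ∈□ B₁ ×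
      (∀ {e t} → e ∈ K → γ e t ∈□ B₁ → Chain B (on e₀ t₀) (on e t))
    nbhd {e₀} {t₀} {B} m₀ i₀ = let (B₁ , i , h) = openBox (mkOpen U f g o) {on e₀ t₀} (inj₁ (m₀ , i₀ , nil)) in B₁ , i ,
        λ {e} {t} m j → [ (λ { (_ , _ , c) → c }) , (λ { (n , _) → ⊥-elim (n m) }) ]′ (h (on e t) j)
      where
      Pr : Point graph → Set
      Pr a = φ a ∈□ B × Chain B (on e₀ t₀) a
      U : Point graph → Set
      U (vertex v) = Pr (vertex v)
      U (on e t) = (e ∈ K × Pr (on e t)) ⊎ (e ∉ K × (Interior t ⊎ (proj₁ t ≋ 𝟎 × Pr (vertex (src e))) ⊎ (proj₁ t ≋ 𝟏 × Pr (vertex (tgt e)))))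
      move : ∀ {e s t} → proj₁ s ≋ proj₁ t → e ∈ K → Pr (on e s) → Pr (on e t)
      move {e} {s} {t} h m (i , c) = ∈-≑ (γ-≋ {e} {s} {t} h) i , chain-trans c (seg m (λ u b → ∈-≑ (γ-≋ {e} {s} {u} (eq {u} b)) i) ▸ nil)
        where
        eq : ∀ {u} → Btw s t u → proj₁ s ≋ proj₁ u
        eq (inj₁ (a , b)) = ≼-antisym a (≼-trans b (≈⇒⊀ (≋-sym h)))
        eq (inj₂ (a , b)) = ≼-antisym (≼-trans (≈⇒⊀ h) a) b
      slide : ∀ {e s t} → proj₁ s ≋ proj₁ t → U (on e s) → U (on e t)
      slide {e} {s} {t} h (inj₁ (m , p)) = inj₁ (m , move {e} {s} {t} h m p)
      slide {e} {s} {t} h (inj₂ (n , inj₁ i)) = inj₂ (n , inj₁ (Interior-≋ {s} {t} h i))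
      slide h (inj₂ (n , inj₂ (inj₁ (z , p)))) = inj₂ (n , inj₂ (inj₁ (≋-trans (≋-sym h) z , p)))
      slide h (inj₂ (n , inj₂ (inj₂ (z , p)))) = inj₂ (n , inj₂ (inj₂ (≋-trans (≋-sym h) z , p)))
      f : ∀ {a b} → Glue graph a b → U a → U b
      f (same {e} {s} {t} h) u = slide {e} {s} {t} (mk≋ h) u
      f start (inj₁ (m , i , c)) = ∈-≑ (γ-src {t = 0ᴵ} ≋-refl) i , chain-trans c (st m ≋-refl ▸ nil)
      f start (inj₂ (_ , inj₁ i)) = ⊥-elim (0≉int {0ᴵ} i ≋-refl)
      f start (inj₂ (_ , inj₂ (inj₁ (_ , p)))) = p
      f start (inj₂ (_ , inj₂ (inj₂ (z , _)))) = ⊥-elim (0≉1 ≋-refl z)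
      f end (inj₁ (m , i , c)) = ∈-≑ (γ-tgt {t = 1ᴵ} ≋-refl) i , chain-trans c (en m ≋-refl ▸ nil)
      f end (inj₂ (_ , inj₁ i)) = ⊥-elim (1≉int {1ᴵ} i ≋-refl)
      f end (inj₂ (_ , inj₂ (inj₁ (z , _)))) = ⊥-elim (0≉1 z ≋-refl)
      f end (inj₂ (_ , inj₂ (inj₂ (_ , p)))) = p
      g : ∀ {a b} → Glue graph a b → U b → U a
      g (same {e} {s} {t} h) u = slide {e} {t} {s} (≋-sym (mk≋ h)) u
      g (start {e}) p = from (dec (e ∈ K))
        where
        from : Dec (e ∈ K) → U (on e 0ᴵ)
        from (yes m) = inj₁ (m , ∈-≑ (≑-sym (γ-src {t = 0ᴵ} ≋-refl)) (proj₁ p) , chain-trans (proj₂ p) (st m ≋-refl ◂ nil))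
        from (no n) = inj₂ (n , inj₂ (inj₁ (≋-refl , p)))
      g (end {e}) p = from (dec (e ∈ K))
        where
        from : Dec (e ∈ K) → U (on e 1ᴵ)
        from (yes m) = inj₁ (m , ∈-≑ (≑-sym (γ-tgt {t = 1ᴵ} ≋-refl)) (proj₁ p) , chain-trans (proj₂ p) (en m ≋-refl ◂ nil))
        from (no n) = inj₂ (n , inj₂ (inj₂ (≋-refl , p)))
      o : ∀ e t → U (on e t) → ∃₂ λ l r → l <∙ proj₁ t × proj₁ t ∙< r × (∀ s → l <∙ proj₁ s → proj₁ s ∙< r → U (on e s))
      o e t (inj₁ (m , i , c)) = let (l , r , u , v , h) = cont e t i in l , r , u , v , λ s x y →
        inj₁ (m , h s x y , chain-trans c (seg m (λ w b → let (p , q) = Btw-open {t} {s} {w} b u v x y in h w p q) ▸ nil))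
      o e t (inj₂ (n , inj₁ i)) = let (l , r , u , v , h) = Interior-open {t} i in l , r , u , v , λ s x y → inj₂ (n , inj₁ (h s x y))
      o e t (inj₂ (n , inj₂ (inj₁ (z , p)))) = - 1ℚ , 1ℚ , <∙-≼ {𝟎} (<⇒<∙ (ℚₚ.negative⁻¹ (- 1ℚ))) (≈⇒⊁ z) , ≈-∙< (≋-sym z) (<⇒∙< (0<1/ 0)) , λ s x y →
        inj₂ (n , [ (λ w → inj₂ (inj₁ (w , p))) , [ (λ w → ⊥-elim (≈⇒⊀ (≋-sym w) (∙<⇒≺ y))) , inj₁ ]′ ]′ (I-cases s))
      o e t (inj₂ (n , inj₂ (inj₂ (z , p)))) = 0ℚ , 1ℚ + 1ℚ , ≈-<∙ (≋-sym z) (<⇒<∙ (0<1/ 0)) , ≈-∙< (≋-sym z) (<⇒∙< 1<2) , λ s x y →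
        inj₂ (n , [ (λ w → ⊥-elim (≈⇒⊀ w (<∙⇒≺ x))) , [ (λ w → inj₂ (inj₂ (w , p))) , inj₁ ]′ ]′ (I-cases s))
        where
        1<2 : 1ℚ < 1ℚ + 1ℚ
        1<2 = lin< (0<1/ 0) (linear 1 (λ a → (a :+ a) :+ :0 := a :+ a) refl 1ℚ)

    module _ (𝓑 : Box → Set) (cover : ∀ {e} → e ∈ K → ∀ t → ∃ λ B → 𝓑 B × γ e t ∈□ B) where

      private
        Good : ℚ → E → I → Set
        Good ε e s = ∀ {b f t} → Size ε b → γ e s ∈□ b → f ∈ K → γ f t ∈□ b → ∃ λ B → 𝓑 B × b ⊑ B × Chain B (on e s) (on f t)

        edgeGood : ∀ {e} → e ∈ K → ∃ λ ε → 0ℚ < ε × (∀ s → Good ε e s)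
        edgeGood {e} m = let (ε , p , h) = cousinI Q add loc in ε , p , λ s → h s (All-In s)
          where
          Q : ℚ → ℚ → Set
          Q l r = ∃ λ ε → 0ℚ < ε × (∀ s → In[ l , r ] s → Good ε e s)
          add : ∀ {l m r} → 0ℚ ≤ l → l ≤ m → m ≤ r → r ≤ 1ℚ → Q l m → Q m r → Q l r
          add _ _ _ _ (ε , p , h) (ε' , p' , h') = ε ⊓ ε' , 0<⊓ p p' ,
            pointwise {R = Good (ε ⊓ ε') e} (λ s i z → h s i (Size-mono (ℚₚ.p⊓q≤p ε ε') z)) (λ s i z → h' s i (Size-mono (ℚₚ.p⊓q≤q ε ε') z))
          loc : ∀ t → ∃₂ λ l₀ r₀ → l₀ <∙ proj₁ t × proj₁ t ∙< r₀ × (∀ {l r} → l₀ < l → r < r₀ → Q l r)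
          loc t₀ =
            let (B , bB , i) = cover m t₀
                (B₁ , i₁ , ch) = nbhd m i
                (B₂ , ε , i₂ , pos , _ , mg) = margin (∈⊓ i i₁)
                (l , r , u , v , h) = cont e t₀ i₂
            in l , r , u , v , λ pl pr → ε , pos , λ s is {b} {f} {t} z sb mf tb →
              let (x , y) = In[]-open {t = s} is pl pr
                  b⊑ = mg (h s x y) z sb
                  b⊑B = ⊑-trans b⊑ (⊓⊑ˡ B B₁)
                  b⊑B₁ = ⊑-trans b⊑ (⊓⊑ʳ B B₁)
              in B , bB , b⊑B , chain-trans (chain-sym (ch m (∈-⊑ b⊑B₁ sb))) (ch mf (∈-⊑ b⊑B₁ tb))

        listGood : ∀ L → (∀ {e} → e ∈ L → e ∈ K) → ∃ λ ε → 0ℚ < ε × (∀ {e} → e ∈ L → ∀ s → Good ε e s)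
        listGood [] _ = 1ℚ , 0<1/ 0 , λ ()
        listGood (e ∷ L) inc =
          let (ε , p , h) = edgeGood (inc (here refl))
              (ε' , p' , h') = listGood L (λ m → inc (there m))
          in ε ⊓ ε' , 0<⊓ p p' , λ { (here refl) s z → h s (Size-mono (ℚₚ.p⊓q≤p ε ε') z) ; (there m) s z → h' m s (Size-mono (ℚₚ.p⊓q≤q ε ε') z) }

      -- Uniform local connectedness, with a Lebesgue number for the cover `𝓑`. It lets a pair of
      -- close points on the graph be replaced by a path along the graph.
      locallyConnected : ∃ λ ε → 0ℚ < ε × (∀ {b e s f t} → Size ε b → e ∈ K → γ e s ∈□ b → f ∈ K → γ f t ∈□ b → ∃ λ B → 𝓑 B × b ⊑ B × Chain B (on e s) (on f t))
      locallyConnected = let (ε , p , h) = listGood K (λ m → m) in ε , p , λ z m i mf j → h m _ z i mf j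

  -- Pushing an outline into the boundary edges

  listBound : ∀ {A : Set} (Q : List A) (R : ℚ → A → Set) → (∀ {ε ε' a} → ε ≤ ε' → R ε' a → R ε a) →
    (∀ {a} → a ∈ Q → ∃ λ ε → 0ℚ < ε × R ε a) → ∃ λ ε → 0ℚ < ε × (∀ {a} → a ∈ Q → R ε a)
  listBound [] R mono f = 1ℚ , 0<1/ 0 , λ ()
  listBound (a ∷ Q) R mono f =
    let (ε , p , h) = f (here refl)
        (ε' , p' , h') = listBound Q R mono (λ m → f (there m))
    in ε ⊓ ε' , 0<⊓ p p' , λ { (here refl) → mono (ℚₚ.p⊓q≤p ε ε') h ; (there m) → mono (ℚₚ.p⊓q≤q ε ε') (h' m) }

  missList : ∀ {x} (Q : List ℝ²) → (∀ {q} → q ∈ Q → ¬ (x ≑ q)) → ∃ λ B → x ∈□ B × (∀ {q} → q ∈ Q → ¬ (q ∈□ B))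
  missList {x} [] h = let (B , i , _) = smallBox x (0<1/ 0) in B , i , λ ()
  missList {x} (q ∷ Q) h =
    let (A , A' , i , j , s) = ≉⇒Sep (h (here refl))
        (B , i' , k) = missList Q (λ m → h (there m))
    in A ⊓□ B , ∈⊓ i i' , λ { (here refl) w → Sep-∉ s (∈-⊑ (⊓⊑ˡ A B) w) j ; (there m) w → k m (∈-⊑ (⊓⊑ʳ A B) w) }

  -- The boundary of a region whose frontier lies in a set X of points of the
  -- finite subgraph K and in a remote closed set Ext is pushed into the edges D
  -- that X contains entirely.  An edge e outside D is cut at a point z e off X.
  module Push
    (K D : List E) (X : E → I → Set) (X⊂K : ∀ {e t} → X e t → e ∈ K) (D⊂K : ∀ {e} → e ∈ D → e ∈ K)
    (z : E → I) (zfree : ∀ {e} → e ∈ K → e ∉ D → ∃ λ B → γ e (z e) ∈□ B × (∀ {f t} → X f t → ¬ (γ f t ∈□ B)))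
    (Ext : ℝ² → Set) (ε₀ : ℚ) (ε₀>0 : 0ℚ < ε₀)
    (apart : ∀ {b e t y} → Size ε₀ b → X e t → γ e t ∈□ b → Ext y → ¬ (y ∈□ b))
    (Φ : ℝ² → Set)
    (inv : ∀ {x y B} → x ∈□ B → y ∈□ B → (∀ {e t} → X e t → ¬ (γ e t ∈□ B)) → (∀ {a} → Ext a → ¬ (a ∈□ B)) → Φ x → Φ y)
    (lo hi : ℚ) (lo≤hi : lo ≤ hi) (sup : ∀ {x} → Φ x → Supp lo hi x)
    (Q : List ℝ²) (Q-off : ∀ {q} → q ∈ Q → OffL q K)
    (Q-free : ∀ {q} → q ∈ Q → ∃ λ B → q ∈□ B × (∀ {e t} → X e t → ¬ (γ e t ∈□ B)) × (∀ {a} → Ext a → ¬ (a ∈□ B)))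
    (exact : ∀ {q q'} → q ∈ Q → q' ∈ Q → ∃ λ (g : ℝ² → Bool) → ∀ {b a a'} → Size ε₀ b → Ext a → a ∈□ b → Ext a' → a' ∈□ b →
       cr q a a' xor cr q' a a' ≡ g a xor g a') where

    private
      wd : List E → ℝ² → Bool
      wd L q = ⨁ (var′ q) L

      T : Set
      T = (∃₂ λ e t → X e t) ⊎ ∃ Ext
      pos : T → ℝ²
      pos (inj₁ (e , t , _)) = γ e t
      pos (inj₂ (y , _)) = y
      open Star pos

      Avoids : Box → Set
      Avoids B = (∀ {q} → q ∈ Q → ¬ (q ∈□ B)) × (∀ {e} → e ∈ K → e ∉ D → ¬ (γ e (z e) ∈□ B))

      𝓑 : Box → Set
      𝓑 B = Avoids B ⊎ (∀ {f t} → X f t → ¬ (γ f t ∈□ B))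

      cover : ∀ {e} → e ∈ K → ∀ t → ∃ λ B → 𝓑 B × γ e t ∈□ B
      cover {e} m t = from (dec (∃ λ q → q ∈ Q × γ e t ≑ q)) (dec (∃ λ f → f ∈ K × f ∉ D × γ e t ≑ γ f (z f)))
        where
        cuts : ∀ L → (∀ {f} → f ∈ L → f ∈ K) → (¬ ∃ λ f → f ∈ K × f ∉ D × γ e t ≑ γ f (z f)) → ∃ λ B → γ e t ∈□ B × (∀ {f} → f ∈ L → f ∉ D → ¬ (γ f (z f) ∈□ B))
        cuts [] inc no′ = let (B , i , _) = smallBox (γ e t) (0<1/ 0) in B , i , λ ()
        cuts (f ∷ L) inc no′ = go (dec (f ∈ D)) (cuts L (λ m → inc (there m)) no′)
          where
          go : Dec (f ∈ D) → (∃ λ B → γ e t ∈□ B × (∀ {f} → f ∈ L → f ∉ D → ¬ (γ f (z f) ∈□ B))) → ∃ λ B → γ e t ∈□ B × (∀ {g} → g ∈ f ∷ L → g ∉ D → ¬ (γ g (z g) ∈□ B))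
          go (yes d) (B , i , h) = B , i , λ { (here refl) n → ⊥-elim (n d) ; (there m) → h m }
          go (no n) (B , i , h) = let (A , A' , j , k , s) = ≉⇒Sep (λ w → no′ (f , inc (here refl) , n , w)) in
            A ⊓□ B , ∈⊓ j i , λ { (here refl) _ w → Sep-∉ s (∈-⊑ (⊓⊑ˡ A B) w) k ; (there m) n' w → h m n' (∈-⊑ (⊓⊑ʳ A B) w) }
        from : _ → _ → ∃ λ B → 𝓑 B × γ e t ∈□ B
        from (yes (q , mq , h)) _ = let (B , i , f , _) = Q-free mq in B , inj₂ f , ∈-≑ (≑-sym h) i
        from (no _) (yes (f , mf , nf , h)) = let (B , i , k) = zfree mf nf in B , inj₂ k , ∈-≑ (≑-sym h) i
        from (no a) (no b) = let (B , i , h) = missList Q (λ m w → a (_ , m , w))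
                                 (B' , i' , h') = cuts K (λ m → m) b
          in B ⊓□ B' , inj₁ ((λ m w → h m (∈-⊑ (⊓⊑ˡ B B') w)) , λ m n w → h' m n (∈-⊑ (⊓⊑ʳ B B') w)) , ∈⊓ i i'

      side′ : ∀ {e} → Dec (e ∈ D) → I → Bool
      side′ (yes _) t = false
      side′ {e} (no _) t = ⟦ proj₁ (z e) ≺ proj₁ t ⟧
      side : E → I → Bool
      side e t = side′ {e} (dec (e ∈ D)) t

      -- The retraction. An edge with a cut is contracted from the cut to its two ends, an edge of
      -- `D` to its source; so a path picks up an edge only when it passes the target of an edge of
      -- `D`.
      base : Point graph → V
      base (vertex v) = v
      base (on e t) = if side e t then tgt e else src e

      -- The parity of crossings on the way between a point and its `base`.
      α : ℝ² → Point graph → Bool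
      α q (vertex v) = false
      α q (on e t) = acc q e t xor (side e t ∧ var′ q e)

      record Path (a b : Point graph) (B : Box) : Set where
        constructor path
        field
          Jl   : List E
          J⊂D  : ∀ {e} → e ∈ Jl → e ∈ D
          ends : ∀ g → g (base a) xor g (base b) ≡ ⨁ (δ g) Jl
          meas : ∀ {q} → q ∈ Q → cr q (φ a) (φ b) ≡ (α q a xor α q b) xor ⨁ (var′ q) Jl
          stay : φ b ∈□ B

      module _ {B : Box} (av : Avoids B) where
        side-seg : ∀ {e s t} → e ∈ K → Seg B e s t → side e s ≡ side e t
        side-seg {e} {s} {t} m sg = go (dec (e ∈ D))
          where
          go : (d : Dec (e ∈ D)) → side′ {e} d s ≡ side′ {e} d t
          go (yes _) = refl
          go (no n) = ⟦⟧-cong (λ h → dne λ k → proj₂ av m n (sg (z e) (inj₂ (k , ≺⇒≼ h)))) (λ h → dne λ k → proj₂ av m n (sg (z e) (inj₁ (k , ≺⇒≼ h))))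

        stepPath : ∀ {a b} → Step K B a b → φ a ∈□ B → Path a b B
        stepPath (seg {e} {s} {t} m sg) i = path [] (λ ())
          (λ g → ≡-xor (cong (λ b → g (if b then tgt e else src e)) (side-seg {e} {s} {t} m sg)))
          (λ {q} mq → trans (sym (acc-prim (Q-off mq m) s t (proj₁ av mq) sg)) (trans (alg (acc q e s) (acc q e t) (side e s ∧ var′ q e))
             (cong (λ b → ((acc q e s xor (side e s ∧ var′ q e)) xor (acc q e t xor (b ∧ var′ q e))) xor false) (side-seg {e} {s} {t} m sg))))
          (sg t (Btw-r {s} {t}))
          where
          alg : ∀ a b c → a xor b ≡ ((a xor c) xor (b xor c)) xor false
          alg = λ a b c → trans (bool 3 (λ a b c → a ⊕ b ⊜ (a ⊕ c) ⊕ (b ⊕ c)) refl a b c) (sym (xor-identityʳ _))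
        stepPath (st {e} {t} m h) i = path [] (λ ())
          (λ g → ≡-xor (cong (λ b → g (if b then tgt e else src e)) low))
          (λ {q} mq → trans (cr-≑ (γ-src h)) (sym (trans (xor-identityʳ _) (trans (xor-identityʳ _) (cong₂ (λ a b → a xor (b ∧ var′ q e)) (trans (acc-≋ {q} {e} {t} {0ᴵ} (Q-off mq m) h) (acc-0 q e)) low)))))
          (∈-≑ (γ-src h) i)
          where
          low : side e t ≡ false
          low = go (dec (e ∈ D))
            where
            go : (d : Dec (e ∈ D)) → side′ {e} d t ≡ false
            go (yes _) = refl
            go (no _) = ⟦⟧-false λ k → I≥0 (z e) (≺-≼ k (≈⇒⊀ h))
        stepPath (en {e} {t} m h) i = go (dec (e ∈ D)) refl
          where
          acc1 : ∀ {q} → q ∈ Q → acc q e t ≡ var′ q e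
          acc1 {q} mq = acc-≋ {q} {e} {t} {1ᴵ} (Q-off mq m) h
          go : (d : Dec (e ∈ D)) → dec (e ∈ D) ≡ d → Path (on e t) (vertex (tgt e)) B
          -- Here the path passes from the edge, represented by its source, to the target, and thus
          -- acquires the edge.
          go (yes d) eq = path (e ∷ []) (λ { (here refl) → d })
            (λ g → trans (cong (λ b → g (if b then tgt e else src e) xor g (tgt e)) low) (sym (xor-identityʳ (δ g e))))
            (λ {q} mq → trans (cr-≑ (γ-tgt h)) (sym (trans (cong₂ (λ a b → ((a xor (b ∧ var′ q e)) xor false) xor (var′ q e xor false)) (acc1 mq) low) (self (var′ q e)))))
            (∈-≑ (γ-tgt h) i)
            where
            low : side e t ≡ false
            low = cong (λ d → side′ {e} d t) eq
            self : ∀ v → ((v xor false) xor false) xor (v xor false) ≡ false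
            self false = refl
            self true = refl
          go (no n) eq = path [] (λ ())
            (λ g → ≡-xor (cong (λ b → g (if b then tgt e else src e)) up))
            (λ {q} mq → trans (cr-≑ (γ-tgt h)) (sym (trans (cong₂ (λ a b → ((a xor (b ∧ var′ q e)) xor false) xor false) (acc1 mq) up) (self (var′ q e)))))
            (∈-≑ (γ-tgt h) i)
            where
            up : side e t ≡ true
            up = trans (cong (λ d → side′ {e} d t) eq) (⟦⟧-true (dne λ k → proj₂ av m n (∈-≑ (γ-≋ {e} {t} {z e} (≼-antisym k (≼-trans (I≤1 (z e)) (≈⇒⊁ h)))) i)))
            self : ∀ v → ((v xor v) xor false) xor false ≡ false
            self false = refl
            self true = refl

        backPath : ∀ {a b} → Step K B b a → φ a ∈□ B → Path a b B
        backPath {a} {b} s i = let (path J J⊂D e m _) = stepPath s (start∈ s i) in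
          path J J⊂D (λ g → trans (xor-comm (g (base a)) (g (base b))) (e g))
            (λ {q} mq → trans (cr-sym (proj₁ av mq) i (start∈ s i)) (trans (m mq) (cong (_xor ⨁ (var′ q) J) (xor-comm (α q b) (α q a))))) (start∈ s i)
          where
          start∈ : ∀ {a b} → Step K B b a → φ a ∈□ B → φ b ∈□ B
          start∈ (seg {e} {s} {t} _ sg) _ = sg s (Btw-l {s} {t})
          start∈ (st _ h) i = ∈-≑ (≑-sym (γ-src h)) i
          start∈ (en _ h) i = ∈-≑ (≑-sym (γ-tgt h)) i

        join : ∀ {a b c} → φ a ∈□ B → Path a b B → Path b c B → Path a c B
        join {a} {b} {c} i (path J s e m k) (path J' s' e' m' k') = path (J ++ J') (λ w → [ s , s' ]′ (∈-++⁻ J w))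
          (λ g → trans (tel (g (base a)) (g (base b)) (g (base c))) (trans (cong₂ _xor_ (e g) (e' g)) (sym (⨁-++ (δ g) J J'))))
          (λ {q} mq → trans (sym (cr-cocycle (proj₁ av mq) i k k')) (trans (cong₂ _xor_ (m mq) (m' mq)) (trans (mix (α q a) (α q b) (α q c) (⨁ (var′ q) J) (⨁ (var′ q) J')) (cong ((α q a xor α q c) xor_) (sym (⨁-++ (var′ q) J J'))))))
          k'
          where
          tel : ∀ x y z → x xor z ≡ (x xor y) xor (y xor z)
          tel = bool 3 (λ x y z → x ⊕ z ⊜ (x ⊕ y) ⊕ (y ⊕ z)) refl
          mix : ∀ x y z u v → ((x xor y) xor u) xor ((y xor z) xor v) ≡ (x xor z) xor (u xor v)
          mix = bool 5 (λ x y z u v → ((x ⊕ y) ⊕ u) ⊕ ((y ⊕ z) ⊕ v) ⊜ (x ⊕ z) ⊕ (u ⊕ v)) refl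

        chainPath : ∀ {a b} → Chain K B a b → φ a ∈□ B → Path a b B
        chainPath {a} nil i = path [] (λ ()) (λ g → xor-same (g (base a))) (λ {q} _ → trans (cr-≑ ≑-refl) (sym (trans (xor-identityʳ _) (xor-same (α q a))))) i
        chainPath (s ▸ c) i = let p = stepPath s i in join i p (chainPath c (Path.stay p))
        chainPath (s ◂ c) i = let p = backPath s i in join i p (chainPath c (Path.stay p))

      ptOf : ∃₂ (λ e t → X e t) → Point graph
      ptOf (e , t , _) = on e t

      gT : (V → Bool) → T → Bool
      gT g (inj₁ x) = g (base (ptOf x))
      gT g (inj₂ _) = false

      aT : ∀ {q q'} → q ∈ Q → q' ∈ Q → T → Bool
      aT {q} {q'} _ _ (inj₁ x) = α q (ptOf x) xor α q' (ptOf x)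
      aT m m' (inj₂ (y , _)) = proj₁ (exact m m') y

      Pair : T × T → Set
      Pair (a , b) = ∃ λ J → (∀ {e} → e ∈ J → e ∈ D) × (∀ g → gT g a xor gT g b ≡ ⨁ (δ g) J) ×
        (∀ {q q'} (m : q ∈ Q) (m' : q' ∈ Q) → (cr q (pos a) (pos b) xor cr q' (pos a) (pos b)) xor (wd J q xor wd J q') ≡ aT m m' a xor aT m m' b)

      lc = locallyConnected K 𝓑 cover
      ε₁ = proj₁ lc
      testBound = listBound Q (λ ε q → ∀ {B} → Size ε B → q ∈□ B → (∀ {e t} → X e t → ¬ (γ e t ∈□ B)) × (∀ {a} → Ext a → ¬ (a ∈□ B)))
        (λ le h s i → h (Size-mono le s) i)
        (λ m → let (B , i , f , g) = Q-free m
                   (B₁ , ε , i₁ , p , _ , mg) = margin i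
               in ε , p , λ s j → (λ x k → f x (∈-⊑ (mg i₁ s j) k)) , λ x k → g x (∈-⊑ (mg i₁ s j) k))
      ε₂ = proj₁ testBound
      ε : ℚ
      ε = ε₀ ⊓ (ε₁ ⊓ ε₂)
      ε≤₀ : ε ≤ ε₀
      ε≤₀ = ℚₚ.p⊓q≤p ε₀ (ε₁ ⊓ ε₂)
      ε≤₁ : ε ≤ ε₁
      ε≤₁ = ℚₚ.≤-trans (ℚₚ.p⊓q≤q ε₀ (ε₁ ⊓ ε₂)) (ℚₚ.p⊓q≤p ε₁ ε₂)
      ε≤₂ : ε ≤ ε₂
      ε≤₂ = ℚₚ.≤-trans (ℚₚ.p⊓q≤q ε₀ (ε₁ ⊓ ε₂)) (ℚₚ.p⊓q≤q ε₁ ε₂)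
      ε>0 : 0ℚ < ε
      ε>0 = 0<⊓ ε₀>0 (0<⊓ (proj₁ (proj₂ lc)) (proj₁ (proj₂ testBound)))

      far : ∀ {q} → q ∈ Q → Far ε q
      far m s i (inj₁ (e , t , x)) = proj₁ (proj₂ (proj₂ testBound) m (Size-mono ε≤₂ s) i) x
      far m s i (inj₂ (y , x)) = proj₂ (proj₂ (proj₂ testBound) m (Size-mono ε≤₂ s) i) x

      pair : ∀ {a b B} → Size ε B → pos a ∈□ B → pos b ∈□ B → Pair (a , b)
      pair {inj₁ (e , s , x)} {inj₁ (f , t , y)} {b} sz i j = go (proj₂ (proj₂ lc) (Size-mono ε≤₁ sz) (X⊂K x) i (X⊂K y) j)
        where
        go : (∃ λ B → 𝓑 B × b ⊑ B × Chain K B (on e s) (on f t)) → Pair (inj₁ (e , s , x) , inj₁ (f , t , y))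
        go (B , inj₂ free , b⊑ , c) = ⊥-elim (free x (∈-⊑ b⊑ i))
        go (B , inj₁ av , b⊑ , c) = let (path J J⊂D ed me _) = chainPath av c (∈-⊑ b⊑ i) in J , J⊂D , ed ,
          λ {q} {q'} m m' → trans (cong₂ (λ u v → (u xor v) xor (wd J q xor wd J q')) (me m) (me m'))
            (mix (α q (on e s)) (α q (on f t)) (α q' (on e s)) (α q' (on f t)) (wd J q) (wd J q'))
          where
          mix : ∀ a b c d u v → (((a xor b) xor u) xor ((c xor d) xor v)) xor (u xor v) ≡ (a xor c) xor (b xor d)
          mix = bool 6 (λ a b c d u v → (((a ⊕ b) ⊕ u) ⊕ ((c ⊕ d) ⊕ v)) ⊕ (u ⊕ v) ⊜ (a ⊕ c) ⊕ (b ⊕ d)) refl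
      pair {inj₁ (e , s , x)} {inj₂ (y , k)} sz i j = ⊥-elim (apart (Size-mono ε≤₀ sz) x i k j)
      pair {inj₂ (y , k)} {inj₁ (e , s , x)} sz i j = ⊥-elim (apart (Size-mono ε≤₀ sz) x j k i)
      pair {inj₂ (y , k)} {inj₂ (y' , k')} sz i j = [] , (λ ()) , (λ _ → refl) , λ m m' → trans (xor-identityʳ _) (proj₂ (exact m m') (Size-mono ε≤₀ sz) k i k' j)

      collect : ∀ (Z : List (T × T)) → (∀ {w} → w ∈ Z → Pair w) → ∃ λ L → (∀ {e} → e ∈ L → e ∈ D) ×
        (∀ g → ⨁ (δ g) L ≡ ⨁ (λ w → gT g (proj₁ w) xor gT g (proj₂ w)) Z) ×
        (∀ {q q'} (m : q ∈ Q) (m' : q' ∈ Q) → wd L q xor wd L q' ≡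
          (⨁ (λ w → cr q (pos (proj₁ w)) (pos (proj₂ w))) Z xor ⨁ (λ w → cr q' (pos (proj₁ w)) (pos (proj₂ w))) Z) xor ⨁ (λ w → aT m m' (proj₁ w) xor aT m m' (proj₂ w)) Z)
      collect [] h = [] , (λ ()) , (λ _ → refl) , λ _ _ → refl
      collect (w ∷ Z) h =
        let (J , s , e , k) = h (here refl)
            (L , s' , e' , k') = collect Z (λ m → h (there m))
        in J ++ L , (λ m → [ s , s' ]′ (∈-++⁻ J m)) , (λ g → trans (⨁-++ (δ g) J L) (cong₂ _xor_ (sym (e g)) (e' g))) ,
          λ {q} {q'} m m' → trans (cong₂ _xor_ (⨁-++ (var′ q) J L) (⨁-++ (var′ q') J L)) (trans (xor-interchange (wd J q) (wd L q) (wd J q') (wd L q'))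
            (trans (cong₂ _xor_ (solve-for (cr q (pos (proj₁ w)) (pos (proj₂ w)) xor cr q' (pos (proj₁ w)) (pos (proj₂ w))) (wd J q xor wd J q') _ (k m m')) (k' m m')) (mix (cr q (pos (proj₁ w)) (pos (proj₂ w))) (cr q' (pos (proj₁ w)) (pos (proj₂ w))) (aT m m' (proj₁ w) xor aT m m' (proj₂ w)) _ _ _)))
        where
        solve-for : ∀ a b c → a xor b ≡ c → b ≡ a xor c
        solve-for a b c refl = sym (xor-cancel a b)
        mix : ∀ a b c d e f → ((a xor b) xor c) xor ((d xor e) xor f) ≡ ((a xor d) xor (b xor e)) xor (c xor f)
        mix = bool 6 (λ a b c d e f → ((a ⊕ b) ⊕ c) ⊕ ((d ⊕ e) ⊕ f) ⊜ ((a ⊕ d) ⊕ (b ⊕ e)) ⊕ (c ⊕ f)) refl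

    -- The part of the outline along `Ext` is dropped. By `exact` it contributes a coboundary to the
    -- difference of two test points, though not to each of them, so only differences are
    -- determined.
    push : ∃ λ L → (∀ {e} → e ∈ L → e ∈ D) × Cycle L ×
      (∀ {q q'} → q ∈ Q → q' ∈ Q → wind L q xor wind L q' ≡ ⟦ Φ q ⟧ xor ⟦ Φ q' ⟧)
    push = from (star Φ (λ i j fr → inv i j (λ {e} {t} x → fr (inj₁ (e , t , x))) (λ {a} x → fr (inj₂ (a , x)))) lo hi lo≤hi sup ε ε>0)
      where
      from : StarChain Φ (λ i j fr → inv i j (λ {e} {t} x → fr (inj₁ (e , t , x))) (λ {a} x → fr (inj₂ (a , x)))) lo hi lo≤hi sup ε → _
      from (Z , close , closed , value) = fin (collect Z (λ { {a , b} m → let (B , s , i , j) = close m in pair {a} {b} s i j }))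
        where
        fin : (∃ λ L → (∀ {e} → e ∈ L → e ∈ D) ×
          (∀ g → ⨁ (δ g) L ≡ ⨁ (λ w → gT g (proj₁ w) xor gT g (proj₂ w)) Z) ×
          (∀ {q q'} (m : q ∈ Q) (m' : q' ∈ Q) → wd L q xor wd L q' ≡
            (⨁ (λ w → cr q (pos (proj₁ w)) (pos (proj₂ w))) Z xor ⨁ (λ w → cr q' (pos (proj₁ w)) (pos (proj₂ w))) Z) xor ⨁ (λ w → aT m m' (proj₁ w) xor aT m m' (proj₂ w)) Z)) →
          ∃ λ L → (∀ {e} → e ∈ L → e ∈ D) × Cycle L × (∀ {q q'} → q ∈ Q → q' ∈ Q → wind L q xor wind L q' ≡ ⟦ Φ q ⟧ xor ⟦ Φ q' ⟧)
        fin (L , s , e , k) = L , s , mkCycle (λ g → trans (e g) (closed (gT g))) ,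
          λ {q} {q'} m m' → trans (cong₂ _xor_ (wind≡ L q) (wind≡ L q')) (trans (k m m') (trans (cong₂ _xor_ (cong₂ _xor_ (value q (far m)) (value q' (far m'))) (closed (aT m m'))) (xor-identityʳ _)))

  -- An arc does not fill a box

  γ-inj : ∀ {e s t} → γ e s ≑ γ e t → proj₁ s ≋ proj₁ t
  γ-inj {e} {s} {t} h = from (I-cases s)
    where
    from : proj₁ s ≋ 𝟎 ⊎ proj₁ s ≋ 𝟏 ⊎ Interior s → proj₁ s ≋ proj₁ t
    from (inj₁ z) = [ (λ { (w , _) → ≋-trans z (≋-sym w) }) , (λ { (_ , w) → ⊥-elim (loopless e (sym w)) }) ]′ (vx-γ {src e} {e} {t} (≑-trans (≑-sym (γ-src z)) h))
    from (inj₂ (inj₁ z)) = [ (λ { (_ , w) → ⊥-elim (loopless e w) }) , (λ { (w , _) → ≋-trans z (≋-sym w) }) ]′ (vx-γ {tgt e} {e} {t} (≑-trans (≑-sym (γ-tgt z)) h))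
    from (inj₂ (inj₂ i)) = ≋-sym (proj₂ (γ-int-inj i h))

  avoidPart : ∀ {e x} (S : I → Set) → (∀ t → γ e t ≑ x → ∃₂ λ l r → l <∙ proj₁ t × proj₁ t ∙< r × (∀ s → l <∙ proj₁ s → proj₁ s ∙< r → ¬ S s)) →
    ∃ λ B → x ∈□ B × (∀ s → S s → ¬ (γ e s ∈□ B))
  avoidPart {e} {x} S f = let (B , i , h) = cousinI Q add loc in B , i , λ s p j → let (A , k , sp) = h s (All-In s) p in Sep-∉ sp j k
    where
    Q : ℚ → ℚ → Set
    Q l r = ∃ λ B → x ∈□ B × (∀ s → In[ l , r ] s → S s → ∃ λ A → γ e s ∈□ A × Sep B A)
    add : ∀ {l m r} → 0ℚ ≤ l → l ≤ m → m ≤ r → r ≤ 1ℚ → Q l m → Q m r → Q l r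
    add _ _ _ _ (B , i , f) (B' , i' , f') = B ⊓□ B' , ∈⊓ i i' ,
      pointwise {R = λ s → S s → ∃ λ A → γ e s ∈□ A × Sep (B ⊓□ B') A} (λ t h p → let (A , j , s) = f t h p in A , j , Sep-⊑ (⊓⊑ˡ B B') ⊑-refl s) (λ t h p → let (A , j , s) = f' t h p in A , j , Sep-⊑ (⊓⊑ʳ B B') ⊑-refl s)
    loc : ∀ t → ∃₂ λ l₀ r₀ → l₀ <∙ proj₁ t × proj₁ t ∙< r₀ × (∀ {l r} → l₀ < l → r < r₀ → Q l r)
    loc t = go (dec (γ e t ≑ x))
      where
      go : Dec (γ e t ≑ x) → ∃₂ λ l₀ r₀ → l₀ <∙ proj₁ t × proj₁ t ∙< r₀ × (∀ {l r} → l₀ < l → r < r₀ → Q l r)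
      go (yes h) = let (l , r , u , v , k) = f t h
                       (B , i , _) = smallBox x (0<1/ 0)
        in l , r , u , v , λ p q → B , i , λ s is ps → let (a , b) = In[]-open {t = s} is p q in ⊥-elim (k s a b ps)
      go (no n) = let (A , B , i , j , s) = ≉⇒Sep n
                      (l , r , u , v , k) = cont e t i
        in l , r , u , v , λ p q → B , j , λ t' h _ → let (a , b) = In[]-open {t = t'} h p q in A , k t' a b , Sep-sym s

  -- A box without one point is connected, while an arc without an interior point is not. If the arc
  -- filled the box, every centre considered would have the largest or the smallest parameter among
  -- the points of the box. At most two can, but three on a horizontal line are compared.
  hole : ∀ e {B x} → x ∈□ B → ∃ λ y → y ∈□ B × Off y e
  hole e {B} {x} xB = dne λ none → contra (λ {y} i → let (t , h) = ¬∀⇒∃ (λ off → none (y , i , off)) in t , dne h)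
    where
    contra : (∀ {y} → y ∈□ B → ∃ λ t → γ e t ≑ y) → ⊥
    contra fill = pick (ℚₚ.<-dense lr) (ℚₚ.<-dense bt)
      where
      lr : left B < right B
      lr = cut-< (proj₁ x) (∈-left xB) (∈-right xB)
      bt : bottom B < top B
      bt = cut-< (proj₂ x) (∈-bottom xB) (∈-top xB)
      par : ∀ {y} → y ∈□ B → I
      par i = proj₁ (fill i)
      par-γ : ∀ {y} (i : y ∈□ B) → γ e (par i) ≑ y
      par-γ i = proj₂ (fill i)

      module Center (a b : ℚ) (la : left B < a) (ar : a < right B) (bb : bottom B < b) (bt′ : b < top B) where
        c : ℝ²
        c = fromℚ a , fromℚ b
        cB : c ∈□ B
        cB = mk∈ (<⇒<∙ la) (<⇒∙< ar) (<⇒<∙ bb) (<⇒∙< bt′)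
        m : I
        m = par cB

        κ : ℝ² → Bool
        κ y = ⟦ (∃ λ t → γ e t ≑ y × proj₁ t ≺ proj₁ m) ⟧

        κ-par : ∀ {y} (i : y ∈□ B) → κ y ≡ ⟦ proj₁ (par i) ≺ proj₁ m ⟧
        κ-par i = ⟦⟧-cong (λ { (t , h , k) → ≺-resp (γ-inj (≑-trans h (≑-sym (par-γ i)))) ≋-refl k }) (λ k → par i , par-γ i , k)

        κ-loc : ∀ {A} → A ⊑ B → ¬ (c ∈□ A) → ∀ y → y ∈□ A → ∃ λ A' → y ∈□ A' × (∀ w → w ∈□ A' → w ∈□ A → κ w ≡ κ y)
        κ-loc {A} A⊑ nc y yA = from (≉⇒≺ ne)
          where
          yB = ∈-⊑ A⊑ yA
          s = par yB
          ne : ¬ (proj₁ s ≋ proj₁ m)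
          ne h = nc (∈-≑ (≑-trans (≑-sym (par-γ yB)) (≑-trans (γ-≋ {e} {s} {m} h) (par-γ cB))) yA)
          same-par : ∀ t → γ e t ≑ y → proj₁ t ≋ proj₁ s
          same-par t h = γ-inj (≑-trans h (≑-sym (par-γ yB)))
          from : proj₁ s ≺ proj₁ m ⊎ proj₁ m ≺ proj₁ s → ∃ λ A' → y ∈□ A' × (∀ w → w ∈□ A' → w ∈□ A → κ w ≡ κ y)
          from (inj₁ (q , u , v)) = let (A' , i , h) = avoidPart {e} {y} (λ t → proj₁ m ≼ proj₁ t) (λ t h → let (l , _ , p , _) = bracket (proj₁ t) (0<1/ 0) in l , q , p , ≈-∙< (≋-sym (same-par t h)) u , λ w _ wq k → k (q , wq , v))
            in A' , i , λ w wA' wA → trans (trans (κ-par (∈-⊑ A⊑ wA)) (⟦⟧-true (dne λ k → h _ k (∈-≑ (≑-sym (par-γ (∈-⊑ A⊑ wA))) wA')))) (sym (trans (κ-par yB) (⟦⟧-true (q , u , v))))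
          from (inj₂ (q , u , v)) = let (A' , i , h) = avoidPart {e} {y} (λ t → proj₁ t ≼ proj₁ m) (λ t h → let (_ , r , _ , p , _) = bracket (proj₁ t) (0<1/ 0) in q , r , ≈-<∙ (≋-sym (same-par t h)) v , p , λ w qw _ k → k (q , u , qw))
            in A' , i , λ w wA' wA → trans (trans (κ-par (∈-⊑ A⊑ wA)) (⟦⟧-false λ k → h _ (≺⇒≼ k) (∈-≑ (≑-sym (par-γ (∈-⊑ A⊑ wA))) wA'))) (sym (trans (κ-par yB) (⟦⟧-false λ k → ≺⇒≼ k (q , u , v))))

        Lf Rt Bo To : Box
        Lf = mkBox (left B) a (bottom B) (top B)
        Rt = mkBox a (right B) (bottom B) (top B)
        Bo = mkBox (left B) (right B) (bottom B) b
        To = mkBox (left B) (right B) b (top B)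

        κ-Lf : ∀ {u v} → u ∈□ Lf → v ∈□ Lf → κ u ≡ κ v
        κ-Lf = boxConn κ (κ-loc (sub ℚₚ.≤-refl (ℚₚ.<⇒≤ ar) ℚₚ.≤-refl ℚₚ.≤-refl) (λ h → ℚₚ.<-irrefl refl (∙<⇒< (∈-right h))))
        κ-Rt : ∀ {u v} → u ∈□ Rt → v ∈□ Rt → κ u ≡ κ v
        κ-Rt = boxConn κ (κ-loc (sub (ℚₚ.<⇒≤ la) ℚₚ.≤-refl ℚₚ.≤-refl ℚₚ.≤-refl) (λ h → ℚₚ.<-irrefl refl (<∙⇒< (∈-left h))))
        κ-Bo : ∀ {u v} → u ∈□ Bo → v ∈□ Bo → κ u ≡ κ v
        κ-Bo = boxConn κ (κ-loc (sub ℚₚ.≤-refl ℚₚ.≤-refl ℚₚ.≤-refl (ℚₚ.<⇒≤ bt′)) (λ h → ℚₚ.<-irrefl refl (∙<⇒< (∈-top h))))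
        κ-To : ∀ {u v} → u ∈□ To → v ∈□ To → κ u ≡ κ v
        κ-To = boxConn κ (κ-loc (sub ℚₚ.≤-refl ℚₚ.≤-refl (ℚₚ.<⇒≤ bb) ℚₚ.≤-refl) (λ h → ℚₚ.<-irrefl refl (<∙⇒< (∈-bottom h))))

        k₀ : Bool
        k₀ = κ (fromℚ (proj₁ (ℚₚ.<-dense la)) , fromℚ (proj₁ (ℚₚ.<-dense bb)))

        -- The four half-boxes cover the box except for the centre and overlap in quadrants, so the
        -- constants on them agree.
        κ-all : ∀ {y} → y ∈□ B → ¬ (y ≑ c) → κ y ≡ k₀
        κ-all {y} i ne = go (ℚₚ.<-dense la) refl (ℚₚ.<-dense bb) refl (ℚₚ.<-dense ar) (ℚₚ.<-dense bt′)
          where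
          go : (p : ∃ λ l → left B < l × l < a) → ℚₚ.<-dense la ≡ p → (q : ∃ λ d → bottom B < d × d < b) → ℚₚ.<-dense bb ≡ q → (∃ λ r → a < r × r < right B) → (∃ λ u → b < u × u < top B) → κ y ≡ k₀
          go (l , l₁ , l₂) e₁ (d , d₁ , d₂) e₂ (r , r₁ , r₂) (u , u₁ , u₂) = trans (cases (dec (proj₁ y ≋ fromℚ a))) (sym k₀≡)
            where
            k₀≡ : k₀ ≡ κ (fromℚ l , fromℚ d)
            k₀≡ = cong₂ (λ p q → κ (fromℚ (proj₁ p) , fromℚ (proj₁ q))) e₁ e₂
            pt : ∀ {l' r' b' t'} s w → l' < s → s < r' → b' < w → w < t' → (fromℚ s , fromℚ w) ∈□ mkBox l' r' b' t'
            pt s w p q p' q' = mk∈ (<⇒<∙ p) (<⇒∙< q) (<⇒<∙ p') (<⇒∙< q')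
            d<t = ℚₚ.<-trans d₂ bt′
            b<u = ℚₚ.<-trans bb u₁
            l<r = ℚₚ.<-trans l₂ ar
            a<r = ℚₚ.<-trans la r₁
            LB-Lf = pt l d l₁ l₂ d₁ d<t
            LB-Bo = pt l d l₁ l<r d₁ d₂
            RB-Bo = pt r d a<r r₂ d₁ d₂
            RB-Rt = pt r d r₁ r₂ d₁ d<t
            LT-Lf = pt l u l₁ l₂ b<u u₂
            LT-To = pt l u l₁ l<r u₁ u₂
            cases : Dec (proj₁ y ≋ fromℚ a) → κ y ≡ κ (fromℚ l , fromℚ d)
            cases (no n) = [ (λ h → κ-Lf (mk∈ (∈-left i) (≺⇒∙< h) (∈-bottom i) (∈-top i)) LB-Lf)
                           , (λ h → trans (κ-Rt (mk∈ (≺⇒<∙ h) (∈-right i) (∈-bottom i) (∈-top i)) RB-Rt) (κ-Bo RB-Bo LB-Bo)) ]′ (≉⇒≺ n)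
            cases (yes e) = [ (λ h → κ-Bo (mk∈ (∈-left i) (∈-right i) (∈-bottom i) (≺⇒∙< h)) LB-Bo)
                            , (λ h → trans (κ-To (mk∈ (∈-left i) (∈-right i) (≺⇒<∙ h) (∈-top i)) LT-To) (κ-Lf LT-Lf LB-Lf)) ]′ (≉⇒≺ (λ f → ne (mk≑ e f)))

      -- Two centres cannot both be maxima, or both minima, of the parameter.
      clash : ∀ {a b a' b'} (la : left B < a) (ar : a < right B) (bb : bottom B < b) (bt : b < top B) (la' : left B < a') (ar' : a' < right B) (bb' : bottom B < b') (bt' : b' < top B) →
        a < a' → Center.k₀ a b la ar bb bt ≡ Center.k₀ a' b' la' ar' bb' bt' → ⊥
      clash {a} {b} {a'} {b'} la ar bb bt la' ar' bb' bt' lt eq = go C.k₀ refl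
        where
        module C = Center a b la ar bb bt
        module C' = Center a' b' la' ar' bb' bt'
        ne : ¬ (C'.c ≑ C.c)
        ne h = ≈⇒⊀ (≑₁ h) (<∙⇒≺ (<⇒<∙ lt))
        v₁ : ⟦ proj₁ C'.m ≺ proj₁ C.m ⟧ ≡ C.k₀
        v₁ = trans (sym (C.κ-par C'.cB)) (C.κ-all C'.cB ne)
        v₂ : ⟦ proj₁ C.m ≺ proj₁ C'.m ⟧ ≡ C.k₀
        v₂ = trans (sym (C'.κ-par C.cB)) (trans (C'.κ-all C.cB (λ h → ne (≑-sym h))) (sym eq))
        go : ∀ k → C.k₀ ≡ k → ⊥
        go true e = ≺⇒≼ (⟦⟧-sound (trans v₁ e)) (⟦⟧-sound (trans v₂ e))
        go false e = ne (≑-trans (≑-sym (par-γ C'.cB)) (≑-trans (γ-≋ {e = _} {C'.m} {C.m} (≼-antisym (⟦⟧-refute (trans v₂ e)) (⟦⟧-refute (trans v₁ e)))) (par-γ C.cB)))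

      pick : (∃ λ a → left B < a × a < right B) → (∃ λ b → bottom B < b × b < top B) → ⊥
      pick (a , la , ar) (b , bb , bt′) = pick₂ (ℚₚ.<-dense la) (ℚₚ.<-dense ar)
        where
        pick₂ : (∃ λ l → left B < l × l < a) → (∃ λ r → a < r × r < right B) → ⊥
        pick₂ (l , l₁ , l₂) (r , r₁ , r₂) = go (Center.k₀ l b l₁ l<r bb bt′) refl (Center.k₀ a b la ar bb bt′) refl (Center.k₀ r b a<r r₂ bb bt′) refl
          where
          l<r = ℚₚ.<-trans l₂ ar
          a<r = ℚₚ.<-trans la r₁
          go : ∀ x → Center.k₀ l b l₁ l<r bb bt′ ≡ x → ∀ y → Center.k₀ a b la ar bb bt′ ≡ y → ∀ z → Center.k₀ r b a<r r₂ bb bt′ ≡ z → ⊥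
          go true p true q _ _ = clash l₁ l<r bb bt′ la ar bb bt′ l₂ (trans p (sym q))
          go false p false q _ _ = clash l₁ l<r bb bt′ la ar bb bt′ l₂ (trans p (sym q))
          go true p false q true r = clash l₁ l<r bb bt′ a<r r₂ bb bt′ (ℚₚ.<-trans l₂ r₁) (trans p (sym r))
          go true p false q false r = clash la ar bb bt′ a<r r₂ bb bt′ r₁ (trans q (sym r))
          go false p true q false r = clash l₁ l<r bb bt′ a<r r₂ bb bt′ (ℚₚ.<-trans l₂ r₁) (trans p (sym r))
          go false p true q true r = clash la ar bb bt′ a<r r₂ bb bt′ r₁ (trans q (sym r))

  holeL : ∀ K {B x} → x ∈□ B → ∃ λ y → y ∈□ B × OffL y K
  holeL [] i = _ , i , λ ()
  holeL (e ∷ K) {B} i =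
    let (y , j , off) = hole e i
        (B₁ , j₁ , cl) = avoid off
        (w , k , offK) = holeL K (∈⊓ j j₁)
    in w , ∈-⊑ (⊓⊑ˡ B B₁) k , λ { (here refl) → Clear-Off cl (∈-⊑ (⊓⊑ʳ B B₁) k) ; (there m) → offK m }

  -- The jump of the winding number across an edge

  OffG : ℝ² → Set
  OffG x = ∀ a → ¬ (φ a ≑ x)

  OpenStar : V → Point graph → Set
  OpenStar v (vertex w) = w ≡ v
  OpenStar v (on f t) = (src f ≡ v × proj₁ t ≺ 𝟏) ⊎ (tgt f ≡ v × 𝟎 ≺ proj₁ t)

  starBox : ∀ v → ∃ λ B → vx v ∈□ B × (∀ b → φ b ∈□ B → OpenStar v b)
  starBox v = openBox (mkOpen (OpenStar v) f g o) {vertex v} refl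
    where
    f : ∀ {a b} → Glue graph a b → OpenStar v a → OpenStar v b
    f (same h) (inj₁ (w , k)) = inj₁ (w , ≺-resp (mk≋ h) ≋-refl k)
    f (same h) (inj₂ (w , k)) = inj₂ (w , ≺-resp ≋-refl (mk≋ h) k)
    f start (inj₁ (w , _)) = w
    f start (inj₂ (_ , k)) = ⊥-elim (≺-irrefl k)
    f end (inj₁ (_ , k)) = ⊥-elim (≺-irrefl k)
    f end (inj₂ (w , _)) = w
    g : ∀ {a b} → Glue graph a b → OpenStar v b → OpenStar v a
    g (same h) (inj₁ (w , k)) = inj₁ (w , ≺-resp (≋-sym (mk≋ h)) ≋-refl k)
    g (same h) (inj₂ (w , k)) = inj₂ (w , ≺-resp ≋-refl (≋-sym (mk≋ h)) k)
    g start w = inj₁ (w , 0≺1)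
    g end w = inj₂ (w , 0≺1)
    o : ∀ e t → OpenStar v (on e t) → ∃₂ λ l r → l <∙ proj₁ t × proj₁ t ∙< r × (∀ s → l <∙ proj₁ s → proj₁ s ∙< r → OpenStar v (on e s))
    o e t (inj₁ (w , q , a , b)) = let (l , _ , u , _) = bracket (proj₁ t) (0<1/ 0) in l , q , u , a , λ s _ y → inj₁ (w , q , y , b)
    o e t (inj₂ (w , q , a , b)) = let (_ , r , _ , u , _) = bracket (proj₁ t) (0<1/ 0) in q , r , b , u , λ s x _ → inj₂ (w , q , a , x)

  OnEdge : E → Point graph → Set
  OnEdge e (vertex w) = ⊥
  OnEdge e (on f t) = f ≡ e × Interior t

  edgeBox : ∀ e t → Interior t → ∃ λ B → γ e t ∈□ B × (∀ b → φ b ∈□ B → OnEdge e b)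
  edgeBox e t i = openBox (mkOpen (OnEdge e) f g o) {on e t} (refl , i)
    where
    f : ∀ {a b} → Glue graph a b → OnEdge e a → OnEdge e b
    f (same {_} {s} {t} h) (w , k) = w , Interior-≋ {s} {t} (mk≋ h) k
    f start (_ , k) = ⊥-elim (0≉int {0ᴵ} k ≋-refl)
    f end (_ , k) = ⊥-elim (1≉int {1ᴵ} k ≋-refl)
    g : ∀ {a b} → Glue graph a b → OnEdge e b → OnEdge e a
    g (same {_} {s} {t} h) (w , k) = w , Interior-≋ {t} {s} (≋-sym (mk≋ h)) k
    o : ∀ f t → OnEdge e (on f t) → ∃₂ λ l r → l <∙ proj₁ t × proj₁ t ∙< r × (∀ s → l <∙ proj₁ s → proj₁ s ∙< r → OnEdge e (on f s))
    o f t (w , k) = let (l , r , u , v , h) = Interior-open {t} k in l , r , u , v , λ s x y → w , h s x y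

  OpenStar⇒Inc : ∀ {v f t} → OpenStar v (on f t) → Inc v f
  OpenStar⇒Inc (inj₁ (w , _)) = inj₁ w
  OpenStar⇒Inc (inj₂ (w , _)) = inj₂ w

  ∉-split′ : ∀ {a B} → ¬ (a ∈□ B) → (∃ λ v → ∀ {x} → x ∈□ B → hgt x a ≡ v) ⊎ (∃ λ v → ∀ {x} → x ∈□ B → rgt x a ≡ v)
  ∉-split′ {a} {B} n = from (dec (left B <∙ proj₁ a)) (dec (proj₁ a ∙< right B)) (dec (bottom B <∙ proj₂ a)) (dec (proj₂ a ∙< top B))
    where
    lower≼ : ∀ {l x} → ¬ (l <∙ x) → ∀ {y} → l <∙ y → ¬ (y ≺ x)
    lower≼ n h = ≺⇒≼ (≼-≺ (λ k → n (≺⇒<∙ k)) (<∙⇒≺ h))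
    upper≼ : ∀ {r x} → ¬ (x ∙< r) → ∀ {y} → y ∙< r → y ≺ x
    upper≼ n h = ≺-≼ (∙<⇒≺ h) (λ k → n (≺⇒∙< k))
    from : _ → _ → _ → _ → (∃ λ v → ∀ {x} → x ∈□ B → hgt x a ≡ v) ⊎ (∃ λ v → ∀ {x} → x ∈□ B → rgt x a ≡ v)
    from (no k) _ _ _ = inj₂ (false , λ i → rgt-false (lower≼ k (∈-left i)))
    from _ (no k) _ _ = inj₂ (true , λ i → rgt-true (upper≼ k (∈-right i)))
    from _ _ (no k) _ = inj₁ (false , λ i → hgt-false (lower≼ k (∈-bottom i)))
    from _ _ _ (no k) = inj₁ (true , λ i → hgt-true (upper≼ k (∈-top i)))
    from (yes a) (yes b) (yes c) (yes d) = ⊥-elim (n (mk∈ a b c d))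

  shift-cocycle : ∀ {a B x y z} → ¬ (a ∈□ B) → x ∈□ B → y ∈□ B → z ∈□ B → shift x y a xor shift y z a ≡ shift x z a
  shift-cocycle {a} {B} {x} {y} {z} n i j k = from (∉-split′ n)
    where
    alg : ∀ v p q r → (v ∧ (p xor q)) xor (v ∧ (q xor r)) ≡ v ∧ (p xor r)
    alg = bool 4 (λ v p q r → (v ⊗ (p ⊕ q)) ⊕ (v ⊗ (q ⊕ r)) ⊜ v ⊗ (p ⊕ r)) refl
    from : (∃ λ v → ∀ {x} → x ∈□ B → hgt x a ≡ v) ⊎ (∃ λ v → ∀ {x} → x ∈□ B → rgt x a ≡ v) → shift x y a xor shift y z a ≡ shift x z a
    from (inj₂ (v , f)) rewrite f i | f j = alg v (hgt x a) (hgt y a) (hgt z a)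
    from (inj₁ (v , f)) rewrite f i | f j | f k | xor-same v | ∧-zeroʳ (rgt x a) | ∧-zeroʳ (rgt y a) = refl

  -- If the winding number did not change across `e`, then `d x y` would be, locally around `a`, the
  -- difference of the values of `var′` at `x` and `y`. Such differences telescope to zero along a
  -- rectangle around `a`. But the part of `d` that belongs to `a` counts the crossings of the
  -- rectangle with a ray from `a`, which is odd, and the part that belongs to `o` vanishes as `o`
  -- is outside `B₀`.
  module Jump (finiteStar : ∀ v → ∃ λ (l : List E) → ∀ {e} → Inc v e → e ∈ l)
    {e : E} {L : List E} (cyc : Cycle (e ∷ L)) (e∉L : e ∉ L)
    (still : ∀ {b x y} → (∀ p → φ p ∈□ b → OnEdge e p) → x ∈□ b → y ∈□ b → OffG x → OffG y → wind (e ∷ L) x ≡ wind (e ∷ L) y) where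

    private
      a o : ℝ²
      a = vx (src e)
      o = vx (tgt e)
      B₀ : Box
      B₀ = proj₁ (starBox (src e))
      aB : a ∈□ B₀
      aB = proj₁ (proj₂ (starBox (src e)))
      star₀ : ∀ b → φ b ∈□ B₀ → OpenStar (src e) b
      star₀ = proj₂ (proj₂ (starBox (src e)))
      oB : ¬ (o ∈□ B₀)
      oB i = loopless e (sym (star₀ (vertex (tgt e)) i))
      K : List E
      K = proj₁ (finiteStar (src e))
      K-spec : ∀ {f} → Inc (src e) f → f ∈ K
      K-spec = proj₂ (finiteStar (src e))

      eK : e ∈ K
      eK = K-spec (inj₁ refl)

      offG : ∀ {x} → x ∈□ B₀ → OffL x K → OffG x
      offG i off (on f t) h = off (K-spec (OpenStar⇒Inc {t = t} (star₀ (on f t) (∈-≑ (≑-sym h) i)))) t h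
      offG i off (vertex w) h with star₀ (vertex w) (∈-≑ (≑-sym h) i)
      ... | refl = off eK 0ᴵ (≑-trans (γ-src {e} {0ᴵ} ≋-refl) h)

      -- By `var-move`, the change of `var′` for the edge `e` when the base point moves from `x` to
      -- `y` in a box clear of `e`.
      d : ℝ² → ℝ² → Bool
      d x y = shift x y a xor shift x y o

      d-cocycle : ∀ {S x y z} → S ⊑ B₀ → ¬ (a ∈□ S) → x ∈□ S → y ∈□ S → z ∈□ S → d x y xor d y z ≡ d x z
      d-cocycle {S} {x} {y} {z} s n i j k = trans (xor-interchange (shift x y a) (shift x y o) (shift y z a) (shift y z o))
        (cong₂ _xor_ (shift-cocycle n i j k) (shift-cocycle oB (∈-⊑ s i) (∈-⊑ s j) (∈-⊑ s k)))

      Good : Box → Set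
      Good b = ∀ {x y} → x ∈□ b → y ∈□ b → OffG x → OffG y → d x y ≡ var′ x e xor var′ y e

      clear-good : ∀ {b} → Clear b e → Good b
      clear-good cl i j _ _ = sym (var-move cl i j)

      good : ∀ z → z ∈□ B₀ → ¬ (z ≑ a) → ∃ λ b → z ∈□ b × Good b
      good z zB ne = from (dec (∃₂ λ f t → γ f t ≑ z))
        where
        from : Dec (∃₂ λ f t → γ f t ≑ z) → ∃ λ b → z ∈□ b × Good b
        from (no n) = let (b , i , cl) = avoid {z} {e} (λ t h → n (e , t , h)) in b , i , clear-good cl
        from (yes (f , t , h)) = go (dec (f ≡ e))
          where
          sf : OpenStar (src e) (on f t)
          sf = star₀ (on f t) (∈-≑ (≑-sym h) zB)
          int : Interior t
          int = [ (λ k → ⊥-elim (ne (≑-trans (≑-sym h) (≑-trans (γ-src k) (src-case k sf))))) , [ (λ k → ⊥-elim (ne (≑-trans (≑-sym h) (≑-trans (γ-tgt k) (tgt-case k sf))))) , (λ i → i) ]′ ]′ (I-cases t)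
            where
            src-case : proj₁ t ≋ 𝟎 → OpenStar (src e) (on f t) → vx (src f) ≑ a
            src-case k (inj₁ (w , _)) = subst (λ v → vx (src f) ≑ vx v) w ≑-refl
            src-case k (inj₂ (_ , w)) = ⊥-elim (≈⇒⊀ k w)
            tgt-case : proj₁ t ≋ 𝟏 → OpenStar (src e) (on f t) → vx (tgt f) ≑ a
            tgt-case k (inj₁ (_ , w)) = ⊥-elim (≈⇒⊁ k w)
            tgt-case k (inj₂ (w , _)) = subst (λ v → vx (tgt f) ≑ vx v) w ≑-refl
          go : Dec (f ≡ e) → ∃ λ b → z ∈□ b × Good b
          go (no n) = let (b , i , cl) = avoid {z} {e} (λ s k → n (sym (proj₁ (γ-int-inj {f} {e} {t} {s} int (≑-trans h (≑-sym k)))))) in b , i , clear-good cl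
          -- At a point of `e` the rest of the cycle is still avoidable. Its coboundary sum equals
          -- that of `e`, since the whole is closed, and `still` transfers the change of its winding
          -- number to `e`.
          go (yes refl) =
            let (b , i , only) = edgeBox e t int
                (b' , i' , cl) = avoidL {z} L (λ {g} m s k → e∉L (subst (_∈ L) (proj₁ (γ-int-inj {e} {g} {t} {s} int (≑-trans h (≑-sym k)))) m))
            in b ⊓□ b' , ∈⊓ (∈-≑ h i) i' , λ {x} {y} j k ox oy →
              let mv : wind L x xor wind L y ≡ d x y
                  mv = trans (wind-move {L} (λ m → cl m) (∈-⊑ (⊓⊑ʳ b b') j) (∈-⊑ (⊓⊑ʳ b b') k)) (sym (xor-≡ (bd cyc (λ v → shift x y (vx v)))))
                  st = still {b} only (∈-⊑ (⊓⊑ˡ b b') j) (∈-⊑ (⊓⊑ˡ b b') k) ox oy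
              in trans (sym mv) (alg (var′ x e) (wind L x) (var′ y e) (wind L y) (trans (sym (wind-∷ e L x)) (trans st (wind-∷ e L y))))
            where
            alg : ∀ p u q v → p xor u ≡ q xor v → u xor v ≡ p xor q
            alg p u q v k = trans (sym (bool 3 (λ p u v → p ⊕ ((p ⊕ u) ⊕ v) ⊜ u ⊕ v) refl p u v))
              (trans (cong (λ w → p xor (w xor v)) k) (bool 3 (λ p q v → p ⊕ ((q ⊕ v) ⊕ v) ⊜ p ⊕ q) refl p q v))

      module Side (σ : ℝ → ℝ²) (S : Box) (S⊑ : S ⊑ B₀) (aS : ¬ (a ∈□ S)) (l r : ℚ) (l≤r : l ≤ r)
        (σ-cont : ∀ x {b} → σ x ∈□ b → ∃₂ λ l₀ r₀ → l₀ <∙ x × x ∙< r₀ × (∀ y → l₀ <∙ y → y ∙< r₀ → σ y ∈□ b))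
        (σS : ∀ x → fromℚ l ≼ x → x ≼ fromℚ r → σ x ∈□ S) where

        -- The identity is known for points off the graph only, while the rectangle may run on the
        -- graph. So each end of a side stands for all nearby points off the graph, which exist by
        -- `holeL`.
        Linked : ℝ² → ℝ² → Set
        Linked p q = ∃₂ λ b b' → p ∈□ b × q ∈□ b' × b ⊑ S × b' ⊑ S × (∀ {x y} → x ∈□ b → y ∈□ b' → OffG x → OffG y → d x y ≡ var′ x e xor var′ y e)

        side : Linked (σ (fromℚ l)) (σ (fromℚ r))
        side = Cousin.cousin (λ s t → Linked (σ (fromℚ s)) (σ (fromℚ t))) l r (λ _ _ _ _ → add) loc l≤r
          where
          add : ∀ {s m t} → Linked (σ (fromℚ s)) (σ (fromℚ m)) → Linked (σ (fromℚ m)) (σ (fromℚ t)) → Linked (σ (fromℚ s)) (σ (fromℚ t))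
          add (b , b₁ , i , i₁ , s , s₁ , f) (b₂ , b₃ , i₂ , i₃ , s₂ , s₃ , g) = b , b₃ , i , i₃ , s , s₃ , λ {x} {y} xb yb ox oy →
            let (w , k , off) = holeL K (∈⊓ i₁ i₂)
                w₁ = ∈-⊑ (⊓⊑ˡ b₁ b₂) k
                w₂ = ∈-⊑ (⊓⊑ʳ b₁ b₂) k
                ow = offG (∈-⊑ S⊑ (∈-⊑ s₁ w₁)) off
            in trans (sym (d-cocycle S⊑ aS (∈-⊑ s xb) (∈-⊑ s₁ w₁) (∈-⊑ s₃ yb))) (trans (cong₂ _xor_ (f xb w₁ ox ow) (g w₂ yb ow oy)) (tel (var′ x e) (var′ w e) (var′ y e)))
            where
            tel : ∀ p q r → (p xor q) xor (q xor r) ≡ p xor r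
            tel = bool 3 (λ p q r → (p ⊕ q) ⊕ (q ⊕ r) ⊜ p ⊕ r) refl
          loc : ∀ x → fromℚ l ≼ x → x ≼ fromℚ r → ∃₂ λ l₀ r₀ → l₀ <∙ x × x ∙< r₀ × (∀ {s t} → l ≤ s → s ≤ t → t ≤ r → l₀ < s → t < r₀ → Linked (σ (fromℚ s)) (σ (fromℚ t)))
          loc x lx xr =
            let xS = σS x lx xr
                (b , i , gd) = good (σ x) (∈-⊑ S⊑ xS) (λ h → aS (∈-≑ h xS))
                (l₀ , r₀ , u , v , f) = σ-cont x (∈⊓ i xS)
            in l₀ , r₀ , u , v , λ {s} {t} _ st _ ls tr →
              let p = f (fromℚ s) (<⇒<∙ ls) (<⇒∙< (ℚₚ.≤-<-trans st tr))
                  q = f (fromℚ t) (<⇒<∙ (ℚₚ.<-≤-trans ls st)) (<⇒∙< tr)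
              in b ⊓□ S , b ⊓□ S , p , q , ⊓⊑ʳ b S , ⊓⊑ʳ b S , λ xb yb → gd (∈-⊑ (⊓⊑ˡ b S) xb) (∈-⊑ (⊓⊑ˡ b S) yb)

    impossible : ⊥
    impossible = go (<∙-round (proj₁ a) (∈-left aB)) (∙<-round (proj₁ a) (∈-right aB)) (<∙-round (proj₂ a) (∈-bottom aB)) (∙<-round (proj₂ a) (∈-top aB))
      where
      go : (∃ λ l → left B₀ < l × l <∙ proj₁ a) → (∃ λ r → r < right B₀ × proj₁ a ∙< r) → (∃ λ b → bottom B₀ < b × b <∙ proj₂ a) → (∃ λ t → t < top B₀ × proj₂ a ∙< t) → ⊥
      go (l , l₁ , l₂) (r , r₁ , r₂) (b , b₁ , b₂) (t , t₁ , t₂) = go′ (<∙-round (proj₁ a) l₂) (∙<-round (proj₁ a) r₂) (<∙-round (proj₂ a) b₂) (∙<-round (proj₂ a) t₂)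
        where
        go′ : (∃ λ l' → l < l' × l' <∙ proj₁ a) → (∃ λ r' → r' < r × proj₁ a ∙< r') → (∃ λ b' → b < b' × b' <∙ proj₂ a) → (∃ λ t' → t' < t × proj₂ a ∙< t') → ⊥
        go′ (l' , l₃ , l₄) (r' , r₃ , r₄) (b' , b₃ , b₄) (t' , t₃ , t₄) = finish bot top′ lef rig
          where
          l<r = cut-< (proj₁ a) l₂ r₂
          b<t = cut-< (proj₂ a) b₂ t₂
          Sb St Sl Sr : Box
          Sb = mkBox (left B₀) (right B₀) (bottom B₀) b'
          St = mkBox (left B₀) (right B₀) t' (top B₀)
          Sl = mkBox (left B₀) l' (bottom B₀) (top B₀)
          Sr = mkBox r' (right B₀) (bottom B₀) (top B₀)
          b'≤ = ℚₚ.<⇒≤ (cut-< (proj₂ a) b₄ (∈-top aB))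
          t'≥ = ℚₚ.<⇒≤ (cut-< (proj₂ a) (∈-bottom aB) t₄)
          l'≤ = ℚₚ.<⇒≤ (cut-< (proj₁ a) l₄ (∈-right aB))
          r'≥ = ℚₚ.<⇒≤ (cut-< (proj₁ a) (∈-left aB) r₄)
          Sb⊑ : Sb ⊑ B₀
          Sb⊑ = sub ℚₚ.≤-refl ℚₚ.≤-refl ℚₚ.≤-refl b'≤
          St⊑ : St ⊑ B₀
          St⊑ = sub ℚₚ.≤-refl ℚₚ.≤-refl t'≥ ℚₚ.≤-refl
          Sl⊑ : Sl ⊑ B₀
          Sl⊑ = sub ℚₚ.≤-refl l'≤ ℚₚ.≤-refl ℚₚ.≤-refl
          Sr⊑ : Sr ⊑ B₀
          Sr⊑ = sub r'≥ ℚₚ.≤-refl ℚₚ.≤-refl ℚₚ.≤-refl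
          contH : ∀ y x {B} → (x , fromℚ y) ∈□ B → ∃₂ λ l₀ r₀ → l₀ <∙ x × x ∙< r₀ × (∀ w → l₀ <∙ w → w ∙< r₀ → (w , fromℚ y) ∈□ B)
          contH y x {B} i = left B , right B , ∈-left i , ∈-right i , λ w p q → mk∈ p q (∈-bottom i) (∈-top i)
          contV : ∀ y x {B} → (fromℚ y , x) ∈□ B → ∃₂ λ l₀ r₀ → l₀ <∙ x × x ∙< r₀ × (∀ w → l₀ <∙ w → w ∙< r₀ → (fromℚ y , w) ∈□ B)
          contV y x {B} i = bottom B , top B , ∈-bottom i , ∈-top i , λ w p q → mk∈ (∈-left i) (∈-right i) p q
          hx : ∀ x → fromℚ l ≼ x → x ≼ fromℚ r → left B₀ <∙ x × x ∙< right B₀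
          hx x p q = <∙-≼ (<⇒<∙ l₁) p , ≼-∙< q (<⇒∙< r₁)
          vy : ∀ x → fromℚ b ≼ x → x ≼ fromℚ t → bottom B₀ <∙ x × x ∙< top B₀
          vy x p q = <∙-≼ (<⇒<∙ b₁) p , ≼-∙< q (<⇒∙< t₁)
          module Bot = Side (λ x → x , fromℚ b) Sb Sb⊑ (λ i → ℚₚ.<-irrefl refl (cut-< (proj₂ a) b₄ (∈-top i))) l r (ℚₚ.<⇒≤ l<r) (contH b) (λ x p q → mk∈ (proj₁ (hx x p q)) (proj₂ (hx x p q)) (<⇒<∙ b₁) (<⇒∙< b₃))
          module Top = Side (λ x → x , fromℚ t) St St⊑ (λ i → ℚₚ.<-irrefl refl (cut-< (proj₂ a) (∈-bottom i) t₄)) l r (ℚₚ.<⇒≤ l<r) (contH t) (λ x p q → mk∈ (proj₁ (hx x p q)) (proj₂ (hx x p q)) (<⇒<∙ t₃) (<⇒∙< t₁))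
          module Lef = Side (λ x → fromℚ l , x) Sl Sl⊑ (λ i → ℚₚ.<-irrefl refl (cut-< (proj₁ a) l₄ (∈-right i))) b t (ℚₚ.<⇒≤ b<t) (contV l) (λ x p q → mk∈ (<⇒<∙ l₁) (<⇒∙< l₃) (proj₁ (vy x p q)) (proj₂ (vy x p q)))
          module Rig = Side (λ x → fromℚ r , x) Sr Sr⊑ (λ i → ℚₚ.<-irrefl refl (cut-< (proj₁ a) (∈-left i) r₄)) b t (ℚₚ.<⇒≤ b<t) (contV r) (λ x p q → mk∈ (<⇒<∙ r₃) (<⇒∙< r₁) (proj₁ (vy x p q)) (proj₂ (vy x p q)))
          bot = Bot.side
          top′ = Top.side
          lef = Lef.side
          rig = Rig.side
          corner : ∀ {p A A'} → p ∈□ A → p ∈□ A' → A ⊑ B₀ → ∃ λ x → x ∈□ A × x ∈□ A' × OffG x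
          corner {p} {A} {A'} i j s = let (x , k , off) = holeL K (∈⊓ i j) in x , ∈-⊑ (⊓⊑ˡ A A') k , ∈-⊑ (⊓⊑ʳ A A') k , offG (∈-⊑ s (∈-⊑ (⊓⊑ˡ A A') k)) off
          above : ∀ {x : ℝ} {m} {y : ℝ} → x ∙< m → m <∙ y → x ≺ y
          above p q = _ , p , q
          finish : Bot.Linked (fromℚ l , fromℚ b) (fromℚ r , fromℚ b) → Top.Linked (fromℚ l , fromℚ t) (fromℚ r , fromℚ t) →
                   Lef.Linked (fromℚ l , fromℚ b) (fromℚ l , fromℚ t) → Rig.Linked (fromℚ r , fromℚ b) (fromℚ r , fromℚ t) → ⊥
          finish (B1 , B2 , i1 , i2 , s1 , s2 , fB) (T1 , T2 , j1 , j2 , u1 , u2 , fT) (L1 , L2 , k1 , k2 , v1 , v2 , fL) (R1 , R2 , m1 , m2 , w1 , w2 , fR) =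
            let (x1 , p1 , q1 , o1) = corner i1 k1 (⊑-trans s1 Sb⊑)
                (x2 , p2 , q2 , o2) = corner i2 m1 (⊑-trans s2 Sb⊑)
                (x3 , p3 , q3 , o3) = corner j2 m2 (⊑-trans u2 St⊑)
                (x4 , p4 , q4 , o4) = corner j1 k2 (⊑-trans u1 St⊑)
                X1 = ∈-⊑ Sb⊑ (∈-⊑ s1 p1)
                X2 = ∈-⊑ Sb⊑ (∈-⊑ s2 p2)
                X3 = ∈-⊑ St⊑ (∈-⊑ u2 p3)
                X4 = ∈-⊑ St⊑ (∈-⊑ u1 p4)
                at = λ {x} (k : x ∈□ St) → hgt-false {x} {a} (≺⇒≼ (above t₄ (∈-bottom k)))
                h1 = hgt-true {x1} {a} (above (∈-top (∈-⊑ s1 p1)) b₄)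
                h2 = hgt-true {x2} {a} (above (∈-top (∈-⊑ s2 p2)) b₄)
                h3 = at (∈-⊑ u2 p3)
                h4 = at (∈-⊑ u1 p4)
                r1 = rgt-true {x1} {a} (above (∈-right (∈-⊑ v1 q1)) l₄)
                r2 = rgt-false {x2} {a} (≺⇒≼ (above r₄ (∈-left (∈-⊑ w1 q2))))
                a12 = trans (cong₂ (λ u v → rgt x1 a ∧ (u xor v)) h1 h2) (∧-zeroʳ (rgt x1 a))
                a23 = cong (_∧ (hgt x2 a xor hgt x3 a)) r2
                a43 = trans (cong₂ (λ u v → rgt x4 a ∧ (u xor v)) h4 h3) (∧-zeroʳ (rgt x4 a))
                -- The ray of `a` runs to the left, so the left side of the rectangle is the only
                -- one that crosses it.
                a14 = trans (cong₂ (λ u v → u ∧ (v xor hgt x4 a)) r1 h1) (cong not h4)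
            in parity (var′ x1 e) (var′ x2 e) (var′ x3 e) (var′ x4 e)
                 (trans (shift-cocycle oB X1 X2 X3) (sym (shift-cocycle oB X1 X4 X3)))
                 (trans (sym (cong (_xor shift x1 x2 o) a12)) (fB p1 p2 o1 o2)) (trans (sym (cong (_xor shift x2 x3 o) a23)) (fR q2 q3 o2 o3))
                 (trans (sym (cong (_xor shift x4 x3 o) a43)) (fT p4 p3 o4 o3)) (trans (sym (cong (_xor shift x1 x4 o) a14)) (fL q1 q4 o1 o4))
            where
            parity : ∀ a b c d {O₁ O₂ O₃ O₄} → O₁ xor O₂ ≡ O₄ xor O₃ → O₁ ≡ a xor b → O₂ ≡ b xor c → O₃ ≡ d xor c → not O₄ ≡ a xor d → ⊥
            parity a b c d {O₄ = O₄} h refl refl refl k = not-fix (a xor c) (trans (sym (bool 3 (λ a b c → (a ⊕ b) ⊕ (b ⊕ c) ⊜ a ⊕ c) refl a b c)) (trans h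
               (trans (cong (_xor (d xor c)) (flip O₄ k)) (trans (not-l (a xor d) (d xor c)) (cong not (bool 3 (λ a d c → (a ⊕ d) ⊕ (d ⊕ c) ⊜ a ⊕ c) refl a d c))))))
              where
              flip : ∀ x {y} → not x ≡ y → x ≡ not y
              flip false refl = refl
              flip true refl = refl
              not-l : ∀ x y → not x xor y ≡ not (x xor y)
              not-l false false = refl
              not-l false true = refl
              not-l true false = refl
              not-l true true = refl
              not-fix : ∀ x → x ≡ not x → ⊥
              not-fix false ()
              not-fix true ()

  -- Connected sets and faces

  Cl : (ℝ² → Set) → ℝ² → Set
  Cl F x = ∀ {B} → x ∈□ B → ∃ λ y → y ∈□ B × F y

  Cl-≑ : ∀ {F x y} → x ≑ y → Cl F x → Cl F y
  Cl-≑ e c i = c (∈-≑ (≑-sym e) i)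

  ¬Cl : ∀ {F x} → ¬ Cl F x → ∃ λ B → x ∈□ B × (∀ {y} → y ∈□ B → ¬ F y)
  ¬Cl {F} {x} n = dne λ k → n λ {B} i → dne λ m → k (B , i , λ {y} j f → m (y , j , f))

  Open′ : (ℝ² → Set) → Set
  Open′ U = ∀ {x} → U x → ∃ λ B → x ∈□ B × (∀ {y} → y ∈□ B → U y)

  Open⇒ : ∀ {U} → Open U → Open′ U
  Open⇒ o {x} u = let (B , i , h) = o x u in B , ∈ᴮ⇒∈□ i , λ {y} j → h y (∈□⇒∈ᴮ j)

  ⇒Open : ∀ {U} → Open′ U → Open U
  ⇒Open o x u = let (B , i , h) = o u in B , ∈□⇒∈ᴮ i , λ y j → h (∈ᴮ⇒∈□ j)

  point-connected : ∀ p → Connected (_≑ p)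
  point-connected p = (p , ≑-refl) , λ { U W oU oW cov (y , e , u) (y' , e' , w) →
    let (B , i , h) = Open⇒ oU u in y' , e' , h (∈-≑ (≑-trans e (≑-sym e')) i) , w }

  box-connected : ∀ {B x} → x ∈□ B → Connected (_∈□ B)
  box-connected {B} {x} xB = (x , xB) , λ U W oU oW cov (y , yB , u) (y' , yB' , w) → dne λ none →
    let loc : ∀ v → v ∈□ B → ∃ λ A → v ∈□ A × (∀ v' → v' ∈□ A → v' ∈□ B → ⟦ U v' ⟧ ≡ ⟦ U v ⟧)
        loc v vB = [ (λ uv → let (A , i , h) = Open⇒ oU uv in A , i , λ v' j _ → trans (⟦⟧-true (h j)) (sym (⟦⟧-true uv)))
                   , (λ wv → let (A , i , h) = Open⇒ oW wv in A , i , λ v' j k → trans (⟦⟧-false (λ u' → none (v' , k , u' , h j))) (sym (⟦⟧-false (λ u' → none (v , vB , u' , wv))))) ]′ (cov vB)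
    in none (y' , yB' , ⟦⟧-sound (trans (sym (boxConn (λ v → ⟦ U v ⟧) loc yB yB')) (⟦⟧-true u)) , w)

  union-connected : ∀ {C D : Pred ℝ² 0ℓ} → Connected C → Connected D → (∃ λ x → C x × D x) → Connected (C ∪ D)
  union-connected {C} {D} (c₀ , fC) (_ , fD) (x , xC , xD) = (proj₁ c₀ , inj₁ (proj₂ c₀)) , meet
    where
    meet : ∀ (U W : Pred ℝ² 0ℓ) → Open U → Open W → C ∪ D ⊆ U ∪ W → (∃ λ y → (C ∪ D) y × U y) → (∃ λ y → (C ∪ D) y × W y) → ∃ λ y → (C ∪ D) y × U y × W y
    meet U W oU oW cov a b = [ (λ u → allU u b) , (λ w → allW w a) ]′ (cov (inj₁ xC))
      where
      allU : U x → (∃ λ y → (C ∪ D) y × W y) → ∃ λ y → (C ∪ D) y × U y × W y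
      allU u (y , inj₁ p , w) = let (v , q , r) = fC U W oU oW (λ q → cov (inj₁ q)) (x , xC , u) (y , p , w) in v , inj₁ q , r
      allU u (y , inj₂ p , w) = let (v , q , r) = fD U W oU oW (λ q → cov (inj₂ q)) (x , xD , u) (y , p , w) in v , inj₂ q , r
      allW : W x → (∃ λ y → (C ∪ D) y × U y) → ∃ λ y → (C ∪ D) y × U y × W y
      allW w (y , inj₁ p , u) = let (v , q , r) = fC U W oU oW (λ q → cov (inj₁ q)) (y , p , u) (x , xC , w) in v , inj₁ q , r
      allW w (y , inj₂ p , u) = let (v , q , r) = fD U W oU oW (λ q → cov (inj₂ q)) (y , p , u) (x , xD , w) in v , inj₂ q , r

  OffG⇒Complement : ∀ {x} → OffG x → Complement P x
  OffG⇒Complement off a h = off a (≈⇒≑ h)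

  OffG-≑ : ∀ {x y} → x ≑ y → OffG x → OffG y
  OffG-≑ e off a h = off a (≑-trans h (≑-sym e))

  OffG⇒OffL : ∀ {x L} → OffG x → OffL x L
  OffG⇒OffL off {e} _ t = off (on e t)

  -- The face through a point p of the complement; the excluded middle at level
  -- one makes the union of all connected sets through p a small predicate.
  module FaceOf (p : ℝ²) (off : OffG p) where
    private
      Big : ℝ² → Set₁
      Big x = Σ (Pred ℝ² 0ℓ) λ D → Connected D × (D ⊆ Complement P) × D p × D x

      decide : (A : Set₁) → Dec A
      decide A = em {A}

      from-does : ∀ {A : Set₁} (d : Dec A) → does d ≡ true → A
      from-does (yes a) _ = a
      to-does : ∀ {A : Set₁} (d : Dec A) → A → does d ≡ true
      to-does (yes _) _ = refl
      to-does (no n) a = ⊥-elim (n a)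

    Face : ℝ² → Set
    Face x = does (decide (Big x)) ≡ true

    private
      un : ∀ {x} → Face x → Big x
      un {x} = from-does (decide (Big x))
      mk : ∀ {x} → Big x → Face x
      mk {x} = to-does (decide (Big x))

    p∈Face : Face p
    p∈Face = mk ((_≑ p) , point-connected p , (λ e a h → off a (≑-trans (≈⇒≑ h) e)) , ≑-refl , ≑-refl)

    isFace : IsFace P Face
    isFace = (λ f → let (D , _ , D⊆ , _ , x) = un f in D⊆ x) , ((p , p∈Face) , conn) , λ D cD F⊆D D⊆ x → mk (D , cD , D⊆ , F⊆D p∈Face , x)
      where
      conn : ∀ (U W : Pred ℝ² 0ℓ) → Open U → Open W → Face ⊆ U ∪ W → (∃ λ x → Face x × U x) → (∃ λ x → Face x × W x) → ∃ λ x → Face x × U x × W x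
      conn U W oU oW cov (y , yF , yU) (w , wF , wW) = [ inU , inW ]′ (cov p∈Face)
        where
        inU : U p → ∃ λ x → Face x × U x × W x
        inU u = let (D , cD , D⊆ , dp , dw) = un wF
                    (v , q , r) = proj₂ cD U W oU oW (λ k → cov (mk (D , cD , D⊆ , dp , k))) (p , dp , u) (w , dw , wW)
                in v , mk (D , cD , D⊆ , dp , q) , r
        inW : W p → ∃ λ x → Face x × U x × W x
        inW u = let (D , cD , D⊆ , dp , dy) = un yF
                    (v , q , r) = proj₂ cD U W oU oW (λ k → cov (mk (D , cD , D⊆ , dp , k))) (y , dy , yU) (p , dp , u)
                in v , mk (D , cD , D⊆ , dp , q) , r

  module _ {F : ℝ² → Set} (isF : IsFace P F) where

    face-off : ∀ {x} → F x → OffG x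
    face-off f a h = proj₁ isF f a (≑⇒≈ h)

    face-absorb : ∀ {D : Pred ℝ² 0ℓ} → Connected D → (∀ {x} → D x → OffG x) → (∃ λ x → F x × D x) → ∀ {x} → D x → F x
    face-absorb {D} cD off meet d = proj₂ (proj₂ isF) (F ∪ D) (union-connected (proj₁ (proj₂ isF)) cD meet) inj₁
      (λ { (inj₁ f) → proj₁ isF f ; (inj₂ d) → OffG⇒Complement (off d) }) (inj₂ d)

    face-box : ∀ {B x y} → (∀ {w} → w ∈□ B → OffG w) → x ∈□ B → F x → y ∈□ B → F y
    face-box {B} off i f = face-absorb (box-connected i) off (_ , f , i)

    -- A connected set stays connected when a limit point is added, and a face is maximal.
    face-closed : ∀ {x} → Cl F x → OffG x → F x
    face-closed {x} c off = proj₂ (proj₂ isF) (F ∪ (_≑ x)) conn inj₁ (λ { (inj₁ f) → proj₁ isF f ; (inj₂ e) → OffG⇒Complement (OffG-≑ (≑-sym e) off) }) (inj₂ ≑-refl)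
      where
      fC = proj₁ (proj₂ isF)
      pull : ∀ (A : Pred ℝ² 0ℓ) → Open A → (∃ λ y → (F ∪ (_≑ x)) y × A y) → ∃ λ y → F y × A y
      pull A oA (y , inj₁ f , u) = y , f , u
      pull A oA (y , inj₂ e , u) = let (B , i , h) = Open⇒ oA u
                                       (w , j , f) = c (∈-≑ e i)
                                   in w , f , h j
      conn : Connected (F ∪ (_≑ x))
      conn = (proj₁ (proj₁ fC) , inj₁ (proj₂ (proj₁ fC))) , λ U W oU oW cov a b →
        let (v , f , r) = proj₂ fC U W oU oW (λ q → cov (inj₁ q)) (pull U oU a) (pull W oW b)
        in v , inj₁ f , r

    face-wind : ∀ {L x y} → Cycle L → F x → F y → wind L x ≡ wind L y
    face-wind {L} {x} {y} cy fx fy = go (wind L x) refl (wind L y) refl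
      where
      Side : Bool → Pred ℝ² 0ℓ
      Side b w = OffL w L × wind L w ≡ b
      side-open : ∀ b → Open′ (Side b)
      side-open b (off , e) = let (B , i , cl , h) = wind-local cy off in B , i , λ j → (λ m → Clear-Off (cl m) j) , trans (h j i) e
      cov : F ⊆ Side true ∪ Side false
      cov {w} f = pick (wind L w) refl
        where
        pick : ∀ b → wind L w ≡ b → (Side true ∪ Side false) w
        pick true e = inj₁ ((λ {e} → OffG⇒OffL (face-off f) {e}) , e)
        pick false e = inj₂ ((λ {e} → OffG⇒OffL (face-off f) {e}) , e)
      clash : ∀ {u v} → F u → wind L u ≡ true → F v → wind L v ≡ false → ⊥
      clash fu eu fv ev = let (w , _ , (_ , a) , (_ , b)) = proj₂ (proj₁ (proj₂ isF)) (Side true) (Side false) (⇒Open (side-open true)) (⇒Open (side-open false)) cov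
                                (_ , fu , (λ {e} → OffG⇒OffL (face-off fu) {e}) , eu) (_ , fv , (λ {e} → OffG⇒OffL (face-off fv) {e}) , ev) in not-both a b
      go : ∀ a → wind L x ≡ a → ∀ b → wind L y ≡ b → wind L x ≡ wind L y
      go true p true q = trans p (sym q)
      go false p false q = trans p (sym q)
      go true p false q = ⊥-elim (clash fx p fy q)
      go false p true q = ⊥-elim (clash fy q fx p)

    cl-wind : ∀ {L x y} → Cycle L → F y → Cl F x → OffL x L → wind L x ≡ wind L y
    cl-wind cy f c off = let (B , i , _ , h) = wind-local cy off
                             (w , j , g) = c i
                         in trans (h i j) (face-wind cy g f)

    -- Within `B` the face is open by `op`. It is also closed there, since a limit point that is not
    -- in the face lies on the graph, which `cl` excludes; so connectedness of the box applies.
    face-fill : ∀ {B} → (∀ {y} → y ∈□ B → F y → ∃ λ A → y ∈□ A × (∀ {w} → w ∈□ A → OffG w)) → (∀ a → φ a ∈□ B → ¬ Cl F (φ a)) →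
      ∀ {x y} → x ∈□ B → y ∈□ B → F x → F y
    face-fill {B} op cl {x} {y} i j f = ⟦⟧-sound (trans (sym (boxConn (λ w → ⟦ F w ⟧) loc i j)) (⟦⟧-true f))
      where
      loc : ∀ w → w ∈□ B → ∃ λ A → w ∈□ A × (∀ v → v ∈□ A → v ∈□ B → ⟦ F v ⟧ ≡ ⟦ F w ⟧)
      loc w wB = go (dec (F w))
        where
        go : Dec (F w) → ∃ λ A → w ∈□ A × (∀ v → v ∈□ A → v ∈□ B → ⟦ F v ⟧ ≡ ⟦ F w ⟧)
        go (yes fw) = let (A , k , off) = op wB fw in A , k , λ v l _ → trans (⟦⟧-true (face-box off k fw l)) (sym (⟦⟧-true fw))
        go (no nf) = let (A , k , h) = ¬Cl {F} {w} λ c → on? c (dec (∃ λ a → φ a ≑ w)) in A , k , λ v l _ → trans (⟦⟧-false (h l)) (sym (⟦⟧-false nf))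
          where
          on? : Cl F w → Dec (∃ λ a → φ a ≑ w) → ⊥
          on? c (yes (a , e)) = cl a (∈-≑ (≑-sym e) wB) (Cl-≑ {F} (≑-sym e) c)
          on? c (no n) = nf (face-closed c λ a e → n (a , e))

  face-unique : ∀ {F F' : ℝ² → Set} → IsFace P F → IsFace P F' → (∃ λ x → F x × F' x) → ∀ {y} → F y → F' y
  face-unique isF isF' (x , f , f') = face-absorb isF' (proj₁ (proj₂ isF)) (face-off isF) (x , f' , f)

  -- Boundary cycles of faces

  Bdry : (ℝ² → Set) → E → Set
  Bdry F e = ∀ t → Cl F (γ e t)

  Bdry⇒ : ∀ {F e} → Bdry F e → BoundaryEdge P F e
  Bdry⇒ {F} {e} c t B i = let (y , j , f) = c t (∈ᴮ⇒∈□ {γ e t} {B} i) in y , ∈□⇒∈ᴮ {y} {B} j , f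

  ⇒Bdry : ∀ {F e} → BoundaryEdge P F e → Bdry F e
  ⇒Bdry {F} {e} c t {B} i = let (y , j , f) = c t B (∈□⇒∈ᴮ {γ e t} {B} i) in y , ∈ᴮ⇒∈□ {y} {B} j , f

  ½ᴵ : I
  ½ᴵ = toI (fromℚ ½) (≤⇒≼ (ℚₚ.<⇒≤ (ℚₚ.positive⁻¹ ½))) (≤⇒≼ (ℚ.*≤* (ℤ.+≤+ (ℕ.s≤s ℕ.z≤n))))

  ½-int : Interior ½ᴵ
  ½-int = <∙⇒≺ (<⇒<∙ (ℚₚ.positive⁻¹ ½)) , ∙<⇒≺ (<⇒∙< (ℚ.*<* (ℤ.+<+ (ℕ.s≤s (ℕ.s≤s ℕ.z≤n)))))

  choose : ∀ {A B : Set} (b : B) (R : A → B → Set) (Pr : A → Set) → (∀ {a} → Pr a → ∃ (R a)) → ∃ λ (f : A → B) → ∀ {a} → Pr a → R a (f a)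
  choose {A} {B} b R Pr h = (λ a → f′ a (dec (Pr a))) , λ {a} p → ok a p (dec (Pr a))
    where
    f′ : ∀ a → Dec (Pr a) → B
    f′ a (yes p) = proj₁ (h p)
    f′ a (no _) = b
    ok : ∀ a → Pr a → (d : Dec (Pr a)) → R a (f′ a d)
    ok a p (yes q) = proj₂ (h q)
    ok a p (no n) = ⊥-elim (n p)

  -- The finite list `K` accounts for the graph on and inside `C`. So the face is open, every limit
  -- point of it on the graph is on `K`, and `Push` is used with empty `Ext`.
  module Surrounded (C K : List E) (cyc : Cycle C) (C⊂K : ∀ {e} → e ∈ C → e ∈ K)
    (inside : ∀ a → OffL (φ a) C → wind C (φ a) ≡ true → ∃₂ λ e t → e ∈ K × φ a ≑ γ e t)
    {F : ℝ² → Set} (isF : IsFace P F) {p : ℝ²} (Fp : F p) (wp : wind C p ≡ true) where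

    Fw : ∀ {x} → F x → wind C x ≡ true
    Fw f = trans (face-wind isF cyc f Fp) wp

    cl-inside : ∀ a → Cl F (φ a) → ∃₂ λ e t → e ∈ K × φ a ≑ γ e t
    cl-inside a c = go (dec (∃₂ λ e t → e ∈ C × γ e t ≑ φ a))
      where
      go : Dec (∃₂ λ e t → e ∈ C × γ e t ≑ φ a) → ∃₂ λ e t → e ∈ K × φ a ≑ γ e t
      go (yes (e , t , m , h)) = e , t , C⊂K m , ≑-sym h
      go (no n) = let off : OffL (φ a) C
                      off {e} m t h = n (e , t , m , h)
                  in inside a off (trans (cl-wind isF cyc Fp c off) wp)

    bdry∈K : ∀ {e} → Bdry F e → e ∈ K
    bdry∈K {e} c = let (f , t , m , h) = cl-inside (on e ½ᴵ) (c ½ᴵ) in subst (_∈ K) (proj₁ (γ-int-inj {e} {f} {½ᴵ} {t} ½-int h)) m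

    open-face : ∀ {y} → F y → ∃ λ A → y ∈□ A × (∀ {w} → w ∈□ A → OffG w)
    open-face {y} f = let (A , i , cl) = avoidL {y} K (OffG⇒OffL (face-off isF f))
                          (A' , i' , cl' , h) = wind-local cyc (OffG⇒OffL (face-off isF f))
                      in A ⊓□ A' , ∈⊓ i i' , λ {w} j a e →
                         let wA = ∈-⊑ (⊓⊑ˡ A A') j
                             wA' = ∈-⊑ (⊓⊑ʳ A A') j
                             (g , t , m , k) = inside a (λ m t k → Clear-Off (cl' m) wA' t (≑-trans k e)) (trans (trans (wind-≑ cyc (λ m t k → Clear-Off (cl' m) wA' t (≑-trans k e)) e) (h wA' i')) (Fw f))
                         in Clear-Off (cl m) wA t (≑-trans (≑-sym k) e)

    D : List E
    D = proj₁ (select (Bdry F) K)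
    D-spec : ∀ {e} → e ∈ D → e ∈ K × Bdry F e
    D-spec = proj₁ (proj₂ (select (Bdry F) K))
    D-all : ∀ {e} → Bdry F e → e ∈ D
    D-all c = proj₂ (proj₂ (select (Bdry F) K)) (bdry∈K c) c

    private
      W = window K
      lo = proj₁ W
      hi = proj₁ (proj₂ W)
      wK : ∀ {e} → e ∈ K → ∀ t → Supp lo hi (γ e t)
      wK = proj₂ (proj₂ W)
      F-supp : ∀ {x} → F x → Supp lo hi x
      F-supp f = dne λ n → not-both (Fw f) (wind-outside cyc (λ m → wK (C⊂K m)) n)
      lo≤hi : lo ≤ hi
      lo≤hi = let (supp a b _ _) = F-supp Fp in ℚₚ.<⇒≤ (cut-< (proj₁ p) a b)
      -- A test point outside the window, where both the winding number and the indicator of the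
      -- face vanish. It turns the differences given by `push` into values.
      o : ℝ²
      o = fromℚ hi , fromℚ hi
      ¬So : ¬ Supp lo hi o
      ¬So (supp _ b _ _) = ℚₚ.<-irrefl refl (∙<⇒< b)
      o-off : OffL o K
      o-off m t h = ¬So (let (supp a b c d) = wK m t in supp (≈-<∙ (≑₁ h) a) (≈-∙< (≑₁ h) b) (≈-<∙ (≑₂ h) c) (≈-∙< (≑₂ h) d))
      X : E → I → Set
      X e t = e ∈ K × Cl F (γ e t)
      cuts = choose 0ᴵ (λ e t → ¬ Cl F (γ e t)) (λ e → ¬ Bdry F e) (λ {e} n → ¬∀⇒∃ {P = λ t → Cl F (γ e t)} (λ h → n (λ t {B} → h t {B})))

    boundaryCycle : ∀ (Q : List ℝ²) → (∀ {q} → q ∈ Q → OffG q) → ∃ λ L → (∀ {e} → e ∈ L → e ∈ D) × Cycle L × (∀ {q} → q ∈ Q → wind L q ≡ ⟦ F q ⟧)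
    boundaryCycle Q Q-off = let (L , s , cy , h) = Push.push K D X proj₁ (λ m → proj₁ (D-spec m)) (proj₁ cuts)
                                     (λ {e} m n → let (B , i , k) = ¬Cl {F} (proj₂ cuts {e} (λ b → n (D-all b))) in B , i , λ { (_ , c) j → let (y , l , f) = c j in k l f })
                                     (λ _ → ⊥) 1ℚ (0<1/ 0) (λ _ _ _ ()) F
                                     (λ {x} {y} {B} i j free _ f → face-fill isF {B} (λ _ → open-face) (λ a k c → let (e , t , m , h) = cl-inside a c in free (m , Cl-≑ {F} h c) (∈-≑ h k)) i j f)
                                     lo hi lo≤hi F-supp (o ∷ Q)
                                     (λ { (here refl) → o-off ; (there m) → OffG⇒OffL (Q-off m) })
                                     (λ m → let (B , i , cl) = avoidL K (off′ m) in B , i , (λ { (m , _) j → Clear-Off (cl m) j _ ≑-refl }) , λ ())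
                                     (λ _ _ → (λ _ → false) , λ _ ())
                            in L , s , cy , λ {q} m → trans (sym (xor-identityʳ (wind L q))) (trans (cong (wind L q xor_) (sym (wind-outside cy (λ k → wK (proj₁ (D-spec (s k)))) ¬So)))
                                  (trans (h (there m) (here refl)) (trans (cong (⟦ F q ⟧ xor_) (⟦⟧-false (λ f → ¬So (F-supp f)))) (xor-identityʳ ⟦ F q ⟧))))
      where
      off′ : ∀ {q} → q ∈ o ∷ Q → OffL q K
      off′ (here refl) = o-off
      off′ (there m) = OffG⇒OffL (Q-off m)

  open Walks em graph

  -- `x` and `y` lie in a box whose sides are at least `ε` away from those of `g`. A box of size `ε`
  -- with a point outside `g` is separated from it, and `cr-move` applies.
  exact-step : ∀ {g x y} → x ∈□ g → y ∈□ g → ∃ λ ε → 0ℚ < ε × (∀ {b a a'} → Size ε b → ¬ (a ∈□ g) → a ∈□ b → a' ∈□ b → cr x a a' xor cr y a a' ≡ shift x y a xor shift x y a')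
  exact-step {g} {x} {y} xg yg = go (low (∈-left xg) (∈-left yg)) (upp (∈-right xg) (∈-right yg)) (low (∈-bottom xg) (∈-bottom yg)) (upp (∈-top xg) (∈-top yg))
    where
    low : ∀ {q} {u v : ℝ} → q <∙ u → q <∙ v → ∃ λ q' → q < q' × q' <∙ u × q' <∙ v
    low {q} {u} {v} a b = let (s , p , c) = <∙-round u a
                              (t , p' , c') = <∙-round v b
      in s ⊓ t , [ (λ e → subst (q <_) (sym e) p) , (λ e → subst (q <_) (sym e) p') ]′ (ℚₚ.⊓-sel s t) , <∙-down u (ℚₚ.p⊓q≤p s t) c , <∙-down v (ℚₚ.p⊓q≤q s t) c'
    upp : ∀ {q} {u v : ℝ} → u ∙< q → v ∙< q → ∃ λ q' → q' < q × u ∙< q' × v ∙< q'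
    upp {q} {u} {v} a b = let (s , p , c) = ∙<-round u a
                              (t , p' , c') = ∙<-round v b
      in s ⊔ t , [ (λ e → subst (_< q) (sym e) p) , (λ e → subst (_< q) (sym e) p') ]′ (ℚₚ.⊔-sel s t) , ∙<-up u (ℚₚ.p≤p⊔q s t) c , ∙<-up v (ℚₚ.p≤q⊔p s t) c'
    go : _ → _ → _ → _ → ∃ λ ε → 0ℚ < ε × (∀ {b a a'} → Size ε b → ¬ (a ∈□ g) → a ∈□ b → a' ∈□ b → cr x a a' xor cr y a a' ≡ shift x y a xor shift x y a')
    go (l , l₁ , l₂ , l₃) (r , r₁ , r₂ , r₃) (d , d₁ , d₂ , d₃) (u , u₁ , u₂ , u₃) =
      ε , 0<⊓ (0<⊓ (diff-pos l₁) (diff-pos r₁)) (0<⊓ (diff-pos d₁) (diff-pos u₁)) , λ {b} {a} s n i j →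
        cr-move {h} {b} (sep s n i) (mk∈ l₂ r₂ d₂ u₂) (mk∈ l₃ r₃ d₃ u₃) i j
      where
      h : Box
      h = mkBox l r d u
      ε₁ = (l - left g) ⊓ (right g - r)
      ε₂ = (d - bottom g) ⊓ (top g - u)
      ε : ℚ
      ε = ε₁ ⊓ ε₂
      εl : ε ≤ l - left g
      εl = ℚₚ.≤-trans (ℚₚ.p⊓q≤p ε₁ ε₂) (ℚₚ.p⊓q≤p (l - left g) (right g - r))
      εr : ε ≤ right g - r
      εr = ℚₚ.≤-trans (ℚₚ.p⊓q≤p ε₁ ε₂) (ℚₚ.p⊓q≤q (l - left g) (right g - r))
      εd : ε ≤ d - bottom g
      εd = ℚₚ.≤-trans (ℚₚ.p⊓q≤q ε₁ ε₂) (ℚₚ.p⊓q≤p (d - bottom g) (top g - u))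
      εu : ε ≤ top g - u
      εu = ℚₚ.≤-trans (ℚₚ.p⊓q≤q ε₁ ε₂) (ℚₚ.p⊓q≤q (d - bottom g) (top g - u))
      below : ∀ {p q l' r'} {z : ℝ} → ¬ (p <∙ z) → l' <∙ z → r' ≤ l' + ε → ε ≤ q - p → r' ≤ q
      below {p} {q} {l'} {r'} {z} n lz s e = lin≤ (l'≤p ≤+≤ s ≤+≤ e) (linear 5 (λ p q l' r' ε → q :+ (l' :+ r' :+ ε) := r' :+ (p :+ (l' :+ ε) :+ (q :- p))) refl p q l' r' ε)
        where
        l'≤p : l' ≤ p
        l'≤p = ≮⇒≥ λ lt → n (<∙-down z (ℚₚ.<⇒≤ lt) lz)
      above : ∀ {p q l' r'} {z : ℝ} → ¬ (z ∙< p) → z ∙< r' → r' ≤ l' + ε → ε ≤ p - q → q ≤ l'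
      above {p} {q} {l'} {r'} {z} n zr s e = lin≤ (p≤r' ≤+≤ s ≤+≤ e) (linear 5 (λ p q l' r' ε → l' :+ (p :+ r' :+ ε) := q :+ (r' :+ (l' :+ ε) :+ (p :- q))) refl p q l' r' ε)
        where
        p≤r' : p ≤ r'
        p≤r' = ≮⇒≥ λ lt → n (∙<-up z (ℚₚ.<⇒≤ lt) zr)
      sep : ∀ {b a} → Size ε b → ¬ (a ∈□ g) → a ∈□ b → Sep h b
      sep {b} {a} s n i = from (dec (left g <∙ proj₁ a)) (dec (proj₁ a ∙< right g)) (dec (bottom g <∙ proj₂ a)) (dec (proj₂ a ∙< top g))
        where
        from : _ → _ → _ → _ → Sep h b
        from (no k) _ _ _ = sepᵣ (below k (∈-left i) (width s) εl)
        from _ (no k) _ _ = sepₗ (above k (∈-right i) (width s) εr)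
        from _ _ (no k) _ = sepᵗ (below k (∈-bottom i) (height s) εd)
        from _ _ _ (no k) = sepᵇ (above k (∈-top i) (height s) εu)
        from (yes p) (yes q) (yes p') (yes q') = ⊥-elim (n (mk∈ p q p' q'))

  -- If a point z of an edge f is not in the closure of the face F, but f is
  -- connected to the boundary of F, then a boundary cycle of F separates F from z.
  module Escape (finiteStar : ∀ v → ∃ λ (l : List E) → ∀ {e} → Inc v e → e ∈ l)
    {F : ℝ² → Set} (isF : IsFace P F) (dF : List E) (dF-sound : ∀ {e} → e ∈ dF → Bdry F e) (dF-complete : ∀ {e} → Bdry F e → e ∈ dF)
    (e₀ : E) (t₀ : I) (touch : Cl F (γ e₀ t₀)) (f : E) (f∉ : f ∉ dF) (link : Walk graph (src e₀) (src f)) where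

    private
      cuts = choose 0ᴵ (λ e t → ¬ Cl F (γ e t)) (λ e → e ∉ dF) (λ {e} n → ¬∀⇒∃ {P = λ t → Cl F (γ e t)} (λ h → n (dF-complete (λ t {B} → h t {B}))))
      z : E → I
      z = proj₁ cuts
      z-out : ∀ {e} → e ∉ dF → ¬ Cl F (γ e (z e))
      z-out = proj₂ cuts

      -- The boundary, together with a connection from `e₀` to `f` along which a test point at the
      -- face is compared with one at `f`.
      Bs : List E
      Bs = e₀ ∷ f ∷ walkEdges link ++ dF

      VB : V → Set
      VB v = ∃ λ e → e ∈ Bs × Inc v e

      stars : List E → List E
      stars L = concat (map (λ e → proj₁ (finiteStar (src e)) ++ proj₁ (finiteStar (tgt e))) L)

      stars-spec : ∀ L {e v g} → e ∈ L → Inc v e → Inc v g → g ∈ stars L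
      stars-spec (e ∷ L) {v = v} (here refl) (inj₁ refl) i = ∈-++⁺ˡ (∈-++⁺ˡ (proj₂ (finiteStar v) i))
      stars-spec (e ∷ L) {v = v} (here refl) (inj₂ refl) i = ∈-++⁺ˡ (∈-++⁺ʳ (proj₁ (finiteStar (src e))) (proj₂ (finiteStar v) i))
      stars-spec (e ∷ L) (there m) j i = ∈-++⁺ʳ (proj₁ (finiteStar (src e)) ++ proj₁ (finiteStar (tgt e))) (stars-spec L m j i)

      K : List E
      K = stars Bs
      VB⊂K : ∀ {v e} → VB v → Inc v e → e ∈ K
      VB⊂K (g , m , i) j = stars-spec Bs m i j
      B⊂K : ∀ {e} → e ∈ Bs → e ∈ K
      B⊂K m = VB⊂K (_ , m , inj₁ refl) (inj₁ refl)
      dF⊂B : ∀ {e} → e ∈ dF → e ∈ Bs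
      dF⊂B m = there (there (∈-++⁺ʳ (walkEdges link) m))

      -- An edge outside `dF` counts only from an end in `VB` up to its cut. The cut is off the
      -- closure of `F`, so the part of that closure in `Core` is closed along every edge.
      Core : E → I → Set
      Core e t = e ∈ dF ⊎ (proj₁ t ≺ proj₁ (z e) × VB (src e)) ⊎ (proj₁ (z e) ≺ proj₁ t × VB (tgt e))

      Core⊂K : ∀ {e t} → Core e t → e ∈ K
      Core⊂K (inj₁ m) = B⊂K (dF⊂B m)
      Core⊂K (inj₂ (inj₁ (_ , v))) = VB⊂K v (inj₁ refl)
      Core⊂K (inj₂ (inj₂ (_ , v))) = VB⊂K v (inj₂ refl)

      lo = proj₁ (window K)
      hi = proj₁ (proj₂ (window K))
      wK : ∀ {e} → e ∈ K → ∀ t → Supp lo hi (γ e t)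
      wK = proj₂ (proj₂ (window K))
      Wb : Box
      Wb = mkBox lo hi lo hi
      inW : ∀ {e} → e ∈ K → ∀ t → γ e t ∈□ Wb
      inW m t = let (supp a b c d) = wK m t in mk∈ a b c d

      record Good (b : Box) : Set where
        field
          inWindow : b ⊑ Wb
          inK      : ∀ a → φ a ∈□ b → ∃₂ λ e t → e ∈ K × φ a ≑ γ e t
          core     : ∀ {e t} → γ e t ∈□ b → Cl F (γ e t) → Core e t
      open Good

      -- The neighbourhood under control. Every point of the graph in it is on an edge of the finite
      -- list `K`; elsewhere, infinitely many edges may come close.
      N : ℝ² → Set
      N x = ∃ λ b → Good b × x ∈□ b

      X : E → I → Set
      X e t = Cl F (γ e t) × Core e t

      clear-of-F : ∀ {x} → ¬ Cl F x → ∃ λ B → x ∈□ B × (∀ {y} → y ∈□ B → ¬ Cl F y)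
      clear-of-F n = let (B , i , h) = ¬Cl {F} n in B , i , λ j c → let (w , k , fw) = c j in h k fw

      vertexGood : ∀ {v} → VB v → N (vx v)
      vertexGood {v} vb = from (dec (Cl F (vx v)))
        where
        S = starBox v
        B₀ = proj₁ S
        i₀ = proj₁ (proj₂ S)
        st₀ = proj₂ (proj₂ S)
        inK′ : ∀ {b} → b ⊑ B₀ → ∀ a → φ a ∈□ b → ∃₂ λ e t → e ∈ K × φ a ≑ γ e t
        inK′ s (on e t) i = e , t , VB⊂K vb (OpenStar⇒Inc {t = t} (st₀ (on e t) (∈-⊑ s i))) , ≑-refl
        inK′ s (vertex w) i with st₀ (vertex w) (∈-⊑ s i)
        ... | refl = go vb
          where
          go : VB w → ∃₂ λ e t → e ∈ K × vx w ≑ γ e t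
          go (e , m , inj₁ refl) = e , 0ᴵ , B⊂K m , ≑-sym (γ-src {e} {0ᴵ} ≋-refl)
          go (e , m , inj₂ refl) = e , 1ᴵ , B⊂K m , ≑-sym (γ-tgt {e} {1ᴵ} ≋-refl)
        vW : vx v ∈□ Wb
        vW = go vb
          where
          go : VB v → vx v ∈□ Wb
          go (e , m , inj₁ refl) = ∈-≑ (γ-src {e} {0ᴵ} ≋-refl) (inW (B⊂K m) 0ᴵ)
          go (e , m , inj₂ refl) = ∈-≑ (γ-tgt {e} {1ᴵ} ≋-refl) (inW (B⊂K m) 1ᴵ)
        Beyond : E → I → Set
        Beyond g s = (src g ≡ v × proj₁ (z g) ≼ proj₁ s) ⊎ (tgt g ≡ v × proj₁ s ≼ proj₁ (z g))
        trim : Cl F (vx v) → ∀ L → ∃ λ B → vx v ∈□ B × (∀ {g} → g ∈ L → g ∉ dF → ∀ s → Beyond g s → ¬ (γ g s ∈□ B))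
        trim c [] = B₀ , i₀ , λ ()
        trim c (g ∷ L) = go (dec (g ∈ dF)) (trim c L)
          where
          go : Dec (g ∈ dF) → (∃ λ B → vx v ∈□ B × (∀ {g} → g ∈ L → g ∉ dF → ∀ s → Beyond g s → ¬ (γ g s ∈□ B))) → ∃ λ B → vx v ∈□ B × (∀ {g'} → g' ∈ g ∷ L → g' ∉ dF → ∀ s → Beyond g' s → ¬ (γ g' s ∈□ B))
          go (yes m) (B , i , h) = B , i , λ { (here refl) n → ⊥-elim (n m) ; (there k) → h k }
          go (no n) (B , i , h) = let (B' , i' , h') = avoidPart {g} {vx v} (Beyond g) part in
            B ⊓□ B' , ∈⊓ i i' , λ { (here refl) _ s b j → h' s b (∈-⊑ (⊓⊑ʳ B B') j) ; (there k) n' s b j → h k n' s b (∈-⊑ (⊓⊑ˡ B B') j) }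
            where
            z≉ : ∀ t → γ g t ≑ vx v → ¬ (proj₁ t ≋ proj₁ (z g))
            z≉ t e k = z-out n (Cl-≑ {F} (≑-trans (≑-sym e) (γ-≋ {g} {t} {z g} k)) c)
            part : ∀ t → γ g t ≑ vx v → ∃₂ λ l r → l <∙ proj₁ t × proj₁ t ∙< r × (∀ s → l <∙ proj₁ s → proj₁ s ∙< r → ¬ Beyond g s)
            part t e = by (vx-γ {v} {g} {t} (≑-sym e))
              where
              by : At v (on g t) → ∃₂ λ l r → l <∙ proj₁ t × proj₁ t ∙< r × (∀ s → l <∙ proj₁ s → proj₁ s ∙< r → ¬ Beyond g s)
              by (inj₁ (t0 , sv)) = let (q , u , w) = lt
                                        (l , _ , p , _) = bracket (proj₁ t) (0<1/ 0)
                                    in l , q , p , u , λ s _ sq → λ { (inj₁ (_ , k)) → k (q , sq , w) ; (inj₂ (tv , _)) → loopless g (trans sv (sym tv)) }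
                where
                lt : proj₁ t ≺ proj₁ (z g)
                lt = dne λ k → z≉ t e (≼-antisym (≼-trans (≈⇒⊀ t0) (I≥0 (z g))) k)
              by (inj₂ (t1 , tv)) = let (q , u , w) = gt
                                        (_ , r , _ , p , _) = bracket (proj₁ t) (0<1/ 0)
                                    in q , r , w , p , λ s qs _ → λ { (inj₁ (sv , _)) → loopless g (trans sv (sym tv)) ; (inj₂ (_ , k)) → k (q , u , qs) }
                where
                gt : proj₁ (z g) ≺ proj₁ t
                gt = dne λ k → z≉ t e (≼-antisym k (≼-trans (I≤1 (z g)) (≈⇒⊁ t1)))
        from : Dec (Cl F (vx v)) → N (vx v)
        from (no n) = let (B , i , h) = clear-of-F n in (B₀ ⊓□ B) ⊓□ Wb , record
          { inWindow = ⊓⊑ʳ (B₀ ⊓□ B) Wb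
          ; inK = inK′ (⊑-trans (⊓⊑ˡ (B₀ ⊓□ B) Wb) (⊓⊑ˡ B₀ B))
          ; core = λ j c → ⊥-elim (h (∈-⊑ (⊑-trans (⊓⊑ˡ (B₀ ⊓□ B) Wb) (⊓⊑ʳ B₀ B)) j) c) } , ∈⊓ (∈⊓ i₀ i) vW
        from (yes c) = let (B , i , h) = trim c (proj₁ (finiteStar v)) in (B₀ ⊓□ B) ⊓□ Wb , record
          { inWindow = ⊓⊑ʳ (B₀ ⊓□ B) Wb
          ; inK = inK′ (⊑-trans (⊓⊑ˡ (B₀ ⊓□ B) Wb) (⊓⊑ˡ B₀ B))
          ; core = λ {g} {t} j _ → core′ {g} {t} (λ n b → h (proj₂ (finiteStar v) (OpenStar⇒Inc {t = t} (st₀ (on g t) (∈-⊑ (⊑-trans (⊓⊑ˡ (B₀ ⊓□ B) Wb) (⊓⊑ˡ B₀ B)) j)))) n t b (∈-⊑ (⊑-trans (⊓⊑ˡ (B₀ ⊓□ B) Wb) (⊓⊑ʳ B₀ B)) j))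
              (st₀ (on g t) (∈-⊑ (⊑-trans (⊓⊑ˡ (B₀ ⊓□ B) Wb) (⊓⊑ˡ B₀ B)) j)) } , ∈⊓ (∈⊓ i₀ i) vW
          where
          core′ : ∀ {g t} → (g ∉ dF → ¬ Beyond g t) → OpenStar v (on g t) → Core g t
          core′ {g} {t} nb os = go (dec (g ∈ dF)) os
            where
            go : Dec (g ∈ dF) → OpenStar v (on g t) → Core g t
            go (yes m) _ = inj₁ m
            go (no n) (inj₁ (e , _)) = inj₂ (inj₁ (dne (λ k → nb n (inj₁ (e , k))) , subst VB (sym e) vb))
            go (no n) (inj₂ (e , _)) = inj₂ (inj₂ (dne (λ k → nb n (inj₂ (e , k))) , subst VB (sym e) vb))

      pointGood : ∀ e t → (e ∈ Bs ⊎ X e t) → N (γ e t)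
      pointGood e t h = from (I-cases t)
        where
        eK : e ∈ K
        eK = [ B⊂K , (λ x → Core⊂K {e} {t} (proj₂ x)) ]′ h
        N-≑ : ∀ {x y} → x ≑ y → N x → N y
        N-≑ k (b , g , i) = b , g , ∈-≑ k i
        vsrc : proj₁ t ≋ 𝟎 → (e ∈ Bs ⊎ X e t) → VB (src e)
        vsrc _ (inj₁ m) = e , m , inj₁ refl
        vsrc _ (inj₂ (_ , inj₁ m)) = e , dF⊂B m , inj₁ refl
        vsrc _ (inj₂ (_ , inj₂ (inj₁ (_ , v)))) = v
        vsrc k (inj₂ (_ , inj₂ (inj₂ (l , _)))) = ⊥-elim (I≥0 (z e) (≺-≼ l (≈⇒⊀ k)))
        vtgt : proj₁ t ≋ 𝟏 → (e ∈ Bs ⊎ X e t) → VB (tgt e)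
        vtgt _ (inj₁ m) = e , m , inj₂ refl
        vtgt _ (inj₂ (_ , inj₁ m)) = e , dF⊂B m , inj₂ refl
        vtgt k (inj₂ (_ , inj₂ (inj₁ (l , _)))) = ⊥-elim (I≤1 (z e) (≼-≺ (≈⇒⊁ k) l))
        vtgt _ (inj₂ (_ , inj₂ (inj₂ (_ , v)))) = v
        from : proj₁ t ≋ 𝟎 ⊎ proj₁ t ≋ 𝟏 ⊎ Interior t → N (γ e t)
        from (inj₁ k) = N-≑ (≑-sym (γ-src k)) (vertexGood (vsrc k h))
        from (inj₂ (inj₁ k)) = N-≑ (≑-sym (γ-tgt k)) (vertexGood (vtgt k h))
        from (inj₂ (inj₂ int)) = go h
          where
          EB = edgeBox e t int
          B₀ = proj₁ EB
          i₀ = proj₁ (proj₂ EB)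
          only = proj₂ (proj₂ EB)
          build : ∀ B → γ e t ∈□ B → (∀ {s} → γ e s ∈□ B → Cl F (γ e s) → Core e s) → N (γ e t)
          build B i c = (B₀ ⊓□ B) ⊓□ Wb , record
            { inWindow = ⊓⊑ʳ (B₀ ⊓□ B) Wb
            ; inK = λ a j → inK′ a (only a (∈-⊑ s₀ j))
            ; core = λ {g} {s} j k → core′ g s (only (on g s) (∈-⊑ s₀ j)) (∈-⊑ (⊑-trans (⊓⊑ˡ (B₀ ⊓□ B) Wb) (⊓⊑ʳ B₀ B)) j) k } , ∈⊓ (∈⊓ i₀ i) (inW eK t)
            where
            s₀ : (B₀ ⊓□ B) ⊓□ Wb ⊑ B₀
            s₀ = ⊑-trans (⊓⊑ˡ (B₀ ⊓□ B) Wb) (⊓⊑ˡ B₀ B)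
            inK′ : ∀ a → OnEdge e a → ∃₂ λ e t → e ∈ K × φ a ≑ γ e t
            inK′ (on g s) (refl , _) = e , s , eK , ≑-refl
            core′ : ∀ g s → OnEdge e (on g s) → γ g s ∈□ B → Cl F (γ g s) → Core g s
            core′ g s (refl , _) = c
          splitCore : VB (src e) → VB (tgt e) → e ∉ dF → ∀ {s} → Cl F (γ e s) → Core e s
          splitCore vs vt n {s} c = [ (λ l → inj₂ (inj₁ (l , vs))) , (λ l → inj₂ (inj₂ (l , vt))) ]′ (≉⇒≺ λ k → z-out n (Cl-≑ {F} (γ-≋ {e} {s} {z e} k) c))
          go : e ∈ Bs ⊎ X e t → N (γ e t)
          go (inj₁ m) = build B₀ i₀ λ {s} _ c → inB (dec (e ∈ dF)) {s} c
            where
            inB : Dec (e ∈ dF) → ∀ {s} → Cl F (γ e s) → Core e s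
            inB (yes k) _ = inj₁ k
            inB (no n) {s} c = splitCore (e , m , inj₁ refl) (e , m , inj₂ refl) n {s} c
          go (inj₂ (_ , inj₁ m)) = build B₀ i₀ λ _ _ → inj₁ m
          go (inj₂ (_ , inj₂ (inj₁ ((q , u , w) , v)))) =
            let (B , i , h) = avoidPart {e} {γ e t} (λ s → proj₁ (z e) ≼ proj₁ s) (λ t' k → let (l , _ , p , _) = bracket (proj₁ t') (0<1/ 0) in l , q , p , ≈-∙< (γ-inj {e} {t} {t'} (≑-sym k)) u , λ s _ sq k' → k' (q , sq , w))
            in build B i λ {s} j _ → inj₂ (inj₁ (dne (λ k → h s k j) , v))
          go (inj₂ (_ , inj₂ (inj₂ ((q , u , w) , v)))) =
            let (B , i , h) = avoidPart {e} {γ e t} (λ s → proj₁ s ≼ proj₁ (z e)) (λ t' k → let (_ , r , _ , p , _) = bracket (proj₁ t') (0<1/ 0) in q , r , ≈-<∙ (γ-inj {e} {t} {t'} (≑-sym k)) w , p , λ s qs _ k' → k' (q , u , qs))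
            in build B i λ {s} j _ → inj₂ (inj₂ (dne (λ k → h s k j) , v))

      Ext : ℝ² → Set
      Ext x = ¬ N x

      Within′ : ℚ → E → I → Set
      Within′ ε e s = X e s → ∀ {b} → Size ε b → γ e s ∈□ b → ∃ λ g → Good g × b ⊑ g

      edgeApart : ∀ e → ∃ λ ε → 0ℚ < ε × (∀ s → Within′ ε e s)
      edgeApart e = let (ε , p , h) = cousinI Q add loc in ε , p , λ s → h s (All-In s)
        where
        Q : ℚ → ℚ → Set
        Q l r = ∃ λ ε → 0ℚ < ε × (∀ s → In[ l , r ] s → Within′ ε e s)
        add : ∀ {l m r} → 0ℚ ≤ l → l ≤ m → m ≤ r → r ≤ 1ℚ → Q l m → Q m r → Q l r
        add _ _ _ _ (ε , p , h) (ε' , p' , h') = ε ⊓ ε' , 0<⊓ p p' ,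
          pointwise {R = Within′ (ε ⊓ ε') e} (λ s i x k → h s i x (Size-mono (ℚₚ.p⊓q≤p ε ε') k)) (λ s i x k → h' s i x (Size-mono (ℚₚ.p⊓q≤q ε ε') k))
        Loc : I → Set
        Loc t = ∃₂ λ l₀ r₀ → l₀ <∙ proj₁ t × proj₁ t ∙< r₀ × (∀ {l r} → l₀ < l → r < r₀ → Q l r)
        none : ∀ t → (∃₂ λ l₀ r₀ → l₀ <∙ proj₁ t × proj₁ t ∙< r₀ × (∀ s → l₀ <∙ proj₁ s → proj₁ s ∙< r₀ → ¬ X e s)) → Loc t
        none t (l , r , u , v , h) = l , r , u , v , λ p q → 1ℚ , 0<1/ 0 , λ s i x → let (a , b) = In[]-open {t = s} i p q in ⊥-elim (h s a b x)
        loc : ∀ t → Loc t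
        loc t = go (dec (Cl F (γ e t))) (dec (Core e t))
          where
          go : Dec (Cl F (γ e t)) → Dec (Core e t) → Loc t
          go (no n) _ = let (B , i , h) = clear-of-F n
                            (l , r , u , v , k) = cont e t i
                        in none t (l , r , u , v , λ s a b x → h (k s a b) (proj₁ x))
          go (yes c) (yes co) = let (g , gd , i) = pointGood e t (inj₂ (c , co))
                                    (B₁ , ε , i₁ , p , _ , mg) = margin i
                                    (l , r , u , v , k) = cont e t i₁
            in l , r , u , v , λ pl pr → ε , p , λ s is _ sz j → let (a , b) = In[]-open {t = s} is pl pr in g , gd , mg (k s a b) sz j
          go (yes c) (no nc) = none t ([ lowr , uppr ]′ (≉⇒≺ λ k → z-out e∉ (Cl-≑ {F} (γ-≋ {e} {t} {z e} k) c)))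
            where
            e∉ : e ∉ dF
            e∉ m = nc (inj₁ m)
            lowr : proj₁ t ≺ proj₁ (z e) → _
            lowr (q , u , w) = let (l , _ , p , _) = bracket (proj₁ t) (0<1/ 0) in l , q , p , u , λ s _ sq →
              λ { (_ , inj₁ m) → e∉ m ; (_ , inj₂ (inj₁ (_ , v))) → nc (inj₂ (inj₁ ((q , u , w) , v))) ; (_ , inj₂ (inj₂ (k , _))) → ≺⇒≼ k (q , sq , w) }
            uppr : proj₁ (z e) ≺ proj₁ t → _
            uppr (q , u , w) = let (_ , r , _ , p , _) = bracket (proj₁ t) (0<1/ 0) in q , r , w , p , λ s qs _ →
              λ { (_ , inj₁ m) → e∉ m ; (_ , inj₂ (inj₁ (k , _))) → ≺⇒≼ k (q , u , qs) ; (_ , inj₂ (inj₂ (_ , v))) → nc (inj₂ (inj₂ ((q , u , w) , v))) }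

      apartness = listBound K (λ ε e → ∀ s → Within′ ε e s) (λ le h s x k → h s x (Size-mono le k)) (λ {e} _ → edgeApart e)

      data Lnk : ℝ² → ℝ² → Set where
        here′ : ∀ {x} → Lnk x x
        hop   : ∀ {x y w g} → Good g → x ∈□ g → y ∈□ g → Lnk y w → Lnk x w

      lnk-trans : ∀ {x y w} → Lnk x y → Lnk y w → Lnk x w
      lnk-trans here′ m = m
      lnk-trans (hop g i j l) m = hop g i j (lnk-trans l m)

      hop₁ : ∀ {x y} → N x → x ≑ y → Lnk x y
      hop₁ (b , g , i) e = hop g i (∈-≑ e i) here′

      edgeLnk : ∀ {e} → e ∈ Bs → ∀ s t → Lnk (γ e s) (γ e t)
      edgeLnk {e} m s t = ⟦⟧-sound (trans (sym (connI (λ u → ⟦ Lnk (γ e s) (γ e u) ⟧) s t loc)) (⟦⟧-true here′))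
        where
        loc : ∀ a → Btw s t a → ∃₂ λ l r → l <∙ proj₁ a × proj₁ a ∙< r × (∀ b → l <∙ proj₁ b → proj₁ b ∙< r → Btw s t b → ⟦ Lnk (γ e s) (γ e b) ⟧ ≡ ⟦ Lnk (γ e s) (γ e a) ⟧)
        loc a _ = let (g , gd , i) = pointGood e a (inj₁ m)
                      (l , r , u , v , k) = cont e a i
                  in l , r , u , v , λ b x y _ → ⟦⟧-cong (λ h → lnk-trans h (hop gd (k b x y) i here′)) (λ h → lnk-trans h (hop gd i (k b x y) here′))

      joinLnk : ∀ {e u v} → e ∈ Bs → Joins e u v → Lnk (vx u) (vx v)
      joinLnk {e} m (inj₁ (refl , refl)) = lnk-trans (hop₁ (vertexGood (e , m , inj₁ refl)) (≑-sym (γ-src {e} {0ᴵ} ≋-refl))) (lnk-trans (edgeLnk m 0ᴵ 1ᴵ) (hop₁ (pointGood e 1ᴵ (inj₁ m)) (γ-tgt {e} {1ᴵ} ≋-refl)))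
      joinLnk {e} m (inj₂ (refl , refl)) = lnk-trans (hop₁ (vertexGood (e , m , inj₂ refl)) (≑-sym (γ-tgt {e} {1ᴵ} ≋-refl))) (lnk-trans (edgeLnk m 1ᴵ 0ᴵ) (hop₁ (pointGood e 0ᴵ (inj₁ m)) (γ-src {e} {0ᴵ} ≋-refl)))

      walkLnk : ∀ {u v} (w : Walk graph u v) → (∀ {e} → e ∈ walkEdges w → e ∈ Bs) → Lnk (vx u) (vx v)
      walkLnk done _ = here′
      walkLnk (step (e , j) w) s = lnk-trans (joinLnk (s (here refl)) j) (walkLnk w (λ m → s (there m)))

      Exact : ℝ² → ℝ² → Set
      Exact x y = ∃ λ ε → 0ℚ < ε × ∃ λ (g : ℝ² → Bool) → ∀ {b a a'} → Size ε b → Ext a → a ∈□ b → Ext a' → a' ∈□ b → cr x a a' xor cr y a a' ≡ g a xor g a'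

      -- Moving the base point within a good box changes the crossing cochain outside the box by a
      -- coboundary. `Ext` is outside all good boxes, so the coboundaries of a chain of boxes add
      -- up.
      lnk-exact : ∀ {x y} → Lnk x y → Exact x y
      lnk-exact {x} here′ = 1ℚ , 0<1/ 0 , (λ _ → false) , λ {b} {a} {a'} _ _ _ _ _ → xor-same (cr x a a')
      lnk-exact {x} {w} (hop {y = y} {g = g} gd i j l) =
        let (ε , p , h) = exact-step i j
            (ε' , p' , f , h') = lnk-exact l
        in ε ⊓ ε' , 0<⊓ p p' , (λ a → shift x y a xor f a) , λ {b} {a} {a'} s ea ia ea' ia' →
          trans (tel (cr x a a') (cr y a a') (cr w a a')) (trans (cong₂ _xor_ (h (Size-mono (ℚₚ.p⊓q≤p ε ε') s) (λ k → ea (g , gd , k)) ia ia') (h' (Size-mono (ℚₚ.p⊓q≤q ε ε') s) ea ia ea' ia'))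
            (xor-interchange (shift x y a) (shift x y a') (f a) (f a')))
        where
        tel : ∀ p q r → p xor r ≡ (p xor q) xor (q xor r)
        tel = bool 3 (λ p q r → p ⊕ r ⊜ (p ⊕ q) ⊕ (q ⊕ r)) refl

      goodOff : ∀ {x} → N x → OffL x K → OffG x
      goodOff (b , g , i) off a e = let (h , t , m , k) = inK g a (∈-≑ (≑-sym e) i) in off m t (≑-trans (≑-sym k) e)

      f∈B : f ∈ Bs
      f∈B = there (here refl)

      g₀ = pointGood e₀ t₀ (inj₁ (here refl))
      test₁ = touch (proj₂ (proj₂ g₀))
      p : ℝ²
      p = proj₁ test₁
      p∈g : p ∈□ proj₁ g₀
      p∈g = proj₁ (proj₂ test₁)
      Fp : F p
      Fp = proj₂ (proj₂ test₁)
      gz = pointGood f (z f) (inj₁ f∈B)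
      cz = clear-of-F (z-out f∉)
      test₂ = holeL K (∈⊓ (proj₂ (proj₂ gz)) (proj₁ (proj₂ cz)))
      o : ℝ²
      o = proj₁ test₂
      o∈g : o ∈□ proj₁ gz
      o∈g = ∈-⊑ (⊓⊑ˡ (proj₁ gz) (proj₁ cz)) (proj₁ (proj₂ test₂))
      o∈c : o ∈□ proj₁ cz
      o∈c = ∈-⊑ (⊓⊑ʳ (proj₁ gz) (proj₁ cz)) (proj₁ (proj₂ test₂))
      o-off : OffG o
      o-off = goodOff (proj₁ gz , proj₁ (proj₂ gz) , o∈g) (proj₂ (proj₂ test₂))
      ¬Fo : ¬ F o
      ¬Fo h = proj₂ (proj₂ cz) o∈c (λ {B} i → o , i , h)

      linked : Lnk p o
      linked = hop (proj₁ (proj₂ g₀)) p∈g (proj₂ (proj₂ g₀)) (lnk-trans (edgeLnk (here refl) t₀ 0ᴵ) (lnk-trans (hop₁ (pointGood e₀ 0ᴵ (inj₁ (here refl))) (γ-src {e₀} {0ᴵ} ≋-refl))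
        (lnk-trans (walkLnk link (λ m → there (there (∈-++⁺ˡ m)))) (lnk-trans (hop₁ (vertexGood (f , f∈B , inj₁ refl)) (≑-sym (γ-src {f} {0ᴵ} ≋-refl)))
          (lnk-trans (edgeLnk f∈B 0ᴵ (z f)) (hop (proj₁ (proj₂ gz)) (proj₂ (proj₂ gz)) o∈g here′))))))

      ex = lnk-exact linked
      ε₀ : ℚ
      ε₀ = proj₁ ex ⊓ proj₁ apartness
      ε₀>0 : 0ℚ < ε₀
      ε₀>0 = 0<⊓ (proj₁ (proj₂ ex)) (proj₁ (proj₂ apartness))

      -- The face cut off at the frontier of the controlled neighbourhood, so its own frontier is in
      -- `X` or in `Ext`.
      Φ : ℝ² → Set
      Φ x = F x × N x

      tests : List ℝ²
      tests = p ∷ o ∷ []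
      OffG-test : ∀ {q} → q ∈ tests → OffG q
      OffG-test (here refl) = face-off isF Fp
      OffG-test (there (here refl)) = o-off
      N-test : ∀ {q} → q ∈ tests → N q
      N-test (here refl) = proj₁ g₀ , proj₁ (proj₂ g₀) , p∈g
      N-test (there (here refl)) = proj₁ gz , proj₁ (proj₂ gz) , o∈g

      free : ∀ {q} → q ∈ tests → ∃ λ B → q ∈□ B × (∀ {e t} → X e t → ¬ (γ e t ∈□ B)) × (∀ {a} → Ext a → ¬ (a ∈□ B))
      free m = let (b , g , i) = N-test m
                   (B , j , cl) = avoidL K (OffG⇒OffL (OffG-test m))
               in b ⊓□ B , ∈⊓ i j , (λ {e} {t} x k → Clear-Off (cl (Core⊂K {e} {t} (proj₂ x))) (∈-⊑ (⊓⊑ʳ b B) k) t ≑-refl) , λ n k → n (b , g , ∈-⊑ (⊓⊑ˡ b B) k)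

      exact : ∀ {q q'} → q ∈ tests → q' ∈ tests → ∃ λ (g : ℝ² → Bool) → ∀ {b a a'} → Size ε₀ b → Ext a → a ∈□ b → Ext a' → a' ∈□ b → cr q a a' xor cr q' a a' ≡ g a xor g a'
      exact (here refl) (here refl) = (λ _ → false) , λ {b} {a} {a'} _ _ _ _ _ → xor-same (cr p a a')
      exact (here refl) (there (here refl)) = proj₁ (proj₂ (proj₂ ex)) , λ s → proj₂ (proj₂ (proj₂ ex)) (Size-mono (ℚₚ.p⊓q≤p (proj₁ ex) (proj₁ apartness)) s)
      exact (there (here refl)) (here refl) = proj₁ (proj₂ (proj₂ ex)) , λ {b} {a} {a'} s ea ia ea' ia' → trans (xor-comm (cr o a a') (cr p a a')) (proj₂ (proj₂ (proj₂ ex)) (Size-mono (ℚₚ.p⊓q≤p (proj₁ ex) (proj₁ apartness)) s) ea ia ea' ia')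
      exact (there (here refl)) (there (here refl)) = (λ _ → false) , λ {b} {a} {a'} _ _ _ _ _ → xor-same (cr o a a')

      invΦ : ∀ {x y B} → x ∈□ B → y ∈□ B → (∀ {e t} → X e t → ¬ (γ e t ∈□ B)) → (∀ {a} → Ext a → ¬ (a ∈□ B)) → Φ x → Φ y
      invΦ {x} {y} {B} i j noX noE (fx , _) = face-fill isF {B} op cl i j fx , inN j
        where
        inN : ∀ {w} → w ∈□ B → N w
        inN k = dne λ n → noE n k
        op : ∀ {w} → w ∈□ B → F w → ∃ λ A → w ∈□ A × (∀ {v} → v ∈□ A → OffG v)
        op {w} k fw = let (b , g , l) = inN k
                          (A , m , c) = avoidL {w} K (OffG⇒OffL (face-off isF fw))
          in b ⊓□ A , ∈⊓ l m , λ q → goodOff (b , g , ∈-⊑ (⊓⊑ˡ b A) q) (λ mm → Clear-Off (c mm) (∈-⊑ (⊓⊑ʳ b A) q))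
        cl : ∀ a → φ a ∈□ B → ¬ Cl F (φ a)
        cl a k c = let (b , g , l) = inN k
                       (e , t , m , h) = inK g a l
                       c' = Cl-≑ {F} h c
                   in noX {e} {t} (c' , core g (∈-≑ h l) c') (∈-≑ h k)

      supΦ : ∀ {x} → Φ x → Supp lo hi x
      supΦ (_ , b , g , i) = let j = ∈-⊑ (inWindow g) i in supp (∈-left j) (∈-right j) (∈-bottom j) (∈-top j)

      lo≤hi : lo ≤ hi
      lo≤hi = let (supp a b _ _) = supΦ {p} (Fp , N-test (here refl)) in ℚₚ.<⇒≤ (cut-< (proj₁ p) a b)

      result = Push.push K dF X (λ {e} {t} x → Core⊂K {e} {t} (proj₂ x)) (λ m → B⊂K (dF⊂B m)) z
        (λ {e} _ n → let (B , i , h) = clear-of-F (z-out n) in B , i , λ x j → h j (proj₁ x))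
        Ext ε₀ ε₀>0
        (λ {b} {e} {t} s x i n k → let (g , gd , b⊑) = proj₂ (proj₂ apartness) (Core⊂K {e} {t} (proj₂ x)) t x (Size-mono (ℚₚ.p⊓q≤q (proj₁ ex) (proj₁ apartness)) s) i in n (g , gd , ∈-⊑ b⊑ k))
        Φ invΦ lo hi lo≤hi supΦ tests (λ m → OffG⇒OffL (OffG-test m)) free exact

    escape : ∃ λ z → ¬ Cl F (γ f z) × ∃ λ L → (∀ {e} → e ∈ L → e ∈ dF) × Cycle L × (∀ {q} → F q → wind L q ≡ not (wind L (γ f z)))
    escape = let (L , s , cy , h) = result in z f , z-out f∉ , L , s , cy , λ {q} fq →
        fin (wind L q) (wind L p) (wind L o) (wind L (γ f (z f))) (face-wind isF cy fq Fp)
          (trans (h (here refl) (there (here refl))) (cong₂ _xor_ (⟦⟧-true (Fp , N-test (here refl))) (⟦⟧-false (λ k → ¬Fo (proj₁ k)))))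
          (boxConn (wind L) (λ w wc → let (A , i , _ , k) = wind-local cy (λ m t e → proj₂ (proj₂ cz) (∈-≑ (≑-sym e) wc) (dF-sound (s m) t)) in A , i , λ v j _ → k j i) o∈c (proj₁ (proj₂ cz)))
      where
      fin : ∀ q p o z → q ≡ p → p xor o ≡ true → o ≡ z → q ≡ not z
      fin true true false false _ _ _ = refl
      fin false false true true _ _ _ = refl

  -- Finitely many vertices in a bounded region

  module _ (accFree : AccumulationFree P) where

    isolating : ∀ x → ∃ λ B → x ∈□ B × (∀ v → vx v ∈□ B → vx v ≑ x)
    isolating x = dne λ none → accFree x λ B i → dne λ k → none (B , ∈ᴮ⇒∈□ i , λ v j → dne λ ne →
      k (vx v , ∈□⇒∈ᴮ j , (v , ≑⇒≈ {vx v} {vx v} ≑-refl) , λ e → ne (≈⇒≑ e)))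

    locallyFinite : ∀ x → ∃ λ B → x ∈□ B × ∃ λ (L : List V) → ∀ v → vx v ∈□ B → v ∈ L
    locallyFinite x = let (B , i , h) = isolating x in B , i , go B h (dec (∃ λ v → vx v ≑ x))
      where
      go : ∀ B → (∀ v → vx v ∈□ B → vx v ≑ x) → Dec (∃ λ v → vx v ≑ x) → ∃ λ (L : List V) → ∀ v → vx v ∈□ B → v ∈ L
      go B h (yes (v , e)) = v ∷ [] , λ w j → here (vx-inj (≑-trans (h w j) (≑-sym e)))
      go B h (no n) = [] , λ w j → ⊥-elim (n (w , h w j))

    -- Compactness of the square. `Cousin` in the second coordinate gives a strip with finitely many
    -- vertices around each abscissa, and `Cousin` in the first coordinate covers the square by such
    -- strips.
    finiteVertices : ∀ lo hi → ∃ λ (L : List V) → ∀ v → Supp lo hi (vx v) → v ∈ L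
    finiteVertices lo hi = go (<-or-≥ lo hi)
      where
      go : lo < hi ⊎ hi ≤ lo → ∃ λ (L : List V) → ∀ v → Supp lo hi (vx v) → v ∈ L
      go (inj₂ ge) = [] , λ { v (supp a b _ _) → ⊥-elim (<⇒≢≥ (cut-< (proj₁ (vx v)) a b) ge) }
      go (inj₁ lt) = let (L , h) = Cousin.cousin Q lo hi (λ _ _ _ _ → add) (λ x _ _ → loc x) (ℚₚ.<⇒≤ lt) in L ,
          λ { v (supp a b c d) → h v (≺⇒≼ (<∙⇒≺ a)) (≺⇒≼ (∙<⇒≺ b)) (≺⇒≼ (<∙⇒≺ c)) (≺⇒≼ (∙<⇒≺ d)) }
        where
        Q : ℚ → ℚ → Set
        Q l r = ∃ λ (L : List V) → ∀ v → fromℚ l ≼ proj₁ (vx v) → proj₁ (vx v) ≼ fromℚ r → fromℚ lo ≼ proj₂ (vx v) → proj₂ (vx v) ≼ fromℚ hi → v ∈ L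
        add : ∀ {l m r} → Q l m → Q m r → Q l r
        add {m = m} (L , f) (L' , f') = L ++ L' , λ v a b c d → [ (λ k → ∈-++⁺ˡ (f v a k c d)) , (λ k → ∈-++⁺ʳ L (f' v k b c d)) ]′ (≼-total (proj₁ (vx v)) (fromℚ m))
        loc : ∀ x → ∃₂ λ l₀ r₀ → l₀ <∙ x × x ∙< r₀ × (∀ {l r} → lo ≤ l → l ≤ r → r ≤ hi → l₀ < l → r < r₀ → Q l r)
        loc x = let (l₀ , r₀ , u , v , L , f) = Cousin.cousin Q₂ lo hi (λ _ _ _ _ → add₂) (λ y _ _ → loc₂ y) (ℚₚ.<⇒≤ lt) in
            l₀ , r₀ , u , v , λ _ _ _ p q → L , λ w a b c d → f w (<∙-≼ (<⇒<∙ p) a) (≼-∙< b (<⇒∙< q)) c d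
          where
          Q₂ : ℚ → ℚ → Set
          Q₂ l r = ∃₂ λ l₀ r₀ → l₀ <∙ x × x ∙< r₀ × ∃ λ (L : List V) → ∀ v → l₀ <∙ proj₁ (vx v) → proj₁ (vx v) ∙< r₀ → fromℚ l ≼ proj₂ (vx v) → proj₂ (vx v) ≼ fromℚ r → v ∈ L
          add₂ : ∀ {l m r} → Q₂ l m → Q₂ m r → Q₂ l r
          add₂ {m = m} (l₀ , r₀ , a , b , L , f) (l₁ , r₁ , a' , b' , L' , f') = l₀ ⊔ l₁ , r₀ ⊓ r₁ , <∙-⊔ a a' , ∙<-⊓ b b' , L ++ L' , λ v c d e g →
            [ (λ k → ∈-++⁺ˡ (f v (<∙-down (proj₁ (vx v)) (ℚₚ.p≤p⊔q l₀ l₁) c) (∙<-up (proj₁ (vx v)) (ℚₚ.p⊓q≤p r₀ r₁) d) e k))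
            , (λ k → ∈-++⁺ʳ L (f' v (<∙-down (proj₁ (vx v)) (ℚₚ.p≤q⊔p l₀ l₁) c) (∙<-up (proj₁ (vx v)) (ℚₚ.p⊓q≤q r₀ r₁) d) k g)) ]′ (≼-total (proj₂ (vx v)) (fromℚ m))
          loc₂ : ∀ y → ∃₂ λ l₀ r₀ → l₀ <∙ y × y ∙< r₀ × (∀ {l r} → lo ≤ l → l ≤ r → r ≤ hi → l₀ < l → r < r₀ → Q₂ l r)
          loc₂ y = let (B , i , L , f) = locallyFinite (x , y) in bottom B , top B , ∈-bottom i , ∈-top i , λ _ _ _ p q →
            left B , right B , ∈-left i , ∈-right i , L , λ v a b c d → f v (mk∈ a b (<∙-≼ (<⇒<∙ p) c) (≼-∙< d (<⇒∙< q)))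

  -- Vertices inside a cycle

  OnV : List E → V → Set
  OnV C v = ∃ λ e → e ∈ C × Inc v e

  onList : List E → List V
  onList C = concat (map (λ e → src e ∷ tgt e ∷ []) C)

  onList-full : ∀ {C v} → OnV C v → v ∈ onList C
  onList-full (e , m , inj₁ refl) = ∈-concat-map (λ e → src e ∷ tgt e ∷ []) m (here refl)
  onList-full (e , m , inj₂ refl) = ∈-concat-map (λ e → src e ∷ tgt e ∷ []) m (there (here refl))

  onList-len : ∀ C → length (onList C) ℕ.≤ length C ℕ.* 2
  onList-len C = concat-length (λ e → src e ∷ tgt e ∷ []) 2 C (λ _ → ℕₚ.≤-refl)

  offV : ∀ {C v} → ¬ OnV C v → OffL (vx v) C
  offV n m t h = n (_ , m , At⇒Inc {t = t} (vx-γ {t = t} (≑-sym h)))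

  Ins : List E → V → Set
  Ins C v = ¬ OnV C v × wind C (vx v) ≡ true

  along : ∀ {C} f s t → Cycle C → f ∉ C → (∀ u → Btw s t u → ∀ v → At v (on f u) → ¬ OnV C v) → wind C (γ f s) ≡ wind C (γ f t)
  along {C} f s t cy f∉ ok = wind-edge f s t cy λ u b {e} m w h →
    let (v , p , q) = γ-meet {f} {e} {u} {w} (λ k → f∉ (subst (_∈ C) (sym k) m)) (≑-sym h) in ok u b v p (e , m , At⇒Inc {t = w} q)

  vertex-along : ∀ {C e u v} → Cycle C → Joins e u v → ¬ OnV C u → ¬ OnV C v → wind C (vx u) ≡ wind C (vx v)
  vertex-along {C} {e} {u} {v} cy j nu nv = go j
    where
    e∉ : e ∉ C
    e∉ m = nu (e , m , inc j)
      where
      inc : Joins e u v → Inc u e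
      inc (inj₁ (a , _)) = inj₁ a
      inc (inj₂ (_ , b)) = inj₂ b
    whole : (∀ w → Inc w e → ¬ OnV C w) → wind C (vx (src e)) ≡ wind C (vx (tgt e))
    whole ok = trans (sym (wind-≑ cy (λ m t h → offV (ok (src e) (inj₁ refl)) m t (≑-trans h (γ-src {e} {0ᴵ} ≋-refl))) (γ-src {e} {0ᴵ} ≋-refl)))
      (trans (along e 0ᴵ 1ᴵ cy e∉ (λ u _ w p → ok w (At⇒Inc {t = u} p)))
        (wind-≑ cy (λ m t h → offV (ok (tgt e) (inj₂ refl)) m t (≑-trans h (γ-tgt {e} {1ᴵ} ≋-refl))) (γ-tgt {e} {1ᴵ} ≋-refl)))
    go : Joins e u v → wind C (vx u) ≡ wind C (vx v)
    go (inj₁ (refl , refl)) = whole λ { w (inj₁ refl) → nu ; w (inj₂ refl) → nv }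
    go (inj₂ (refl , refl)) = sym (whole λ { w (inj₁ refl) → nv ; w (inj₂ refl) → nu })

  module Inside (accFree : AccumulationFree P) where

    insFinite : ∀ {C} → Cycle C → Finite (Ins C)
    insFinite {C} cy = let (lo , hi , w) = window C
                           (L , h) = finiteVertices accFree lo hi
                       in enumerate (Ins C) L (λ { {v} (_ , e) → h v (dne λ n → not-both e (wind-outside cy w n)) })

    -- An edge between two vertices off the cycle has the same winding number at both ends, so one
    -- can leave the inside only through the cycle.
    ins-boundary : ∀ {C} (cy : Cycle C) {v} → ∂ graph (Finite.elems (insFinite cy)) v → v ∈ onList C
    ins-boundary {C} cy {v} (n , w , w∈ , (e , j)) = onList-full (dne λ k → n (Finite.full (insFinite cy) (k ,
      trans (vertex-along cy j k (proj₁ (Finite.sound (insFinite cy) w∈))) (proj₂ (Finite.sound (insFinite cy) w∈)))))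

    ins-bound : ∀ (β : ℕ → ℕ) → (∀ {m n} → m ℕ.≤ n → β m ℕ.≤ β n) → (∀ s S → Unique (s ∷ S) → ∀ b → HasSize (∂ graph (s ∷ S)) b → length (s ∷ S) ℕ.≤ β b) →
      ∀ {C} (cy : Cycle C) → length (Finite.elems (insFinite cy)) ℕ.≤ β (length C ℕ.* 2)
    ins-bound β mono iso {C} cy = go (Finite.elems (insFinite cy)) (Finite.uniq (insFinite cy)) (λ {v} → ins-boundary cy {v})
      where
      go : ∀ S → Unique S → (∀ {v} → ∂ graph S v → v ∈ onList C) → length S ℕ.≤ β (length C ℕ.* 2)
      go [] _ _ = ℕ.z≤n
      go (s ∷ S) u h = let f = enumerate (∂ graph (s ∷ S)) (onList C) h in
        ℕₚ.≤-trans (iso s S u _ (hasSize f)) (mono (ℕₚ.≤-trans (finite-≤ f (onList C) h) (onList-len C)))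

  module Bounded (accFree : AccumulationFree P) (Δ : ℕ) (star : V → List E) (star-len : ∀ v → length (star v) ℕ.≤ Δ) (star-full : ∀ {e v w} → Joins e v w → e ∈ star v) where
    open Inside accFree public
    open Balls Δ star star-len star-full public

    star-inc : ∀ {v e} → Inc v e → e ∈ star v
    star-inc (inj₁ refl) = star-full (inj₁ (refl , refl))
    star-inc (inj₂ refl) = star-full (inj₂ (refl , refl))

    finiteStar : ∀ v → ∃ λ (l : List E) → ∀ {e} → Inc v e → e ∈ l
    finiteStar v = star v , star-inc

    hull : ∀ {C} → Cycle C → List V
    hull {C} cy = onList C ++ Finite.elems (insFinite cy)

    hull-full : ∀ {C} (cy : Cycle C) {v} → wind C (vx v) ≡ true ⊎ OnV C v → v ∈ hull cy
    hull-full {C} cy {v} (inj₂ o) = ∈-++⁺ˡ (onList-full o)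
    hull-full {C} cy {v} (inj₁ w) = go (dec (OnV C v))
      where
      go : Dec (OnV C v) → v ∈ hull cy
      go (yes o) = ∈-++⁺ˡ (onList-full o)
      go (no n) = ∈-++⁺ʳ (onList C) (Finite.full (insFinite cy) (n , w))

    hull⁻ : ∀ {C} (cy : Cycle C) {v} → v ∈ hull cy → v ∈ onList C ⊎ Ins C v
    hull⁻ {C} cy m = [ inj₁ , (λ k → inj₂ (Finite.sound (insFinite cy) k)) ]′ (∈-++⁻ (onList C) m)

    hullEdges : ∀ {C} → Cycle C → List E
    hullEdges cy = edgesAt (hull cy)

    C⊂hull : ∀ {C} (cy : Cycle C) {e} → e ∈ C → e ∈ hullEdges cy
    C⊂hull cy {e} m = edgesAt-full {w = tgt e} (hull-full cy (inj₂ (e , m , inj₁ refl))) (inj₁ (refl , refl))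

    -- If `src e` is off the cycle, the winding number is constant on the edge from there up to `t`.
    -- The cycle could interfere only at `tgt e` with `t` equal to 1, which is excluded by `off`.
    edge-inside : ∀ {C} (cy : Cycle C) e t → OffL (γ e t) C → wind C (γ e t) ≡ true → src e ∈ hull cy
    edge-inside {C} cy e t off w = go (dec (OnV C (src e)))
      where
      go : Dec (OnV C (src e)) → src e ∈ hull cy
      go (yes o) = hull-full cy (inj₂ o)
      go (no n) = hull-full cy (inj₁ (trans (sym (wind-≑ cy (λ m s h → offV n m s (≑-trans h (γ-src {e} {0ᴵ} ≋-refl))) (γ-src {e} {0ᴵ} ≋-refl))) (trans (along e 0ᴵ t cy (λ m → off m t ≑-refl) ok) w)))
        where
        ok : ∀ u → Btw 0ᴵ t u → ∀ v → At v (on e u) → ¬ OnV C v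
        ok u b v (inj₁ (_ , refl)) = n
        ok u b v (inj₂ (k , refl)) (f , m , i) = at-tgt i
          where
          t1 : proj₁ t ≋ 𝟏
          t1 = [ (λ { (_ , ut) → ≼-antisym (I≤1 t) (≼-trans (≈⇒⊁ k) ut) }) , (λ { (_ , u0) → ⊥-elim (u0 (≺-resp ≋-refl (≋-sym k) 0≺1)) }) ]′ b
          at-tgt : Inc (tgt e) f → ⊥
          at-tgt (inj₁ p) = off m 0ᴵ (≑-trans (γ-src {f} {0ᴵ} ≋-refl) (≑-trans (subst (λ x → vx (src f) ≑ vx x) p ≑-refl) (≑-sym (γ-tgt {e} {t} t1))))
          at-tgt (inj₂ p) = off m 1ᴵ (≑-trans (γ-tgt {f} {1ᴵ} ≋-refl) (≑-trans (subst (λ x → vx (tgt f) ≑ vx x) p ≑-refl) (≑-sym (γ-tgt {e} {t} t1))))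

    module _ (noIsolated : ∀ v → ∃ λ e → Inc v e) where

      inside : ∀ {C} (cy : Cycle C) a → OffL (φ a) C → wind C (φ a) ≡ true → ∃₂ λ e t → e ∈ hullEdges cy × φ a ≑ γ e t
      inside cy (on e t) off w = e , t , edgesAt-full {w = tgt e} (edge-inside cy e t off w) (inj₁ (refl , refl)) , ≑-refl
      inside {C} cy (vertex v) off w = go (noIsolated v)
        where
        go : (∃ λ e → Inc v e) → ∃₂ λ e t → e ∈ hullEdges cy × vx v ≑ γ e t
        go (e , inj₁ refl) = e , 0ᴵ , edgesAt-full {w = tgt e} (hull-full cy (inj₁ w)) (inj₁ (refl , refl)) , ≑-sym (γ-src {e} {0ᴵ} ≋-refl)
        go (e , inj₂ refl) = e , 1ᴵ , edgesAt-full {w = src e} (hull-full cy (inj₁ w)) (inj₂ (refl , refl)) , ≑-sym (γ-tgt {e} {1ᴵ} ≋-refl)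

    cl-hull : ∀ {C} (cy : Cycle C) {F} → IsFace P F → ∀ {q} → F q → wind C q ≡ true → ∀ {v} → Cl F (vx v) → v ∈ hull cy
    cl-hull {C} cy isF fq w {v} c = go (dec (OnV C v))
      where
      go : Dec (OnV C v) → v ∈ hull cy
      go (yes o) = hull-full cy (inj₂ o)
      go (no n) = hull-full cy (inj₁ (trans (cl-wind isF cy fq c (offV n)) w))

    Infinite : V → Set
    Infinite v = ∀ n → ¬ HasSize (ComponentOf graph v) n

    beyond : ∀ {v} → Infinite v → ∀ L → ∃ λ u → Walk graph v u × u ∉ L
    beyond {v} inf L = dne λ none → let f = enumerate (ComponentOf graph v) L (λ {u} p → dne λ n → none (u , p , n)) in inf _ (hasSize f)

    -- An infinite component leaves every bounded window, so it has an edge `f` with an end `u`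
    -- outside the window of the boundary edges. `Escape` separates the face from a point of `f`.
    -- The winding number vanishes at `u` and hence, along `f`, at that point.
    surround : ∀ {F} → IsFace P F → (dF : List E) → (∀ {e} → e ∈ dF → Bdry F e) → (∀ {e} → Bdry F e → e ∈ dF) →
      ∀ e₀ t₀ → Cl F (γ e₀ t₀) → Infinite (src e₀) → ∃ λ L → (∀ {e} → e ∈ L → e ∈ dF) × Cycle L × (∀ {q} → F q → wind L q ≡ true)
    surround {F} isF dF sound complete e₀ t₀ touch inf = go (beyond inf (proj₁ VL))
      where
      W = window dF
      lo = proj₁ W
      hi = proj₁ (proj₂ W)
      wd : ∀ {e} → e ∈ dF → ∀ t → Supp lo hi (γ e t)
      wd = proj₂ (proj₂ W)
      VL = finiteVertices accFree lo hi
      Supp-≑ : ∀ {x y} → x ≑ y → Supp lo hi x → Supp lo hi y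
      Supp-≑ h (supp a b c d) = supp (≈-<∙ (≑₁ h) a) (≈-∙< (≑₁ h) b) (≈-<∙ (≑₂ h) c) (≈-∙< (≑₂ h) d)
      lastEdge : ∀ {v u} → Walk graph v u → (∃ λ e → Inc v e) → ∃ λ e → Inc u e
      lastEdge done h = h
      lastEdge (step (e , inj₁ (_ , refl)) p) _ = lastEdge p (e , inj₂ refl)
      lastEdge (step (e , inj₂ (refl , _)) p) _ = lastEdge p (e , inj₁ refl)
      go : (∃ λ u → Walk graph (src e₀) u × u ∉ proj₁ VL) → ∃ λ L → (∀ {e} → e ∈ L → e ∈ dF) × Cycle L × (∀ {q} → F q → wind L q ≡ true)
      go (u , p , u∉) = go₁ (lastEdge p (e₀ , inj₁ refl))
        where
        ¬S : ¬ Supp lo hi (vx u)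
        ¬S s = u∉ (proj₂ VL u s)
        go₁ : (∃ λ f → Inc u f) → ∃ λ L → (∀ {e} → e ∈ L → e ∈ dF) × Cycle L × (∀ {q} → F q → wind L q ≡ true)
        go₁ (f , i) = finish (Escape.escape finiteStar isF dF sound complete e₀ t₀ touch f f∉ (walk i))
          where
          uEnd : Inc u f → I
          uEnd (inj₁ _) = 0ᴵ
          uEnd (inj₂ _) = 1ᴵ
          uEnd-at : ∀ i → At u (on f (uEnd i))
          uEnd-at (inj₁ h) = inj₁ (≋-refl , h)
          uEnd-at (inj₂ h) = inj₂ (≋-refl , h)
          walk : Inc u f → Walk graph (src e₀) (src f)
          walk (inj₁ refl) = p
          walk (inj₂ refl) = p · step (f , inj₂ (refl , refl)) done
          f∉ : f ∉ dF
          f∉ m = ¬S (Supp-≑ (At⇒vx {u} {f} {uEnd i} (uEnd-at i)) (wd m (uEnd i)))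
          finish : (∃ λ z → ¬ Cl F (γ f z) × ∃ λ L → (∀ {e} → e ∈ L → e ∈ dF) × Cycle L × (∀ {q} → F q → wind L q ≡ not (wind L (γ f z)))) → ∃ λ L → (∀ {e} → e ∈ L → e ∈ dF) × Cycle L × (∀ {q} → F q → wind L q ≡ true)
          finish (z , zout , L , s , cy , h) = L , s , cy , λ fq → trans (h fq) (cong not zero′)
            where
            uoff : OffL (vx u) L
            uoff m t k = ¬S (Supp-≑ k (wd (s m) t))
            uv : γ f (uEnd i) ≑ vx u
            uv = At⇒vx {u} {f} {uEnd i} (uEnd-at i)
            -- A vertex of the cycle on this part of `f` is not `u`, which is outside the window.
            -- The other end of `f` is reached only if it is the point at `z`; but vertices of the
            -- cycle are in the closure of the face, and that point is not.
            ok : ∀ w → Btw (uEnd i) z w → ∀ v → At v (on f w) → ¬ OnV L v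
            ok w b v at (e , m , j) = clash i at b
              where
              onF : Cl F (vx v)
              onF = at-v j
                where
                at-v : Inc v e → Cl F (vx v)
                at-v (inj₁ refl) = Cl-≑ {F} (γ-src {e} {0ᴵ} ≋-refl) (sound (s m) 0ᴵ)
                at-v (inj₂ refl) = Cl-≑ {F} (γ-tgt {e} {1ᴵ} ≋-refl) (sound (s m) 1ᴵ)
              isU : v ≡ u → ⊥
              isU refl = at-u j
                where
                at-u : Inc v e → ⊥
                at-u (inj₁ refl) = uoff m 0ᴵ (γ-src {e} {0ᴵ} ≋-refl)
                at-u (inj₂ refl) = uoff m 1ᴵ (γ-tgt {e} {1ᴵ} ≋-refl)
              isZ : proj₁ w ≋ proj₁ z → ⊥
              isZ k = zout (Cl-≑ {F} (≑-trans (≑-sym (At⇒vx {v} {f} {w} at)) (γ-≋ {f} {w} {z} k)) onF)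
              clash : (i : Inc u f) → At v (on f w) → Btw (uEnd i) z w → ⊥
              clash (inj₁ refl) (inj₁ (_ , k)) _ = isU (sym k)
              clash (inj₁ refl) (inj₂ (w1 , _)) (inj₁ (_ , wz)) = isZ (≼-antisym wz (≼-trans (I≤1 z) (≈⇒⊁ w1)))
              clash (inj₁ refl) (inj₂ (w1 , _)) (inj₂ (_ , w0)) = w0 (≺-resp ≋-refl (≋-sym w1) 0≺1)
              clash (inj₂ refl) (inj₂ (_ , k)) _ = isU (sym k)
              clash (inj₂ refl) (inj₁ (w0 , _)) (inj₁ (1w , _)) = 1w (≺-resp (≋-sym w0) ≋-refl 0≺1)
              clash (inj₂ refl) (inj₁ (w0 , _)) (inj₂ (zw , _)) = isZ (≼-antisym (≼-trans (≈⇒⊀ w0) (I≥0 z)) zw)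
            zero′ : wind L (γ f z) ≡ false
            zero′ = trans (sym (along f (uEnd i) z cy (λ m → f∉ (s m)) ok)) (trans (sym (wind-≑ cy uoff (≑-sym uv))) (wind-outside cy (λ m → wd (s m)) ¬S))

  -- Bounded codegree of hyperbolic graphs

  loop-cycle : ∀ {v} (w : Walk graph v v) → Cycle (walkEdges w)
  loop-cycle {v} w = mkCycle λ g → trans (walk-δ g w) (xor-same (g v))

  euler-surround : ∀ {L q} → Cycle L → wind L q ≡ true → ∃ λ (l : Loop) → (∀ {e} → e ∈ walkEdges (proj₂ l) → e ∈ L) × wind (walkEdges (proj₂ l)) q ≡ true
  euler-surround {L} {q} cy w =
    let module U = Euler (euler (length L) L ℕₚ.≤-refl (bd cy))
        (l , m , e) = ⨁-true U.loops (trans (sym (trans (wind≡ L q) (U.sums (var′ q)))) w)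
    in l , U.loops⊂ m , trans (wind≡ _ q) e

  LinearFilling : ℕ → Set
  LinearFilling k = ∀ n {a} (w : Walk graph a a) → len graph w ℕ.≤ n → ∃ λ (Ls : List Loop) → length Ls ℕ.≤ suc n ×
    (∀ {l} → l ∈ Ls → len graph (proj₂ l) ℕ.≤ k) × (∀ ψ → ⨁ ψ (walkEdges w) ≡ ⨁ (λ l → ⨁ ψ (walkEdges (proj₂ l))) Ls)

  module ShortLoops (k : ℕ) (linearFilling : LinearFilling k) where

    shortLoop : ∀ {L q} → Cycle L → wind L q ≡ true → ∃ λ (l : Loop) → len graph (proj₂ l) ℕ.≤ k × wind (walkEdges (proj₂ l)) q ≡ true
    shortLoop {L} {q} cy w =
      let ((v , c) , _ , e) = euler-surround {L} {q} cy w
          (Ls , _ , b , s) = linearFilling (len graph c) c ℕₚ.≤-refl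
          (l , m , e') = ⨁-true Ls (trans (sym (trans (wind≡ (walkEdges c) q) (s (var′ q)))) e)
      in l , b m , trans (wind≡ (walkEdges (proj₂ l)) q) e'

  module Codegree (accFree : AccumulationFree P) (Δ : ℕ) (star : V → List E) (star-len : ∀ v → length (star v) ℕ.≤ Δ) (star-full : ∀ {e v w} → Joins e v w → e ∈ star v)
    (k : ℕ) (linearFilling : LinearFilling k)
    (β : ℕ → ℕ) (mono : ∀ {m n} → m ℕ.≤ n → β m ℕ.≤ β n)
    (iso : ∀ s S → Unique (s ∷ S) → ∀ b → HasSize (∂ graph (s ∷ S)) b → length (s ∷ S) ℕ.≤ β b) where
    open Bounded accFree Δ star star-len star-full public
    open ShortLoops k linearFilling public

    -- A bound for the hull of a short loop: two ends for each of at most `k` edges, and the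
    -- vertices inside, whose vertex boundary consists of such ends.
    M : ℕ
    M = k ℕ.* 2 ℕ.+ β (k ℕ.* 2)

    hull-short : ∀ (l : Loop) → len graph (proj₂ l) ℕ.≤ k → length (hull (loop-cycle (proj₂ l))) ℕ.≤ M
    hull-short (v , w) le = subst (ℕ._≤ M) (sym (length-++ (onList (walkEdges w))))
      (ℕₚ.+-mono-≤ (ℕₚ.≤-trans (onList-len (walkEdges w)) l2) (ℕₚ.≤-trans (ins-bound β mono iso (loop-cycle w)) (mono l2)))
      where
      l2 : length (walkEdges w) ℕ.* 2 ℕ.≤ k ℕ.* 2
      l2 = ℕₚ.*-monoˡ-≤ 2 (subst (ℕ._≤ k) (sym (length-edges w)) le)

    shortSurround : ∀ {F} → IsFace P F → (dF : List E) → (∀ {e} → e ∈ dF → Bdry F e) → (∀ {e} → Bdry F e → e ∈ dF) →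
      ∀ e₀ t₀ → Cl F (γ e₀ t₀) → Infinite (src e₀) → ∃ λ (l : Loop) → len graph (proj₂ l) ℕ.≤ k × (∀ {q} → F q → wind (walkEdges (proj₂ l)) q ≡ true)
    shortSurround {F} isF dF sound complete e₀ t₀ touch inf =
      let (L , s , cy , h) = surround isF dF sound complete e₀ t₀ touch inf
          (q , fq) = proj₁ (proj₁ (proj₂ isF))
          (l , le , w) = shortLoop cy (h fq)
      in l , le , λ fq' → trans (face-wind isF (loop-cycle (proj₂ l)) fq' fq) w

    -- The second summand bounds the edges at the hull of a short loop around the face. The first is
    -- for a face whose boundary edges are all in finite components: the union of these has empty
    -- vertex boundary, hence at most `β 0` vertices.
    D : ℕ
    D = β 0 ℕ.* Δ ℕ.+ M ℕ.* Δ

    codegree : ∀ F → IsFace P F → ∀ n → FaceLength P F n → n ℕ.≤ D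
    codegree F isF n (xs , u , refl , spec) = go (dec (∃ λ e → e ∈ xs × Infinite (src e)))
      where
      sound : ∀ {e} → e ∈ xs → Bdry F e
      sound {e} m = ⇒Bdry {F} {e} (Equivalence.from (spec e) m)
      complete : ∀ {e} → Bdry F e → e ∈ xs
      complete {e} b = Equivalence.to (spec e) (Bdry⇒ {F} {e} b)
      go : Dec (∃ λ e → e ∈ xs × Infinite (src e)) → length xs ℕ.≤ D
      go (yes (e , m , inf)) =
        let (l , le , w) = shortSurround isF xs sound complete e 0ᴵ (sound m 0ᴵ) inf
            cy = loop-cycle (proj₂ l)
            (q , fq) = proj₁ (proj₁ (proj₂ isF))
        in ℕₚ.≤-trans (pigeonhole u (λ {e} m → edgesAt-full {w = tgt e} (cl-hull cy isF fq (w fq) (Cl-≑ {F} (γ-src {e} {0ᴵ} ≋-refl) (sound m 0ᴵ))) (inj₁ (refl , refl))))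
           (ℕₚ.≤-trans (edgesAt-len (hull cy)) (ℕₚ.≤-trans (ℕₚ.*-monoˡ-≤ Δ (hull-short l le)) (ℕₚ.m≤n+m (M ℕ.* Δ) (β 0 ℕ.* Δ))))
      go (no none) = ℕₚ.≤-trans (pigeonhole u (λ {e} m → edgesAt-full {w = tgt e} (S-src m) (inj₁ (refl , refl))))
          (ℕₚ.≤-trans (edgesAt-len S) (ℕₚ.≤-trans (ℕₚ.*-monoˡ-≤ Δ (small S (Dedup.uniq DS) noBoundary)) (ℕₚ.m≤m+n (β 0 ℕ.* Δ) (M ℕ.* Δ))))
        where
        comp : ∀ v → ∃ λ (l : List V) → (∀ {u} → u ∈ l → Walk graph v u) × (¬ Infinite v → ∀ {u} → Walk graph v u → u ∈ l)
        comp v = pick (dec (∃ λ n → HasSize (ComponentOf graph v) n))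
          where
          pick : Dec (∃ λ n → HasSize (ComponentOf graph v) n) → ∃ λ (l : List V) → (∀ {u} → u ∈ l → Walk graph v u) × (¬ Infinite v → ∀ {u} → Walk graph v u → u ∈ l)
          pick (yes (n , h)) = let (finite l _ s f , _) = fromSize h in l , (λ {u} → s {u}) , λ _ {u} → f {u}
          pick (no k) = [] , (λ ()) , λ fin → ⊥-elim (fin λ n h → k (n , h))
        compE : E → List V
        compE e = proj₁ (comp (src e))
        DS = dedup (concat (map compE xs))
        S : List V
        S = Dedup.list DS
        finite′ : ∀ {e} → e ∈ xs → ¬ Infinite (src e)
        finite′ {e} m i = none (e , m , i)
        S-src : ∀ {e} → e ∈ xs → src e ∈ S
        S-src {e} m = Dedup.full DS (∈-concat-map compE m (proj₂ (proj₂ (comp (src e))) (finite′ m) done))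
        noBoundary : ∀ {v} → ¬ ∂ graph S v
        noBoundary {v} (v∉ , w , w∈ , a) = let (e , m , k) = ∈-concat-map⁻ compE xs (Dedup.sound DS w∈) in
          v∉ (Dedup.full DS (∈-concat-map compE m (proj₂ (proj₂ (comp (src e))) (finite′ m) (proj₁ (proj₂ (comp (src e))) k · step (adj-sym a) done))))
        small : ∀ S → Unique S → (∀ {v} → ¬ ∂ graph S v) → length S ℕ.≤ β 0
        small [] _ _ = ℕ.z≤n
        small (s ∷ S) u nb = iso s S u 0 ([] , [] , refl , λ v → mk⇔ (λ b → ⊥-elim (nb {v} b)) (λ ()))

  -- Sums of face boundaries

  wind-sum : ∀ {L M} → (∀ ψ → ⨁ ψ L ≡ ⨁ ψ M) → ∀ x → wind L x ≡ wind M x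
  wind-sum {L} {M} h x = trans (wind≡ L x) (trans (h (var′ x)) (sym (wind≡ M x)))

  Cycle-sum : ∀ {L M} → (∀ ψ → ⨁ ψ L ≡ ⨁ ψ M) → Cycle M → Cycle L
  Cycle-sum h cy = mkCycle λ g → trans (h (δ g)) (bd cy g)

  Pt : Set
  Pt = ∃ OffG

  face : Pt → ℝ² → Set
  face (p , off) = FaceOf.Face p off

  face-is : ∀ x → IsFace P (face x)
  face-is (p , off) = FaceOf.isFace p off

  face-self : ∀ x → face x (proj₁ x)
  face-self (p , off) = FaceOf.p∈Face p off

  face-join : ∀ {x y q} → face x q → face y q → ∀ {w} → face x w → face y w
  face-join {x} {y} a b = face-unique (face-is x) (face-is y) (_ , a , b)

  -- Distinct faces are disjoint, so their indicators add up modulo 2. A representative is skipped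
  -- if its face has been counted for another one.
  module Fill (Good : List E → Set) (reps : List Pt) (τ : ℝ² → Set) (τ-face : ∀ {x q} → τ (proj₁ x) → face x q → τ q)
    (bdc : ∀ {r} → r ∈ reps → τ (proj₁ r) → ∃ λ L → Good L × Cycle L × (∀ {q} → q ∈ reps → wind L (proj₁ q) ≡ ⟦ face r (proj₁ q) ⟧)) where

    private
      Covered : List Pt → ℝ² → Set
      Covered rs q = ∃ λ r → r ∈ rs × τ (proj₁ r) × face r q

      Result : List Pt → Set
      Result rs = ∃ λ (Ls : List (List E)) → (∀ {L} → L ∈ Ls → Good L × Cycle L) × (∀ {q} → q ∈ reps → wind (concat Ls) (proj₁ q) ≡ ⟦ Covered rs (proj₁ q) ⟧)

      wind-[] : ∀ x → wind [] x ≡ false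
      wind-[] x = wind≡ [] x

      go : ∀ rs → (∀ {r} → r ∈ rs → r ∈ reps) → Result rs
      go [] _ = [] , (λ ()) , λ {q} _ → trans (wind-[] (proj₁ q)) (sym (⟦⟧-false λ { (_ , () , _) }))
      go (r ∷ rs) inc = next (dec (τ (proj₁ r))) (dec (Covered rs (proj₁ r))) (go rs (λ m → inc (there m)))
        where
        same′ : (∀ {q} → τ (proj₁ r) → face r q → Covered rs q) → Result rs → Result (r ∷ rs)
        same′ h (Ls , g , w) = Ls , g , λ m → trans (w m) (⟦⟧-cong (λ { (r' , k , t , f) → r' , there k , t , f }) λ { (_ , here refl , t , f) → h t f ; (r' , there k , t , f) → r' , k , t , f })
        next : Dec (τ (proj₁ r)) → Dec (Covered rs (proj₁ r)) → Result rs → Result (r ∷ rs)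
        next (no n) _ R = same′ (λ t _ → ⊥-elim (n t)) R
        next (yes t) (yes (r' , k , t' , f)) R = same′ (λ _ fq → r' , k , t' , face-join {r} {r'} (face-self r) f fq) R
        next (yes t) (no n) (Ls , g , w) = let (L , gd , cy , v) = bdc (inc (here refl)) t in L ∷ Ls , (λ { (here refl) → gd , cy ; (there k) → g k }) , λ {q} m →
            trans (wind-++ L (concat Ls) (proj₁ q)) (trans (cong₂ _xor_ (v m) (w m)) (disjoint (proj₁ q)))
          where
          disjoint : ∀ q → ⟦ face r q ⟧ xor ⟦ Covered rs q ⟧ ≡ ⟦ Covered (r ∷ rs) q ⟧
          disjoint q = cases (dec (face r q)) (dec (Covered rs q))
            where
            cases : Dec (face r q) → Dec (Covered rs q) → ⟦ face r q ⟧ xor ⟦ Covered rs q ⟧ ≡ ⟦ Covered (r ∷ rs) q ⟧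
            cases (yes f) (yes (r' , k , t' , f')) = ⊥-elim (n (r' , k , t' , face-join {r} {r'} f f' (face-self r)))
            cases (yes f) (no c) = trans (cong₂ _xor_ (⟦⟧-true f) (⟦⟧-false c)) (sym (⟦⟧-true (r , here refl , t , f)))
            cases (no f) (yes c@(r' , k , t' , f')) = trans (cong₂ _xor_ (⟦⟧-false f) (⟦⟧-true c)) (sym (⟦⟧-true (r' , there k , t' , f')))
            cases (no f) (no c) = trans (cong₂ _xor_ (⟦⟧-false f) (⟦⟧-false c)) (sym (⟦⟧-false λ { (_ , here refl , _ , f') → f f' ; (r' , there k , t' , f') → c (r' , k , t' , f') }))

    fill : ∃ λ (Ls : List (List E)) → (∀ {L} → L ∈ Ls → Good L × Cycle L) × (∀ {q} → q ∈ reps → wind (concat Ls) (proj₁ q) ≡ ⟦ τ (proj₁ q) ⟧)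
    fill = let (Ls , g , w) = go reps (λ m → m) in Ls , g , λ {q} m → trans (w m) (⟦⟧-cong (λ { (r , _ , t , f) → τ-face {r} t f }) (λ t → q , m , t , face-self q))

  concat-cycle : ∀ {Ls} → (∀ {L} → L ∈ Ls → Cycle L) → Cycle (concat Ls)
  concat-cycle {[]} h = mkCycle λ _ → refl
  concat-cycle {L ∷ Ls} h = Cycle-++ (h (here refl)) (concat-cycle (λ m → h (there m)))

  ∈-concat⁻ : ∀ {A : Set} (Ls : List (List A)) {x} → x ∈ concat Ls → ∃ λ L → L ∈ Ls × x ∈ L
  ∈-concat⁻ (L ∷ Ls) m = [ (λ k → L , here refl , k) , (λ k → let (M , a , b) = ∈-concat⁻ Ls k in M , there a , b) ]′ (∈-++⁻ L m)

  -- `bdryCycle` allows finitely many test points only. One test point for each behaviour towards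
  -- the chains on `K` is as good as all points of the complement.
  module Classes (K : List E) where
    private
      R = representatives (λ M (x : Pt) → wind M (proj₁ x)) (sublists K) (λ _ → ⊤)

    reps : List Pt
    reps = proj₁ R

    repOf : ∀ (x : Pt) → ∃ λ r → r ∈ reps × (∀ {L} → (∀ {e} → e ∈ L → e ∈ K) → wind L (proj₁ x) ≡ wind L (proj₁ r))
    repOf x = let (r , m , h) = proj₂ (proj₂ R) {x} tt in r , m , λ {L} s →
      let (M , a , _ , c) = sublist-of K L s in trans (wind-sum (λ ψ → sym (c ψ)) (proj₁ x)) (trans (h a) (wind-sum c (proj₁ r)))

  module Geometry (accFree : AccumulationFree P) (Δ : ℕ) (star : V → List E) (star-len : ∀ v → length (star v) ℕ.≤ Δ) (star-full : ∀ {e v w} → Joins e v w → e ∈ star v)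
    (noIsolated : ∀ v → ∃ λ e → Inc v e) where
    open Bounded accFree Δ star star-len star-full public

    jump : ∀ {L} → Cycle L → ∀ {e} → e ∈ Reduced.list (reduce L) →
      (∀ {b x y} → (∀ p → φ p ∈□ b → OnEdge e p) → x ∈□ b → y ∈□ b → OffG x → OffG y → wind L x ≡ wind L y) → ⊥
    jump {L} cy {e} m still = Jump.impossible finiteStar {e} {X.rest} (Cycle-sum eq cy) (proj₂ (X.uniq R.uniq))
        (λ only i j ox oy → trans (wind-sum eq _) (trans (still only i j ox oy) (sym (wind-sum eq _))))
      where
      module R = Reduced (reduce L)
      module X = Extract (extract m)
      eq : ∀ ψ → ⨁ ψ (e ∷ X.rest) ≡ ⨁ ψ L
      eq ψ = trans (sym (X.parity ψ)) (R.equal ψ)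

    -- An edge of odd multiplicity would show as a jump of the winding number, so nothing survives
    -- the reduction.
    zero-cycle : ∀ {L} → Cycle L → (∀ {x} → OffG x → wind L x ≡ false) → ∀ ψ → ⨁ ψ L ≡ false
    zero-cycle {L} cy z ψ = trans (sym (R.equal ψ)) (empty R.list (λ m → jump cy m (λ _ _ _ ox oy → trans (z ox) (sym (z oy)))))
      where
      module R = Reduced (reduce L)
      empty : ∀ M → (∀ {e} → e ∈ M → ⊥) → ⨁ ψ M ≡ false
      empty [] _ = refl
      empty (e ∷ M) h = ⊥-elim (h (here refl))

    module _ {C} (cy : Cycle C) {F} (isF : IsFace P F) {p} (Fp : F p) (wp : wind C p ≡ true) where
      private module S = Surrounded C (hullEdges cy) cy (C⊂hull cy) (inside noIsolated cy) isF Fp wp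

      bdryFinite : Finite (Bdry F)
      bdryFinite = enumerate (Bdry F) S.D S.D-all

      bdryLength : FaceLength P F (length (Finite.elems bdryFinite))
      bdryLength = let (xs , u , e , h) = hasSize bdryFinite in xs , u , e , λ x → mk⇔ (λ b → Equivalence.to (h x) (⇒Bdry {F} {x} b)) (λ m → Bdry⇒ {F} {x} (Equivalence.from (h x) m))

      bdryCycle : ∀ (Q : List Pt) → ∃ λ L → Unique L × (∀ {e} → e ∈ L → Bdry F e) × Cycle L × (∀ {q} → q ∈ Q → wind L (proj₁ q) ≡ ⟦ F (proj₁ q) ⟧)
      bdryCycle Q = finish (S.boundaryCycle (map proj₁ Q) (off Q))
        where
        off : ∀ (Q : List Pt) {q} → q ∈ map proj₁ Q → OffG q
        off (x ∷ Q) (here refl) = proj₂ x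
        off (x ∷ Q) (there m) = off Q m
        ∈-map : ∀ {Q : List Pt} {x} → x ∈ Q → proj₁ x ∈ map proj₁ Q
        ∈-map (here refl) = here refl
        ∈-map {_ ∷ Q} {x} (there m) = there (∈-map {Q} {x} m)
        finish : (∃ λ L → (∀ {e} → e ∈ L → e ∈ S.D) × Cycle L × (∀ {q} → q ∈ map proj₁ Q → wind L q ≡ ⟦ F q ⟧)) →
          ∃ λ L → Unique L × (∀ {e} → e ∈ L → Bdry F e) × Cycle L × (∀ {q} → q ∈ Q → wind L (proj₁ q) ≡ ⟦ F (proj₁ q) ⟧)
        finish (L , s , cL , w) = R.list , R.uniq , (λ m → proj₂ (S.D-spec (s (R.sound m)))) , Cycle-sum R.equal cL , λ {q} m → trans (wind-sum R.equal (proj₁ q)) (w (∈-map {Q} {q} m))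
          where module R = Reduced (reduce L)

      bdry-ends : ∀ {e} → Bdry F e → src e ∈ hull cy × tgt e ∈ hull cy
      bdry-ends {e} b = cl-hull cy isF Fp wp (Cl-≑ {F} (γ-src {e} {0ᴵ} ≋-refl) (b 0ᴵ)) , cl-hull cy isF Fp wp (Cl-≑ {F} (γ-tgt {e} {1ᴵ} ≋-refl) (b 1ᴵ))

      -- With the two points as tests, `bdryCycle` gives a boundary chain that would distinguish
      -- them if only one were in the face.
      same-face : ∀ (x y : Pt) → F (proj₁ x) → (∀ {L} → (∀ {e} → e ∈ L → Bdry F e) → Cycle L → wind L (proj₁ x) ≡ wind L (proj₁ y)) → F (proj₁ y)
      same-face x y fx h = let (L , _ , s , cL , w) = bdryCycle (x ∷ y ∷ []) in
        ⟦⟧-sound (trans (sym (w (there (here refl)))) (trans (sym (h s cL)) (trans (w (here refl)) (⟦⟧-true fx))))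

    module _ (D : ℕ) (codeg : ∀ F → IsFace P F → ∀ n → FaceLength P F n → n ℕ.≤ D) where

      -- The boundary cycles of the faces inside are chosen to fit at the representatives. By
      -- `repOf` their sum then has the winding numbers of `C` everywhere off the graph, so it
      -- equals `C` by `zero-cycle`. Each boundary cycle is finally cut into closed walks, none
      -- longer than the face.
      decompose : ∀ {C} (cy : Cycle C) → ∃ λ (Ls : List Loop) → (∀ {l} → l ∈ Ls → len graph (proj₂ l) ℕ.≤ D) ×
        (∀ {l e} → l ∈ Ls → e ∈ walkEdges (proj₂ l) → src e ∈ hull cy × tgt e ∈ hull cy) × (∀ ψ → ⨁ ψ C ≡ ⨁ (λ l → ⨁ ψ (walkEdges (proj₂ l))) Ls)
      decompose {C} cy = let (Ls , g , w) = Fill.fill Good reps τ (λ {x} → τ-face {x}) bdc in finish Ls g w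
        where
        K : List E
        K = hullEdges cy
        open Classes K
        τ : ℝ² → Set
        τ x = wind C x ≡ true
        τ-face : ∀ {x q} → τ (proj₁ x) → face x q → τ q
        τ-face {x} t f = trans (face-wind (face-is x) cy f (face-self x)) t
        Good : List E → Set
        Good L = length L ℕ.≤ D × (∀ {e} → e ∈ L → src e ∈ hull cy × tgt e ∈ hull cy)
        bdc : ∀ {r} → r ∈ reps → τ (proj₁ r) → ∃ λ L → Good L × Cycle L × (∀ {q} → q ∈ reps → wind L (proj₁ q) ≡ ⟦ face r (proj₁ q) ⟧)
        bdc {r} _ t = let (L , u , s , cL , w) = bdryCycle cy (face-is r) (face-self r) t reps in
          L , (ℕₚ.≤-trans (pigeonhole u (λ m → Finite.full (bdryFinite cy (face-is r) (face-self r) t) (s m))) (codeg (face r) (face-is r) _ (bdryLength cy (face-is r) (face-self r) t))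
              , λ m → bdry-ends cy (face-is r) (face-self r) t (s m)) , cL , w
        inK : ∀ {L} → (∀ {e} → e ∈ L → src e ∈ hull cy × tgt e ∈ hull cy) → ∀ {e} → e ∈ L → e ∈ K
        inK h {e} m = edgesAt-full {w = tgt e} (proj₁ (h m)) (inj₁ (refl , refl))
        finish : ∀ Ls → (∀ {L} → L ∈ Ls → Good L × Cycle L) → (∀ {q} → q ∈ reps → wind (concat Ls) (proj₁ q) ≡ ⟦ τ (proj₁ q) ⟧) →
          ∃ λ (Ls : List Loop) → (∀ {l} → l ∈ Ls → len graph (proj₂ l) ℕ.≤ D) ×
          (∀ {l e} → l ∈ Ls → e ∈ walkEdges (proj₂ l) → src e ∈ hull cy × tgt e ∈ hull cy) × (∀ ψ → ⨁ ψ C ≡ ⨁ (λ l → ⨁ ψ (walkEdges (proj₂ l))) Ls)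
        finish Ls g w = let (Ws , a , b , c) = loops Ls g in Ws , a , b , λ ψ → trans (xor-≡ (trans (sym (⨁-++ ψ C T)) (zero-cycle (Cycle-++ cy cT) zero′ ψ))) (c ψ)
          where
          T : List E
          T = concat Ls
          cT : Cycle T
          cT = concat-cycle (λ m → proj₂ (g m))
          T⊂K : ∀ {e} → e ∈ T → e ∈ K
          T⊂K m = let (L , a , b) = ∈-concat⁻ Ls m in inK (proj₂ (proj₁ (g a))) b
          zero′ : ∀ {x} → OffG x → wind (C ++ T) x ≡ false
          zero′ {x} off = let (r , m , h) = repOf (x , off) in trans (wind-++ C T x) (≡-xor (trans (h (C⊂hull cy)) (trans (bool-⟦⟧ (wind C (proj₁ r))) (trans (sym (w m)) (sym (h T⊂K))))))
            where
            bool-⟦⟧ : ∀ b → b ≡ ⟦ b ≡ true ⟧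
            bool-⟦⟧ true = sym (⟦⟧-true refl)
            bool-⟦⟧ false = sym (⟦⟧-false λ ())
          loops : ∀ Ls → (∀ {L} → L ∈ Ls → Good L × Cycle L) → ∃ λ (Ws : List Loop) → (∀ {l} → l ∈ Ws → len graph (proj₂ l) ℕ.≤ D) ×
            (∀ {l e} → l ∈ Ws → e ∈ walkEdges (proj₂ l) → src e ∈ hull cy × tgt e ∈ hull cy) × (∀ ψ → ⨁ ψ (concat Ls) ≡ ⨁ (λ l → ⨁ ψ (walkEdges (proj₂ l))) Ws)
          loops [] _ = [] , (λ ()) , (λ ()) , λ _ → refl
          loops (L ∷ Ls) g =
            let gd = proj₁ (g (here refl))
                le = proj₁ gd
                module U = Euler (euler (length L) L ℕₚ.≤-refl (bd (proj₂ (g (here refl)))))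
                (Ws , a , b , c) = loops Ls (λ m → g (there m))
            in U.loops ++ Ws , (λ m → [ (λ k → ℕₚ.≤-trans (len≤total k) (ℕₚ.≤-trans U.total le)) , a ]′ (∈-++⁻ U.loops m)) ,
               (λ m k → [ (λ q → proj₂ gd (U.loops⊂ q k)) , (λ q → b q k) ]′ (∈-++⁻ U.loops m)) ,
               λ ψ → trans (⨁-++ ψ L (concat Ls)) (trans (cong₂ _xor_ (U.sums ψ) (c ψ)) (sym (⨁-++ (λ l → ⨁ ψ (walkEdges (proj₂ l))) U.loops Ws)))

  -- Otherwise `face-fill` would spread the face of `x` over the whole box, including a point of the
  -- graph.
  touch : ∀ K {b} → (∀ p → φ p ∈□ b → ∃₂ λ e t → e ∈ K × φ p ≑ γ e t) → ∀ (x : Pt) → proj₁ x ∈□ b → ∀ a → φ a ∈□ b → ∃₂ λ e t → e ∈ K × Cl (face x) (γ e t)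
  touch K {b} onK x xb a ab = dne impossible
    where
    Touching : Set
    Touching = ∃₂ λ e t → e ∈ K × Cl (face x) (γ e t)
    free : ∀ y → y ∈□ b → face x y → ∃ λ A → y ∈□ A × (∀ {w} → w ∈□ A → OffG w)
    free y j f = let (A , i , cl) = avoidL {y} K (OffG⇒OffL (face-off (face-is x) f)) in A ⊓□ b , ∈⊓ i j , λ {w} k p h →
      let (e , t , m , q) = onK p (∈-≑ (≑-sym h) (∈-⊑ (⊓⊑ʳ A b) k)) in Clear-Off (cl m) (∈-⊑ (⊓⊑ˡ A b) k) t (≑-trans (≑-sym q) h)
    impossible : ¬ ¬ Touching
    impossible none = face-off (face-is x) (face-fill (face-is x) (λ {y} j f → free y j f) (λ p i c → missed p c (onK p i)) xb ab (face-self x)) a ≑-refl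
      where
      missed : ∀ p → Cl (face x) (φ p) → (∃₂ λ e t → e ∈ K × φ p ≑ γ e t) → ⊥
      missed p c (e , t , m , h) = none (e , t , m , λ {B} → Cl-≑ {face x} h c {B})

  -- Linear isoperimetry when all faces are bounded

  shortLoops : ∀ {k} → LinearFilling k → ∀ Ls → ∃ λ (Ss : List Loop) → length Ss ℕ.≤ length Ls ℕ.+ totalLen Ls × (∀ {l} → l ∈ Ss → len graph (proj₂ l) ℕ.≤ k) ×
    (∀ ψ → ⨁ (λ l → ⨁ ψ (walkEdges (proj₂ l))) Ls ≡ ⨁ (λ l → ⨁ ψ (walkEdges (proj₂ l))) Ss)
  shortLoops fill [] = [] , ℕ.z≤n , (λ ()) , λ _ → refl
  shortLoops {k} fill ((v , w) ∷ Ls) =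
    let (As , a , b , c) = fill (len graph w) w ℕₚ.≤-refl
        (Bs , a' , b' , c') = shortLoops fill Ls
    in As ++ Bs , ℕₚ.≤-trans (ℕₚ.≤-reflexive (length-++ As)) (ℕₚ.≤-trans (ℕₚ.+-mono-≤ a a') (ℕₚ.≤-reflexive (rearrange (len graph w) (length Ls) (totalLen Ls)))) ,
       (λ m → [ b , b' ]′ (∈-++⁻ As m)) ,
       λ ψ → trans (cong₂ _xor_ (c ψ) (c' ψ)) (sym (⨁-++ (λ l → ⨁ ψ (walkEdges (proj₂ l))) As Bs))
    where
    rearrange : ∀ a b c → suc a ℕ.+ (b ℕ.+ c) ≡ suc b ℕ.+ (a ℕ.+ c)
    rearrange a b c = cong suc (trans (sym (ℕₚ.+-assoc a b c)) (trans (cong (ℕ._+ c) (ℕₚ.+-comm a b)) (ℕₚ.+-assoc b a c)))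

  module Expansion (accFree : AccumulationFree P) (Δ : ℕ) (star : V → List E) (star-len : ∀ v → length (star v) ℕ.≤ Δ) (star-full : ∀ {e v w} → Joins e v w → e ∈ star v)
    (k : ℕ) (linearFilling : LinearFilling k)
    (β : ℕ → ℕ) (mono : ∀ {m n} → m ℕ.≤ n → β m ℕ.≤ β n)
    (iso : ∀ s S → Unique (s ∷ S) → ∀ b → HasSize (∂ graph (s ∷ S)) b → length (s ∷ S) ℕ.≤ β b)
    (noIsolated : ∀ v → ∃ λ e → Inc v e) (noUnbounded : NoUnboundedFace P) (infinite : NoFiniteComponent graph) where
    open Codegree accFree Δ star star-len star-full k linearFilling β mono iso
    open Geometry accFree Δ star star-len star-full noIsolated using (jump; bdryCycle; bdry-ends; same-face)

    hullOf : Loop → List V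
    hullOf l = hull (loop-cycle (proj₂ l))

    -- A vertex inside the loop is joined to it, since its component is infinite.
    toBase : ∀ (l : Loop) → len graph (proj₂ l) ℕ.≤ k → ∀ {v} → v ∈ hullOf l → Σ (Walk graph v (proj₁ l)) λ p → len graph p ℕ.≤ M ℕ.+ k
    toBase (a , w) le {v} m = [ (λ o → let (p , q) = onLoop o in p , ℕₚ.≤-trans q (ℕₚ.m≤n+m k M)) , ins ]′ (hull⁻ (loop-cycle w) m)
      where
      C = walkEdges w
      onLoop : ∀ {v} → v ∈ onList C → Σ (Walk graph v a) λ p → len graph p ℕ.≤ k
      onLoop {v} m = let (e , i , j) = ∈-concat-map⁻ (λ e → src e ∷ tgt e ∷ []) C m in go (splitVertex w (endOn e i j))
        where
        endOn : ∀ e → e ∈ C → v ∈ src e ∷ tgt e ∷ [] → v ∈ vertices graph w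
        endOn e i (here refl) = proj₁ (edge-ends w i)
        endOn e i (there (here refl)) = proj₂ (edge-ends w i)
        go : (Σ (Split w) λ s → Split.mid s ≡ v) → Σ (Walk graph v a) λ p → len graph p ℕ.≤ k
        go (split A B e , refl) = B , ℕₚ.≤-trans (ℕₚ.≤-trans (ℕₚ.m≤n+m (len graph B) (len graph A)) (ℕₚ.≤-reflexive (trans (sym (len-· A B)) (cong (len graph) (sym e))))) le
      ins : Ins C v → Σ (Walk graph v a) λ p → len graph p ℕ.≤ M ℕ.+ k
      ins i = let I′ = insFinite (loop-cycle w)
                  H = Finite.elems I′
                  (u , p , u∉) = beyond (infinite v) H
                  (y , z , y∈ , z∉ , ad , q , ql) = quickExit H p (Finite.full I′ i) u∉
                  (r , rl) = onLoop (ins-boundary (loop-cycle w) (z∉ , y , y∈ , adj-sym ad))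
              in q · r , ℕₚ.≤-trans (ℕₚ.≤-reflexive (len-· q r)) (ℕₚ.+-mono-≤ (ℕₚ.≤-trans ql (ℕₚ.≤-trans (ℕₚ.≤-trans (ℕₚ.m≤n+m (length H) (length (onList C))) (ℕₚ.≤-reflexive (sym (length-++ (onList C))))) (hull-short (a , w) le))) rl)

    across : ∀ (l : Loop) → len graph (proj₂ l) ℕ.≤ k → ∀ {v w} → v ∈ hullOf l → w ∈ hullOf l → Σ (Walk graph v w) λ p → len graph p ℕ.≤ (M ℕ.+ k) ℕ.+ (M ℕ.+ k)
    across l le m n = let (p , a) = toBase l le m
                          (q , b) = toBase l le n
                      in p · rev q , ℕₚ.≤-trans (ℕₚ.≤-reflexive (trans (len-· p (rev q)) (cong (len graph p ℕ.+_) (len-rev q)))) (ℕₚ.+-mono-≤ a b)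

    -- If the point is on the cycle, then `e` is an edge of the cycle or meets it in a vertex.
    -- Otherwise the point is inside and `edge-inside` applies.
    edge-hull : ∀ {C} (cy : Cycle C) {F} → IsFace P F → ∀ {q} → F q → wind C q ≡ true → ∀ e t → Cl F (γ e t) → ∃ λ v → Inc v e × v ∈ hull cy
    edge-hull {C} cy {F} isF fq w e t c = go (dec (∃₂ λ f u → f ∈ C × γ f u ≑ γ e t))
      where
      go : Dec (∃₂ λ f u → f ∈ C × γ f u ≑ γ e t) → ∃ λ v → Inc v e × v ∈ hull cy
      go (no n) = let off : OffL (γ e t) C
                      off {f} m u h = n (f , u , m , h)
                  in src e , inj₁ refl , edge-inside cy e t off (trans (cl-wind isF cy fq c off) w)
      go (yes (f , u , m , h)) = go₂ (dec (f ≡ e))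
        where
        go₂ : Dec (f ≡ e) → ∃ λ v → Inc v e × v ∈ hull cy
        go₂ (yes refl) = src e , inj₁ refl , hull-full cy (inj₂ (e , m , inj₁ refl))
        go₂ (no ne) = let (v , p , q) = γ-meet {f} {e} {u} {t} ne h in v , At⇒Inc {t = t} q , hull-full cy (inj₂ (f , m , At⇒Inc {t = u} p))

    -- One step along the touched edge at `S`, then a way `across` the hull of the short loop that
    -- surrounds the face.
    radius : ℕ
    radius = suc ((M ℕ.+ k) ℕ.+ (M ℕ.+ k))

    factor : ℕ
    factor = base ℕ.^ radius ℕ.* Δ

    module Around (S : List V) where

      SE : E → Set
      SE e = ∃ λ s → s ∈ S × Inc s e

      private
        SK = select SE (edgesAt S)

      K : List E
      K = proj₁ SK

      K-full : ∀ {e} → SE e → e ∈ K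
      K-full (s , m , i) = proj₂ (proj₂ SK) (∈-concat-map star m (star-inc i)) (s , m , i)

      Touched : (ℝ² → Set) → Set
      Touched F = ∃₂ λ e t → e ∈ K × Cl F (γ e t)

      record Near (x : Pt) : Set where
        field
          loop  : Loop
          short : len graph (proj₂ loop) ℕ.≤ k
          winds : wind (walkEdges (proj₂ loop)) (proj₁ x) ≡ true
          close : ∀ {e} → Bdry (face x) e → ∀ {v} → Inc v e → ∃ λ s → s ∈ S × Σ (Walk graph s v) λ p → len graph p ℕ.≤ radius

      near : ∀ x → Touched (face x) → Near x
      near x (e₀ , t₀ , m₀ , c₀) = from (noUnbounded (face x) (face-is x))
        where
        from : BoundedFace P (face x) → Near x
        from (n , xs , u , _ , spec) = build (shortSurround (face-is x) xs sound complete e₀ t₀ c₀ (infinite (src e₀)))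
          where
          sound : ∀ {e} → e ∈ xs → Bdry (face x) e
          sound {e} m = ⇒Bdry {face x} {e} (Equivalence.from (spec e) m)
          complete : ∀ {e} → Bdry (face x) e → e ∈ xs
          complete {e} b = Equivalence.to (spec e) (Bdry⇒ {face x} {e} b)
          build : (∃ λ (l : Loop) → len graph (proj₂ l) ℕ.≤ k × (∀ {q} → face x q → wind (walkEdges (proj₂ l)) q ≡ true)) → Near x
          build (l , le , w) = record { loop = l ; short = le ; winds = wx ; close = close }
            where
            cy = loop-cycle (proj₂ l)
            wx : wind (walkEdges (proj₂ l)) (proj₁ x) ≡ true
            wx = w (face-self x)
            endIn : ∀ {e v} → Bdry (face x) e → Inc v e → v ∈ hull cy
            endIn b (inj₁ refl) = proj₁ (bdry-ends cy (face-is x) (face-self x) wx b)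
            endIn b (inj₂ refl) = proj₂ (bdry-ends cy (face-is x) (face-self x) wx b)
            hop : ∀ {s v} → Inc s e₀ → Inc v e₀ → Σ (Walk graph s v) λ p → len graph p ℕ.≤ 1
            hop (inj₁ refl) (inj₁ refl) = done , ℕ.z≤n
            hop (inj₁ refl) (inj₂ refl) = step (e₀ , inj₁ (refl , refl)) done , ℕₚ.≤-refl
            hop (inj₂ refl) (inj₁ refl) = step (e₀ , inj₂ (refl , refl)) done , ℕₚ.≤-refl
            hop (inj₂ refl) (inj₂ refl) = done , ℕ.z≤n
            close : ∀ {e} → Bdry (face x) e → ∀ {v} → Inc v e → ∃ λ s → s ∈ S × Σ (Walk graph s v) λ p → len graph p ℕ.≤ radius
            close b i = via (proj₂ (proj₁ (proj₂ SK) m₀)) (edge-hull cy (face-is x) (face-self x) wx e₀ t₀ c₀) (endIn b i)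
              where
              via : ∀ {v} → SE e₀ → (∃ λ v₀ → Inc v₀ e₀ × v₀ ∈ hull cy) → v ∈ hull cy → ∃ λ s → s ∈ S × Σ (Walk graph s v) λ p → len graph p ℕ.≤ radius
              via (s , s∈ , si) (v₀ , vi , v₀∈) v∈ = s , s∈ , proj₁ p · proj₁ q , ℕₚ.≤-trans (ℕₚ.≤-reflexive (len-· (proj₁ p) (proj₁ q))) (ℕₚ.+-mono-≤ (proj₂ p) (proj₂ q))
                where
                p = hop si vi
                q = across l le v₀∈ v∈

      -- The faces touching S sum up to a cycle around S with edges near the boundary of S.
      K′ : List E
      K′ = edgesAt (ball radius S)

      bdry∈K′ : ∀ x → Touched (face x) → ∀ {e} → Bdry (face x) e → e ∈ K′
      bdry∈K′ x t {e} b = let (s , m , p , l) = Near.close (near x t) b (inj₁ refl) in edgesAt-full {w = tgt e} (ball-full m p l) (inj₁ (refl , refl))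

      open Classes K′

      τ : ℝ² → Set
      τ p = Σ (OffG p) λ off → Touched (face (p , off))

      Cl-⊂ : ∀ {F F′ : ℝ² → Set} {p} → (∀ {q} → F q → F′ q) → Cl F p → Cl F′ p
      Cl-⊂ h c i = let (y , j , f) = c i in y , j , h f

      touched-face : ∀ x y → face x (proj₁ y) → Touched (face x) → Touched (face y)
      touched-face x y f (e , t , m , c) = e , t , m , Cl-⊂ {face x} {face y} (face-join {x} {y} f (face-self y)) c

      τ-face : ∀ x {q} → τ (proj₁ x) → face x q → τ q
      τ-face x {q} (off , tc) f = face-off (face-is x) f , touched-face x (q , face-off (face-is x) f) f (touched-face (proj₁ x , off) x (face-self (proj₁ x , off)) tc)

      τ⇒ : ∀ x → τ (proj₁ x) → Touched (face x)
      τ⇒ x (off , tc) = touched-face (proj₁ x , off) x (face-self (proj₁ x , off)) tc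

      Good : List E → Set
      Good L = ∀ {e} → e ∈ L → e ∈ K′ × (∀ {v} → Inc v e → ∃ λ s → s ∈ S × Σ (Walk graph s v) λ p → len graph p ℕ.≤ radius)

      good : ∀ x → Touched (face x) → ∀ {L} → (∀ {e} → e ∈ L → Bdry (face x) e) → Good L
      good x t s m = bdry∈K′ x t (s m) , Near.close (near x t) (s m)

      same-rep : ∀ x y → Touched (face x) → (∀ {L} → (∀ {e} → e ∈ L → e ∈ K′) → wind L (proj₁ x) ≡ wind L (proj₁ y)) → face x (proj₁ y)
      same-rep x y t h = same-face (loop-cycle (proj₂ (Near.loop N))) (face-is x) (face-self x) (Near.winds N) x y (face-self x) (λ s _ → h (λ m → bdry∈K′ x t (s m)))
        where N = near x t

      bdc : ∀ {r} → r ∈ reps → τ (proj₁ r) → ∃ λ L → Good L × Cycle L × (∀ {q} → q ∈ reps → wind L (proj₁ q) ≡ ⟦ face r (proj₁ q) ⟧)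
      bdc {r} _ t = from (bdryCycle (loop-cycle (proj₂ (Near.loop N))) (face-is r) (face-self r) (Near.winds N) reps)
        where
        N = near r (τ⇒ r t)
        from : (∃ λ L → Unique L × (∀ {e} → e ∈ L → Bdry (face r) e) × Cycle L × (∀ {q} → q ∈ reps → wind L (proj₁ q) ≡ ⟦ face r (proj₁ q) ⟧)) →
          ∃ λ L → Good L × Cycle L × (∀ {q} → q ∈ reps → wind L (proj₁ q) ≡ ⟦ face r (proj₁ q) ⟧)
        from (L , _ , s , cL , w) = L , (λ {e} → good r (τ⇒ r t) s {e}) , cL , w

      private
        filled : ∃ λ (Ls : List (List E)) → (∀ {L} → L ∈ Ls → Good L × Cycle L) × (∀ {q} → q ∈ reps → wind (concat Ls) (proj₁ q) ≡ ⟦ τ (proj₁ q) ⟧)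
        filled = Fill.fill Good reps τ (λ {x} → τ-face x) bdc

      T : List E
      T = concat (proj₁ filled)

      T-cycle : Cycle T
      T-cycle = concat-cycle (λ m → proj₂ (proj₁ (proj₂ filled) m))

      T-good : Good T
      T-good m = let (L , a , b) = ∈-concat⁻ (proj₁ filled) m in proj₁ (proj₁ (proj₂ filled) a) b

      -- `T` has been fitted at the representatives. The boundary of a touched face is in `K′`, so
      -- `same-rep` puts a point and its representative in one face, whichever of the two is known
      -- to be in a touched face.
      T-wind : ∀ (x : Pt) → wind T (proj₁ x) ≡ ⟦ Touched (face x) ⟧
      T-wind x = from (repOf x)
        where
        from : (∃ λ r → r ∈ reps × (∀ {L} → (∀ {e} → e ∈ L → e ∈ K′) → wind L (proj₁ x) ≡ wind L (proj₁ r))) → wind T (proj₁ x) ≡ ⟦ Touched (face x) ⟧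
        from (r , m , h) = trans (h (λ m → proj₁ (T-good m))) (trans (proj₂ (proj₂ filled) m) (⟦⟧-cong
          (λ t → touched-face r x (same-rep r x (τ⇒ r t) (λ s → sym (h s))) (τ⇒ r t))
          (λ t → proj₂ r , touched-face x (proj₁ r , proj₂ r) (same-rep x r t h) t)))

      module R = Reduced (reduce T)

      R-cycle : Cycle R.list
      R-cycle = Cycle-sum R.equal T-cycle

      -- Both sides of an edge at S are touched, so it cancels.
      R-off : ∀ {e} → SE e → e ∉ R.list
      R-off {e} se m = jump T-cycle m λ {b} {x} {y} only i j ox oy → cases {b} {x} {y} only i j ox oy (dec (∃ λ a → φ a ∈□ b))
        where
        cases : ∀ {b x y} → (∀ p → φ p ∈□ b → OnEdge e p) → x ∈□ b → y ∈□ b → OffG x → OffG y → Dec (∃ λ a → φ a ∈□ b) → wind T x ≡ wind T y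
        cases {b} {x} {y} only i j ox oy (yes (a , ab)) = trans (touches x i ox) (sym (touches y j oy))
          where
          onK : ∀ p → φ p ∈□ b → ∃₂ λ f t → f ∈ K × φ p ≑ γ f t
          onK (vertex v) h = ⊥-elim (only (vertex v) h)
          onK (on f t) h = f , t , subst (_∈ K) (sym (proj₁ (only (on f t) h))) (K-full se) , ≑-refl
          touches : ∀ z → z ∈□ b → OffG z → wind T z ≡ true
          touches z h oz = trans (T-wind (z , oz)) (⟦⟧-true (touch K onK (z , oz) h a ab))
        cases {b} {x} {y} only i j ox oy (no n) = face-wind (face-is (x , ox)) T-cycle (face-self (x , ox))
          (face-box (face-is (x , ox)) {b} (λ {w} wb a h → n (a , ∈-≑ (≑-sym h) wb)) i (face-self (x , ox)) j)

      -- The vertex is off the reduced cycle by `R-off`. A point off the graph in a small box around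
      -- it lies in a face that touches an edge at `s`, and has the same winding number.
      R-around : ∀ {s} → s ∈ S → wind R.list (vx s) ≡ true
      R-around {s} s∈ = from (starBox s) (wind-local R-cycle off)
        where
        off : OffL (vx s) R.list
        off = offV λ { (e , m , i) → R-off (s , s∈ , i) m }
        from : (∃ λ B → vx s ∈□ B × (∀ b → φ b ∈□ B → OpenStar s b)) →
          (∃ λ B → vx s ∈□ B × (∀ {e} → e ∈ R.list → Clear B e) × (∀ {y z} → y ∈□ B → z ∈□ B → wind R.list y ≡ wind R.list z)) → wind R.list (vx s) ≡ true
        from (A , sA , inStar) (B , sB , _ , h) = pick (holeL K {A ⊓□ B} {vx s} (∈⊓ sA sB))
          where
          vertexOn : ∀ {v} → v ≡ s → (∃ λ e → Inc s e) → ∃₂ λ f t → f ∈ K × vx v ≑ γ f t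
          vertexOn refl (e , inj₁ k) = e , 0ᴵ , K-full (s , s∈ , inj₁ k) , ≑-trans (subst (λ v → vx s ≑ vx v) (sym k) ≑-refl) (≑-sym (γ-src {e} {0ᴵ} ≋-refl))
          vertexOn refl (e , inj₂ k) = e , 1ᴵ , K-full (s , s∈ , inj₂ k) , ≑-trans (subst (λ v → vx s ≑ vx v) (sym k) ≑-refl) (≑-sym (γ-tgt {e} {1ᴵ} ≋-refl))
          onK : ∀ p → φ p ∈□ (A ⊓□ B) → ∃₂ λ f t → f ∈ K × φ p ≑ γ f t
          onK (vertex v) i = vertexOn (inStar (vertex v) (∈-⊑ (⊓⊑ˡ A B) i)) (noIsolated s)
          onK (on f t) i = f , t , K-full (s , s∈ , OpenStar⇒Inc {t = t} (inStar (on f t) (∈-⊑ (⊓⊑ˡ A B) i))) , ≑-refl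
          pick : (∃ λ x → x ∈□ (A ⊓□ B) × OffL x K) → wind R.list (vx s) ≡ true
          pick (x , i , offK) = trans (h sB (∈-⊑ (⊓⊑ʳ A B) i)) (trans (wind-sum R.equal x) (trans (T-wind (x , offG)) (⟦⟧-true (touch K onK (x , offG) i (vertex s) (∈⊓ sA sB)))))
            where
            offG : OffG x
            offG a k = let (f , t , m , q) = onK a (∈-≑ (≑-sym k) i) in offK m t (≑-trans (≑-sym q) k)

      -- The reduced cycle has a bounded number of edges per vertex of the boundary of `S`. It is
      -- the sum of at most twice as many short loops, since both the number of closed walks and
      -- their total length are bounded by its own length. Each vertex of `S` is in the hull of one
      -- of these loops.
      count : ∀ bS → (∀ {v} → ∂ graph S v → v ∈ bS) → Unique S → length S ℕ.≤ ((length bS ℕ.* factor) ℕ.+ (length bS ℕ.* factor)) ℕ.* M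
      count bS full u = from (shortLoops linearFilling U.loops)
        where
        module U = Euler (euler (length R.list) R.list ℕₚ.≤-refl (bd R-cycle))
        R⊂ : ∀ {e} → e ∈ R.list → e ∈ edgesAt (ball radius bS)
        R⊂ {e} m = via (proj₂ (T-good (R.sound m)) (inj₁ refl))
          where
          via : (∃ λ s → s ∈ S × Σ (Walk graph s (src e)) λ p → len graph p ℕ.≤ radius) → e ∈ edgesAt (ball radius bS)
          -- The edge has its source outside `S`, since edges at `S` have cancelled. So a walk from
          -- `S` to it passes a vertex of the boundary of `S`, and the rest of the walk is not
          -- longer.
          via (s , s∈ , p , pl) = let module X = Exit (exit S p s∈ (λ k → R-off (src e , k , inj₁ refl) m)) in
            edgesAt-full {w = tgt e} (ball-full (full (X.out , X.last , X.inside (last∈ X.within) , adj-sym X.leave)) X.onward (ℕₚ.≤-trans X.shorter pl)) (inj₁ (refl , refl))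
        R-len : length R.list ℕ.≤ length bS ℕ.* factor
        R-len = ℕₚ.≤-trans (pigeonhole R.uniq R⊂) (ℕₚ.≤-trans (edgesAt-len (ball radius bS)) (ℕₚ.≤-trans (ℕₚ.*-monoˡ-≤ Δ (ball-len radius bS)) (ℕₚ.≤-reflexive (ℕₚ.*-assoc (length bS) (base ℕ.^ radius) Δ))))
        from : (∃ λ (Ss : List Loop) → length Ss ℕ.≤ length U.loops ℕ.+ totalLen U.loops × (∀ {l} → l ∈ Ss → len graph (proj₂ l) ℕ.≤ k) ×
          (∀ ψ → ⨁ (λ l → ⨁ ψ (walkEdges (proj₂ l))) U.loops ≡ ⨁ (λ l → ⨁ ψ (walkEdges (proj₂ l))) Ss)) → length S ℕ.≤ ((length bS ℕ.* factor) ℕ.+ (length bS ℕ.* factor)) ℕ.* M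
        from (Ss , n , short , sums) = ℕₚ.≤-trans (pigeonhole u cover) (ℕₚ.≤-trans (concat-length hullOf M Ss (λ {l} m → hull-short l (short m)))
            (ℕₚ.*-monoˡ-≤ M (ℕₚ.≤-trans n (ℕₚ.+-mono-≤ (ℕₚ.≤-trans U.count R-len) (ℕₚ.≤-trans U.total R-len)))))
          where
          cover : ∀ {s} → s ∈ S → s ∈ concat (map hullOf Ss)
          cover {s} m = let (l , i , e) = ⨁-true Ss (trans (sym (trans (wind≡ R.list (vx s)) (trans (U.sums (var′ (vx s))) (sums (var′ (vx s)))))) (R-around m)) in
            ∈-concat-map hullOf i (hull-full (loop-cycle (proj₂ l)) (inj₁ (trans (wind≡ _ (vx s)) e)))

    expansion : ∃ λ c → ∀ S → Unique S → ∀ b → HasSize (∂ graph S) b → length S ℕ.≤ c ℕ.* b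
    expansion = (factor ℕ.+ factor) ℕ.* M , λ { S u b (xs , _ , refl , spec) → ℕₚ.≤-trans (Around.count S xs (λ {v} → Equivalence.to (spec v)) u) (ℕₚ.≤-reflexive (rearrange (length xs) factor M)) }
      where
      rearrange : ∀ n f m → (n ℕ.* f ℕ.+ n ℕ.* f) ℕ.* m ≡ ((f ℕ.+ f) ℕ.* m) ℕ.* n
      rearrange n f m = trans (cong (ℕ._* m) (sym (ℕₚ.*-distribˡ-+ n f f))) (trans (ℕₚ.*-assoc n (f ℕ.+ f) m) (ℕₚ.*-comm n ((f ℕ.+ f) ℕ.* m)))

  -- Cheeger constants and the three implications

  -- The reciprocal of `c + 1` instead of `c` keeps the bound defined and positive for every `c`.
  unit-≤ : ∀ c b n → suc n ℕ.≤ c ℕ.* b → 1/1+ c ℚ.≤ ℤ.+ b ℚ./ suc n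
  unit-≤ c b n h = ℚₚ.toℚᵘ-cancel-≤ (ℚᵘₚ.≤-respˡ-≃ (ℚᵘₚ.≃-sym (ℚₚ.toℚᵘ-fromℚᵘ (ℚᵘ.mkℚᵘ (ℤ.+ 1) c))) (ℚᵘₚ.≤-respʳ-≃ (ℚᵘₚ.≃-sym (ℚₚ.toℚᵘ-fromℚᵘ (ℚᵘ.mkℚᵘ (ℤ.+ b) n)))
    (ℚᵘ.*≤* (subst₂ ℤ._≤_ (sym (ℤₚ.*-identityˡ (ℤ.+ suc n))) (ℤₚ.pos-* b (suc c)) (ℤ.+≤+ (ℕₚ.≤-trans h (ℕₚ.≤-trans (ℕₚ.m≤n+m (c ℕ.* b) b) (ℕₚ.≤-reflexive (ℕₚ.*-comm (suc c) b)))))))))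

  -- The numerator of a positive `r` is at least 1, so `r` is at least the reciprocal of its
  -- denominator.
  ≤-denominator : ∀ r → 0ℚ < r → ∀ b n → r ℚ.≤ ℤ.+ b ℚ./ suc n → suc n ℕ.≤ b ℕ.* ℚ.denominatorℕ r
  ≤-denominator r@(ℚ.mkℚ (ℤ.+ zero) d _) (ℚ.*<* (ℤ.+<+ ())) b n le
  ≤-denominator r@(ℚ.mkℚ (ℤ.+ suc m) d _) pos b n le = from (ℚᵘₚ.≤-respʳ-≃ (ℚₚ.toℚᵘ-fromℚᵘ (ℚᵘ.mkℚᵘ (ℤ.+ b) n)) (ℚₚ.toℚᵘ-mono-≤ le))
    where
    from : ℚᵘ.mkℚᵘ (ℤ.+ suc m) d ℚᵘ.≤ ℚᵘ.mkℚᵘ (ℤ.+ b) n → suc n ℕ.≤ b ℕ.* suc d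
    from (ℚᵘ.*≤* h) = ℕₚ.≤-trans (ℕₚ.m≤m+n (suc n) (m ℕ.* suc n)) (ℤₚ.drop‿+≤+ (subst (ℤ._≤_ (ℤ.+ (suc m ℕ.* suc n))) (sym (ℤₚ.pos-* b (suc d))) h))
  ≤-denominator r@(ℚ.mkℚ (ℤ.-[1+ m ]) d _) (ℚ.*<* ()) b n le

  module _ (accFree : AccumulationFree P) (degree : BoundedDegree graph) where
    private
      Δ : ℕ
      Δ = proj₁ degree
      star : V → List E
      star v = proj₁ (proj₁ (proj₂ (proj₂ degree v)))
      star-len : ∀ v → length (star v) ℕ.≤ Δ
      star-len v = let (d , (xs , _ , e , _) , l) = proj₂ degree v in ℕₚ.≤-trans (ℕₚ.≤-reflexive e) l
      star-full : ∀ {e v w} → Joins e v w → e ∈ star v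
      star-full {e} {v} {w} j = let (d , (xs , _ , _ , h) , l) = proj₂ degree v in Equivalence.to (h e) (w , j)

    nonAmenable⇒hyperbolic : NonAmenable graph → BoundedCodegree P → Hyperbolic graph
    -- The loops have length at most `D`; `Polygon` adds one, so that its threshold step is
    -- positive. The factor 2 accounts for the two ends of each edge of the closed walk.
    nonAmenable⇒hyperbolic (r , pos , cheeger) (D , codegree) = Polygon.R₀ D (c ℕ.* 2) filling , λ v _ _ _ → Polygon.thin D (c ℕ.* 2) filling
      where
      c : ℕ
      c = ℚ.denominatorℕ r
      iso : ∀ s S → Unique (s ∷ S) → ∀ b → HasSize (∂ graph (s ∷ S)) b → length (s ∷ S) ℕ.≤ c ℕ.* b
      iso s S u b h = ℕₚ.≤-trans (≤-denominator r pos b (length S) (cheeger s S u b h)) (ℕₚ.≤-reflexive (ℕₚ.*-comm b c))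
      noIsolated : ∀ v → ∃ λ e → Inc v e
      -- An isolated vertex has empty vertex boundary, which contradicts `iso`.
      noIsolated v = dne λ n → ℕₚ.n≮0 (ℕₚ.≤-trans (iso v [] ([] ∷ []) 0 ([] , [] , refl , λ w → mk⇔ (λ { (_ , _ , here refl , e , j) → ⊥-elim (n (e , incʳ j)) }) (λ ()))) (ℕₚ.≤-reflexive (ℕₚ.*-zeroʳ c)))
        where
        incʳ : ∀ {e v w} → Joins e w v → Inc v e
        incʳ (inj₁ (_ , q)) = inj₂ q
        incʳ (inj₂ (p , _)) = inj₁ p
      open Geometry accFree Δ star star-len star-full noIsolated
      filling : ∀ {a} (w : Walk graph a a) → Filled (suc D) (c ℕ.* 2) w
      filling w = from (decompose D codegree cy)
        where
        C = walkEdges w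
        cy = loop-cycle w
        onWalk : ∀ {v} → v ∈ onList C → v ∈ vertices graph w
        onWalk m = let (e , i , j) = ∈-concat-map⁻ (λ e → src e ∷ tgt e ∷ []) C m in at′ e i j
          where
          at′ : ∀ {v} e → e ∈ C → v ∈ src e ∷ tgt e ∷ [] → v ∈ vertices graph w
          at′ e i (here refl) = proj₁ (edge-ends w i)
          at′ e i (there (here refl)) = proj₂ (edge-ends w i)
        inHull : ∀ {v} → v ∈ hull cy → v ∈ vertices graph w ⊎ v ∈ Finite.elems (insFinite cy)
        inHull m = [ (λ k → inj₁ (onWalk k)) , inj₂ ]′ (∈-++⁻ (onList C) m)
        few : length (Finite.elems (insFinite cy)) ℕ.≤ (c ℕ.* 2) ℕ.* len graph w
        few = ℕₚ.≤-trans (ins-bound (c ℕ.*_) (ℕₚ.*-monoʳ-≤ c) iso cy) (ℕₚ.≤-reflexive (trans (cong (λ l → c ℕ.* (l ℕ.* 2)) (length-edges w)) (trans (cong (c ℕ.*_) (ℕₚ.*-comm (len graph w) 2)) (sym (ℕₚ.*-assoc c 2 (len graph w))))))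
        from : (∃ λ (Ls : List Loop) → (∀ {l} → l ∈ Ls → len graph (proj₂ l) ℕ.≤ D) ×
          (∀ {l e} → l ∈ Ls → e ∈ walkEdges (proj₂ l) → src e ∈ hull cy × tgt e ∈ hull cy) × (∀ ψ → ⨁ ψ C ≡ ⨁ (λ l → ⨁ ψ (walkEdges (proj₂ l))) Ls)) → Filled (suc D) (c ℕ.* 2) w
        from (Ls , short , ends , sums) = record
          { new = Finite.elems (insFinite cy) ; few = few ; loops = Ls ; short = λ m → ℕₚ.m≤n⇒m≤1+n (short m)
          ; within = λ { m k (inj₁ refl) → inHull (proj₁ (ends m k)) ; m k (inj₂ refl) → inHull (proj₂ (ends m k)) } ; sums = sums }

    hyperbolic⇒boundedCodegree : Hyperbolic graph → WeaklyNonAmenable graph → BoundedCodegree P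
    hyperbolic⇒boundedCodegree (δ , hyp) (f , mono , _ , iso) = C.D , C.codegree
      where
      module C = Codegree accFree Δ star star-len star-full (Dehn.k δ hyp) (Dehn.linearFilling δ hyp) f mono iso

    hyperbolic⇒nonAmenable : Hyperbolic graph → WeaklyNonAmenable graph → NoUnboundedFace P → NoFiniteComponent graph → NonAmenable graph
    hyperbolic⇒nonAmenable (δ , hyp) (f , mono , _ , iso) noUnbounded infinite = from (Expansion.expansion accFree Δ star star-len star-full (Dehn.k δ hyp) (Dehn.linearFilling δ hyp) f mono iso noIsolated noUnbounded infinite)
      where
      noIsolated : ∀ v → ∃ λ e → Inc v e
      -- An isolated vertex would be a component of size one.
      noIsolated v = dne λ n → infinite v 1 (v ∷ [] , ([] ∷ []) , refl , λ w → mk⇔ (λ p → alone n p) (λ { (here refl) → done }))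
        where
        alone : ∀ {w} → ¬ (∃ λ e → Inc v e) → Walk graph v w → w ∈ v ∷ []
        alone n done = here refl
        alone n (step (e , inj₁ (p , _)) _) = ⊥-elim (n (e , inj₁ p))
        alone n (step (e , inj₂ (_ , q)) _) = ⊥-elim (n (e , inj₂ q))
      from : (∃ λ c → ∀ S → Unique S → ∀ b → HasSize (∂ graph S) b → length S ℕ.≤ c ℕ.* b) → NonAmenable graph
      from (c , h) = 1/1+ c , 0<1/ c , λ s S u b size → unit-≤ c b (length S) (h (s ∷ S) u b size)

open PlaneGraph using (graph)

theorem1p2 : ExcludedMiddle (lsuc 0ℓ) →
    (P : PlaneGraph) →
    AccumulationFree P →
    BoundedDegree (graph P) →
    (NonAmenable (graph P) → BoundedCodegree P → Hyperbolic (graph P))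
    × (Hyperbolic (graph P) → WeaklyNonAmenable (graph P) → BoundedCodegree P)
    × (Hyperbolic (graph P) → WeaklyNonAmenable (graph P) → NoUnboundedFace P →
    NoFiniteComponent (graph P) → NonAmenable (graph P))
theorem1p2 em P accFree degree = Embedded.nonAmenable⇒hyperbolic em P accFree degree , Embedded.hyperbolic⇒boundedCodegree em P accFree degree , Embedded.hyperbolic⇒nonAmenable em P accFree degree
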